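{- There is a randomized algorithm which, for a simple directed graph on $n$ vertices, computes the shortest even-cycle length and the union of the arc sets of all shortest even cycles in $\widetilde O(n^{\tau+1})$ bit operations. Both outputs are correct with probability $1-O(n^{ -3})$. On a graph without an even cycle the algorithm always reports that fact correctly. If the matrix multiplication and fast linear algebra routines used have quadratic workspace, the algorithm uses $O(n^2)$ field elements of space.
   Context: Graphs are simple directed graphs without loops; oppositely directed arcs are allowed. A cycle is always directed and simple (no repeated vertices); its length is its number of arcs, and it is even if its length is even (so two oppositely directed arcs form an even cycle of length two). Cycles are distinguished by their arc sets. A shortest even cycle is an even cycle of minimum length among all even cycles. Probability is over the internal randomness of the algorithm. $\tau$ is a fixed real number with $2<\tau\le 3$ for which multiplication of $n\times n$ matrices over the fields in question has a uniform algorithm using $O(n^\tau)$ arithmetic operations; constants may depend on $\tau$. The notation $\widetilde O$ hides logarithmic factors. Field elements are elements of a binary extension field $\mathbb F_{2^d}$ with $d=O(\log n)$. -}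

module Defs where

open import Algebra.Bundles using (CommutativeRing)
open import Algebra.Core using (Op₁; Op₂)
import Algebra.Properties.Monoid.Sum as MonoidSum
open import Algebra.Structures using (IsCommutativeRing)
open import Data.Bool.Base using (Bool; true; false; if_then_else_; T)
open import Data.Fin.Base using (Fin; zero; suc; toℕ; combine; punchIn)
import Data.Fin.Properties as Fin
open import Data.Integer.Base using (+_)
open import Data.List.Base using (List; []; _∷_; [_]; _++_; map; sum)
open import Data.List.Relation.Unary.All using (All)
open import Data.Nat.Base
open import Data.Nat.Divisibility using (_∣_)
open import Data.Nat.DivMod using (_mod_)
open import Data.Nat.Logarithm using (⌊log₂_⌋)
open import Data.Product.Base using (Σ-syntax; ∃-syntax; _×_; _,_; proj₁; proj₂)
open import Data.Rational.Base using (ℚ) renaming (_/_ to _/ℚ_; _<_ to _<ℚ_)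
open import Data.Sum.Base using (_⊎_; inj₁; inj₂)
open import Data.Vec.Base using (Vec; []; _∷_; toList)
open import Function.Base using (_∘_)
open import Function.Bundles using (_↔_; _⇔_)
open import Function.Definitions using (Injective)
open import Function.Properties.Inverse using (↔⇒↣)
open import Level using (0ℓ)
open import Relation.Binary.Definitions using (DecidableEquality)
open import Relation.Binary.PropositionalEquality using (_≡_; _≢_)
open import Relation.Nullary using (¬_; does)
open import Relation.Nullary.Decidable using (via-injection)

------------------------------------------------------------------------
-- Real numbers (Dedekind cuts) and growth rates with a real exponent

record ℝ : Set₁ where
  field
    lower upper   : ℚ → Set
    lower-inhab   : ∃[ p ] lower p
    upper-inhab   : ∃[ p ] upper p
    lower-rounded : ∀ p → lower p ⇔ (∃[ q ] (p <ℚ q × lower q))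
    upper-rounded : ∀ p → upper p ⇔ (∃[ q ] (q <ℚ p × upper q))
    disjoint      : ∀ p → ¬ (lower p × upper p)
    located       : ∀ p q → p <ℚ q → lower p ⊎ upper q

open ℝ public using (lower; upper)

_<ʳ_ : ℚ → ℝ → Set
q <ʳ x = lower x q

_≤ʳ_ : ℝ → ℚ → Set
x ≤ʳ q = ¬ lower x q

infix 4 _≲_·_^ʳ_

-- f ≤ K · n ^ τ for n ≥ 1 and τ > 0: since n ^ τ is the infimum of
-- n ^ (p / q) over the rationals p / q above τ, this says
-- f ≤ K · n ^ (p / q) for each of them, with q-th powers taken.
_≲_·_^ʳ_ : ℕ → ℕ → ℕ → ℝ → Set
f ≲ K · n ^ʳ τ = ∀ p q .{{_ : NonZero q}} → upper τ (+ p /ℚ q) →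
                 f ^ q ≤ K ^ q * n ^ p

size : ℕ → ℕ
size n = suc ⌊log₂ n ⌋

------------------------------------------------------------------------
-- Directed graphs and even cycles

record Digraph (n : ℕ) : Set where
  field
    arc      : Fin n → Fin n → Bool
    loopless : ∀ u → arc u u ≡ false

open Digraph public using (arc)

-- A cycle comes with a starting vertex. Rotations have the same length and
-- the same arcs, so neither output below depends on that choice.
record Cycle {n : ℕ} (G : Digraph n) : Set where
  field
    len        : ℕ
    .{{len≢0}} : NonZero len
    vertex     : Fin len → Fin n
    simple     : Injective _≡_ _≡_ vertex

  next : Fin len → Fin len
  next i = suc (toℕ i) mod len

  field
    closed : ∀ i → T (arc G (vertex i) (vertex (next i)))

  Even : Set
  Even = 2 ∣ len

  Uses : Fin n → Fin n → Set
  Uses u v = ∃[ i ] (vertex i ≡ u × vertex (next i) ≡ v)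

module _ {n : ℕ} (G : Digraph n) where

  HasEvenCycle : Set
  HasEvenCycle = Σ[ C ∈ Cycle G ] Cycle.Even C

  ShortestEven : Cycle G → Set
  ShortestEven C = Cycle.Even C ×
    (∀ (D : Cycle G) → Cycle.Even D → Cycle.len C ≤ Cycle.len D)

  OnShortestEven : Fin n → Fin n → Set
  OnShortestEven u v = Σ[ C ∈ Cycle G ] (ShortestEven C × Cycle.Uses C u v)

------------------------------------------------------------------------
-- Programs
--
-- Random access programs over an instruction set Op. Data lives in variables
-- (named by numerals in the program text) and in a heap indexed by ℕ; tests
-- branch on whether an integer variable is zero.

data Prog (Op : Set) : Set where
  skip           : Prog Op
  ‹_›            : Op → Prog Op
  _⨾_            : Prog Op → Prog Op → Prog Op
  ifz_then_else_ : ℕ → Prog Op → Prog Op → Prog Op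
  while_loop_    : ℕ → Prog Op → Prog Op

module Execution {Op State : Set} (val : State → ℕ → ℕ)
                 (Step : Op → State → State → Set) where

  -- A run is recorded as the sequence of executed instructions (inj₁) and
  -- tested variables (inj₂), each with the state in which it happens.
  data Run : Prog Op → State → List ((Op ⊎ ℕ) × State) → State → Set where
    skip   : ∀ {s} → Run skip s [] s
    op     : ∀ {o s s′} → Step o s s′ → Run ‹ o › s [ inj₁ o , s ] s′
    seq    : ∀ {p q s s′ s″ l l′} → Run p s l s′ → Run q s′ l′ s″ →
             Run (p ⨾ q) s (l ++ l′) s″
    ifz    : ∀ {x p q s s′ l} → val s x ≡ 0 → Run p s l s′ →
             Run (ifz x then p else q) s ((inj₂ x , s) ∷ l) s′
    ifnz   : ∀ {x p q s s′ l} → val s x ≢ 0 → Run q s l s′ →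
             Run (ifz x then p else q) s ((inj₂ x , s) ∷ l) s′
    stop   : ∀ {x p s} → val s x ≡ 0 →
             Run (while x loop p) s [ inj₂ x , s ] s
    repeat : ∀ {x p s s′ s″ l l′} → val s x ≢ 0 → Run p s l s′ →
             Run (while x loop p) s′ l′ s″ →
             Run (while x loop p) s ((inj₂ x , s) ∷ l ++ l′) s″

record Store (A : Set) : Set where
  constructor store
  field
    var heap : ℕ → A

open Store public

_[_↦_] : {A : Set} → (ℕ → A) → ℕ → A → (ℕ → A)
(f [ a ↦ v ]) b = if a ≡ᵇ b then v else f b

setVar : {A : Set} → ℕ → A → Store A → Store A
setVar x v s = store (var s [ x ↦ v ]) (heap s)

setHeap : {A : Set} → ℕ → A → Store A → Store A
setHeap a v s = store (var s) (heap s [ a ↦ v ])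

data IntOp : Set where
  const    : (x k : ℕ) → IntOp      -- x := k
  add sub  : (x y z : ℕ) → IntOp    -- x := y + z,  x := y ∸ z
  half     : (x y : ℕ) → IntOp      -- x := ⌊ y / 2 ⌋
  load     : (x y : ℕ) → IntOp      -- x := heap[ y ]
  save     : (x y : ℕ) → IntOp      -- heap[ x ] := y

execInt : IntOp → Store ℕ → Store ℕ
execInt (const x k) s = setVar x k s
execInt (add x y z) s = setVar x (var s y + var s z) s
execInt (sub x y z) s = setVar x (var s y ∸ var s z) s
execInt (half x y)  s = setVar x ⌊ var s y /2⌋ s
execInt (load x y)  s = setVar x (heap s (var s y)) s
execInt (save x y)  s = setHeap (var s x) (var s y) s

-- Logarithmic cost: the bit lengths of all operands and addresses.
intCost : IntOp → Store ℕ → ℕ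
intCost (const x k) s = size k
intCost (add x y z) s = size (var s y) + size (var s z)
intCost (sub x y z) s = size (var s y) + size (var s z)
intCost (half x y)  s = size (var s y)
intCost (load x y)  s = size (var s y) + size (heap s (var s y))
intCost (save x y)  s = size (var s x) + size (var s y)

-- The heap is confined to the first S cells and every integer has at most
-- w bits. The variables are a fixed finite number of further cells.
FitsInt : ℕ → ℕ → Store ℕ → Set
FitsInt S w s = (∀ x → size (var s x) ≤ w)
              × (∀ a → size (heap s a) ≤ w)
              × (∀ a → S ≤ a → heap s a ≡ 0)

------------------------------------------------------------------------
-- Randomized bit algorithms

data CoinOp : Set where
  int  : IntOp → CoinOp
  toss : ℕ → CoinOp

-- Integer memory together with the coin tosses not yet used.
CoinState : Set
CoinState = Store ℕ × List Bool

-- Tossing is stuck when the coins have run out, so a complete run uses at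
-- most as many coins as are supplied.
data CoinStep : CoinOp → CoinState → CoinState → Set where
  int  : ∀ {o s cs} → CoinStep (int o) (s , cs) (execInt o s , cs)
  toss : ∀ {x s c cs} →
         CoinStep (toss x) (s , c ∷ cs) (setVar x (if c then 1 else 0) s , cs)

module Coin = Execution {CoinOp} {CoinState} (var ∘ proj₁) CoinStep

coinCost : (CoinOp ⊎ ℕ) × CoinState → ℕ
coinCost (inj₁ (int o)  , s , _) = intCost o s
coinCost (inj₁ (toss x) , _)     = 1
coinCost (inj₂ x , s , _)        = size (var s x)

bitOperations : List ((CoinOp ⊎ ℕ) × CoinState) → ℕ
bitOperations = sum ∘ map coinCost

count : ∀ {r} → (Vec Bool r → Bool) → ℕ
count {zero}  E = if E [] then 1 else 0
count {suc r} E = count (E ∘ (true ∷_)) + count (E ∘ (false ∷_))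

------------------------------------------------------------------------
-- Binary fields and matrices

record BinaryField (d : ℕ) : Set₁ where
  infixl 6 _⊕_
  infixl 7 _⊗_
  field
    Carrier           : Set
    _⊕_ _⊗_           : Op₂ Carrier
    ⊖_ _⁻¹            : Op₁ Carrier
    0# 1#             : Carrier
    isCommutativeRing : IsCommutativeRing _≡_ _⊕_ _⊗_ ⊖_ 0# 1#
    0≢1               : 0# ≢ 1#
    ⁻¹-inverse        : ∀ x → x ≢ 0# → x ⊗ x ⁻¹ ≡ 1#
    0⁻¹               : 0# ⁻¹ ≡ 0#
    enumeration       : Carrier ↔ Fin (2 ^ d)

  commutativeRing : CommutativeRing 0ℓ 0ℓ
  commutativeRing = record { isCommutativeRing = isCommutativeRing }

  open MonoidSum (CommutativeRing.+-monoid commutativeRing) public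
    using () renaming (sum to ∑)

  _≟_ : DecidableEquality Carrier
  _≟_ = via-injection (↔⇒↣ enumeration) Fin._≟_

  Matrix : ℕ → Set
  Matrix n = Fin n → Fin n → Carrier

  _∙_ : ∀ {n} → Matrix n → Matrix n → Matrix n
  (X ∙ Y) i j = ∑ λ k → X i k ⊗ Y k j

  identity : ∀ {n} → Matrix n
  identity i j = if does (i Fin.≟ j) then 1# else 0#

  alternating : ∀ {n} → (Fin n → Carrier) → Carrier
  alternating {zero}  f = 0#
  alternating {suc n} f = f zero ⊕ ⊖ alternating (f ∘ suc)

  det : ∀ {n} → Matrix n → Carrier
  det {zero}  X = 1#
  det {suc n} X =
    alternating λ j → X zero j ⊗ det (λ k l → X (suc k) (punchIn j l))

  -- Row-major storage from address 0.
  Stores : ∀ {n} → Matrix n → (ℕ → Carrier) → Set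
  Stores X h = ∀ i j → h (toℕ (combine i j)) ≡ X i j

------------------------------------------------------------------------
-- Uniform algebraic algorithms
--
-- One program for all dimensions and all fields: it has field instructions
-- with constants 0 and 1, and integer instructions for indexing and control.

data FieldOp : Set where
  int       : IntOp → FieldOp
  fzero     : (x : ℕ) → FieldOp        -- x := 0
  fone      : (x : ℕ) → FieldOp        -- x := 1
  fadd fmul : (x y z : ℕ) → FieldOp    -- x := y + z,  x := y z
  finv      : (x y : ℕ) → FieldOp      -- x := y ⁻¹
  fload     : (x a : ℕ) → FieldOp      -- x := heap[ a ], integer variable a
  fsave     : (a x : ℕ) → FieldOp      -- heap[ a ] := x, integer variable a
  isZero    : (b x : ℕ) → FieldOp      -- integer variable b := [ x = 0 ]

module Algebraic {d : ℕ} (F : BinaryField d) where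
  open BinaryField F

  FieldState : Set
  FieldState = Store ℕ × Store Carrier

  execField : FieldOp → FieldState → FieldState
  execField (int o)      (s , t) = execInt o s , t
  execField (fzero x)    (s , t) = s , setVar x 0# t
  execField (fone x)     (s , t) = s , setVar x 1# t
  execField (fadd x y z) (s , t) = s , setVar x (var t y ⊕ var t z) t
  execField (fmul x y z) (s , t) = s , setVar x (var t y ⊗ var t z) t
  execField (finv x y)   (s , t) = s , setVar x (var t y ⁻¹) t
  execField (fload x a)  (s , t) = s , setVar x (heap t (var s a)) t
  execField (fsave a x)  (s , t) = s , setHeap (var s a) (var t x) t
  execField (isZero b x) (s , t) =
    setVar b (if does (var t x ≟ 0#) then 1 else 0) s , t

  open Execution {FieldOp} {FieldState} (var ∘ proj₁)
    (λ o s s′ → s′ ≡ execField o s) public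

  arithmeticCost : (FieldOp ⊎ ℕ) × FieldState → ℕ
  arithmeticCost (inj₁ (fadd x y z) , _) = 1
  arithmeticCost (inj₁ (fmul x y z) , _) = 1
  arithmeticCost (inj₁ (finv x y) , _)   = 1
  arithmeticCost _                       = 0

  -- Bit cost of everything which is not arithmetic in the field.
  controlCost : (FieldOp ⊎ ℕ) × FieldState → ℕ
  controlCost (inj₁ (int o) , s , _)      = intCost o s
  controlCost (inj₁ (fload x a) , s , _)  = size (var s a)
  controlCost (inj₁ (fsave a x) , s , _)  = size (var s a)
  controlCost (inj₁ (fzero x) , _)        = 1
  controlCost (inj₁ (fone x) , _)         = 1
  controlCost (inj₁ (isZero b x) , _)     = 1
  controlCost (inj₁ (fadd x y z) , _)     = 0
  controlCost (inj₁ (fmul x y z) , _)     = 0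
  controlCost (inj₁ (finv x y) , _)       = 0
  controlCost (inj₂ x , s , _)            = size (var s x)

  arithmeticOperations controlOperations :
    List ((FieldOp ⊎ ℕ) × FieldState) → ℕ
  arithmeticOperations = sum ∘ map arithmeticCost
  controlOperations    = sum ∘ map controlCost

  Fits : ℕ → ℕ → FieldState → Set
  Fits S w (s , t) = FitsInt S w s × (∀ a → S ≤ a → heap t a ≡ 0#)

  -- Input of k matrices of dimension n, stored one after the other.
  Input : ∀ {k n} → (Fin k → Matrix n) → FieldState → Set
  Input {k} {n} X (s , t) =
      var s 0 ≡ n × var s 1 ≡ d × (∀ x → 2 ≤ x → var s x ≡ 0)
    × (∀ a → heap s a ≡ 0)
    × (∀ x → var t x ≡ 0#)
    × (∀ m i j → heap t (toℕ (combine m (combine i j))) ≡ X m i j)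
    × (∀ a → k * (n * n) ≤ a → heap t a ≡ 0#)

-- A problem on n × n matrices: how many are given, and which final contents
-- of the field heap are correct.
record Problem : Set₁ where
  field
    arity  : ℕ
    Output : ∀ {d} (F : BinaryField d) {n} →
             (Fin arity → BinaryField.Matrix F n) →
             (ℕ → BinaryField.Carrier F) → Set

open Problem

multiplication determinant inversion : Problem

multiplication = record
  { arity  = 2
  ; Output = λ F X h → let open BinaryField F in
      Stores (X zero ∙ X (suc zero)) h }

determinant = record
  { arity  = 1
  ; Output = λ F X h → let open BinaryField F in h 0 ≡ det (X zero) }

-- No requirement on the result for a singular matrix.
inversion = record
  { arity  = 1
  ; Output = λ F {n} X h → let open BinaryField F in
      ∀ (Y : Matrix n) → (∀ i j → (X zero ∙ Y) i j ≡ identity i j) →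
      Stores Y h }

-- The fields F_{2^d} with d = O(log n) are those with d ≤ c · size n, for an
-- arbitrary c on which the implied constants may depend.

Fast : ℝ → Problem → Prog FieldOp → Set₁
Fast τ P prog = ∀ (c : ℕ) → Σ[ K ∈ ℕ ] Σ[ e ∈ ℕ ]
  (∀ n → 1 ≤ n → ∀ d → d ≤ c * size n → (F : BinaryField d) →
   (X : Fin (arity P) → BinaryField.Matrix F n) →
   let open Algebraic F in
   ∀ s → Input X s → ∃[ log ] ∃[ s′ ]
     ( Run prog s log s′
     × Output P F X (heap (proj₂ s′))
     × arithmeticOperations log ≲ K · n ^ʳ τ
     × controlOperations log ≲ K * size n ^ e · n ^ʳ τ ))

QuadraticWorkspace : Problem → Prog FieldOp → Set₁
QuadraticWorkspace P prog = ∀ (c : ℕ) → Σ[ K ∈ ℕ ]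
  (∀ n → 1 ≤ n → ∀ d → d ≤ c * size n → (F : BinaryField d) →
   (X : Fin (arity P) → BinaryField.Matrix F n) →
   let open Algebraic F in
   ∀ s log s′ → Input X s → Run prog s log s′ →
     All (Fits (K * n ^ 2) (K * size n) ∘ proj₂) log
     × Fits (K * n ^ 2) (K * size n) s′)

------------------------------------------------------------------------
-- Computing the shortest even cycles

-- The reported length is variable 0, with 0 standing for "no even cycle".
ReportsNone : Store ℕ → Set
ReportsNone s = var s 0 ≡ 0

module _ {n : ℕ} (G : Digraph n) where

  InputGraph : Store ℕ → Set
  InputGraph s =
      var s 0 ≡ n × (∀ x → 1 ≤ x → var s x ≡ 0)
    × (∀ u v → heap s (toℕ (combine u v)) ≡ (if arc G u v then 1 else 0))
    × (∀ a → n * n ≤ a → heap s a ≡ 0)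

  CorrectLength : Store ℕ → Set
  CorrectLength s =
      (¬ HasEvenCycle G × ReportsNone s)
    ⊎ (Σ[ C ∈ Cycle G ] (ShortestEven G C × var s 0 ≡ Cycle.len C))

  CorrectArcs : Store ℕ → Set
  CorrectArcs s = ∀ u v →
      (OnShortestEven G u v × heap s (toℕ (combine u v)) ≡ 1)
    ⊎ (¬ OnShortestEven G u v × heap s (toℕ (combine u v)) ≡ 0)

-- Outputs are incorrect only inside an event `bad` of probability at most
-- K / n ^ 3 under uniform independent coins. Time is bounded, and the absence
-- of even cycles reported, for every outcome of the coins.
FindsShortestEvenCycles : ℝ → Prog CoinOp → Set
FindsShortestEvenCycles τ prog =
  Σ[ coins ∈ (ℕ → ℕ) ] Σ[ K ∈ ℕ ] Σ[ e ∈ ℕ ]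
  (∀ n (G : Digraph n) → Σ[ bad ∈ (Vec Bool (coins n) → Bool) ]
    ( count bad * n ^ 3 ≤ K * 2 ^ coins n
    × (∀ ω s → InputGraph G s → ∃[ log ] Σ[ s′ ∈ CoinState ]
        ( Coin.Run prog (s , toList ω) log s′
        × (1 ≤ n → bitOperations log ≲ (K * size n ^ e) * n · n ^ʳ τ)
        × (¬ HasEvenCycle G → ReportsNone (proj₁ s′))
        × (bad ω ≡ false →
             CorrectLength G (proj₁ s′) × CorrectArcs G (proj₁ s′))))))

-- O(n ^ 2) cells of O(log n) bits, that is, O(n ^ 2) field elements.
QuadraticSpace : Prog CoinOp → Set
QuadraticSpace prog = Σ[ K ∈ ℕ ]
  (∀ n → 1 ≤ n → (G : Digraph n) → ∀ s cs log s′ →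
   InputGraph G s → Coin.Run prog (s , cs) log s′ →
   All (FitsInt (K * n ^ 2) (K * size n) ∘ proj₁ ∘ proj₂) log
   × FitsInt (K * n ^ 2) (K * size n) (proj₁ s′))

-- Give the arcs independent random weights in a field of characteristic 2, with matrix X, and
-- let N = (1 + z X)⁻¹ count walks. As long as all loops are odd, the walks that are not simple
-- cancel in a matrix Γ derived from N, so that the coefficient of z^k in Γ is, on an arc, the
-- polynomial of the simple paths with k arcs that close it to an even cycle. The first k with a
-- coefficient which is not zero on some arc gives the length k + 1, and these arcs the union.
-- Paths have distinct multi-affine monomials, so the Schwartz–Zippel bound applies to each arc.
-- The field is a tower of cubic extensions of F₄, a quotient of F₂[x]/(x^L - 1) with L = 3^(κ+1):
-- there elements are words of L bits, and products of matrices of words are cyclic convolutions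
-- of products over F₂ of their bit slices, each computed by a call of the given program. Its
-- memory is simulated with stamped cells, so that calls need not clear it.

module Submission where

open import Defs
open import Algebra.Bundles using (CommutativeRing; RawRing)
import Algebra.Properties.Semiring.Sum as SemiringSum
import Algebra.Solver.Ring as RingSolver
open import Algebra.Solver.Ring.AlmostCommutativeRing using (fromCommutativeRing; _-Raw-AlmostCommutative⟶_)
open import Data.Bool.Base using (Bool; true; false; _xor_; _∧_; if_then_else_)
import Data.Bool.Properties as Bool
open import Data.Fin.Base using (Fin; zero; suc)
import Data.Fin.Properties as Fin
open import Data.Maybe.Base using (Maybe; just; nothing)
open import Data.Nat.Base using (ℕ; zero; suc; _≤_)
import Data.Nat.Properties as ℕ
open import Data.Product.Base using (_,_)
open import Function.Base using (id)
open import Level using (0ℓ)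
open import Relation.Binary.PropositionalEquality as ≡ using (_≡_; _≢_)
open import Relation.Binary.Bundles using (Setoid)
open import Relation.Binary.Structures using (IsEquivalence)
open import Relation.Nullary using (yes; no; does; contradiction)
open import Relation.Binary.PropositionalEquality using () renaming (trans to infixr 5 _⊙_)
open import Data.Nat.Properties using () renaming (≤-trans to infixr 5 _⟫_)

-- A commutative ring of characteristic 2, in which - x is x.
module _ {A : Set} (_≈_ : A → A → Set) (_+_ _*_ : A → A → A) (0# 1# : A) where

 open import Algebra.Definitions _≈_

 char2-ring : IsEquivalence _≈_ → Congruent₂ _+_ → Associative _+_ → Commutative _+_ → LeftIdentity 0# _+_ → (∀ x → (x + x) ≈ 0#) →
  Congruent₂ _*_ → Associative _*_ → Commutative _*_ → LeftIdentity 1# _*_ → _*_ DistributesOverʳ _+_ → CommutativeRing 0ℓ 0ℓ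
 char2-ring equivalence +-cong +-assoc +-comm +-identityˡ char2 *-cong *-assoc *-comm *-identityˡ distribʳ = record
  { _≈_ = _≈_ ; _+_ = _+_ ; _*_ = _*_ ; -_ = id ; 0# = 0# ; 1# = 1#
  ; isCommutativeRing = record
   { isRing = record
    { +-isAbelianGroup = record
     { isGroup = record
      { isMonoid = record
       { isSemigroup = record { isMagma = record { isEquivalence = equivalence ; ∙-cong = +-cong } ; assoc = +-assoc }
       ; identity = comm∧idˡ⇒id +-comm +-identityˡ }
      ; inverse = char2 , char2 ; ⁻¹-cong = id }
     ; comm = +-comm }
    ; *-cong = *-cong ; *-assoc = *-assoc
    ; *-identity = comm∧idˡ⇒id *-comm *-identityˡ
    ; distrib = comm∧distrʳ⇒distrˡ +-cong *-comm distribʳ , distribʳ }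
   ; *-comm = *-comm } }
  where
  setoid : Setoid 0ℓ 0ℓ
  setoid = record { isEquivalence = equivalence }
  open import Algebra.Consequences.Setoid setoid using (comm∧idˡ⇒id; comm∧distrʳ⇒distrˡ)

infixr 5 _≡⟫_ _⟫≡_

_≡⟫_ : ∀ {a b c} → a ≡ b → b ≤ c → a ≤ c
≡.refl ≡⟫ p = p

_⟫≡_ : ∀ {a b c} → a ≤ b → b ≡ c → a ≤ c
p ⟫≡ ≡.refl = p

F2-raw : RawRing 0ℓ 0ℓ
F2-raw = record { Carrier = Bool ; _≈_ = _≡_ ; _+_ = _xor_ ; _*_ = _∧_
                ; -_ = id ; 0# = false ; 1# = true }

CharTwo : CommutativeRing 0ℓ 0ℓ → Set
CharTwo R = let open CommutativeRing R in ∀ x → x + x ≈ 0#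

module Char2 (R : CommutativeRing 0ℓ 0ℓ) (char2 : CharTwo R) where

 open CommutativeRing R public hiding (zero)
 open import Relation.Binary.Reasoning.Setoid setoid

 infixr 5 _⊚_
 _⊚_ : ∀ {x y z} → x ≈ y → y ≈ z → x ≈ z
 _⊚_ = trans

 bool : Bool → Carrier
 bool b = if b then 1# else 0#

 -x≈x : ∀ x → - x ≈ x
 -x≈x x = begin
  - x ≈⟨ +-identityʳ _ ⟨
  - x + 0# ≈⟨ +-congˡ (char2 x) ⟨
  - x + (x + x) ≈⟨ +-assoc _ _ _ ⟨
  - x + x + x ≈⟨ +-congʳ (-‿inverseˡ x) ⟩
  0# + x ≈⟨ +-identityˡ x ⟩
  x ∎

 morphism : F2-raw -Raw-AlmostCommutative⟶ fromCommutativeRing R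
 morphism = record
  { ⟦_⟧ = bool
  ; +-homo = λ { false y → sym (+-identityˡ _)
               ; true false → sym (+-identityʳ _)
               ; true true → sym (char2 _) }
  ; *-homo = λ { false y → sym (zeroˡ _) ; true y → sym (*-identityˡ _) }
  ; -‿homo = λ b → sym (-x≈x (bool b))
  ; 0-homo = refl ; 1-homo = refl }

 dec : ∀ (a b : Bool) → Maybe (bool a ≈ bool b)
 dec false false = just refl
 dec true  true  = just refl
 dec _     _     = nothing

 module Solver = RingSolver F2-raw (fromCommutativeRing R) morphism dec
 open Solver public using (solve; prove; Polynomial; ⟦_⟧; ⟦_⟧↓; _:=_; _:+_; _:*_; con) renaming (var to variable′)

 private module Sum = SemiringSum semiring

 abstract
  ∑ : ∀ {n} → (Fin n → Carrier) → Carrier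
  ∑ = Sum.sum

  ∑-empty : (f : Fin 0 → Carrier) → ∑ f ≡ 0#
  ∑-empty f = ≡.refl

  ∑-suc : ∀ {n} (f : Fin (suc n) → Carrier) → ∑ f ≡ f zero + ∑ (λ i → f (suc i))
  ∑-suc f = ≡.refl

  sum-cong-≋ : ∀ {n} {f g : Fin n → Carrier} → (∀ i → f i ≈ g i) → ∑ f ≈ ∑ g
  sum-cong-≋ = Sum.sum-cong-≋

  ∑-distrib-+ : ∀ {n} (f g : Fin n → Carrier) → ∑ (λ i → f i + g i) ≈ ∑ f + ∑ g
  ∑-distrib-+ = Sum.∑-distrib-+

  ∑-comm : ∀ {m n} (f : Fin m → Fin n → Carrier) →
           ∑ (λ i → ∑ λ j → f i j) ≈ ∑ (λ j → ∑ λ i → f i j)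
  ∑-comm = Sum.∑-comm

  *-distribˡ-sum : ∀ {n} x (f : Fin n → Carrier) → x * ∑ f ≈ ∑ (λ i → x * f i)
  *-distribˡ-sum = Sum.*-distribˡ-sum

  *-distribʳ-sum : ∀ {n} x (f : Fin n → Carrier) → ∑ f * x ≈ ∑ (λ i → f i * x)
  *-distribʳ-sum = Sum.*-distribʳ-sum

  sum-replicate-zero : ∀ n → ∑ {n} (λ _ → 0#) ≈ 0#
  sum-replicate-zero = Sum.sum-replicate-zero

 ∑-zero : ∀ {n} {f : Fin n → Carrier} → (∀ i → f i ≈ 0#) → ∑ f ≈ 0#
 ∑-zero {n} h = sum-cong-≋ h ⊚ sum-replicate-zero n

 ∑-square : ∀ {n} (f : Fin n → Carrier) → ∑ f * ∑ f ≈ ∑ λ i → f i * f i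
 ∑-square {zero}  f = *-congʳ (reflexive (∑-empty f)) ⊚
  zeroˡ _ ⊚ reflexive (≡.sym (∑-empty _))
 ∑-square {suc n} f = begin
  ∑ f * ∑ f
   ≡⟨ ≡.cong₂ _*_ (∑-suc f) (∑-suc f) ⟩
  (f zero + ∑ g) * (f zero + ∑ g)
   ≈⟨ solve 2 (λ a b → (a :+ b) :* (a :+ b) := a :* a :+ b :* b) refl (f zero) (∑ g) ⟩
  f zero * f zero + ∑ g * ∑ g
   ≈⟨ +-congˡ (∑-square g) ⟩
  f zero * f zero + (∑ λ i → g i * g i)
   ≡⟨ ∑-suc _ ⟨
  (∑ λ i → f i * f i) ∎
  where g : Fin n → Carrier
        g i = f (suc i)

 δ : ∀ {n} → Fin n → Fin n → Carrier
 δ i j = bool (does (i Fin.≟ j))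

 δ-refl : ∀ {n} (i : Fin n) → δ i i ≈ 1#
 δ-refl i with i Fin.≟ i
 ... | yes _ = refl
 ... | no ¬p = contradiction ≡.refl ¬p

 δ-≢ : ∀ {n} {i j : Fin n} → i ≢ j → δ i j ≈ 0#
 δ-≢ {i = i} {j} i≢j with i Fin.≟ j
 ... | yes p = contradiction p i≢j
 ... | no _  = refl

 ∑-single : ∀ {n} (i : Fin n) (f : Fin n → Carrier) → (∀ j → j ≢ i → f j ≈ 0#) → ∑ f ≈ f i
 ∑-single zero    f h = reflexive (∑-suc f) ⊚ +-congˡ (∑-zero λ j → h (suc j) λ ()) ⊚ +-identityʳ _
 ∑-single (suc i) f h = reflexive (∑-suc f) ⊚ +-congʳ (h zero λ ()) ⊚
  +-identityˡ _ ⊚ (∑-single i (λ j → f (suc j)) λ j j≢i → h (suc j) λ { ≡.refl → j≢i ≡.refl })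

 ∑-δˡ : ∀ {n} (i : Fin n) (f : Fin n → Carrier) → ∑ (λ j → δ i j * f j) ≈ f i
 ∑-δˡ i f = (∑-single i _ λ j j≢i → *-congʳ (δ-≢ λ p → j≢i (≡.sym p)) ⊚ zeroˡ _) ⊚
                  *-congʳ (δ-refl i) ⊚ *-identityˡ _

 ∑-δʳ : ∀ {n} (i : Fin n) (f : Fin n → Carrier) → ∑ (λ j → f j * δ j i) ≈ f i
 ∑-δʳ i f = (∑-single i _ λ j j≢i → *-congˡ (δ-≢ j≢i) ⊚ zeroʳ _) ⊚
                  *-congˡ (δ-refl i) ⊚ *-identityʳ _

open import Data.Nat.Base using (_<_; z≤n; s≤s; z<s; s<s)
open import Data.Product.Base using (_×_) renaming (proj₁ to fst; proj₂ to snd)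

module Resolvent (R : CommutativeRing 0ℓ 0ℓ) (char2 : CharTwo R) where

 open Char2 R char2
 open import Relation.Binary.Reasoning.Setoid setoid

 Mat : ℕ → Set
 Mat n = Fin n → Fin n → Carrier

 infixl 7 _·_
 _·_ : ∀ {n} → Mat n → Mat n → Mat n
 (X · Y) i j = ∑ λ k → X i k * Y k j

 record Inverts {n} (X N : Mat n) : Set where
  field
   left  : ∀ i j → N i j ≈ δ i j + (X · N) i j
   right : ∀ i j → N i j ≈ δ i j + (N · X) i j

 ·-assoc : ∀ {n} (X Y Z : Mat n) i j → ((X · Y) · Z) i j ≈ (X · (Y · Z)) i j
 ·-assoc X Y Z i j = begin
  (∑ λ k → (∑ λ l → X i l * Y l k) * Z k j) ≈⟨ sum-cong-≋ (λ k → *-distribʳ-sum (Z k j) _) ⟩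
  (∑ λ k → ∑ λ l → X i l * Y l k * Z k j) ≈⟨ ∑-comm (λ k l → X i l * Y l k * Z k j) ⟩
  (∑ λ l → ∑ λ k → X i l * Y l k * Z k j) ≈⟨ sum-cong-≋ (λ l → sum-cong-≋ λ k → *-assoc _ _ _) ⟩
  (∑ λ l → ∑ λ k → X i l * (Y l k * Z k j)) ≈⟨ sum-cong-≋ (λ l → *-distribˡ-sum (X i l) _) ⟨
  (∑ λ l → X i l * ∑ λ k → Y l k * Z k j) ∎

 ·-cong : ∀ {n} {X X' Y Y' : Mat n} → (∀ i j → X i j ≈ X' i j) → (∀ i j → Y i j ≈ Y' i j) →
          ∀ i j → (X · Y) i j ≈ (X' · Y') i j
 ·-cong p q i j = sum-cong-≋ λ k → *-cong (p i k) (q k j)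

 ·-δ : ∀ {n} (X : Mat n) i j → (X · δ) i j ≈ X i j
 ·-δ X i j = ∑-δʳ j (X i)

 δ-· : ∀ {n} (X : Mat n) i j → (δ · X) i j ≈ X i j
 δ-· X i j = ∑-δˡ i (λ k → X k j)

 distribˡ-· : ∀ {n} (X Y Z : Mat n) i j → (X · (λ a b → Y a b + Z a b)) i j ≈ (X · Y) i j + (X · Z) i j
 distribˡ-· X Y Z i j = (sum-cong-≋ λ k → distribˡ _ _ _) ⊚ ∑-distrib-+ _ _

 distribʳ-· : ∀ {n} (X Y Z : Mat n) i j → ((λ a b → Y a b + Z a b) · X) i j ≈ (Y · X) i j + (Z · X) i j
 distribʳ-· X Y Z i j = (sum-cong-≋ λ k → distribʳ _ _ _) ⊚ ∑-distrib-+ _ _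

 -- A one-sided solution of each kind forces the two to agree.
 one-sided⇒Inverts : ∀ {n} {X N N″ : Mat n} →
  (∀ i j → N i j ≈ δ i j + (X · N) i j) → (∀ i j → N″ i j ≈ δ i j + (N″ · X) i j) → Inverts X N
 one-sided⇒Inverts {X = X} {N} {N″} l r = record { left = l ; right = right' }
  where
  N″XN : ∀ i j → (N″ · (X · N)) i j ≈ (N″ · N) i j + N″ i j
  N″XN i j = begin
   (N″ · (X · N)) i j
    ≈⟨ ·-cong {X = N″} (λ _ _ → refl) (λ a b → solve 2 (λ x d → x := d :+ x :+ d) refl ((X · N) a b) (δ a b) ⊚ +-congʳ (sym (l a b))) i j ⟩
   (N″ · (λ a b → N a b + δ a b)) i j ≈⟨ distribˡ-· N″ N δ i j ⟩
   (N″ · N) i j + (N″ · δ) i j ≈⟨ +-congˡ (·-δ N″ i j) ⟩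
   (N″ · N) i j + N″ i j ∎
  N″XN' : ∀ i j → (N″ · (X · N)) i j ≈ (N″ · N) i j + N i j
  N″XN' i j = begin
   (N″ · (X · N)) i j ≈⟨ ·-assoc N″ X N i j ⟨
   ((N″ · X) · N) i j
    ≈⟨ ·-cong {Y = N} (λ a b → solve 2 (λ x d → x := d :+ x :+ d) refl ((N″ · X) a b) (δ a b) ⊚ +-congʳ (sym (r a b))) (λ _ _ → refl) i j ⟩
   ((λ a b → N″ a b + δ a b) · N) i j ≈⟨ distribʳ-· N N″ δ i j ⟩
   (N″ · N) i j + (δ · N) i j ≈⟨ +-congˡ (δ-· N i j) ⟩
   (N″ · N) i j + N i j ∎
  N≈N″ : ∀ i j → N i j ≈ N″ i j
  N≈N″ i j = begin
   N i j ≈⟨ solve 2 (λ a b → a := b :+ (b :+ a)) refl (N i j) ((N″ · N) i j) ⟩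
   (N″ · N) i j + ((N″ · N) i j + N i j) ≈⟨ +-congˡ (sym (N″XN' i j) ⊚ N″XN i j) ⟩
   (N″ · N) i j + ((N″ · N) i j + N″ i j) ≈⟨ solve 2 (λ a b → b :+ (b :+ a) := a) refl (N″ i j) ((N″ · N) i j) ⟩
   N″ i j ∎
  right' : ∀ i j → N i j ≈ δ i j + (N · X) i j
  right' i j = N≈N″ i j ⊚ r i j ⊚
   +-congˡ (·-cong {X = N″} {Y = X} (λ a b → sym (N≈N″ a b)) (λ _ _ → refl) i j)

 delete : ∀ {n} → Fin n → Mat n → Mat n
 delete v X i j = if does (j Fin.≟ v) then 0# else X i j

 delete-≡ : ∀ {n} (v : Fin n) (X : Mat n) i → delete v X i v ≈ 0#
 delete-≡ v X i with v Fin.≟ v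
 ... | yes _ = refl
 ... | no ¬p = contradiction ≡.refl ¬p

 delete-≢ : ∀ {n} {v j : Fin n} (X : Mat n) i → j ≢ v → delete v X i j ≈ X i j
 delete-≢ {v = v} {j} X i j≢v with j Fin.≟ v
 ... | yes p = contradiction p j≢v
 ... | no _  = refl

 -- G = N P where P(b,a) = δ(b,a) N(a,a) + X(b,a)² N(a,b).
 module Gradient {n} (X N : Mat n) where
  G : Mat n
  G i a = N i a * N a a + ∑ λ b → N i b * (X b a * X b a * N a b)

 module _ {n} {X N : Mat n} (inv : Inverts X N) where
  open Inverts inv
  open Gradient X N

  frobenius : ∀ i a → N i a * N i a + (∑ λ b → N i b * N i b * (X b a * X b a)) ≈ δ i a
  frobenius i a = begin
   N i a * N i a + (∑ λ b → N i b * N i b * (X b a * X b a))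
    ≈⟨ +-congˡ (sum-cong-≋ λ b → solve 2 (λ x y → x :* x :* (y :* y) := x :* y :* (x :* y)) refl (N i b) (X b a)) ⟩
   N i a * N i a + (∑ λ b → N i b * X b a * (N i b * X b a))
    ≈⟨ +-congˡ (∑-square _) ⟨
   N i a * N i a + (N · X) i a * (N · X) i a
    ≈⟨ solve 2 (λ x y → x :* x :+ y :* y := (x :+ y) :* (x :+ y)) refl (N i a) ((N · X) i a) ⟩
   (N i a + (N · X) i a) * (N i a + (N · X) i a)
    ≈⟨ *-cong e e ⟩
   δ i a * δ i a
    ≈⟨ idem ⟩
   δ i a ∎
   where
   e : N i a + (N · X) i a ≈ δ i a
   e = +-congʳ (right i a) ⊚ solve 2 (λ x y → x :+ y :+ y := x) refl (δ i a) ((N · X) i a)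
   idem : δ i a * δ i a ≈ δ i a
   idem with does (i Fin.≟ a)
   ... | true  = *-identityˡ _
   ... | false = zeroˡ _

  G-diagonal : ∀ a → G a a ≈ 1#
  G-diagonal a = (+-congˡ (sum-cong-≋ λ b →
   solve 3 (λ x y z → x :* (y :* y :* x) := x :* x :* (y :* y)) refl (N a b) (X b a) (N a b)) ⊚
   frobenius a a) ⊚ δ-refl a

 module _ {n} {X N N' : Mat n} (v : Fin n) (inv : Inverts X N) (inv' : Inverts (delete v X) N') where
  private
   module I = Inverts inv
   module I' = Inverts inv'
   X' = delete v X

  hit : Fin n → Carrier
  hit x = ∑ λ u → N' x u * X u v

  N'-column : ∀ x → N' x v ≈ δ x v
  N'-column x = I'.right x v ⊚ +-congˡ (∑-zero λ u →
   trans (*-congˡ (delete-≡ v X u)) (zeroʳ _)) ⊚ +-identityʳ _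

  N'X : ∀ x w → (N' · X) x w ≈ N' x w + δ x w + hit x * δ v w
  N'X x w with w Fin.≟ v
  ... | yes ≡.refl = begin
   hit x ≈⟨ solve 2 (λ h d → h := d :+ d :+ h :* con true) refl (hit x) (δ x v) ⟩
   δ x v + δ x v + hit x * 1# ≈⟨ +-cong (+-congʳ (N'-column x)) (*-congˡ (δ-refl v)) ⟨
   N' x v + δ x v + hit x * δ v v ∎
  ... | no w≢v = begin
   (N' · X) x w ≈⟨ sum-cong-≋ (λ u → *-congˡ (sym (delete-≢ X u w≢v))) ⟩
   (N' · X') x w ≈⟨ solve 3 (λ s d h → s := d :+ s :+ d :+ h :* con false) refl _ (δ x w) (hit x) ⟩
   δ x w + (N' · X') x w + δ x w + hit x * 0#
    ≈⟨ +-cong (+-congʳ (I'.right x w)) (*-congˡ (δ-≢ λ p → w≢v (≡.sym p))) ⟨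
   N' x w + δ x w + hit x * δ v w ∎

  N-split : ∀ x b → N x b ≈ N' x b + hit x * N v b
  N-split x b = begin
   N x b
    ≈⟨ solve 3 (λ n m h → n := m :+ h :+ (m :+ n :+ h)) refl (N x b) (N'·N) (hit x * N v b) ⟩
   N'·N + hit x * N v b + (N'·N + N x b + hit x * N v b)
    ≈⟨ +-congˡ (sym S2 ⊚ S1) ⟩
   N'·N + hit x * N v b + (N'·N + N' x b)
    ≈⟨ solve 3 (λ n m h → m :+ h :+ (m :+ n) := n :+ h) refl (N' x b) (N'·N) (hit x * N v b) ⟩
   N' x b + hit x * N v b ∎
   where
   N'·N : Carrier
   N'·N = (N' · N) x b
   S1 : (N' · (X · N)) x b ≈ N'·N + N' x b
   S1 = begin
    (N' · (X · N)) x b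
     ≈⟨ ·-cong {X = N'} (λ _ _ → refl) (λ a b → solve 2 (λ x d → x := d :+ x :+ d) refl ((X · N) a b) (δ a b) ⊚ +-congʳ (sym (I.left a b))) x b ⟩
    (N' · (λ a b → N a b + δ a b)) x b ≈⟨ distribˡ-· N' N δ x b ⟩
    N'·N + (N' · δ) x b ≈⟨ +-congˡ (·-δ N' x b) ⟩
    N'·N + N' x b ∎
   S2 : (N' · (X · N)) x b ≈ N'·N + N x b + hit x * N v b
   S2 = begin
    (N' · (X · N)) x b ≈⟨ ·-assoc N' X N x b ⟨
    ((N' · X) · N) x b ≈⟨ sum-cong-≋ (λ w → *-congʳ (N'X x w)) ⟩
    (∑ λ w → (N' x w + δ x w + hit x * δ v w) * N w b)
     ≈⟨ sum-cong-≋ (λ w → solve 5 (λ a d h e m → (a :+ d :+ h :* e) :* m := a :* m :+ d :* m :+ h :* (e :* m)) refl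
          (N' x w) (δ x w) (hit x) (δ v w) (N w b)) ⟩
    (∑ λ w → N' x w * N w b + δ x w * N w b + hit x * (δ v w * N w b))
     ≈⟨ ∑-distrib-+ _ (λ w → hit x * (δ v w * N w b)) ⊚ +-congʳ (∑-distrib-+ _ _) ⟩
    N'·N + (∑ λ w → δ x w * N w b) + (∑ λ w → hit x * (δ v w * N w b))
     ≈⟨ +-cong (+-congˡ (∑-δˡ x _)) (sym (*-distribˡ-sum _ _) ⊚ *-congˡ (∑-δˡ v _)) ⟩
    N'·N + N x b + hit x * N v b ∎

  N-row : ∀ b → N v b ≈ N v v * N' v b
  N-row b = sym (begin
   N v v * N' v b
    ≈⟨ *-congˡ (solve 2 (λ m h → m := m :+ h :+ h) refl (N' v b) (hit v * N v b) ⊚ +-congʳ (sym (N-split v b))) ⟩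
   N v v * (N v b + hit v * N v b)
    ≈⟨ solve 3 (λ l m h → l :* (m :+ h :* m) := (l :+ h :* l) :* m) refl (N v v) (N v b) (hit v) ⟩
   (N v v + hit v * N v v) * N v b
    ≈⟨ *-congʳ (+-congʳ (N-split v v)) ⟩
   (N' v v + hit v * N v v + hit v * N v v) * N v b
    ≈⟨ *-congʳ (+-congʳ (+-congʳ (N'-column v ⊚ δ-refl v))) ⟩
   (1# + hit v * N v v + hit v * N v v) * N v b
    ≈⟨ solve 2 (λ h m → (con true :+ h :+ h) :* m := m) refl (hit v * N v v) (N v b) ⟩
   N v b ∎)

  private
   module G  = Gradient X N
   module G′ = Gradient X' N'

  G-scale : ∀ {a} → a ≢ v → G.G v a ≈ N v v * G′.G v a
  G-scale {a} a≢v = begin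
   N v a * N a a + (∑ λ b → N v b * (X b a * X b a * N a b))
    ≈⟨ +-cong (*-congˡ (N-split a a)) (sum-cong-≋ λ b → *-congˡ (*-congˡ (N-split a b))) ⟩
   N v a * (N' a a + hit a * N v a) + (∑ λ b → N v b * (X b a * X b a * (N' a b + hit a * N v b)))
    ≈⟨ +-congˡ (sum-cong-≋ λ b → solve 4 (λ m x n h → m :* (x :* x :* (n :+ h :* m)) := m :* (x :* x :* n) :+ h :* (m :* m :* (x :* x)))
         refl (N v b) (X b a) (N' a b) (hit a)) ⟩
   N v a * (N' a a + hit a * N v a) + (∑ λ b → N v b * (X b a * X b a * N' a b) + hit a * (N v b * N v b * (X b a * X b a)))
    ≈⟨ +-congˡ (∑-distrib-+ _ (λ b → hit a * (N v b * N v b * (X b a * X b a))) ⊚ +-congˡ (sym (*-distribˡ-sum (hit a) _))) ⟩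
   N v a * (N' a a + hit a * N v a) + (S + hit a * F)
    ≈⟨ solve 5 (λ m n h s f → m :* (n :+ h :* m) :+ (s :+ h :* f) := (m :* n :+ s) :+ h :* (m :* m :+ f))
         refl (N v a) (N' a a) (hit a) S F ⟩
   (N v a * N' a a + S) + hit a * (N v a * N v a + F)
    ≈⟨ +-congˡ (*-congˡ (frobenius inv v a ⊚ (δ-≢ λ p → a≢v (≡.sym p))) ⊚ zeroʳ _) ⟩
   (N v a * N' a a + S) + 0#
    ≈⟨ +-identityʳ _ ⊚ +-cong (*-congʳ (N-row a)) (sum-cong-≋ λ b →
         *-cong (N-row b) (*-congʳ (sym (*-cong (delete-≢ X b a≢v) (delete-≢ X b a≢v))))) ⟩
   N v v * N' v a * N' a a + (∑ λ b → N v v * N' v b * (X' b a * X' b a * N' a b))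
    ≈⟨ +-cong (*-assoc _ _ _) ((sum-cong-≋ λ b → *-assoc _ _ _) ⊚ sym (*-distribˡ-sum (N v v) _)) ⟩
   N v v * (N' v a * N' a a) + N v v * (∑ λ b → N' v b * (X' b a * X' b a * N' a b))
    ≈⟨ distribˡ _ _ _ ⟨
   N v v * G′.G v a ∎
   where
   S F : Carrier
   S = ∑ λ b → N v b * (X b a * X b a * N' a b)
   F = ∑ λ b → N v b * N v b * (X b a * X b a)

  G'-step : ∀ {a} → a ≢ v → G′.G v a ≈ (X' · G′.G) v a
  G'-step {a} a≢v = begin
   N' v a * N' a a + (∑ λ b → N' v b * P b)
    ≈⟨ +-cong (*-congʳ (I'.left v a ⊚ +-congʳ (δ-≢ λ p → a≢v (≡.sym p)) ⊚ +-identityˡ _))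
              (sum-cong-≋ λ b → *-congʳ (I'.left v b)) ⟩
   (X' · N') v a * N' a a + (∑ λ b → (δ v b + (X' · N') v b) * P b)
    ≈⟨ +-congˡ ((sum-cong-≋ λ b → distribʳ _ _ _) ⊚ ∑-distrib-+ _ _ ⊚
         +-congʳ (∑-δˡ v P ⊚ Pv) ⊚ +-identityˡ _) ⟩
   (X' · N') v a * N' a a + (∑ λ b → (X' · N') v b * P b)
    ≈⟨ +-cong (*-distribʳ-sum (N' a a) _) (·-assoc X' N' (λ b _ → P b) v a) ⟩
   (∑ λ y → X' v y * N' y a * N' a a) + (∑ λ y → X' v y * ∑ λ b → N' y b * P b)
    ≈⟨ ∑-distrib-+ (λ y → X' v y * N' y a * N' a a) _ ⟨
   (∑ λ y → X' v y * N' y a * N' a a + X' v y * ∑ λ b → N' y b * P b)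
    ≈⟨ sum-cong-≋ (λ y → +-congʳ (*-assoc _ _ _) ⊚ sym (distribˡ _ _ _)) ⟩
   (X' · G′.G) v a ∎
   where
   P : Fin n → Carrier
   P b = X' b a * X' b a * N' a b
   Pv : P v ≈ 0#
   Pv = *-congˡ (N'-column a ⊚ δ-≢ a≢v) ⊚ zeroʳ _

open import Data.Bool.Base using (not; T)
open import Data.Nat.Base using (s≤s⁻¹)
open import Data.Unit.Base using (tt)
open import Relation.Nullary using (¬_)

-- Power series with the product determined by (a + z f) g = a g + z (f g).
module PowerSeries (R : CommutativeRing 0ℓ 0ℓ) (char2 : CharTwo R) where

 open Char2 R char2
 open import Relation.Binary.Reasoning.Setoid setoid

 Series : Set
 Series = ℕ → Carrier

 tail : Series → Series
 tail f k = f (suc k)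

 infix 4 _≋_
 _≋_ : Series → Series → Set
 f ≋ g = ∀ k → f k ≈ g k

 infixl 7 _⋆_
 _⋆_ : Series → Series → Series
 (f ⋆ g) zero    = f 0 * g 0
 (f ⋆ g) (suc k) = f 0 * g (suc k) + (tail f ⋆ g) k

 constant : Carrier → Series
 constant a zero    = a
 constant a (suc _) = 0#

 ⋆-cong : ∀ {f f' g g'} → f ≋ f' → g ≋ g' → f ⋆ g ≋ f' ⋆ g'
 ⋆-cong p q zero    = *-cong (p 0) (q 0)
 ⋆-cong p q (suc k) = +-cong (*-cong (p 0) (q (suc k))) (⋆-cong (λ i → p (suc i)) q k)

 ⋆-distribʳ : ∀ h f g → (λ k → f k + g k) ⋆ h ≋ (λ k → (f ⋆ h) k + (g ⋆ h) k)
 ⋆-distribʳ h f g zero    = distribʳ _ _ _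
 ⋆-distribʳ h f g (suc k) = +-congˡ (⋆-distribʳ h (tail f) (tail g) k) ⊚
  solve 5 (λ a b c x y → (a :+ b) :* c :+ (x :+ y) := a :* c :+ x :+ (b :* c :+ y)) refl
   (f 0) (g 0) (h (suc k)) ((tail f ⋆ h) k) ((tail g ⋆ h) k)

 ⋆-zeroˡ : ∀ f → (λ _ → 0#) ⋆ f ≋ (λ _ → 0#)
 ⋆-zeroˡ f zero    = zeroˡ _
 ⋆-zeroˡ f (suc k) = +-cong (zeroˡ _) (⋆-zeroˡ f k) ⊚ +-identityˡ _

 ⋆-scale : ∀ a f g → (λ k → a * f k) ⋆ g ≋ (λ k → a * (f ⋆ g) k)
 ⋆-scale a f g zero    = *-assoc _ _ _
 ⋆-scale a f g (suc k) = +-cong (*-assoc _ _ _) (⋆-scale a (tail f) g k) ⊚ sym (distribˡ _ _ _)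

 ⋆-suc : ∀ f g k → (f ⋆ g) (suc k) ≈ f (suc k) * g 0 + (f ⋆ tail g) k
 ⋆-suc f g zero    = +-comm _ _
 ⋆-suc f g (suc k) = +-congˡ (⋆-suc (tail f) g k) ⊚
  solve 3 (λ a b c → a :+ (b :+ c) := b :+ (a :+ c)) refl
   (f 0 * g (suc (suc k))) (f (suc (suc k)) * g 0) ((tail f ⋆ tail g) k)

 ⋆-comm : ∀ f g → f ⋆ g ≋ g ⋆ f
 ⋆-comm f g zero    = *-comm _ _
 ⋆-comm f g (suc k) = +-cong (*-comm _ _) (⋆-comm (tail f) g k) ⊚ sym (⋆-suc g f k)

 ⋆-assoc : ∀ f g h → (f ⋆ g) ⋆ h ≋ f ⋆ (g ⋆ h)
 ⋆-assoc f g h zero    = *-assoc _ _ _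
 ⋆-assoc f g h (suc k) = begin
  f 0 * g 0 * h (suc k) + ((λ i → f 0 * g (suc i) + (tail f ⋆ g) i) ⋆ h) k
   ≈⟨ +-congˡ (⋆-distribʳ h (λ i → f 0 * g (suc i)) (tail f ⋆ g) k ⊚
        +-cong (⋆-scale (f 0) (tail g) h k) (⋆-assoc (tail f) g h k)) ⟩
  f 0 * g 0 * h (suc k) + (f 0 * (tail g ⋆ h) k + (tail f ⋆ (g ⋆ h)) k)
   ≈⟨ solve 5 (λ a b c x y → a :* b :* c :+ (a :* x :+ y) := a :* (b :* c :+ x) :+ y) refl
        (f 0) (g 0) (h (suc k)) ((tail g ⋆ h) k) ((tail f ⋆ (g ⋆ h)) k) ⟩
  f 0 * (g 0 * h (suc k) + (tail g ⋆ h) k) + (tail f ⋆ (g ⋆ h)) k ∎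

 ⋆-identityˡ : ∀ f → constant 1# ⋆ f ≋ f
 ⋆-identityˡ f zero    = *-identityˡ _
 ⋆-identityˡ f (suc k) = +-cong (*-identityˡ _) (⋆-zeroˡ f k) ⊚ +-identityʳ _

 series : CommutativeRing 0ℓ 0ℓ
 series = char2-ring _≋_ (λ f g k → f k + g k) _⋆_ (λ _ → 0#) (constant 1#)
  (record { refl = λ k → refl ; sym = λ p k → sym (p k) ; trans = λ p q k → p k ⊚ q k })
  (λ p q k → +-cong (p k) (q k)) (λ _ _ _ _ → +-assoc _ _ _) (λ _ _ _ → +-comm _ _) (λ _ _ → +-identityˡ _) (λ _ _ → char2 _)
  ⋆-cong ⋆-assoc ⋆-comm ⋆-identityˡ ⋆-distribʳ

 char2ₛ : ∀ (f : Series) → (λ k → f k + f k) ≋ (λ _ → 0#)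
 char2ₛ f k = char2 (f k)

 module S = Char2 series char2ₛ
 module Mₛ = Resolvent series char2ₛ
 open Resolvent R char2 using (Mat; _·_; delete) public

 ∑-coefficient : ∀ {n} (f : Fin n → Series) k → S.∑ f k ≈ ∑ λ i → f i k
 ∑-coefficient {zero}  f k = reflexive (≡.trans (≡.cong (λ s → s k) (S.∑-empty f)) (≡.sym (∑-empty _)))
 ∑-coefficient {suc n} f k = reflexive (≡.cong (λ s → s k) (S.∑-suc f)) ⊚
  +-congˡ (∑-coefficient (λ i → f (suc i)) k) ⊚ reflexive (≡.sym (∑-suc _))

 z·_ : Carrier → Series
 (z· a) zero    = 0#
 (z· a) (suc k) = constant a k

 constant-⋆ : ∀ a f → constant a ⋆ f ≋ (λ k → a * f k)
 constant-⋆ a f zero    = refl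
 constant-⋆ a f (suc k) = +-congˡ (⋆-zeroˡ f k) ⊚ +-identityʳ _

 z·-⋆-zero : ∀ a f → ((z· a) ⋆ f) 0 ≈ 0#
 z·-⋆-zero a f = zeroˡ _

 z·-⋆-suc : ∀ a f k → ((z· a) ⋆ f) (suc k) ≈ a * f k
 z·-⋆-suc a f k = +-congʳ (zeroˡ _) ⊚ +-identityˡ _ ⊚ constant-⋆ a f k

 ⋆-z·-suc : ∀ f a k → (f ⋆ (z· a)) (suc k) ≈ f k * a
 ⋆-z·-suc f a k = ⋆-comm f (z· a) (suc k) ⊚ z·-⋆-suc a f k ⊚ *-comm _ _

 z·-0 : ∀ {a} → a ≈ 0# → (z· a) ≋ (λ _ → 0#)
 z·-0 p zero          = refl
 z·-0 p (suc zero)    = p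
 z·-0 p (suc (suc k)) = refl

 infix 4 _≋[_]_
 _≋[_]_ : Series → ℕ → Series → Set
 f ≋[ k ] g = ∀ i → i < k → f i ≈ g i

 ⋆-cong[_] : ∀ k {f f' g g'} → f ≋[ k ] f' → g ≋[ k ] g' → f ⋆ g ≋[ k ] f' ⋆ g'
 ⋆-cong[ k     ] p q zero    i<k = *-cong (p 0 i<k) (q 0 i<k)
 ⋆-cong[ suc k ] {f} {f'} {g} {g'} p q (suc i) (s≤s i<k) = +-cong (*-cong (p 0 z<s) (q (suc i) (s≤s i<k)))
  (⋆-cong[ k ] {tail f} {tail f'} {g} {g'} (λ j j<k → p (suc j) (s<s j<k)) (λ j j<k → q j (ℕ.m<n⇒m<1+n j<k)) i i<k)

 z·-⋆-cong : ∀ k a {f g} → f ≋[ k ] g → (z· a) ⋆ f ≋[ suc k ] (z· a) ⋆ g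
 z·-⋆-cong k a {f} {g} p zero    _ = z·-⋆-zero a f ⊚ sym (z·-⋆-zero a g)
 z·-⋆-cong k a {f} {g} p (suc i) (s≤s i<k) = z·-⋆-suc a f i ⊚ *-congˡ (p i i<k) ⊚ sym (z·-⋆-suc a g i)

 ⋆-z·-cong : ∀ k a {f g} → f ≋[ k ] g → f ⋆ (z· a) ≋[ suc k ] g ⋆ (z· a)
 ⋆-z·-cong k a {f} {g} p i i<k = ⋆-comm f _ i ⊚ z·-⋆-cong k a p i i<k ⊚ ⋆-comm _ g i

 ∑-cong[_] : ∀ k {n} {f g : Fin n → Series} → (∀ i → f i ≋[ k ] g i) → S.∑ f ≋[ k ] S.∑ g
 ∑-cong[ k ] p i i<k = ∑-coefficient _ i ⊚ (sum-cong-≋ λ j → p j i i<k) ⊚ sym (∑-coefficient _ i)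

 0ₛ : Series
 0ₛ _ = 0#

 ∑-0[_] : ∀ k {n} {f : Fin n → Series} → (∀ i → f i ≋[ k ] 0ₛ) → S.∑ f ≋[ k ] 0ₛ
 ∑-0[ k ] p i i<k = ∑-coefficient _ i ⊚ (∑-zero λ j → p j i i<k)

 ⋆-0[_] : ∀ k f {g} → g ≋[ k ] 0ₛ → f ⋆ g ≋[ k ] 0ₛ
 ⋆-0[ k ] f {g} p i i<k = (⋆-cong[ k ] {f} (λ _ _ → refl) p i i<k) ⊚
  ⋆-comm f 0ₛ i ⊚ ⋆-zeroˡ f i

 -- The resolvent N = (1 + z A)⁻¹ = Σ z^k A^k.

 pow : ∀ {n} → Mat n → ℕ → Mat n
 pow A zero    = δ
 pow A (suc k) = A · pow A k

 powʳ : ∀ {n} → Mat n → ℕ → Mat n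
 powʳ A zero    = δ
 powʳ A (suc k) = powʳ A k · A

 X : ∀ {n} → Mat n → Mₛ.Mat n
 X A i j = z· A i j

 resolvent : ∀ {n} → Mat n → Mₛ.Mat n
 resolvent A i j k = pow A k i j

 δₛ-zero : ∀ {n} (i j : Fin n) → S.δ i j 0 ≈ δ i j
 δₛ-zero i j with does (i Fin.≟ j)
 ... | true  = refl
 ... | false = refl

 δₛ-suc : ∀ {n} (i j : Fin n) k → S.δ i j (suc k) ≈ 0#
 δₛ-suc i j k with does (i Fin.≟ j)
 ... | true  = refl
 ... | false = refl

 X·-zero : ∀ {n} (A : Mat n) (Y : Mₛ.Mat n) i j → (X A Mₛ.· Y) i j 0 ≈ 0#
 X·-zero A Y i j = ∑-coefficient _ 0 ⊚ (∑-zero λ l → z·-⋆-zero (A i l) (Y l j))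

 X·-suc : ∀ {n} (A : Mat n) (Y : Mₛ.Mat n) i j k → (X A Mₛ.· Y) i j (suc k) ≈ ∑ λ l → A i l * Y l j k
 X·-suc A Y i j k = ∑-coefficient _ (suc k) ⊚ (sum-cong-≋ λ l → z·-⋆-suc _ (Y l j) k)

 ·X-zero : ∀ {n} (A : Mat n) (Y : Mₛ.Mat n) i j → (Y Mₛ.· X A) i j 0 ≈ 0#
 ·X-zero A Y i j = ∑-coefficient (λ l → Y i l ⋆ X A l j) 0 ⊚ (∑-zero λ l → zeroʳ (Y i l 0))

 ·X-suc : ∀ {n} (A : Mat n) (Y : Mₛ.Mat n) i j k → (Y Mₛ.· X A) i j (suc k) ≈ ∑ λ l → Y i l k * A l j
 ·X-suc A Y i j k = ∑-coefficient _ (suc k) ⊚ (sum-cong-≋ λ l → ⋆-z·-suc (Y i l) (A l j) k)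

 resolvent-inverts : ∀ {n} (A : Mat n) → Mₛ.Inverts (X A) (resolvent A)
 resolvent-inverts A = Mₛ.one-sided⇒Inverts {N″ = λ i j k → powʳ A k i j}
  (λ { i j zero    → sym (+-cong (δₛ-zero i j) (X·-zero A (resolvent A) i j) ⊚ +-identityʳ _)
     ; i j (suc k) → sym (+-cong (δₛ-suc i j k) (X·-suc A (resolvent A) i j k) ⊚ +-identityˡ _) })
  (λ { i j zero    → sym (+-cong (δₛ-zero i j) (·X-zero A (λ i j k → powʳ A k i j) i j) ⊚ +-identityʳ _)
     ; i j (suc k) → sym (+-cong (δₛ-suc i j k) (·X-suc A (λ i j k → powʳ A k i j) i j k) ⊚ +-identityˡ _) })

 X-delete : ∀ {n} (v : Fin n) (A : Mat n) i j → X (delete v A) i j ≋ Mₛ.delete v (X A) i j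
 X-delete v A i j with does (j Fin.≟ v)
 ... | true  = z·-0 refl
 ... | false = λ _ → refl

 delete-inverts : ∀ {n} (v : Fin n) (A : Mat n) → Mₛ.Inverts (Mₛ.delete v (X A)) (resolvent (delete v A))
 delete-inverts v A = record
  { left  = λ i j → S.trans (left i j) (S.+-congˡ (Mₛ.·-cong {Y = N'} (X-delete v A) (λ _ _ → S.refl) i j))
  ; right = λ i j → S.trans (right i j) (S.+-congˡ (Mₛ.·-cong {X = N'} (λ _ _ → S.refl) (X-delete v A) i j)) }
  where
  N' = resolvent (delete v A)
  open Mₛ.Inverts (resolvent-inverts (delete v A))

open import Relation.Nullary using (Dec)

odd? : ℕ → Bool
odd? zero    = false
odd? (suc k) = not (odd? k)

Arcs : ℕ → Set
Arcs n = Fin n → Fin n → Bool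

cut : ∀ {n} → Fin n → Arcs n → Arcs n
cut v g i j = if does (j Fin.≟ v) then false else g i j

-- Simple paths: after a step no arc leads back to its source.
data Path {n} (g : Arcs n) : Fin n → Fin n → ℕ → Set where
 []  : ∀ {v} → Path g v v 0
 _∷_ : ∀ {v y u j} → T (cut v g v y) → Path (cut v g) y u j → Path g v u (suc j)

infix 4 _⊆_
_⊆_ : ∀ {n} → Arcs n → Arcs n → Set
g ⊆ h = ∀ i j → T (g i j) → T (h i j)

cut⊆ : ∀ {n} (g : Arcs n) v → cut v g ⊆ g
cut⊆ g v i j t with does (j Fin.≟ v)
... | false = t

cut-mono : ∀ {n} {g h : Arcs n} v → g ⊆ h → cut v g ⊆ cut v h
cut-mono v f i j t with does (j Fin.≟ v)
... | false = f i j t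

path-mono : ∀ {n} {g h : Arcs n} {v u j} → g ⊆ h → Path g v u j → Path h v u j
path-mono f [] = []
path-mono {g = g} {h} {v = v} f (_∷_ {y = y} t p) =
 cut-mono {g = g} {h} v f v y t ∷ path-mono (cut-mono {g = g} {h} v f) p

EvenGirth : ∀ {n} → Arcs n → ℕ → Set
EvenGirth g ℓ = ∀ {a u j} → odd? j ≡ true → Path g a u j → T (g u a) → ℓ ≤ suc j

module Walks (R : CommutativeRing 0ℓ 0ℓ) (char2 : CharTwo R) where

 open Char2 R char2
 open PowerSeries R char2
 open import Relation.Binary.Reasoning.Setoid setoid

 Supported : ∀ {n} → Arcs n → Mat n → Set
 Supported g A = ∀ i j → g i j ≡ false → A i j ≈ 0#

 supported-cut : ∀ {n} {g : Arcs n} {A} v → Supported g A → Supported (cut v g) (delete v A)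
 supported-cut v h i j e with does (j Fin.≟ v)
 ... | true  = refl
 ... | false = h i j e

 -- Walks from v to u, split by the parity of the length of their loop erasure.
 erased : Bool → ℕ → ∀ {n} → Mat n → Fin n → Fin n → Series
 erased b zero    A v u = 0ₛ
 erased b (suc f) A v u = resolvent A v v ⋆
  (λ k → (if b then 0ₛ else S.δ v u) k
       + (X (delete v A) Mₛ.· erased (not b) f (delete v A)) v u k)

 erased-total : ∀ f {n} (A : Mat n) v u →
  (λ k → erased true f A v u k + erased false f A v u k) ≋[ f ] resolvent A v u
 erased-total (suc f) A v u i i<f = begin
  (L ⋆ (λ k → 0# + Y k)) i + (L ⋆ (λ k → S.δ v u k + Z k)) i
   ≈⟨ S.distribˡ L (λ k → 0# + Y k) (λ k → S.δ v u k + Z k) i ⟨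
  (L ⋆ (λ k → (0# + Y k) + (S.δ v u k + Z k))) i
   ≈⟨ ⋆-cong {f = L} (λ _ → refl) (λ k → solve 3 (λ y d z → (con false :+ y) :+ (d :+ z) := d :+ (y :+ z)) refl (Y k) (S.δ v u k) (Z k)) i ⟩
  (L ⋆ (λ k → S.δ v u k + (Y k + Z k))) i
   ≈⟨ ⋆-cong[ suc f ] {f = L} (λ _ _ → refl) (λ k k<f → +-congˡ (sym (Mₛ.distribˡ-· (X A') (erased false f A') (erased true f A') v u k) ⊚
         (∑-cong[ suc f ] (λ y → z·-⋆-cong f (A' v y) (λ j j<f → +-comm _ _ ⊚ erased-total f A' y u j j<f)) k k<f))) i i<f ⟩
  (L ⋆ (λ k → S.δ v u k + (X A' Mₛ.· resolvent A') v u k)) i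
   ≈⟨ ⋆-cong {f = L} (λ _ → refl) (S.sym (Mₛ.Inverts.left (resolvent-inverts A') v u)) i ⟩
  (L ⋆ resolvent A' v u) i
   ≈⟨ Mₛ.N-row v (resolvent-inverts A) (delete-inverts v A) u i ⟨
  resolvent A v u i ∎
  where
  A' = delete v A
  L  = resolvent A v v
  Y Z : Series
  Y = (X A' Mₛ.· erased false f A') v u
  Z = (X A' Mₛ.· erased true f A') v u

 erased-unreachable : ∀ f b {n} (A : Mat n) a → (∀ x → A x a ≈ 0#) →
  ∀ y → (b ≡ false → y ≢ a) → erased b f A y a ≋ 0ₛ
 erased-unreachable zero    b A a h y y≢a = λ _ → refl
 erased-unreachable (suc f) b {n} A a h y y≢a = S.trans
  (⋆-cong {f = resolvent A y y} (λ _ → refl) (S.trans (S.+-cong (first b y≢a) (S.∑-zero rest)) (S.+-identityˡ _)))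
  (S.zeroʳ _)
  where
  A' = delete y A
  h' : ∀ x → A' x a ≈ 0#
  h' x with does (a Fin.≟ y)
  ... | true  = refl
  ... | false = h x
  first : ∀ b → (b ≡ false → y ≢ a) → (if b then 0ₛ else S.δ y a) ≋ 0ₛ
  first true  _ = λ _ → refl
  first false p = S.δ-≢ (p ≡.refl)
  rest : ∀ t → (X A' y t ⋆ erased (not b) f A' t a) ≋ 0ₛ
  rest t with t Fin.≟ a
  ... | yes ≡.refl = S.trans (S.*-congʳ {erased (not b) f A' t a} (z·-0 (h' y))) (S.zeroˡ (erased (not b) f A' t a))
  ... | no t≢a = S.trans (S.*-congˡ {X A' y t} (erased-unreachable f (not b) A' a h' t λ _ → t≢a)) (S.zeroʳ (X A' y t))

 erased-vanishes : ∀ f b {n} {g : Arcs n} {A} → Supported g A → ∀ v u k →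
  (∀ {j} → odd? j ≡ b → Path g v u j → k ≤ j) → erased b f A v u ≋[ k ] 0ₛ
 erased-vanishes zero    b s v u k       h = λ _ _ → refl
 erased-vanishes (suc f) b s v u zero    h = λ _ ()
 erased-vanishes (suc f) b {n} {g} {A} s v u (suc k) h =
  ⋆-0[ suc k ] (resolvent A v v) λ i i<k →
   trans (+-cong (first b h i i<k) (∑-0[ suc k ] rest i i<k)) (+-identityˡ _)
  where
  A' = delete v A
  first : ∀ b → (∀ {j} → odd? j ≡ b → Path g v u j → suc k ≤ j) →
          (if b then 0ₛ else S.δ v u) ≋[ suc k ] 0ₛ
  first true  h = λ _ _ → refl
  first false h i _ = S.δ-≢ {i = v} {u} (λ { ≡.refl → contradiction (h {0} ≡.refl []) λ () }) i
  rest : ∀ y → (X A' v y ⋆ erased (not b) f A' y u) ≋[ suc k ] 0ₛ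
  rest y with cut v g v y in eq
  ... | false = λ i _ → S.*-congʳ {erased (not b) f A' y u} (z·-0 (supported-cut v s v y eq)) i ⊚ S.zeroˡ (erased (not b) f A' y u) i
  ... | true  = λ i i<k → z·-⋆-cong k (A' v y) (erased-vanishes f (not b) (supported-cut v s) y u k
      (λ {j} oj p → s≤s⁻¹ (h {suc j} (≡.trans (≡.cong not oj) (Bool.not-involutive b)) (≡.subst T (≡.sym eq) tt ∷ p)))) i i<k ⊚
      S.zeroʳ (X A' v y) i

 paths : ∀ {n} → ℕ → Mat n → Mat n
 paths zero    A v u = δ v u
 paths (suc k) A v u = ∑ λ y → delete v A v y * paths k (delete v A) y u

 ⋆-0-leading : ∀ f g k → g ≋[ k ] 0ₛ → f 0 ≈ 1# → (f ⋆ g) k ≈ g k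
 ⋆-0-leading f g zero    h e = *-congʳ e ⊚ *-identityˡ _
 ⋆-0-leading f g (suc k) h e = begin
  f 0 * g (suc k) + (tail f ⋆ g) k ≈⟨ +-cong (*-congʳ e ⊚ *-identityˡ _) (⋆-suc' k ⊚ zeroʳ _) ⟩
  g (suc k) + 0# ≈⟨ +-identityʳ _ ⟩
  g (suc k) ∎
  where
  ⋆-suc' : ∀ i → (tail f ⋆ g) k ≈ 0# * 0#
  ⋆-suc' i = (⋆-0[ suc k ] (tail f) h k ℕ.≤-refl) ⊚ sym (zeroʳ _)

 erased-leading : ∀ f k b {n} {g : Arcs n} {A} → Supported g A → ∀ v u → odd? k ≡ b → k < f →
  (∀ {j} → odd? j ≡ b → Path g v u j → k ≤ j) → erased b f A v u k ≈ paths k A v u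
 erased-leading (suc f) zero b {A = A} s v u ≡.refl _ h = begin
  resolvent A v v 0 * (S.δ v u 0 + (X (delete v A) Mₛ.· erased true f (delete v A)) v u 0)
   ≈⟨ *-cong (δ-refl v) (+-cong (δₛ-zero v u) (X·-zero (delete v A) (erased true f (delete v A)) v u)) ⟩
  1# * (δ v u + 0#)
   ≈⟨ *-identityˡ _ ⊚ +-identityʳ _ ⟩
  δ v u ∎
 erased-leading (suc f) (suc k) b {n} {g} {A} s v u ok (s≤s k<f) h = begin
  (resolvent A v v ⋆ inner) (suc k)
   ≈⟨ ⋆-0-leading (resolvent A v v) inner (suc k) vanish (δ-refl v) ⟩
  (if b then 0ₛ else S.δ v u) (suc k) + (X A' Mₛ.· erased (not b) f A') v u (suc k)
   ≈⟨ +-cong (first b) (X·-suc A' (erased (not b) f A') v u k ⊚ sum-cong-≋ step) ⟩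
  0# + paths (suc k) A v u
   ≈⟨ +-identityˡ _ ⟩
  paths (suc k) A v u ∎
  where
  A' = delete v A
  inner : Series
  inner i = (if b then 0ₛ else S.δ v u) i + (X A' Mₛ.· erased (not b) f A') v u i
  first : ∀ b → (if b then 0ₛ else S.δ v u) (suc k) ≈ 0#
  first true  = refl
  first false = δₛ-suc v u k
  odd-k : odd? k ≡ not b
  odd-k = ≡.trans (≡.sym (Bool.not-involutive (odd? k))) (≡.cong not ok)
  shorter : ∀ {y} → cut v g v y ≡ true → ∀ {j} → odd? j ≡ not b → Path (cut v g) y u j → k ≤ j
  shorter eq {j} oj p = s≤s⁻¹ (h {suc j} (≡.trans (≡.cong not oj) (Bool.not-involutive b)) (≡.subst T (≡.sym eq) tt ∷ p))
  step : ∀ y → A' v y * erased (not b) f A' y u k ≈ A' v y * paths k A' y u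
  step y with cut v g v y in eq
  ... | false = (*-congʳ (supported-cut v s v y eq) ⊚ zeroˡ _) ⊚
                      sym (*-congʳ (supported-cut v s v y eq) ⊚ zeroˡ _)
  ... | true  = *-congˡ (erased-leading f k (not b) (supported-cut v s) y u odd-k k<f (shorter eq))
  vanish : inner ≋[ suc k ] 0ₛ
  vanish i i≤k = +-cong (first' b h i) (∑-0[ suc k ] rest i i≤k) ⊚ +-identityˡ _
   where
   first' : ∀ b → (∀ {j} → odd? j ≡ b → Path g v u j → suc k ≤ j) → (if b then 0ₛ else S.δ v u) ≋ 0ₛ
   first' true  h i = refl
   first' false h i = S.δ-≢ {i = v} {u} (λ { ≡.refl → contradiction (h {0} ≡.refl []) λ () }) i
   rest : ∀ y → (X A' v y ⋆ erased (not b) f A' y u) ≋[ suc k ] 0ₛ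
   rest y with cut v g v y in eq
   ... | false = λ i _ → S.*-congʳ {erased (not b) f A' y u} (z·-0 (supported-cut v s v y eq)) i ⊚ S.zeroˡ (erased (not b) f A' y u) i
   ... | true  = λ i i<k → z·-⋆-cong k (A' v y) (erased-vanishes f (not b) (supported-cut v s) y u k (shorter eq)) i i<k ⊚
                                 S.zeroʳ (X A' v y) i

 girth-cut : ∀ {n} {g : Arcs n} {ℓ} v → EvenGirth g ℓ → EvenGirth (cut v g) ℓ
 girth-cut {g = g} v h {a} {u} oj p t = h oj (path-mono (cut⊆ g v) p) (cut⊆ g v u a t)

 off : ∀ {n} → Mₛ.Mat n → Mₛ.Mat n
 off G v a = if does (v Fin.≟ a) then 0ₛ else G v a

 gradient : ∀ {n} → Mat n → Mₛ.Mat n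
 gradient A = Mₛ.Gradient.G (X A) (resolvent A)

 -- The loop erasure of a walk changes parity at each step that does not close a loop,
 -- provided that all loops are odd; the walks whose last step is of that kind are counted by the gradient.
 erased-step : ∀ f {n} {g : Arcs n} {A} {ℓ} → Supported g A → EvenGirth g ℓ →
  ∀ k → k ≤ f → k ≤ ℓ → ∀ v a →
  (λ i → erased true f A v a i + (erased true f A Mₛ.· X A) v a i) ≋[ k ] off (gradient A) v a
 erased-step f       s c zero    _ _ v a = λ _ ()
 erased-step (suc f) {n} {g} {A} {ℓ} s c (suc k) (s≤s k≤f) k<ℓ v a with v Fin.≟ a
 ... | yes ≡.refl = λ i i<k → +-cong (zero1 i) (∑-0[ suc k ] zero2 i i<k) ⊚ +-identityˡ _
  where
  A' = delete v A
  column : ∀ x → A' x v ≈ 0#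
  column x with v Fin.≟ v
  ... | yes _ = refl
  ... | no ¬p = contradiction ≡.refl ¬p
  zero1 : erased true (suc f) A v v ≋ 0ₛ
  zero1 = S.trans (S.*-congˡ {resolvent A v v} (S.trans (S.+-identityˡ _) (S.∑-zero term))) (S.zeroʳ (resolvent A v v))
   where
   term : ∀ t → (X A' v t ⋆ erased false f A' t v) ≋ 0ₛ
   term t = by (t Fin.≟ v)
    where
    by : Dec (t ≡ v) → (X A' v t ⋆ erased false f A' t v) ≋ 0ₛ
    by (yes ≡.refl) = S.trans (S.*-congʳ {erased false f A' t t} (z·-0 (column t))) (S.zeroˡ (erased false f A' t t))
    by (no t≢v)     = S.trans (S.*-congˡ {X A' v t} (erased-unreachable f false A' v column t λ _ → t≢v)) (S.zeroʳ (X A' v t))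
  zero2 : ∀ u → (erased true (suc f) A v u ⋆ X A u v) ≋[ suc k ] 0ₛ
  zero2 u with g u v in eq
  ... | false = λ i _ → S.*-congˡ {erased true (suc f) A v u} (z·-0 (s u v eq)) i ⊚ S.zeroʳ (erased true (suc f) A v u) i
  ... | true  = λ i i<k → ⋆-z·-cong k (A u v) (erased-vanishes (suc f) true s v u k
                  λ oj p → s≤s⁻¹ (k<ℓ ⟫ c oj p (≡.subst T (≡.sym eq) tt))) i i<k ⊚ S.zeroˡ (X A u v) i
 ... | no v≢a = λ i i<k → lhs i ⊚ (⋆-cong[ suc k ] {f = L} (λ _ _ → refl) inner i i<k) ⊚ sym (rhs i)
  where
  A' = delete v A
  L  = resolvent A v v
  N' = resolvent A'
  a≢v : a ≢ v
  a≢v p = v≢a (≡.sym p)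
  E : Mₛ.Mat n
  E = erased false f A'
  O : Mₛ.Mat n
  O = erased true f A'
  XA : ∀ u → X A u a ≋ X A' u a
  XA u = S.sym (S.trans (X-delete v A u a) (Mₛ.delete-≢ (X A) u a≢v))
  lhs : (λ i → erased true (suc f) A v a i + (erased true (suc f) A Mₛ.· X A) v a i)
        ≋ L ⋆ (X A' Mₛ.· (λ y b i → E y b i + (E Mₛ.· X A') y b i)) v a
  lhs = S.trans (S.+-cong (S.*-congˡ {L} (S.+-identityˡ _)) (S.trans
          (S.sum-cong-≋ λ u → S.trans (S.*-cong (S.*-congˡ {L} (S.+-identityˡ _)) (XA u)) (S.*-assoc L _ _))
          (S.trans (S.sym (S.*-distribˡ-sum L _)) (S.*-congˡ {L} (Mₛ.·-assoc (X A') E (X A') v a)))))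
        (S.trans (S.sym (S.distribˡ L _ _)) (S.*-congˡ {L} (S.sym (Mₛ.distribˡ-· (X A') E (E Mₛ.· X A') v a))))
  rhs : gradient A v a ≋ L ⋆ (X A' Mₛ.· gradient A') v a
  rhs = S.trans (Mₛ.G-scale v (resolvent-inverts A) inv' a≢v) (S.*-congˡ {L} (S.trans
   (Mₛ.G'-step v (resolvent-inverts A) inv' a≢v)
   (S.sum-cong-≋ λ y → S.*-cong (S.sym (X-delete v A v y)) (G-cong y))))
   where
   inv' = delete-inverts v A
   G-cong : ∀ y → Mₛ.Gradient.G (Mₛ.delete v (X A)) N' y a ≋ gradient A' y a
   G-cong y = S.+-congˡ (S.sum-cong-≋ λ b → S.*-congˡ {N' y b} (S.*-congʳ {N' a b}
    (S.*-cong (S.sym (X-delete v A b a)) (S.sym (X-delete v A b a)))))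
  inner : (X A' Mₛ.· (λ y b i → E y b i + (E Mₛ.· X A') y b i)) v a ≋[ suc k ] (X A' Mₛ.· gradient A') v a
  inner = ∑-cong[ suc k ] λ y → z·-⋆-cong k (A' v y) (term y)
   where
   term : ∀ y → (λ i → E y a i + (E Mₛ.· X A') y a i) ≋[ k ] gradient A' y a
   term y i i<k = begin
    E y a i + (E Mₛ.· X A') y a i
     ≈⟨ +-cong (E≈ a i i<k) (∑-cong[ k ] (λ u → ⋆-cong[ k ] {f = E y u} (E≈ u) λ _ _ → refl) i i<k) ⟩
    (N' y a i + O y a i) + ((λ p q j → N' p q j + O p q j) Mₛ.· X A') y a i
     ≈⟨ +-congˡ (Mₛ.distribʳ-· (X A') N' O y a i) ⟩
    (N' y a i + O y a i) + ((N' Mₛ.· X A') y a i + (O Mₛ.· X A') y a i)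
     ≈⟨ +-congʳ (+-congʳ (Mₛ.Inverts.right (resolvent-inverts A') y a i)) ⟩
    (S.δ y a i + (N' Mₛ.· X A') y a i + O y a i) + ((N' Mₛ.· X A') y a i + (O Mₛ.· X A') y a i)
     ≈⟨ solve 4 (λ d n o m → (d :+ n :+ o) :+ (n :+ m) := d :+ (o :+ m)) refl
          (S.δ y a i) ((N' Mₛ.· X A') y a i) (O y a i) ((O Mₛ.· X A') y a i) ⟩
    S.δ y a i + (O y a i + (O Mₛ.· X A') y a i)
     ≈⟨ +-congˡ (erased-step f (supported-cut v s) (girth-cut {ℓ = ℓ} v c) k k≤f (ℕ.<⇒≤ k<ℓ) y a i i<k) ⟩
    S.δ y a i + off (gradient A') y a i
     ≈⟨ δ+off i ⟩
    gradient A' y a i ∎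
    where
    E≈ : ∀ b → E y b ≋[ k ] (λ i → N' y b i + O y b i)
    E≈ b i i<k = solve 2 (λ e o → e := o :+ e :+ o) refl (E y b i) (O y b i) ⊚
     +-congʳ (erased-total f A' y b i (ℕ.<-≤-trans i<k k≤f))
    δ+off : ∀ i → S.δ y a i + off (gradient A') y a i ≈ gradient A' y a i
    δ+off i with y Fin.≟ a
    ... | yes ≡.refl = +-identityʳ _ ⊚ sym (Mₛ.G-diagonal (resolvent-inverts A') y i)
    ... | no _ = +-identityˡ _

 module _ {n} (A : Mat n) where

  earlier : ℕ → Mat n
  earlier zero          _ _ = 0#
  earlier (suc zero)    _ _ = 0#
  earlier (suc (suc k)) = pow A k

  source : ℕ → Mat n
  source k b a = δ b a * pow A k a a + A b a * A b a * earlier k a b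

  gradients : ℕ → Mat n
  gradients zero    = source 0
  gradients (suc k) i j = source (suc k) i j + (A · gradients k) i j

  off-diagonal : Mat n → Mat n
  off-diagonal G v a = if does (v Fin.≟ a) then 0# else G v a

  cyclic : ℕ → Mat n
  cyclic zero    = off-diagonal (gradients 0)
  cyclic (suc k) i j = off-diagonal (gradients (suc k)) i j + (cyclic k · A) i j

  private
   sourceₛ : Mₛ.Mat n
   sourceₛ b a k = source k b a

   X²N : ∀ b a k → (X A b a ⋆ X A b a ⋆ resolvent A a b) k ≈ A b a * A b a * earlier k a b
   X²N b a k = ⋆-assoc (X A b a) (X A b a) (resolvent A a b) k ⊚ go k
    where
    go : ∀ k → (X A b a ⋆ (X A b a ⋆ resolvent A a b)) k ≈ A b a * A b a * earlier k a b
    go zero          = z·-⋆-zero (A b a) (X A b a ⋆ resolvent A a b) ⊚ sym (zeroʳ _)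
    go (suc zero)    = z·-⋆-suc (A b a) (X A b a ⋆ resolvent A a b) 0 ⊚
     *-congˡ (z·-⋆-zero (A b a) (resolvent A a b)) ⊚ zeroʳ _ ⊚ sym (zeroʳ _)
    go (suc (suc k)) = z·-⋆-suc (A b a) (X A b a ⋆ resolvent A a b) (suc k) ⊚
     *-congˡ (z·-⋆-suc (A b a) (resolvent A a b) k) ⊚ sym (*-assoc _ _ _)

   δN : ∀ b a k → (S.δ b a ⋆ resolvent A a a) k ≈ δ b a * pow A k a a
   δN b a k with does (b Fin.≟ a)
   ... | true  = ⋆-identityˡ (resolvent A a a) k ⊚ sym (*-identityˡ _)
   ... | false = ⋆-zeroˡ (resolvent A a a) k ⊚ sym (zeroˡ _)

   sourceₛ≋ : ∀ b a → sourceₛ b a ≋ (S.δ b a ⋆ resolvent A a a) S.+ (X A b a ⋆ X A b a ⋆ resolvent A a b)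
   sourceₛ≋ b a k = sym (+-cong (δN b a k) (X²N b a k))

   N·source : ∀ i a → gradient A i a ≋ (resolvent A Mₛ.· sourceₛ) i a
   N·source i a = S.sym (S.trans (S.sum-cong-≋ λ b → S.trans (S.*-congˡ {resolvent A i b} (sourceₛ≋ b a))
       (S.distribˡ (resolvent A i b) _ _))
    (S.trans (S.∑-distrib-+ (λ b → resolvent A i b ⋆ (S.δ b a ⋆ resolvent A a a)) _)
     (S.+-congʳ (S.trans (S.sum-cong-≋ λ b → S.sym (S.*-assoc (resolvent A i b) _ _))
      (S.trans (S.sym (S.*-distribʳ-sum (resolvent A a a) _)) (S.*-congʳ (S.∑-δʳ a (resolvent A i))))))))

   gradient-step : ∀ i a → gradient A i a ≋ sourceₛ i a S.+ (X A Mₛ.· gradient A) i a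
   gradient-step i a = S.trans (N·source i a)
    (S.trans (Mₛ.·-cong {Y = sourceₛ} (Mₛ.Inverts.left (resolvent-inverts A)) (λ _ _ → S.refl) i a)
    (S.trans (Mₛ.distribʳ-· sourceₛ S.δ (X A Mₛ.· resolvent A) i a)
    (S.+-cong (Mₛ.δ-· sourceₛ i a) (S.trans (Mₛ.·-assoc (X A) (resolvent A) sourceₛ i a)
     (Mₛ.·-cong {X = X A} (λ _ _ → S.refl) (λ b c → S.sym (N·source b c)) i a)))))

  gradients≈ : ∀ k i a → gradients k i a ≈ gradient A i a k
  gradients≈ zero    i a = sym (gradient-step i a 0 ⊚ +-congˡ (X·-zero A (gradient A) i a) ⊚ +-identityʳ _)
  gradients≈ (suc k) i a = sym (gradient-step i a (suc k) ⊚ +-congˡ (X·-suc A (gradient A) i a k ⊚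
   (sum-cong-≋ λ l → *-congˡ (sym (gradients≈ k l a)))))

  private
   off≈ : ∀ k i a → off-diagonal (gradients k) i a ≈ off (gradient A) i a k
   off≈ k i a with does (i Fin.≟ a)
   ... | true  = refl
   ... | false = gradients≈ k i a

  module _ {g : Arcs n} {ℓ} (s : Supported g A) (c : EvenGirth g ℓ) where

   cyclic≈erased : ∀ f k → k < f → k < ℓ → ∀ i a → cyclic k i a ≈ erased true f A i a k
   cyclic≈erased f k k<f k<ℓ i a = recursion k k<f k<ℓ ⊚ sym (solve 2 (λ o m → o := o :+ m :+ m) refl (O i a k) ((O Mₛ.· X A) i a k) ⊚
       +-congʳ (erased-step f {ℓ = ℓ} s c (suc k) k<f k<ℓ i a k ℕ.≤-refl))
    where
    O = erased true f A
    recursion : ∀ k → k < f → k < ℓ → cyclic k i a ≈ off (gradient A) i a k + (O Mₛ.· X A) i a k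
    recursion zero    _   _   = off≈ 0 i a ⊚ sym (+-congˡ (·X-zero A O i a) ⊚ +-identityʳ _)
    recursion (suc k) k<f k<ℓ = +-cong (off≈ (suc k) i a) ((sum-cong-≋ λ l → *-congʳ (cyclic≈erased f k (ℕ.<⇒≤ k<f) (ℕ.<⇒≤ k<ℓ) i l)) ⊚
     sym (·X-suc A O i a k))

   cyclic-vanishes : ∀ k → suc k < ℓ → ∀ {u v} → T (g u v) → cyclic k v u ≈ 0#
   cyclic-vanishes k k<ℓ {u} {v} t = cyclic≈erased (suc k) k ℕ.≤-refl (ℕ.<⇒≤ k<ℓ) v u ⊚
    erased-vanishes (suc k) true s v u (suc k) (λ oj p → s≤s⁻¹ (k<ℓ ⟫ c oj p t)) k ℕ.≤-refl

   cyclic-leading : ∀ k → suc k ≡ ℓ → odd? k ≡ true → ∀ {u v} → T (g u v) → cyclic k v u ≈ paths k A v u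
   cyclic-leading k ≡.refl ok {u} {v} t = cyclic≈erased (suc k) k ℕ.≤-refl ℕ.≤-refl v u ⊚
    erased-leading (suc k) k true s v u ok ℕ.≤-refl (λ oj p → s≤s⁻¹ (c oj p t))

open import Data.Nat.Base using (_+_; _*_; _^_)
open import Data.Nat.Solver using (module +-*-Solver)
open import Data.Product.Base using (∃-syntax)
open import Data.Sum.Base using (_⊎_; inj₁; inj₂)
open import Data.Unit.Base using (⊤)
import Data.Vec.Base as Vec
open import Data.Vec.Base using (Vec; []; _∷_; lookup; take; drop)
open import Data.Vec.Properties using (take++drop≡id)
open import Relation.Binary.PropositionalEquality using (refl; cong; cong₂; sym; trans; subst)

⟦_⟧ᵇ : Bool → ℕ
⟦ b ⟧ᵇ = if b then 1 else 0

total : ∀ r → (Vec Bool r → ℕ) → ℕ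
total zero    f = f []
total (suc r) f = total r (λ b → f (true ∷ b)) + total r (λ b → f (false ∷ b))

count≡total : ∀ {r} (E : Vec Bool r → Bool) → count E ≡ total r (λ b → ⟦ E b ⟧ᵇ)
count≡total {zero}  E = refl
count≡total {suc r} E = cong₂ _+_ (count≡total (λ b → E (true ∷ b))) (count≡total (λ b → E (false ∷ b)))

total-mono : ∀ r {f g : Vec Bool r → ℕ} → (∀ b → f b ≤ g b) → total r f ≤ total r g
total-mono zero    h = h []
total-mono (suc r) h = ℕ.+-mono-≤ (total-mono r (λ b → h (true ∷ b))) (total-mono r (λ b → h (false ∷ b)))

total-cong : ∀ r {f g : Vec Bool r → ℕ} → (∀ b → f b ≡ g b) → total r f ≡ total r g
total-cong zero    h = h []
total-cong (suc r) h = cong₂ _+_ (total-cong r (λ b → h (true ∷ b))) (total-cong r (λ b → h (false ∷ b)))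

total-+ : ∀ r (f g : Vec Bool r → ℕ) → total r (λ b → f b + g b) ≡ total r f + total r g
total-+ zero    f g = refl
total-+ (suc r) f g = cong₂ _+_ (total-+ r (λ b → f (true ∷ b)) _) (total-+ r (λ b → f (false ∷ b)) _) ⊙
 +-*-Solver.solve 4 (λ a b c d → (a :+ b) :+ (c :+ d) := (a :+ c) :+ (b :+ d)) refl
  (total r (λ b → f (true ∷ b))) (total r (λ b → g (true ∷ b)))
  (total r (λ b → f (false ∷ b))) (total r (λ b → g (false ∷ b)))
 where open +-*-Solver using (_:+_; _:=_)

total-const : ∀ r c → total r (λ _ → c) ≡ 2 ^ r * c
total-const zero    c = sym (ℕ.+-identityʳ c)
total-const (suc r) c = cong₂ _+_ (total-const r c) (total-const r c) ⊙
 sym (ℕ.*-distribʳ-+ c (2 ^ r) (2 ^ r)) ⊙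
        cong (_* c) (cong (2 ^ r +_) (sym (ℕ.+-identityʳ (2 ^ r))))

total-swap : ∀ r m (f : Vec Bool r → Vec Bool m → ℕ) →
             total r (λ b → total m (f b)) ≡ total m (λ c → total r (λ b → f b c))
total-swap zero    m f = refl
total-swap (suc r) m f = cong₂ _+_ (total-swap r m (λ b → f (true ∷ b))) (total-swap r m (λ b → f (false ∷ b))) ⊙
 sym (total-+ m _ _)

total-++ : ∀ r m (f : Vec Bool (r + m) → ℕ) → total (r + m) f ≡ total r (λ b → total m (λ c → f (b Vec.++ c)))
total-++ zero    m f = refl
total-++ (suc r) m f = cong₂ _+_ (total-++ r m (λ b → f (true ∷ b))) (total-++ r m (λ b → f (false ∷ b)))

total-zero : ∀ r {f : Vec Bool r → ℕ} → (∀ b → f b ≡ 0) → total r f ≡ 0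
total-zero zero    h = h []
total-zero (suc r) h = cong₂ _+_ (total-zero r (λ b → h (true ∷ b))) (total-zero r (λ b → h (false ∷ b)))

any-true : ∀ r (E : Vec Bool r → Bool) → (∃[ b ] E b ≡ true) ⊎ (∀ b → E b ≡ false)
any-true zero E with E [] in eq
... | true  = inj₁ ([] , eq)
... | false = inj₂ λ { [] → eq }
any-true (suc r) E with any-true r (λ b → E (true ∷ b)) | any-true r (λ b → E (false ∷ b))
... | inj₁ (b , e) | _            = inj₁ (true ∷ b , e)
... | inj₂ _       | inj₁ (b , e) = inj₁ (false ∷ b , e)
... | inj₂ h       | inj₂ h'      = inj₂ λ { (true ∷ b) → h b ; (false ∷ b) → h' b }

total-unique : ∀ r (E : Vec Bool r → Bool) → (∀ b b' → E b ≡ true → E b' ≡ true → b ≡ b') →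
               total r (λ b → ⟦ E b ⟧ᵇ) ≤ 1
total-unique zero E u with E []
... | true  = ℕ.≤-refl
... | false = z≤n
total-unique (suc r) E u with any-true r (λ b → E (true ∷ b))
... | inj₁ (b , e) = (cong (total r (λ b → ⟦ E (true ∷ b) ⟧ᵇ) +_)
        (total-zero r λ c → cong ⟦_⟧ᵇ (none c)) ⊙ ℕ.+-identityʳ _) ≡⟫
        (total-unique r (λ b → E (true ∷ b)) λ c c' p q → tail≡ (u _ _ p q))
 where
 none : ∀ c → E (false ∷ c) ≡ false
 none c with E (false ∷ c) in eq
 ... | false = refl
 ... | true  = contradiction (u _ _ e eq) λ ()
 tail≡ : ∀ {x y : Bool} {c c' : Vec Bool r} → x Vec.∷ c ≡ y Vec.∷ c' → c ≡ c'
 tail≡ refl = refl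
... | inj₂ h = cong (_+ total r (λ b → ⟦ E (false ∷ b) ⟧ᵇ)) (total-zero r λ c → cong ⟦_⟧ᵇ (h c)) ≡⟫
        (total-unique r (λ b → E (false ∷ b)) λ c c' p q → tail≡ (u _ _ p q))
 where
 tail≡ : ∀ {x y : Bool} {c c' : Vec Bool r} → x Vec.∷ c ≡ y Vec.∷ c' → c ≡ c'
 tail≡ refl = refl

blocks : ∀ {r} N → Vec Bool (N * r) → Vec (Vec Bool r) N
blocks zero    ω = []
blocks {r} (suc N) ω = take r ω ∷ blocks N (drop r ω)

take-++ : ∀ {r m} (b : Vec Bool r) (c : Vec Bool m) → take r (b Vec.++ c) ≡ b
take-++ []      c = refl
take-++ (x ∷ b) c = cong (x ∷_) (take-++ b c)

drop-++ : ∀ {r m} (b : Vec Bool r) (c : Vec Bool m) → drop r (b Vec.++ c) ≡ c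
drop-++ []      c = refl
drop-++ (x ∷ b) c = drop-++ b c

module SchwartzZippel (R : CommutativeRing 0ℓ 0ℓ) (char2 : CharTwo R)
 (domain : ∀ x y → CommutativeRing._≈_ R (CommutativeRing._*_ R x y) (CommutativeRing.0# R) →
           CommutativeRing._≈_ R x (CommutativeRing.0# R) ⊎ CommutativeRing._≈_ R y (CommutativeRing.0# R))
 (zero? : ∀ x → Dec (CommutativeRing._≈_ R x (CommutativeRing.0# R))) where

 private module A = Char2 R char2
 open A using (Carrier; _≈_; 0#; 1#; solve; _:=_; _:+_; _:*_)

 MultiAffine : ∀ {N} → (Vec Carrier N → Carrier) → Set
 MultiAffine {zero}  F = ⊤
 MultiAffine {suc N} F =
  (∀ c xs → F (c ∷ xs) ≈ F (0# ∷ xs) A.+ c A.* (F (0# ∷ xs) A.+ F (1# ∷ xs))) ×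
  (∀ c → MultiAffine (λ xs → F (c ∷ xs)))

 -- A multi-affine function which is not identically zero vanishes on at most
 -- a fraction N / 2^r of the points with coordinates in a set of size 2^r:
 -- once the other coordinates are good, the first has at most one bad value.
 schwartz-zippel : ∀ {r} (e : Vec Bool r → Carrier) → (∀ b b' → e b ≈ e b' → b ≡ b') →
  ∀ N (F : Vec Carrier N → Carrier) → MultiAffine F → ∀ xs → ¬ F xs ≈ 0# →
  total (N * r) (λ ω → ⟦ does (zero? (F (Vec.map e (blocks N ω)))) ⟧ᵇ) * 2 ^ r ≤ N * 2 ^ (N * r)
 schwartz-zippel e inj zero F ma [] nz with zero? (F [])
 ... | yes z = contradiction z nz
 ... | no _  = z≤n
 schwartz-zippel {r} e inj (suc N) F (affine , ma) (x ∷ xs) nz = begin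
  total (r + N * r) (λ ω → ⟦ bad (take r ω) (drop r ω) ⟧ᵇ) * 2 ^ r
   ≡⟨ cong (_* 2 ^ r) (total-++ r (N * r) _ ⊙ (total-cong r λ b → total-cong (N * r) λ c →
        cong₂ (λ b c → ⟦ bad b c ⟧ᵇ) (take-++ b c) (drop-++ b c))) ⟩
  total r (λ b → total (N * r) λ c → ⟦ bad b c ⟧ᵇ) * 2 ^ r
   ≤⟨ ℕ.*-monoˡ-≤ (2 ^ r) (total-mono r λ b → total-mono (N * r) λ c → split b c) ⟩
  total r (λ b → total (N * r) λ c → ⟦ worst c ⟧ᵇ + ⟦ unlucky b c ⟧ᵇ) * 2 ^ r
   ≡⟨ cong (_* 2 ^ r) ((total-cong r λ b → total-+ (N * r) _ _) ⊙ total-+ r _ _ ⊙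
        cong₂ _+_ (total-const r _) (total-swap r (N * r) _)) ⟩
  (2 ^ r * W + total (N * r) (λ c → total r λ b → ⟦ unlucky b c ⟧ᵇ)) * 2 ^ r
   ≤⟨ ℕ.*-monoˡ-≤ (2 ^ r) (ℕ.+-monoʳ-≤ (2 ^ r * W) ((total-mono (N * r) λ c → total-unique r (λ b → unlucky b c) (one-root c)) ⟫≡
        (total-const (N * r) 1 ⊙ ℕ.*-identityʳ _))) ⟩
  (2 ^ r * W + 2 ^ (N * r)) * 2 ^ r
   ≡⟨ +-*-Solver.solve 3 (λ p w q → (p N:* w N:+ q) N:* p N:= p N:* (w N:* p) N:+ p N:* q) refl (2 ^ r) W (2 ^ (N * r)) ⟩
  2 ^ r * (W * 2 ^ r) + 2 ^ r * 2 ^ (N * r)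
   ≤⟨ ℕ.+-monoˡ-≤ _ (ℕ.*-monoʳ-≤ (2 ^ r) (schwartz-zippel e inj N (λ ys → F (x ∷ ys)) (ma x) xs nz)) ⟩
  2 ^ r * (N * 2 ^ (N * r)) + 2 ^ r * 2 ^ (N * r)
   ≡⟨ +-*-Solver.solve 3 (λ p n q → p N:* (n N:* q) N:+ p N:* q N:= (N:con 1 N:+ n) N:* (p N:* q)) refl (2 ^ r) N (2 ^ (N * r)) ⟩
  suc N * (2 ^ r * 2 ^ (N * r))
   ≡⟨ cong (suc N *_) (ℕ.^-distribˡ-+-* 2 r (N * r)) ⟨
  suc N * 2 ^ (r + N * r) ∎
  where
  open ℕ.≤-Reasoning
  open +-*-Solver using () renaming (_:*_ to _N:*_; _:+_ to _N:+_; _:=_ to _N:=_; con to N:con)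
  ys : Vec Bool (N * r) → Vec Carrier N
  ys c = Vec.map e (blocks N c)
  bad : Vec Bool r → Vec Bool (N * r) → Bool
  bad b c = does (zero? (F (e b ∷ ys c)))
  worst : Vec Bool (N * r) → Bool
  worst c = does (zero? (F (x ∷ ys c)))
  W : ℕ
  W = total (N * r) λ c → ⟦ worst c ⟧ᵇ
  unlucky : Vec Bool r → Vec Bool (N * r) → Bool
  unlucky b c = bad b c ∧ not (worst c)
  split : ∀ b c → ⟦ bad b c ⟧ᵇ ≤ ⟦ worst c ⟧ᵇ + ⟦ unlucky b c ⟧ᵇ
  split b c with bad b c | worst c
  ... | true  | true  = ℕ.≤-refl
  ... | true  | false = ℕ.≤-refl
  ... | false | _     = z≤n
  root : ∀ b c → unlucky b c ≡ true → F (e b ∷ ys c) ≈ 0# × ¬ F (x ∷ ys c) ≈ 0#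
  root b c h with zero? (F (e b ∷ ys c)) | zero? (F (x ∷ ys c))
  ... | yes p | no q = p , q
  one-root : ∀ c b b' → unlucky b c ≡ true → unlucky b' c ≡ true → b ≡ b'
  one-root c b b' p q with root b c p | root b' c q
  ... | z , nx | z' , _ = go (domain (e b A.+ e b') d product)
   where
   f0 d : Carrier
   f0 = F (0# ∷ ys c)
   d  = f0 A.+ F (1# ∷ ys c)
   product : (e b A.+ e b') A.* d ≈ 0#
   product = A.trans (solve 4 (λ u v f d → (u :+ v) :* d := (f :+ u :* d) :+ (f :+ v :* d)) A.refl (e b) (e b') f0 d)
    (A.trans (A.+-cong (A.trans (A.sym (affine (e b) (ys c))) z) (A.trans (A.sym (affine (e b') (ys c))) z')) (A.+-identityˡ _))
   go : e b A.+ e b' ≈ 0# ⊎ d ≈ 0# → b ≡ b'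
   go (inj₁ s) = inj b b' (A.trans (solve 2 (λ u v → u := (u :+ v) :+ v) A.refl (e b) (e b')) (A.trans (A.+-congʳ s) (A.+-identityˡ _)))
   go (inj₂ s) = contradiction (A.trans (affine x (ys c)) (A.trans (A.+-cong f0≈0 (A.trans (A.*-congˡ s) (A.zeroʳ x))) (A.+-identityˡ _))) nx
    where
    f0≈0 : f0 ≈ 0#
    f0≈0 = A.trans (solve 3 (λ f u d → f := (f :+ u :* d) :+ u :* d) A.refl f0 (e b) d)
     (A.trans (A.+-cong (A.trans (A.sym (affine (e b) (ys c))) z) (A.trans (A.*-congˡ s) (A.zeroʳ (e b)))) (A.+-identityˡ _))

 coordinatewise⇒MultiAffine : ∀ {N} (G : Vec Carrier N → Carrier) →
  (∀ i {x x0 x1} c → (∀ j → j ≢ i → lookup x j ≡ lookup x0 j × lookup x j ≡ lookup x1 j) →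
   lookup x i ≡ c → lookup x0 i ≡ 0# → lookup x1 i ≡ 1# → G x ≈ G x0 A.+ c A.* (G x0 A.+ G x1)) →
  MultiAffine G
 coordinatewise⇒MultiAffine {zero}  G h = tt
 coordinatewise⇒MultiAffine {suc N} G h =
  (λ c xs → h zero c (λ { zero p → contradiction refl p ; (suc j) _ → refl , refl }) refl refl refl) ,
  (λ c → coordinatewise⇒MultiAffine (λ y → G (c ∷ y)) λ i c' o → h (suc i) c'
     λ { zero _ → refl , refl ; (suc j) p → o j λ { refl → p refl } })

module PathPolynomial (R : CommutativeRing 0ℓ 0ℓ) (char2 : CharTwo R) where

 open Char2 R char2 hiding (refl; sym; trans) renaming (_+_ to _⊞_; _*_ to _⊠_)
 private module ≈ = Char2 R char2
 open Resolvent R char2 using (Mat; delete; delete-≡; delete-≢)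
 open Walks R char2 using (paths)

 paths-cong : ∀ k {n} {A B : Mat n} → (∀ i j → A i j ≈ B i j) → ∀ v u → paths k A v u ≈ paths k B v u
 paths-cong zero    h v u = ≈.refl
 paths-cong (suc k) {A = A} {B} h v u = sum-cong-≋ λ y → *-cong (cong' v y) (paths-cong k cong' y u)
  where
  cong' : ∀ i j → delete v A i j ≈ delete v B i j
  cong' i j with does (j Fin.≟ v)
  ... | true  = ≈.refl
  ... | false = h i j

 -- No path returns to v, so its row does not matter.
 paths-row : ∀ k {n} {A B : Mat n} v → (∀ i → i ≢ v → ∀ j → A i j ≈ B i j) →
  (∀ i → A i v ≈ 0#) → (∀ i → B i v ≈ 0#) → ∀ {y} → y ≢ v → ∀ u → paths k A y u ≈ paths k B y u
 paths-row zero    v h a b y≢v u = ≈.refl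
 paths-row (suc k) {n} {A} {B} v h a b {y} y≢v u = sum-cong-≋ term
  where
  column : ∀ (C : Mat n) → (∀ i → C i v ≈ 0#) → ∀ i → delete y C i v ≈ 0#
  column C c i with does (v Fin.≟ y)
  ... | true  = ≈.refl
  ... | false = c i
  h' : ∀ i → i ≢ v → ∀ j → delete y A i j ≈ delete y B i j
  h' i i≢v j with does (j Fin.≟ y)
  ... | true  = ≈.refl
  ... | false = h i i≢v j
  term : ∀ t → delete y A y t ⊠ paths k (delete y A) t u ≈ delete y B y t ⊠ paths k (delete y B) t u
  term t = by (t Fin.≟ v)
   where
   by : Dec (t ≡ v) → delete y A y t ⊠ paths k (delete y A) t u ≈ delete y B y t ⊠ paths k (delete y B) t u
   by (yes refl) = (*-congʳ (column A a y) ⊚ zeroˡ _) ⊚ ≈.sym (*-congʳ (column B b y) ⊚ zeroˡ _)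
   by (no t≢v)   = *-cong (h' y y≢v t) (paths-row k v h' (column A a) (column B b) t≢v u)

 paths-affine : ∀ k {n} {A A0 A1 : Mat n} i c →
  (∀ l → l ≢ i → ∀ j → A l j ≈ A0 l j × A l j ≈ A1 l j) →
  (∀ j → A i j ≈ A0 i j ⊞ c ⊠ (A0 i j ⊞ A1 i j)) →
  ∀ v u → paths k A v u ≈ paths k A0 v u ⊞ c ⊠ (paths k A0 v u ⊞ paths k A1 v u)
 paths-affine zero    i c h r v u = solve 2 (λ d c → d := d :+ c :* (d :+ d)) ≈.refl (δ v u) c
 paths-affine (suc k) {n} {A} {A0} {A1} i c h r v u = sum-cong-≋ term ⊚ ∑-distrib-+ s0 _ ⊚
  +-congˡ (≈.sym (*-distribˡ-sum c _) ⊚ *-congˡ (∑-distrib-+ s0 s1))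
  where
  s s0 s1 : Fin n → Carrier
  s  y = delete v A  v y ⊠ paths k (delete v A)  y u
  s0 y = delete v A0 v y ⊠ paths k (delete v A0) y u
  s1 y = delete v A1 v y ⊠ paths k (delete v A1) y u
  h' : ∀ l → l ≢ i → ∀ j → delete v A l j ≈ delete v A0 l j × delete v A l j ≈ delete v A1 l j
  h' l l≢i j with does (j Fin.≟ v)
  ... | true  = ≈.refl , ≈.refl
  ... | false = h l l≢i j
  r' : ∀ j → delete v A i j ≈ delete v A0 i j ⊞ c ⊠ (delete v A0 i j ⊞ delete v A1 i j)
  r' j with does (j Fin.≟ v)
  ... | true  = solve 1 (λ c → con false := con false :+ c :* (con false :+ con false)) ≈.refl c
  ... | false = r j
  same-row : v ≡ i → ∀ {B : Mat n} → (∀ l → l ≢ v → ∀ j → delete v A l j ≈ delete v B l j) →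
             ∀ {y} → y ≢ v → paths k (delete v A) y u ≈ paths k (delete v B) y u
  same-row refl {B} g y≢v = paths-row k v g (delete-≡ v A) (delete-≡ v B) y≢v u
  zero-term : ∀ (B : Mat n) → delete v B v v ⊠ paths k (delete v B) v u ≈ 0#
  zero-term B = *-congʳ (delete-≡ v B v) ⊚ zeroˡ _
  term : ∀ y → s y ≈ s0 y ⊞ c ⊠ (s0 y ⊞ s1 y)
  term y = by (v Fin.≟ i) (y Fin.≟ v)
   where
   by : Dec (v ≡ i) → Dec (y ≡ v) → s y ≈ s0 y ⊞ c ⊠ (s0 y ⊞ s1 y)
   by (yes refl) (yes refl) = zero-term A ⊚ ≈.sym (+-cong (zero-term A0) (*-congˡ (+-cong (zero-term A0) (zero-term A1))) ⊚
    solve 1 (λ c → con false :+ c :* (con false :+ con false) := con false) ≈.refl c)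
   by (yes refl) (no y≢v) = *-congʳ (r' y) ⊚ solve 4 (λ a b c p → (a :+ c :* (a :+ b)) :* p := a :* p :+ c :* (a :* p :+ b :* p)) ≈.refl
       (delete v A0 v y) (delete v A1 v y) c (paths k (delete v A) y u) ⊚
    +-cong e0 (*-congˡ (+-cong e0 e1))
    where
    e0 : delete v A0 v y ⊠ paths k (delete v A) y u ≈ s0 y
    e0 = *-congˡ (same-row refl (λ l p j → fst (h' l p j)) y≢v)
    e1 : delete v A1 v y ⊠ paths k (delete v A) y u ≈ s1 y
    e1 = *-congˡ (same-row refl (λ l p j → snd (h' l p j)) y≢v)
   by (no v≢i) _ = *-congˡ (paths-affine k i c h' r' y u) ⊚ solve 4 (λ a p q c → a :* (p :+ c :* (p :+ q)) := a :* p :+ c :* (a :* p :+ a :* q)) ≈.refl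
       (delete v A v y) (paths k (delete v A0) y u) (paths k (delete v A1) y u) c ⊚
    +-cong e0 (*-congˡ (+-cong e0 e1))
    where
    e0 : delete v A v y ⊠ paths k (delete v A0) y u ≈ s0 y
    e0 = *-congʳ (fst (h' v v≢i y))
    e1 : delete v A v y ⊠ paths k (delete v A1) y u ≈ s1 y
    e1 = *-congʳ (snd (h' v v≢i y))

 -- The indicator of a path isolates its monomial.
 onPath : ∀ {n} {g : Arcs n} {v u k} → Path g v u k → Arcs n
 onPath [] i j = false
 onPath (_∷_ {v = v} {y} t p) i j = if does (i Fin.≟ v) then does (j Fin.≟ y) else onPath p i j

 onPath⊆ : ∀ {n} {g : Arcs n} {v u k} (p : Path g v u k) → onPath p ⊆ g
 onPath⊆ {g = g} (_∷_ {v = v} {y} t p) i j o with i Fin.≟ v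
 ... | no _ = cut⊆ g v i j (onPath⊆ p i j o)
 ... | yes refl with j Fin.≟ y
 ...   | yes refl = cut⊆ g v i j t

 target≢ : ∀ {n} {g : Arcs n} {v y} i → T (cut v g i y) → y ≢ v
 target≢ {v = v} {y} i t y≡v with y Fin.≟ v
 ... | no y≢v = y≢v y≡v

 paths-onPath : ∀ {n} {g : Arcs n} {v u k} (p : Path g v u k) →
                paths k (λ i j → bool (onPath p i j)) v u ≈ 1#
 paths-onPath {v = v} [] = δ-refl v
 paths-onPath {n} {g} {v} {u} {suc k} (_∷_ {y = y} t p) = ∑-single y _ others ⊚
  *-cong first rest ⊚ *-identityˡ _
  where
  I : Mat n
  I i j = bool (onPath (_∷_ {y = y} t p) i j)
  y≢v : y ≢ v
  y≢v = target≢ {g = g} v t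
  Iv : ∀ j → I v j ≈ bool (does (j Fin.≟ y))
  Iv j with v Fin.≟ v
  ... | yes _ = ≈.refl
  ... | no ¬p = contradiction refl ¬p
  first : delete v I v y ≈ 1#
  first = delete-≢ I v y≢v ⊚ Iv y ⊚ δ-refl y
  others : ∀ j → j ≢ y → delete v I v j ⊠ paths k (delete v I) j u ≈ 0#
  others j j≢y = *-congʳ (vanish ⊚ ≈.refl) ⊚ zeroˡ _
   where
   vanish : delete v I v j ≈ 0#
   vanish = by (j Fin.≟ v)
    where
    by : Dec (j ≡ v) → delete v I v j ≈ 0#
    by (yes refl) = delete-≡ v I v
    by (no j≢v)   = delete-≢ I v j≢v ⊚ Iv j ⊚ δ-≢ j≢y
  p-column : ∀ i → onPath p i v ≡ false
  p-column i with onPath p i v in eq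
  ... | false = refl
  ... | true  = contradiction refl (target≢ {g = g} i (onPath⊆ p i v (subst T (sym eq) tt)))
  rest : paths k (delete v I) y u ≈ 1#
  rest = paths-row k v agree (delete-≡ v I) (λ i → reflexive (cong bool (p-column i))) y≢v u ⊚ paths-onPath p
   where
   agree : ∀ i → i ≢ v → ∀ j → delete v I i j ≈ bool (onPath p i j)
   agree i i≢v j = by (j Fin.≟ v)
    where
    Ii : I i j ≈ bool (onPath p i j)
    Ii with i Fin.≟ v
    ... | yes i≡v = contradiction i≡v i≢v
    ... | no _    = ≈.refl
    by : Dec (j ≡ v) → delete v I i j ≈ bool (onPath p i j)
    by (yes refl) = delete-≡ v I i ⊚ reflexive (cong bool (sym (p-column i)))
    by (no j≢v)   = delete-≢ I i j≢v ⊚ Ii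

import Algebra.Properties.CommutativeSemigroup as CommutativeSemigroupProperties
open import Data.Fin using (#_)
import Data.Nat.DivMod as DM
open import Data.Sum.Base using (reduce)
open import Function.Base using (_∘_)
import Relation.Binary.Reasoning.Setoid as SetoidReasoning
open import Relation.Nullary.Decidable using (_×-dec_)

record Pointed : Set₁ where
 field
  ring  : CommutativeRing 0ℓ 0ℓ
 open CommutativeRing ring using (Carrier; _≈_; 0#) renaming (_+_ to _⊞_)
 field
  char2 : ∀ x → x ⊞ x ≈ 0#
  point : Carrier

module Evaluation (P : Pointed) where
 open Pointed P
 open Char2 ring char2 hiding (refl; sym; trans; ring) renaming (_+_ to _⊞_; _*_ to _⊠_)
 private module ≈ = Char2 (Pointed.ring P) (Pointed.char2 P)

 power : ℕ → Carrier
 power zero    = 1#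
 power (suc m) = point ⊠ power m

 -- Σ_{e < m} f(e) t^e.
 eval : ℕ → (ℕ → Bool) → Carrier
 eval zero    f = 0#
 eval (suc m) f = bool (f 0) ⊞ point ⊠ eval m (f ∘ suc)

 eval-cong : ∀ m {f g} → (∀ e → e < m → f e ≡ g e) → eval m f ≈ eval m g
 eval-cong zero    h = ≈.refl
 eval-cong (suc m) h = +-cong (reflexive (cong bool (h 0 z<s))) (*-congˡ (eval-cong m λ e e<m → h (suc e) (s<s e<m)))

 eval-false : ∀ m {f} → (∀ e → e < m → f e ≡ false) → eval m f ≈ 0#
 eval-false zero    h = ≈.refl
 eval-false (suc m) h = +-cong (reflexive (cong bool (h 0 z<s))) (*-congˡ (eval-false m λ e e<m → h (suc e) (s<s e<m)) ⊚ zeroʳ _) ⊚ +-identityˡ _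

 eval-xor : ∀ m f g → eval m (λ e → f e xor g e) ≈ eval m f ⊞ eval m g
 eval-xor zero    f g = ≈.sym (+-identityˡ _)
 eval-xor (suc m) f g = +-cong (xor-homo (f 0) (g 0)) (*-congˡ (eval-xor m (f ∘ suc) (g ∘ suc))) ⊚
  solve 5 (λ a b t x y → a :+ b :+ t :* (x :+ y) := a :+ t :* x :+ (b :+ t :* y)) ≈.refl
   (bool (f 0)) (bool (g 0)) point (eval m (f ∘ suc)) (eval m (g ∘ suc))
  where
  xor-homo : ∀ a b → bool (a xor b) ≈ bool a ⊞ bool b
  xor-homo false b     = ≈.sym (+-identityˡ _)
  xor-homo true  false = ≈.sym (+-identityʳ _)
  xor-homo true  true  = ≈.sym (char2 _)

 eval-+ : ∀ m j f → eval (m + j) f ≈ eval m f ⊞ power m ⊠ eval j (λ e → f (m + e))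
 eval-+ zero    j f = ≈.sym (+-identityˡ _ ⊚ *-identityˡ _)
 eval-+ (suc m) j f = +-congˡ (*-congˡ (eval-+ m j (f ∘ suc))) ⊚
  solve 5 (λ b t x p y → b :+ t :* (x :+ p :* y) := b :+ t :* x :+ t :* p :* y) ≈.refl
   (bool (f 0)) point (eval m (f ∘ suc)) (power m) (eval j (λ e → f (suc m + e)))

 -- The powers 1, t, …, t^(m-1) are linearly independent over F₂.
 Independent : ℕ → Set
 Independent m = ∀ f → eval m f ≈ 0# → ∀ e → e < m → f e ≡ false

 rotate : ℕ → (ℕ → Bool) → (ℕ → Bool)
 rotate m f zero    = f m
 rotate m f (suc e) = f e

 eval-rotate : ∀ m f → power (suc m) ≈ 1# → eval (suc m) (rotate m f) ≈ point ⊠ eval (suc m) f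
 eval-rotate m f h = ≈.sym (*-congˡ (reflexive (cong (λ k → eval k f) (ℕ.+-comm 1 m)) ⊚ eval-+ m 1 f) ⊚
  solve 4 (λ t x p b → t :* (x :+ p :* (b :+ t :* con false)) := t :* p :* b :+ t :* x) ≈.refl
      point (eval m f) (power m) (bool (f (m + 0))) ⊚
   +-congʳ (*-congʳ h ⊚ *-identityˡ _ ⊚ reflexive (cong (bool ∘ f) (ℕ.+-identityʳ m))))

record IsDomain (P : Pointed) : Set where
 open Pointed P
 open CommutativeRing ring using (Carrier; _≈_; 0#) renaming (_*_ to _⊠_)
 field
  cancel   : ∀ x y → x ⊠ y ≈ 0# → x ≈ 0# ⊎ y ≈ 0#
  zero?    : ∀ x → Dec (x ≈ 0#)
  not-cube : ∀ p q → p ⊠ (p ⊠ p) ≈ point ⊠ (q ⊠ (q ⊠ q)) → q ≈ 0#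

-- Adjoining a cube root y of t.
module Cubic (P : Pointed) where
 open Pointed P renaming (point to t)
 open Char2 ring char2 hiding (refl; sym; trans; ring) renaming (_+_ to _⊞_; _*_ to _⊠_)
 private module ≈ = Char2 (Pointed.ring P) (Pointed.char2 P)

 C³ : Set
 C³ = Carrier × Carrier × Carrier

 _≈³_ : C³ → C³ → Set
 (a , b , c) ≈³ (a' , b' , c') = a ≈ a' × b ≈ b' × c ≈ c'

 _+³_ _*³_ : C³ → C³ → C³
 (a , b , c) +³ (a' , b' , c') = a ⊞ a' , b ⊞ b' , c ⊞ c'
 (a , b , c) *³ (a' , b' , c') = a ⊠ a' ⊞ t ⊠ (b ⊠ c' ⊞ c ⊠ b')
                                , a ⊠ b' ⊞ b ⊠ a' ⊞ t ⊠ (c ⊠ c')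
                                , a ⊠ c' ⊞ b ⊠ b' ⊞ c ⊠ a'

 private
  P³ : Set
  P³ = Polynomial 10 × Polynomial 10 × Polynomial 10

  t⁺ : Polynomial 10
  t⁺ = variable′ (# 0)

  x y z 0³ 1³ Y : P³
  x  = variable′ (# 1) , variable′ (# 2) , variable′ (# 3)
  y  = variable′ (# 4) , variable′ (# 5) , variable′ (# 6)
  z  = variable′ (# 7) , variable′ (# 8) , variable′ (# 9)
  0³ = con false , con false , con false
  1³ = con true , con false , con false
  Y  = con false , con true , con false

  infixl 6 _⊕_
  infixl 7 _⊗_
  _⊕_ _⊗_ : P³ → P³ → P³
  (a , b , c) ⊕ (a' , b' , c') = a :+ a' , b :+ b' , c :+ c'
  (a , b , c) ⊗ (a' , b' , c') = a :* a' :+ t⁺ :* (b :* c' :+ c :* b')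
                                , a :* b' :+ b :* a' :+ t⁺ :* (c :* c')
                                , a :* c' :+ b :* b' :+ c :* a'

  env : C³ → C³ → C³ → Vec Carrier 10
  env (a , b , c) (d , e , f) (g , h , i) = t ∷ a ∷ b ∷ c ∷ d ∷ e ∷ f ∷ g ∷ h ∷ i ∷ []

  ⟦_⟧³ ⟦_⟧³↓ : P³ → Vec Carrier 10 → C³
  ⟦ p , q , r ⟧³ ρ  = ⟦ p ⟧ ρ , ⟦ q ⟧ ρ , ⟦ r ⟧ ρ
  ⟦ p , q , r ⟧³↓ ρ = ⟦ p ⟧↓ ρ , ⟦ q ⟧↓ ρ , ⟦ r ⟧↓ ρ

  -- Identities are stated in polynomials; u, v, w are substituted for x, y, z.
  law³ : ∀ u v w p q → ⟦ p ⟧³↓ (env u v w) ≈³ ⟦ q ⟧³↓ (env u v w) → ⟦ p ⟧³ (env u v w) ≈³ ⟦ q ⟧³ (env u v w)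
  law³ u v w (p , q , r) (p' , q' , r') (h , h' , h″) = prove (env u v w) p p' h , prove (env u v w) q q' h' , prove (env u v w) r r' h″

  refl³ : ∀ {u} → u ≈³ u
  refl³ = ≈.refl , ≈.refl , ≈.refl

 cubic : Pointed
 cubic = record
  { ring = char2-ring _≈³_ _+³_ _*³_ (0# , 0# , 0#) (1# , 0# , 0#)
      (record { refl = refl³ ; sym = λ (p , q , r) → ≈.sym p , ≈.sym q , ≈.sym r
              ; trans = λ (p , q , r) (p' , q' , r') → p ⊚ p' , q ⊚ q' , r ⊚ r' })
      (λ (p , q , r) (p' , q' , r') → +-cong p p' , +-cong q q' , +-cong r r')
      (λ u v w → law³ u v w (x ⊕ y ⊕ z) (x ⊕ (y ⊕ z)) refl³)
      (λ u v → law³ u v v (x ⊕ y) (y ⊕ x) refl³)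
      (λ u → law³ u u u (0³ ⊕ x) x refl³)
      (λ u → law³ u u u (x ⊕ x) 0³ refl³)
      (λ (p , q , r) (p' , q' , r') →
       +-cong (*-cong p p') (*-congˡ (+-cong (*-cong q r') (*-cong r q'))) ,
       +-cong (+-cong (*-cong p q') (*-cong q p')) (*-congˡ (*-cong r r')) ,
       +-cong (+-cong (*-cong p r') (*-cong q q')) (*-cong r p'))
      (λ u v w → law³ u v w (x ⊗ y ⊗ z) (x ⊗ (y ⊗ z)) refl³)
      (λ u v → law³ u v v (x ⊗ y) (y ⊗ x) refl³)
      (λ u → law³ u u u (1³ ⊗ x) x refl³)
      (λ u v w → law³ u v w ((y ⊕ z) ⊗ x) (y ⊗ x ⊕ z ⊗ x) refl³)
  ; char2 = λ _ → char2 _ , char2 _ , char2 _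
  ; point = 0# , 1# , 0# }

 norm : C³ → Carrier
 norm (a , b , c) = a ⊠ (a ⊠ a) ⊞ t ⊠ (b ⊠ (b ⊠ b)) ⊞ t ⊠ t ⊠ (c ⊠ (c ⊠ c)) ⊞ t ⊠ (a ⊠ (b ⊠ c))

 norm-cong : ∀ {x y} → x ≈³ y → norm x ≈ norm y
 norm-cong (p , q , r) = +-cong (+-cong (+-cong (*-cong p (*-cong p p)) (*-congˡ (*-cong q (*-cong q q))))
  (*-congˡ (*-cong r (*-cong r r)))) (*-congˡ (*-cong p (*-cong q r)))

 adjugate : C³ → C³
 adjugate (a , b , c) = a ⊠ a ⊞ t ⊠ (b ⊠ c) , t ⊠ (c ⊠ c) ⊞ a ⊠ b , b ⊠ b ⊞ a ⊠ c

 private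
  norm⁺ : P³ → Polynomial 10
  norm⁺ (a , b , c) = a :* (a :* a) :+ t⁺ :* (b :* (b :* b)) :+ t⁺ :* t⁺ :* (c :* (c :* c)) :+ t⁺ :* (a :* (b :* c))

  adjugate⁺ : P³ → P³
  adjugate⁺ (a , b , c) = a :* a :+ t⁺ :* (b :* c) , t⁺ :* (c :* c) :+ a :* b , b :* b :+ a :* c

 adjugate-* : ∀ u → (adjugate u *³ u) ≈³ (norm u , 0# , 0#)
 adjugate-* u = law³ u u u (adjugate⁺ x ⊗ x) (norm⁺ x , con false , con false) refl³

 private module C = CommutativeRing (Pointed.ring cubic)

 adjugate-homo : ∀ u v → adjugate (u *³ v) ≈³ (adjugate u *³ adjugate v)
 adjugate-homo u v = law³ u v v (adjugate⁺ (x ⊗ y)) (adjugate⁺ x ⊗ adjugate⁺ y) refl³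

 norm-* : ∀ u v → norm (u *³ v) ≈ norm u ⊠ norm v
 norm-* u v = ≈.sym (fst (adjugate-* (u *³ v))) ⊚ fst (C.trans {adjugate (u *³ v) *³ (u *³ v)} (C.*-congʳ {u *³ v} (adjugate-homo u v)) (C.trans {_ , _ , _} shuffle
     (C.*-cong {adjugate u *³ u} (adjugate-* u) (adjugate-* v)))) ⊚
  solve 3 (λ t n m → n :* m :+ t :* (con false :* con false :+ con false :* con false) := n :* m) ≈.refl t (norm u) (norm v)
  where
  open CommutativeSemigroupProperties C.*-commutativeSemigroup using (interchange)
  shuffle : ((adjugate u *³ adjugate v) *³ (u *³ v)) ≈³ ((adjugate u *³ u) *³ (adjugate v *³ v))
  shuffle = interchange (adjugate u) (adjugate v) u v

 module _ (D : IsDomain P) where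
  open IsDomain D

  private
   cube-zero : ∀ {a} → a ⊠ (a ⊠ a) ≈ 0# → a ≈ 0#
   cube-zero {a} h with cancel a (a ⊠ a) h
   ... | inj₁ p = p
   ... | inj₂ h' with cancel a a h'
   ...   | inj₁ p = p
   ...   | inj₂ p = p

   sum-zero : ∀ {x y} → x ⊞ y ≈ 0# → x ≈ y
   sum-zero {x} {y} h = solve 2 (λ x y → x := (x :+ y) :+ y) ≈.refl x y ⊚ +-congʳ h ⊚ +-identityˡ _

  -- A zero of the norm form would yield the cube root (t c² + a b) / (b² + a c) of t,
  -- because adjugate (adjugate x) = norm x · x.
  norm-zero : ∀ u → norm u ≈ 0# → u ≈³ (0# , 0# , 0#)
  norm-zero u@(a , b , c) h = a≈0 , b≈0 , c≈0
   where
   n p q N : Carrier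
   n = a ⊠ a ⊞ t ⊠ (b ⊠ c)
   p = t ⊠ (c ⊠ c) ⊞ a ⊠ b
   q = b ⊠ b ⊞ a ⊠ c
   N = norm u
   A B C n⁺ p⁺ q⁺ : Polynomial 10
   A  = fst x
   B  = fst (snd x)
   C  = snd (snd x)
   n⁺ = fst (adjugate⁺ x)
   p⁺ = fst (snd (adjugate⁺ x))
   q⁺ = snd (snd (adjugate⁺ x))
   by-law : ∀ f g → ⟦ f ⟧↓ (env u u u) ≈ ⟦ g ⟧↓ (env u u u) → ⟦ f ⟧ (env u u u) ≈ ⟦ g ⟧ (env u u u)
   by-law = prove (env u u u)
   N· : ∀ x → N ⊠ x ≈ 0#
   N· x = *-congʳ {x} h ⊚ zeroˡ x
   tq²≈np : t ⊠ (q ⊠ q) ≈ n ⊠ p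
   tq²≈np = sum-zero (by-law (t⁺ :* (q⁺ :* q⁺) :+ n⁺ :* p⁺) (norm⁺ x :* B) ≈.refl ⊚ N· b)
   p²≈nq : p ⊠ p ≈ n ⊠ q
   p²≈nq = sum-zero (by-law (p⁺ :* p⁺ :+ n⁺ :* q⁺) (norm⁺ x :* C) ≈.refl ⊚ N· c)
   root : ∀ p q n → t ⊠ (q ⊠ q) ≈ n ⊠ p → p ⊠ p ≈ n ⊠ q → p ⊠ (p ⊠ p) ≈ t ⊠ (q ⊠ (q ⊠ q))
   root p q n e1 e2 = begin
    p ⊠ (p ⊠ p) ≈⟨ *-congˡ e2 ⟩
    p ⊠ (n ⊠ q) ≈⟨ solve 3 (λ p n q → p :* (n :* q) := q :* (n :* p)) ≈.refl p n q ⟩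
    q ⊠ (n ⊠ p) ≈⟨ *-congˡ e1 ⟨
    q ⊠ (t ⊠ (q ⊠ q)) ≈⟨ solve 2 (λ t q → q :* (t :* (q :* q)) := t :* (q :* (q :* q))) ≈.refl t q ⟩
    t ⊠ (q ⊠ (q ⊠ q)) ∎
    where open SetoidReasoning setoid
   q≈0 : q ≈ 0#
   q≈0 = not-cube p q (root p q n tq²≈np p²≈nq)
   p≈0 : p ≈ 0#
   p≈0 = reduce (cancel p p (p²≈nq ⊚ *-congˡ {n} q≈0 ⊚ zeroʳ n))
   c≈0 : c ≈ 0#
   c≈0 = not-cube b c (by-law (B :* (B :* B)) (B :* q⁺ :+ C :* p⁺ :+ t⁺ :* (C :* (C :* C))) ≈.refl ⊚
    +-congʳ (+-cong (*-congˡ {b} q≈0 ⊚ zeroʳ b) (*-congˡ {c} p≈0 ⊚ zeroʳ c) ⊚ +-identityˡ 0#) ⊚ +-identityˡ _)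
   b≈0 : b ≈ 0#
   b≈0 = reduce (cancel b b (by-law (B :* B) (q⁺ :+ A :* C) ≈.refl ⊚
              +-cong q≈0 (*-congˡ {a} c≈0 ⊚ zeroʳ a) ⊚ +-identityˡ 0#))
   a≈0 : a ≈ 0#
   a≈0 = cube-zero (by-law (A :* (A :* A)) (norm⁺ x :+ B :* (t⁺ :* (B :* B)) :+ C :* (t⁺ :* t⁺ :* (C :* C) :+ t⁺ :* (A :* B))) ≈.refl ⊚
       +-cong (+-cong h (*-congʳ b≈0 ⊚ zeroˡ _)) (*-congʳ c≈0 ⊚ zeroˡ _) ⊚ +-identityʳ _ ⊚ +-identityʳ _)

  cubic-domain : IsDomain cubic
  cubic-domain = record
   { cancel = λ x y h → by x y h (zero? (norm x))
   ; zero? = λ (a , b , c) → zero? a ×-dec (zero? b ×-dec zero? c)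
   ; not-cube = λ p q h → norm-zero q (not-cube (norm p) (norm q)
       (≈.sym (norm-* p (p *³ p) ⊚ *-congˡ (norm-* p p)) ⊚
       norm-cong {p *³ (p *³ p)} h ⊚
       norm-* (0# , 1# , 0#) (q *³ (q *³ q)) ⊚
       *-cong (prove (env q q q) (norm⁺ Y) t⁺ ≈.refl)
        (norm-* q (q *³ q) ⊚ *-congˡ (norm-* q q)))) }
   where
   by : ∀ x y → (x *³ y) ≈³ (0# , 0# , 0#) → Dec (norm x ≈ 0#) → x ≈³ (0# , 0# , 0#) ⊎ y ≈³ (0# , 0# , 0#)
   by x y h (yes z) = inj₁ (norm-zero x z)
   by x@(_ , _ , _) y@(a , b , c) h (no nz) = inj₂ (each a (fst Ny) , each b (fst (snd Ny)) , each c (snd (snd Ny)))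
    where
    each : ∀ a → norm x ⊠ a ≈ 0# → a ≈ 0#
    each a e with cancel (norm x) a e
    ... | inj₁ z = contradiction z nz
    ... | inj₂ z = z
    scale : ((norm x , 0# , 0#) *³ y) ≈³ (norm x ⊠ a , norm x ⊠ b , norm x ⊠ c)
    scale = law³ (norm x , 0# , 0#) y y ((A , con false , con false) ⊗ V) (A :* fst V , A :* fst (snd V) , A :* snd (snd V)) refl³
     where
     A = variable′ (# 1)
     V = variable′ (# 4) , variable′ (# 5) , variable′ (# 6)
    Ny : (norm x ⊠ a , norm x ⊠ b , norm x ⊠ c) ≈³ (0# , 0# , 0#)
    Ny = C.trans {_ , _ , _} (C.sym {(norm x , 0# , 0#) *³ y} scale)
     (C.trans {_ , _ , _} (C.*-congʳ {y} (C.sym {adjugate x *³ x} (adjugate-* x)))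
     (C.trans {_ , _ , _} (C.*-assoc (adjugate x) x y)
     (C.trans {_ , _ , _} (C.*-congˡ {adjugate x} h) (C.zeroʳ (adjugate x)))))

 private
  module E = Evaluation P
  module E³ = Evaluation cubic
  module C³ = Char2 (Pointed.ring cubic) (Pointed.char2 cubic)

 component : ℕ → (ℕ → Bool) → ℕ → Bool
 component i f j = f (j * 3 + i)

 private
  infixr 5 _⨟_
  _⨟_ : ∀ {x y z} → x ≈³ y → y ≈³ z → x ≈³ z
  (p , q , r) ⨟ (p' , q' , r') = p ⊚ p' , q ⊚ q' , r ⊚ r'

  point³ : C³
  point³ = Pointed.point cubic

  shift : C³ → C³
  shift (a , b , c) = t ⊠ c , a , b

  shift-cong : ∀ {x y} → x ≈³ y → shift x ≈³ shift y
  shift-cong (p , q , r) = *-congˡ r , p , q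

  Y·≈shift : ∀ x → (point³ *³ x) ≈³ shift x
  Y·≈shift u = law³ u u u (Y ⊗ x) (t⁺ :* snd (snd x) , fst x , fst (snd x)) refl³

  push : Bool → C³ → C³
  push β (a , b , c) = bool β ⊞ t ⊠ c , a , b

  push-cong : ∀ β {x y} → x ≈³ y → push β x ≈³ push β y
  push-cong β (p , q , r) = +-congˡ (*-congˡ r) , p , q

  horner : ∀ β x → (C³.bool β +³ (point³ *³ x)) ≈³ push β x
  horner β x@(a , b , c) = C³.+-cong {C³.bool β} (embed β) (Y·≈shift x) ⨟ (≈.refl , +-identityˡ a , +-identityˡ b)
   where
   embed : ∀ β → C³.bool β ≈³ (bool β , 0# , 0#)
   embed true  = ≈.refl , ≈.refl , ≈.refl
   embed false = ≈.refl , ≈.refl , ≈.refl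

 eval-cubic : ∀ m f → E³.eval (m * 3) f ≈³
  (E.eval m (component 0 f) , E.eval m (component 1 f) , E.eval m (component 2 f))
 eval-cubic zero    f = ≈.refl , ≈.refl , ≈.refl
 eval-cubic (suc m) f =
  horner (f 0) _ ⨟ push-cong (f 0) (horner (f 1) _ ⨟ push-cong (f 1) (horner (f 2) _ ⨟
   push-cong (f 2) (eval-cubic m (λ e → f (3 + e)))))

 cubic-independent : ∀ m → E.Independent m → E³.Independent (m * 3)
 cubic-independent m ind f h e e<3m = cong f (DM.m≡m%n+[m/n]*n e 3 ⊙ ℕ.+-comm (e DM.% 3) _) ⊙
     go (e DM.% 3) (DM.m%n<n e 3)
  where
  vanish = C³.trans {_ , _ , _} (C³.sym {E³.eval (m * 3) f} (eval-cubic m f)) h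
  j<m : e DM./ 3 < m
  j<m = DM.m<n*o⇒m/o<n e<3m
  go : ∀ i → i < 3 → f (e DM./ 3 * 3 + i) ≡ false
  go 0 _ = ind (component 0 f) (fst vanish) _ j<m
  go 1 _ = ind (component 1 f) (fst (snd vanish)) _ j<m
  go 2 _ = ind (component 2 f) (snd (snd vanish)) _ j<m
  go (suc (suc (suc i))) (s≤s (s≤s (s≤s ())))

 cubic-power : ∀ m → E³.power (m * 3) ≈³ (E.power m , 0# , 0#)
 cubic-power zero    = ≈.refl , ≈.refl , ≈.refl
 cubic-power (suc m) = Y·≈shift _ ⨟ shift-cong (Y·≈shift _ ⨟ shift-cong (Y·≈shift _ ⨟ shift-cong (cubic-power m)))
  ⨟ (≈.refl , zeroʳ t , zeroʳ t)

tower : ℕ → Pointed → Pointed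
tower zero    P = P
tower (suc k) P = Cubic.cubic (tower k P)

treble : ℕ → ℕ → ℕ
treble zero    m = m
treble (suc k) m = treble k m * 3

treble≡ : ∀ k m → treble k m ≡ m * 3 ^ k
treble≡ zero    m = sym (ℕ.*-identityʳ m)
treble≡ (suc k) m = cong (_* 3) (treble≡ k m) ⊙ ℕ.*-assoc m (3 ^ k) 3 ⊙ cong (m *_) (ℕ.*-comm (3 ^ k) 3)

tower-independent : ∀ k {P m} → Evaluation.Independent P m → Evaluation.Independent (tower k P) (treble k m)
tower-independent zero    h = h
tower-independent (suc k) {P} {m} h = Cubic.cubic-independent (tower k P) (treble k m) (tower-independent k {P} {m} h)

HasPeriod : Pointed → ℕ → Set
HasPeriod P m = CommutativeRing._≈_ (Pointed.ring P) (Evaluation.power P m) (CommutativeRing.1# (Pointed.ring P))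

tower-period : ∀ k {P m} → HasPeriod P m → HasPeriod (tower k P) (treble k m)
tower-period zero    h = h
tower-period (suc k) {P} {m} h with Cubic.cubic-power (tower k P) (treble k m)
... | p , q , r = CommutativeRing.trans (Pointed.ring (tower k P)) p (tower-period k {P} {m} h) , q , r

tower-domain : ∀ k {P} → IsDomain P → IsDomain (tower k P)
tower-domain zero    D = D
tower-domain (suc k) {P} D = Cubic.cubic-domain (tower k P) (tower-domain k D)

𝔽2 : Pointed
𝔽2 = record { ring = Bool.xor-∧-commutativeRing ; char2 = Bool.xor-same ; point = true }

𝔽2-independent : Evaluation.Independent 𝔽2 1
𝔽2-independent f h zero    _ with f 0
... | false = refl
𝔽2-independent f h (suc e) (s≤s ())

-- F₂[ω] with ω² = ω + 1.
𝔽4 : Pointed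
𝔽4 = record
 { ring = char2-ring _≡_ _⊞_ _⊠_ (false , false) (true , false) ≡.isEquivalence (cong₂ _⊞_)
     (λ u v w → law u v w (x ⊕ y ⊕ z) (x ⊕ (y ⊕ z)) refl)
     (λ u v → law u v v (x ⊕ y) (y ⊕ x) refl)
     (λ _ → refl)
     char2
     (cong₂ _⊠_)
     (λ u v w → law u v w (x ⊗ y ⊗ z) (x ⊗ (y ⊗ z)) refl)
     (λ u v → law u v v (x ⊗ y) (y ⊗ x) refl)
     (λ u → law u u u ((con true , con false) ⊗ x) x refl)
     (λ u v w → law u v w ((y ⊕ z) ⊗ x) (y ⊗ x ⊕ z ⊗ x) refl)
 ; char2 = char2
 ; point = false , true }
 where
 open Char2 Bool.xor-∧-commutativeRing Bool.xor-same using (Polynomial; prove; ⟦_⟧; ⟦_⟧↓; _:+_; _:*_; con; variable′)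
 _⊞_ _⊠_ : Bool × Bool → Bool × Bool → Bool × Bool
 (a , b) ⊞ (c , d) = a xor c , b xor d
 (a , b) ⊠ (c , d) = (a ∧ c) xor (b ∧ d) , ((a ∧ d) xor (b ∧ c)) xor (b ∧ d)
 char2 : ∀ u → u ⊞ u ≡ (false , false)
 char2 (a , b) = cong₂ _,_ (Bool.xor-same a) (Bool.xor-same b)
 P² : Set
 P² = Polynomial 6 × Polynomial 6
 x y z : P²
 x = variable′ (# 0) , variable′ (# 1)
 y = variable′ (# 2) , variable′ (# 3)
 z = variable′ (# 4) , variable′ (# 5)
 infixl 6 _⊕_
 infixl 7 _⊗_
 _⊕_ _⊗_ : P² → P² → P²
 (a , b) ⊕ (c , d) = a :+ c , b :+ d
 (a , b) ⊗ (c , d) = a :* c :+ b :* d , a :* d :+ b :* c :+ b :* d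
 env : (u v w : Bool × Bool) → Vec Bool 6
 env (a , b) (c , d) (e , f) = a ∷ b ∷ c ∷ d ∷ e ∷ f ∷ []
 ⟦_⟧² ⟦_⟧²↓ : P² → Vec Bool 6 → Bool × Bool
 ⟦ p , q ⟧² ρ  = ⟦ p ⟧ ρ , ⟦ q ⟧ ρ
 ⟦ p , q ⟧²↓ ρ = ⟦ p ⟧↓ ρ , ⟦ q ⟧↓ ρ
 law : ∀ u v w p q → ⟦ p ⟧²↓ (env u v w) ≡ ⟦ q ⟧²↓ (env u v w) → ⟦ p ⟧² (env u v w) ≡ ⟦ q ⟧² (env u v w)
 law u v w (p , q) (p' , q') h = cong₂ _,_ (prove (env u v w) p p' (cong fst h)) (prove (env u v w) q q' (cong snd h))

𝔽4-independent : Evaluation.Independent 𝔽4 2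
𝔽4-independent f h e e<2 with f 0 in eq0 | f 1 in eq1
𝔽4-independent f h 0 e<2 | false | false = eq0
𝔽4-independent f h 1 e<2 | false | false = eq1
𝔽4-independent f h (suc (suc e)) (s≤s (s≤s ())) | false | false
𝔽4-independent f () e e<2 | false | true
𝔽4-independent f () e e<2 | true | false
𝔽4-independent f () e e<2 | true | true

𝔽4-domain : IsDomain 𝔽4
𝔽4-domain = record
 { cancel = λ { (false , false) y _ → inj₁ refl
              ; (false , true) (false , false) _ → inj₂ refl
              ; (true , false) (false , false) _ → inj₂ refl
              ; (true , true) (false , false) _ → inj₂ refl
              ; (false , true) (false , true) ()
              ; (false , true) (true , false) ()
              ; (false , true) (true , true) ()
              ; (true , false) (false , true) ()
              ; (true , false) (true , false) ()
              ; (true , false) (true , true) ()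
              ; (true , true) (false , true) ()
              ; (true , true) (true , false) ()
              ; (true , true) (true , true) () }
 ; zero? = λ { (false , false) → yes refl ; (false , true) → no λ () ; (true , false) → no λ () ; (true , true) → no λ () }
 ; not-cube = λ { p (false , false) _ → refl
                ; (false , false) (false , true) () ; (false , true) (false , true) ()
                ; (true , false) (false , true) () ; (true , true) (false , true) ()
                ; (false , false) (true , false) () ; (false , true) (true , false) ()
                ; (true , false) (true , false) () ; (true , true) (true , false) ()
                ; (false , false) (true , true) () ; (false , true) (true , true) ()
                ; (true , false) (true , true) () ; (true , true) (true , true) () } }

𝔽4-period : HasPeriod 𝔽4 3
𝔽4-period = refl

open import Data.Fin.Base using (toℕ; fromℕ<)
open import Data.Nat.Base using (_∸_; NonZero)
open import Data.Nat.Divisibility using (_∣_; divides)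
open import Data.Product.Base using (Σ-syntax)
open import Relation.Binary.PropositionalEquality using (subst₂)
open import Relation.Nullary.Decidable using (map′)

odd⇒2∣suc : ∀ j → odd? j ≡ true → 2 ∣ suc j
odd⇒2∣suc (suc zero)    e = divides 1 refl
odd⇒2∣suc (suc (suc j)) e with odd⇒2∣suc j (sym (Bool.not-involutive _) ⊙ e)
... | divides q p = divides (suc q) (cong (2 +_) p)

2∣suc⇒odd : ∀ j → 2 ∣ suc j → odd? j ≡ true
2∣suc⇒odd zero          (divides zero ())
2∣suc⇒odd zero          (divides (suc q) ())
2∣suc⇒odd (suc zero)    _ = refl
2∣suc⇒odd (suc (suc j)) (divides zero ())
2∣suc⇒odd (suc (suc j)) (divides (suc q) p) =
 Bool.not-involutive _ ⊙ 2∣suc⇒odd j (divides q (ℕ.suc-injective (ℕ.suc-injective p)))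

record Track {n} (g : Arcs n) (v u : Fin n) (j : ℕ) : Set where
 field
  at       : ℕ → Fin n
  start    : at 0 ≡ v
  end      : at j ≡ u
  arcs     : ∀ i → i < j → T (g (at i) (at (suc i)))
  distinct : ∀ a b → a ≤ j → b ≤ j → at a ≡ at b → a ≡ b

not-into-cut : ∀ {n} (g : Arcs n) {v} i {y} → T (cut v g i y) → y ≢ v
not-into-cut g {v} i {y} t y≡v with y Fin.≟ v
... | no y≢v = y≢v y≡v

into-cut : ∀ {n} (g : Arcs n) {v} i {y} → T (g i y) → y ≢ v → T (cut v g i y)
into-cut g {v} i {y} t y≢v with y Fin.≟ v
... | no _    = t
... | yes y≡v = y≢v y≡v

path⇒track : ∀ {n} {g : Arcs n} {v u j} → Path g v u j → Track g v u j
path⇒track {v = v} [] = record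
 { at = λ _ → v ; start = refl ; end = refl ; arcs = λ _ ()
 ; distinct = λ { zero zero _ _ _ → refl } }
path⇒track {n} {g} {v} {u} {suc j} (_∷_ {y = y} t p) = record
 { at = at ; start = refl ; end = τ.end
 ; arcs = λ { zero _ → subst (T ∘ g v) (sym τ.start) (cut⊆ g v v y t)
            ; (suc i) (s≤s i<j) → cut⊆ g v _ _ (τ.arcs i i<j) }
 ; distinct = λ { zero zero _ _ _ → refl
                ; zero (suc b) _ (s≤s b≤j) e → contradiction (sym e) (avoids b b≤j)
                ; (suc a) zero (s≤s a≤j) _ e → contradiction e (avoids a a≤j)
                ; (suc a) (suc b) (s≤s a≤j) (s≤s b≤j) e → cong suc (τ.distinct a b a≤j b≤j e) } }
 where
 module τ = Track (path⇒track p)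
 at : ℕ → Fin n
 at zero    = v
 at (suc i) = τ.at i
 avoids : ∀ i → i ≤ j → τ.at i ≢ v
 avoids zero    _   e = not-into-cut g v t (sym τ.start ⊙ e)
 avoids (suc i) i<j e = not-into-cut g (τ.at i) (τ.arcs i i<j) e

track⇒path : ∀ {n} {g : Arcs n} j (x : ℕ → Fin n) → (∀ i → i < j → T (g (x i) (x (suc i)))) →
 (∀ a b → a ≤ j → b ≤ j → x a ≡ x b → a ≡ b) → Path g (x 0) (x j) j
track⇒path zero    x arcs distinct = []
track⇒path {g = g} (suc j) x arcs distinct =
 into-cut g (x 0) (arcs 0 z<s) (λ e → contradiction (distinct 1 0 (s≤s z≤n) z≤n e) λ ()) ∷
 track⇒path j (x ∘ suc)
  (λ i i<j → into-cut g (x (suc i)) (arcs (suc i) (s<s i<j))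
     λ e → contradiction (distinct (suc (suc i)) 0 (s≤s i<j) z≤n e) λ ())
  (λ a b a≤j b≤j e → ℕ.suc-injective (distinct (suc a) (suc b) (s≤s a≤j) (s≤s b≤j) e))

toℕ-mod : ∀ m n .{{_ : NonZero n}} → toℕ (m DM.mod n) ≡ m DM.% n
toℕ-mod m n = Fin.toℕ-fromℕ< (DM.m%n<n m n)

%-shift-injective : ∀ c L .{{_ : NonZero L}} a b → a < L → b < L → (c + a) DM.% L ≡ (c + b) DM.% L → a ≡ b
%-shift-injective c L a b a<L b<L e = begin
 a ≡⟨ DM.m<n⇒m%n≡m a<L ⟨
 a DM.% L ≡⟨ DM.[m+kn]%n≡m%n a ((c + b) DM./ L) L ⟨
 (a + (c + b) DM./ L * L) DM.% L ≡⟨ cong (DM._% L) same ⟩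
 (b + (c + a) DM./ L * L) DM.% L ≡⟨ DM.[m+kn]%n≡m%n b ((c + a) DM./ L) L ⟩
 b DM.% L ≡⟨ DM.m<n⇒m%n≡m b<L ⟩
 b ∎
 where
 open ≡.≡-Reasoning
 qa qb r : ℕ
 qa = (c + a) DM./ L * L
 qb = (c + b) DM./ L * L
 r = (c + a) DM.% L
 same : a + qb ≡ b + qa
 same = ℕ.+-cancelˡ-≡ c _ _ (begin
  c + (a + qb) ≡⟨ ℕ.+-assoc c a qb ⟨
  c + a + qb ≡⟨ cong (_+ qb) (DM.m≡m%n+[m/n]*n (c + a) L) ⟩
  r + qa + qb ≡⟨ ℕ.+-assoc r qa qb ⊙ cong (r +_) (ℕ.+-comm qa qb) ⊙ sym (ℕ.+-assoc r qb qa) ⟩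
  r + qb + qa ≡⟨ cong (λ r → r + qb + qa) e ⟩
  (c + b) DM.% L + qb + qa ≡⟨ cong (_+ qa) (DM.m≡m%n+[m/n]*n (c + b) L) ⟨
  c + b + qa ≡⟨ ℕ.+-assoc c b qa ⟩
  c + (b + qa) ∎)

module _ {n} (G : Digraph n) where

 path⇒cycle : ∀ {u v j} → Path (arc G) v u j → T (arc G u v) →
  Σ[ C ∈ Cycle G ] (Cycle.len C ≡ suc j × Cycle.Uses C u v)
 path⇒cycle {u} {v} {j} p t = C , refl , last , cong at (Fin.toℕ-fromℕ< (ℕ.n<1+n j)) ⊙ end ,
  trans (cong at (toℕ-mod (suc (toℕ last)) (suc j) ⊙ cong (λ k → suc k DM.% suc j) (Fin.toℕ-fromℕ< (ℕ.n<1+n j)) ⊙ DM.n%n≡0 (suc j))) start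
  where
  open Track (path⇒track p)
  last : Fin (suc j)
  last = fromℕ< (ℕ.n<1+n j)
  closed : ∀ i → T (arc G (at (toℕ i)) (at (toℕ (suc (toℕ i) DM.mod suc j))))
  closed i with ℕ.m≤n⇒m<n∨m≡n (s≤s⁻¹ (Fin.toℕ<n i))
  ... | inj₁ i<j = subst (T ∘ arc G _) (cong at (sym (toℕ-mod (suc (toℕ i)) (suc j) ⊙ DM.m<n⇒m%n≡m (s<s i<j)))) (arcs (toℕ i) i<j)
  ... | inj₂ i≡j = subst₂ (λ a b → T (arc G a b)) (sym end ⊙ cong at (sym i≡j))
          (sym start ⊙ cong at (sym (toℕ-mod (suc (toℕ i)) (suc j) ⊙ cong (λ k → suc k DM.% suc j) i≡j ⊙ DM.n%n≡0 (suc j)))) t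
  C : Cycle G
  C = record { len = suc j ; vertex = λ i → at (toℕ i)
             ; simple = λ {a} {b} e → Fin.toℕ-injective (distinct (toℕ a) (toℕ b) (s≤s⁻¹ (Fin.toℕ<n a)) (s≤s⁻¹ (Fin.toℕ<n b)) e)
             ; closed = closed }

 cycle⇒path : ∀ (C : Cycle G) {u v} → Cycle.Uses C u v →
  ∃[ j ] (Cycle.len C ≡ suc j × Path (arc G) v u j × T (arc G u v))
 cycle⇒path record { len = suc j ; vertex = vertex ; simple = simple ; closed = closed } {u} {v} (i , refl , refl) =
  j , refl , subst₂ (λ a b → Path (arc G) a b j) (cong vertex x0) (cong vertex xⱼ)
   (track⇒path j (λ s → vertex (x s)) arcs distinct) , closed i
  where
  L = suc j
  c = suc (toℕ i)
  x : ℕ → Fin L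
  x s = (c + s) DM.mod L
  x0 : x 0 ≡ c DM.mod L
  x0 = cong (DM._mod L) (ℕ.+-identityʳ c)
  xⱼ : x j ≡ i
  xⱼ = Fin.toℕ-injective (toℕ-mod (c + j) L ⊙ cong (DM._% L) (sym (ℕ.+-suc (toℕ i) j)) ⊙
   DM.[m+n]%n≡m%n (toℕ i) L ⊙ DM.m<n⇒m%n≡m (Fin.toℕ<n i))
  arcs : ∀ s → s < j → T (arc G (vertex (x s)) (vertex (x (suc s))))
  arcs s _ = subst (λ k → T (arc G (vertex (x s)) (vertex k))) (Fin.toℕ-injective (begin
      toℕ (suc (toℕ (x s)) DM.mod L) ≡⟨ toℕ-mod (suc (toℕ (x s))) L ⟩
      suc (toℕ (x s)) DM.% L ≡⟨ cong (λ k → suc k DM.% L) (toℕ-mod (c + s) L) ⟩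
      (1 + (c + s) DM.% L) DM.% L ≡⟨ DM.%-distribˡ-+ 1 ((c + s) DM.% L) L ⟩
      (1 DM.% L + (c + s) DM.% L DM.% L) DM.% L ≡⟨ cong (λ k → (1 DM.% L + k) DM.% L) (DM.m%n%n≡m%n (c + s) L) ⟩
      (1 DM.% L + (c + s) DM.% L) DM.% L ≡⟨ DM.%-distribˡ-+ 1 (c + s) L ⟨
      suc (c + s) DM.% L ≡⟨ cong (DM._% L) (ℕ.+-suc c s) ⟨
      (c + suc s) DM.% L ≡⟨ toℕ-mod (c + suc s) L ⟨
      toℕ (x (suc s)) ∎)) (closed (x s))
   where open ≡.≡-Reasoning
  distinct : ∀ a b → a ≤ j → b ≤ j → vertex (x a) ≡ vertex (x b) → a ≡ b
  distinct a b a≤j b≤j e = %-shift-injective c L a b (s≤s a≤j) (s≤s b≤j)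
   (sym (toℕ-mod (c + a) L) ⊙ cong toℕ (simple e) ⊙ toℕ-mod (c + b) L)

path? : ∀ {n} (g : Arcs n) v u j → Dec (Path g v u j)
path? g v u zero    = map′ (λ { refl → [] }) (λ { [] → refl }) (v Fin.≟ u)
path? g v u (suc j) = map′ (λ (y , t , p) → t ∷ p) (λ { (t ∷ p) → _ , t , p })
 (Fin.any? λ y → Bool.T? (cut v g v y) ×-dec path? (cut v g) y u j)

-- The closing arc (u , v) and the rest of an even cycle of length j + 1.
EvenCycleAt : ∀ {n} → Arcs n → ℕ → Fin n → Fin n → Set
EvenCycleAt g j u v = T (g u v) × Path g v u j

data Girth {n} (g : Arcs n) : Set where
 acyclic : (∀ {j u v} → odd? j ≡ true → ¬ EvenCycleAt g j u v) → Girth g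
 attained : ∀ j {u v} → j < n → odd? j ≡ true → EvenCycleAt g j u v → EvenGirth g (suc j) → Girth g

path-short : ∀ {n} {g : Arcs n} {v u j} → Path g v u j → j < n
path-short {j = j} p = Fin.injective⇒≤ {f = λ (i : Fin (suc j)) → at (toℕ i)}
 λ {a} {b} e → Fin.toℕ-injective (distinct (toℕ a) (toℕ b) (s≤s⁻¹ (Fin.toℕ<n a)) (s≤s⁻¹ (Fin.toℕ<n b)) e)
 where open Track (path⇒track p)

girth : ∀ {n} (g : Arcs n) → Girth g
girth {n} g = search n λ oj (t , p) → path-short p
 where
 found? : ∀ j → Dec (∃[ u ] ∃[ v ] EvenCycleAt g j u v)
 found? j = Fin.any? λ u → Fin.any? λ v → Bool.T? (g u v) ×-dec path? g v u j
 least : ∀ k → (∀ {j u v} → odd? j ≡ true → EvenCycleAt g j u v → k ≤ j) ⊎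
         (∃[ j ] ∃[ u ] ∃[ v ] (odd? j ≡ true × EvenCycleAt g j u v × EvenGirth g (suc j)))
 least zero = inj₁ λ _ _ → z≤n
 least (suc k) with least k
 ... | inj₂ h = inj₂ h
 ... | inj₁ h with odd? k in ok | found? k
 ...   | true | yes (u , v , e) = inj₂ (k , u , v , ok , e , λ oj p t → s≤s (h oj (t , p)))
 ...   | true | no ¬e = inj₁ λ {j} {u} {v} oj e → ℕ.≤∧≢⇒< (h oj e) λ { refl → ¬e (u , v , e) }
 ...   | false | _ = inj₁ λ {j} oj e → ℕ.≤∧≢⇒< (h oj e) λ { refl → contradiction (sym oj ⊙ ok) λ () }
 search : ∀ k → (∀ {j u v} → odd? j ≡ true → EvenCycleAt g j u v → j < k) → Girth g
 search k short with least k
 ... | inj₁ h = acyclic λ oj e → ℕ.<⇒≱ (short oj e) (h oj e)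
 ... | inj₂ (j , u , v , oj , e , h) = attained j (path-short (snd e)) oj e h

module _ {n} (G : Digraph n) where

 private g = arc G

 evenCycle⇒at : ∀ (C : Cycle G) → Cycle.Even C → ∃[ j ] ∃[ u ] ∃[ v ] (Cycle.len C ≡ suc j × odd? j ≡ true × EvenCycleAt g j u v)
 evenCycle⇒at C@record { len = suc l } even with cycle⇒path G C {Cycle.vertex C zero} (zero , refl , refl)
 ... | j , refl , p , t = j , _ , _ , refl , 2∣suc⇒odd j even , t , p

 none⇒¬HasEvenCycle : (∀ {j u v} → odd? j ≡ true → ¬ EvenCycleAt g j u v) → ¬ HasEvenCycle G
 none⇒¬HasEvenCycle h (C , even) with evenCycle⇒at C even
 ... | j , u , v , _ , oj , e = h oj e

 module _ {j} (oj : odd? j ≡ true) (minimal : EvenGirth g (suc j)) where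

  at⇒shortest : ∀ {u v} → EvenCycleAt g j u v → Σ[ C ∈ Cycle G ] (ShortestEven G C × Cycle.len C ≡ suc j × Cycle.Uses C u v)
  at⇒shortest (t , p) with path⇒cycle G p t
  ... | C , l , uses = C , (subst (2 ∣_) (sym l) (odd⇒2∣suc j oj) ,
        λ D even → let (_ , _ , _ , l′ , oi , t' , p') = evenCycle⇒at D even in
         subst₂ _≤_ (sym l) (sym l′) (minimal oi p' t')) , l , uses

  onShortest⇒at : ∀ {u v} → ∀ {x y} → EvenCycleAt g j x y → OnShortestEven G u v → EvenCycleAt g j u v
  onShortest⇒at e (C , (even , shortest) , uses) with cycle⇒path G C uses
  ... | i , l , p , t with at⇒shortest e
  ...   | D , (even' , _) , l′ , _ = subst (λ k → EvenCycleAt g k _ _) i≡j (t , p)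
   where
   oi : odd? i ≡ true
   oi = 2∣suc⇒odd i (subst (2 ∣_) l even)
   i≡j : i ≡ j
   i≡j = ℕ.suc-injective (ℕ.≤-antisym
    (sym l ≡⟫ shortest D even' ⟫≡ l′)
    (minimal oi p t))

open import Data.Fin.Base using (combine)
open import Data.Nat.Base using (⌊_/2⌋)
open import Function.Properties.Inverse using (↔-sym)

halves : ℕ → ℕ → ℕ
halves zero    x = x
halves (suc e) x = halves e ⌊ x /2⌋

parity : ℕ → ℕ
parity x = x ∸ (⌊ x /2⌋ + ⌊ x /2⌋)

bit : ℕ → ℕ → ℕ
bit e x = parity (halves e x)

parity-step : ∀ x → parity (suc (suc x)) ≡ parity x
parity-step x = cong (suc x ∸_) (ℕ.+-suc ⌊ x /2⌋ ⌊ x /2⌋)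

parity≡ : ∀ x → parity x ≡ ⟦ odd? x ⟧ᵇ
parity≡ zero          = refl
parity≡ (suc zero)    = refl
parity≡ (suc (suc x)) = parity-step x ⊙ parity≡ x ⊙ cong ⟦_⟧ᵇ (sym (Bool.not-involutive (odd? x)))

parity≤1 : ∀ x → parity x ≤ 1
parity≤1 x = parity≡ x ≡⟫ bound (odd? x)
 where
 bound : ∀ b → ⟦ b ⟧ᵇ ≤ 1
 bound true  = ℕ.≤-refl
 bound false = z≤n

odd-⟦⟧ : ∀ b → odd? ⟦ b ⟧ᵇ ≡ b
odd-⟦⟧ true  = refl
odd-⟦⟧ false = refl

odd-parity : ∀ x → odd? (parity x) ≡ odd? x
odd-parity x = cong odd? (parity≡ x) ⊙ odd-⟦⟧ _

odd-+ : ∀ x y → odd? (x + y) ≡ odd? x xor odd? y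
odd-+ zero    y = refl
odd-+ (suc x) y = cong not (odd-+ x y) ⊙ Bool.not-distribˡ-xor (odd? x) (odd? y)

odd-double : ∀ x y → odd? (x + x + y) ≡ odd? y
odd-double x y = odd-+ (x + x) y ⊙ cong (_xor odd? y) (odd-+ x x ⊙ Bool.xor-same (odd? x))

half-double : ∀ x {b} → b ≤ 1 → ⌊ x + x + b /2⌋ ≡ x
half-double x z≤n = cong ⌊_/2⌋ (ℕ.+-identityʳ (x + x)) ⊙ sym (ℕ.n≡⌊n+n/2⌋ x)
half-double x (s≤s z≤n) = cong ⌊_/2⌋ (ℕ.+-comm (x + x) 1) ⊙ half-suc x
 where
 half-suc : ∀ x → ⌊ suc (x + x) /2⌋ ≡ x
 half-suc zero    = refl
 half-suc (suc x) = cong suc (cong ⌊_/2⌋ (ℕ.+-suc x x) ⊙ half-suc x)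

-- The word whose bits are the parities of g 0, …, g (k - 1).
word : ℕ → (ℕ → ℕ) → ℕ
word zero    g = 0
word (suc k) g = word k (g ∘ suc) + word k (g ∘ suc) + parity (g 0)

word< : ∀ k g → word k g < 2 ^ k
word< zero    g = z<s
word< (suc k) g = begin
 suc (w + w + parity (g 0)) ≤⟨ s≤s (ℕ.+-monoʳ-≤ (w + w) (parity≤1 (g 0))) ⟩
 suc (w + w + 1) ≡⟨ cong suc (ℕ.+-comm (w + w) 1) ⊙ sym (cong suc (ℕ.+-suc w w)) ⟩
 suc w + suc w ≤⟨ ℕ.+-mono-≤ (word< k (g ∘ suc)) (word< k (g ∘ suc)) ⟩
 2 ^ k + 2 ^ k ≡⟨ cong (2 ^ k +_) (ℕ.+-identityʳ (2 ^ k)) ⟨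
 2 ^ suc k ∎
 where
 open ℕ.≤-Reasoning
 w = word k (g ∘ suc)

word-bit : ∀ k g e → e < k → odd? (halves e (word k g)) ≡ odd? (g e)
word-bit (suc k) g zero    _ = odd-double (word k (g ∘ suc)) _ ⊙ odd-parity (g 0)
word-bit (suc k) g (suc e) (s≤s e<k) =
 cong (odd? ∘ halves e) (half-double (word k (g ∘ suc)) (parity≤1 (g 0))) ⊙ word-bit k (g ∘ suc) e e<k

Words : ℕ → Set
Words n = Fin n → Fin n → ℕ

previous : ℕ → ℕ → ℕ
previous m zero    = m ∸ 1
previous m (suc c) = c

shifted : ℕ → ℕ → ℕ → ℕ
shifted m zero    e = e
shifted m (suc b) e = previous m (shifted m b e)

𝔽2-field : BinaryField 1
𝔽2-field = record
 { Carrier = Bool ; _⊕_ = _xor_ ; _⊗_ = _∧_ ; ⊖_ = id ; _⁻¹ = id ; 0# = false ; 1# = true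
 ; isCommutativeRing = CommutativeRing.isCommutativeRing Bool.xor-∧-commutativeRing
 ; 0≢1 = λ () ; ⁻¹-inverse = λ { false h → contradiction refl h ; true _ → refl } ; 0⁻¹ = refl
 ; enumeration = ↔-sym Fin.2↔Bool }

module F = BinaryField 𝔽2-field

slice : ∀ {n} → Words n → ℕ → Fin n → Fin n → Bool
slice X b i j = odd? (halves b (X i j))

module _ {n : ℕ} (m : ℕ) where

 Slices : Set
 Slices = ℕ → ℕ → Words n

 matrixProduct hadamardProduct : Words n → Words n → Slices
 matrixProduct   X Y b c i j = ⟦ (slice X b F.∙ slice Y c) i j ⟧ᵇ
 hadamardProduct X Y b c i j = bit b (X i j) * bit c (Y i j)

 collect : Slices → Words n → ℕ → ℕ → Words n
 collect D W e zero    i j = bit e (W i j)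
 collect D W e (suc b) i j = collect D W e b i j + D b (shifted m b e) i j

 convolve : Slices → Words n → Words n
 convolve D W i j = word m (λ e → collect D W e m i j)

 zeros : Words n
 zeros _ _ = 0

 withDiagonal : (Fin n → ℕ) → Words n → Words n
 withDiagonal d X i j = if does (i Fin.≟ j) then d i else X i j

 record Stage : Set where
  constructor stage
  field B B⁻ G Γ : Words n

 withDiagonal-≡ : ∀ d X i → withDiagonal d X i i ≡ d i
 withDiagonal-≡ d X i with i Fin.≟ i
 ... | yes _ = refl
 ... | no ¬p = contradiction refl ¬p

 withDiagonal-≢ : ∀ d X {i j} → i ≢ j → withDiagonal d X i j ≡ X i j
 withDiagonal-≢ d X {i} {j} i≢j with i Fin.≟ j
 ... | yes p = contradiction p i≢j
 ... | no _  = refl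

 module _ (A Aᵀ : Words n) where

  open Stage

  initial : Stage
  initial = stage (withDiagonal (λ _ → 1) zeros) zeros (withDiagonal (λ _ → 1) zeros) zeros

  advance : Stage → Stage
  advance s = stage B′ (B s) G′ Γ′
   where
   B′ = convolve (matrixProduct A (B s)) zeros
   H  = convolve (hadamardProduct Aᵀ (convolve (hadamardProduct Aᵀ (B⁻ s)) zeros)) zeros
   G′ = convolve (matrixProduct (G s) Aᵀ) (withDiagonal (λ a → B′ a a) H)
   Γ′ = convolve (matrixProduct Aᵀ (Γ s)) (withDiagonal (λ _ → 0) G′)

  advance-Γ< : ∀ s i j → Γ (advance s) i j < 2 ^ m
  advance-Γ< s i j = word< m λ e → collect (matrixProduct Aᵀ (Γ s)) (withDiagonal (λ _ → 0) (G (advance s))) e m i j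

  stages : ℕ → Stage
  stages zero    = initial
  stages (suc k) = advance (stages k)

module WordRing (P : Pointed) (m : ℕ) (period : HasPeriod P (suc m)) where

 open Pointed P
 open Evaluation P
 open Char2 ring char2 hiding (refl; sym; trans; ring) renaming (_+_ to _⊞_; _*_ to _⊠_)
 private module ≈ = Char2 (Pointed.ring P) (Pointed.char2 P)
 open import Relation.Binary.Reasoning.Setoid setoid

 L : ℕ
 L = suc m

 value : ℕ → Carrier
 value z = eval L (λ e → odd? (halves e z))

 bool-∧ : ∀ a b → bool (a ∧ b) ≈ bool a ⊠ bool b
 bool-∧ true  b = ≈.sym (*-identityˡ _)
 bool-∧ false b = ≈.sym (zeroˡ _)

 eval-∧ : ∀ k a f → eval k (λ e → a ∧ f e) ≈ bool a ⊠ eval k f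
 eval-∧ zero    a f = ≈.sym (zeroʳ _)
 eval-∧ (suc k) a f = +-cong (bool-∧ a (f 0)) (*-congˡ (eval-∧ k a (f ∘ suc))) ⊚
  solve 4 (λ a b t x → a :* b :+ t :* (a :* x) := a :* (b :+ t :* x)) ≈.refl (bool a) (bool (f 0)) point (eval k (f ∘ suc))

 eval-shifted : ∀ b f → eval L (λ e → f (shifted L b e)) ≈ power b ⊠ eval L f
 eval-shifted zero    f = ≈.sym (*-identityˡ _)
 eval-shifted (suc b) f = begin
  eval L (λ e → f (previous L (shifted L b e))) ≈⟨ eval-shifted b (λ c → f (previous L c)) ⟩
  power b ⊠ eval L (λ c → f (previous L c)) ≈⟨ *-congˡ ((eval-cong L {λ c → f (previous L c)} {rotate m f} λ { zero _ → refl ; (suc c) _ → refl }) ⊚ eval-rotate m f period) ⟩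
  power b ⊠ (point ⊠ eval L f) ≈⟨ solve 3 (λ p t x → p :* (t :* x) := t :* p :* x) ≈.refl (power b) point (eval L f) ⟩
  point ⊠ power b ⊠ eval L f ∎

 module _ {n} (D : Slices {n} L) (W : Words n) (i j : Fin n) where

  partial : ℕ → Carrier
  partial zero    = 0#
  partial (suc b) = partial b ⊞ eval L (λ e → odd? (D b (shifted L b e) i j))

  collect-value : ∀ b → eval L (λ e → odd? (collect L D W e b i j)) ≈ value (W i j) ⊞ partial b
  collect-value zero    = (eval-cong L λ e _ → odd-parity (halves e (W i j))) ⊚ ≈.sym (+-identityʳ _)
  collect-value (suc b) = begin
   eval L (λ e → odd? (collect L D W e b i j + D b (shifted L b e) i j))
    ≈⟨ eval-cong L (λ e _ → odd-+ (collect L D W e b i j) (D b (shifted L b e) i j)) ⟩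
   eval L (λ e → odd? (collect L D W e b i j) xor odd? (D b (shifted L b e) i j))
    ≈⟨ eval-xor L (λ e → odd? (collect L D W e b i j)) (λ e → odd? (D b (shifted L b e) i j)) ⟩
   eval L (λ e → odd? (collect L D W e b i j)) ⊞ eval L (λ e → odd? (D b (shifted L b e) i j))
    ≈⟨ +-congʳ (collect-value b) ⟩
   value (W i j) ⊞ partial b ⊞ eval L (λ e → odd? (D b (shifted L b e) i j))
    ≈⟨ +-assoc _ _ _ ⟩
   value (W i j) ⊞ partial (suc b) ∎

  convolve-value : value (convolve L D W i j) ≈ value (W i j) ⊞ partial L
  convolve-value = (eval-cong L λ e e<L → word-bit L (λ e → collect L D W e L i j) e e<L) ⊚ collect-value L

 -- Σ_{b < k} f(b) t^b with the summands on the left, matching `partial`.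
 ascending : ℕ → (ℕ → Bool) → Carrier
 ascending zero    f = 0#
 ascending (suc b) f = ascending b f ⊞ bool (f b) ⊠ power b

 ascending≈eval : ∀ k f → ascending k f ≈ eval k f
 ascending≈eval zero    f = ≈.refl
 ascending≈eval (suc k) f = +-congʳ (ascending≈eval k f) ⊚ ≈.sym (reflexive (cong (λ l → eval l f) (ℕ.+-comm 1 k)) ⊚ eval-+ k 1 f ⊚
  +-congˡ (solve 3 (λ p b t → p :* (b :+ t :* con false) := b :* p) ≈.refl (power k) (bool (f (k + 0))) point ⊚
   *-congʳ (reflexive (cong (bool ∘ f) (ℕ.+-identityʳ k)))))

 eval-∑ : ∀ k {n} (f : Fin n → ℕ → Bool) → eval k (λ e → F.∑ (λ l → f l e)) ≈ ∑ λ l → eval k (f l)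
 eval-∑ k {zero}  f = (eval-false k λ _ _ → refl) ⊚ reflexive (sym (∑-empty _))
 eval-∑ k {suc n} f = eval-xor k (f zero) (λ e → F.∑ (λ l → f (suc l) e)) ⊚ +-congˡ (eval-∑ k (f ∘ suc)) ⊚ reflexive (sym (∑-suc _))

 module _ {n} (X Y : Words n) (i j : Fin n) where

  matrix-partial : ∀ k → partial (matrixProduct L X Y) X i j k ≈ ∑ λ l → ascending k (λ b → slice X b i l) ⊠ value (Y l j)
  matrix-partial zero    = ≈.sym (∑-zero λ l → zeroˡ _)
  matrix-partial (suc b) = begin
   partial D X i j b ⊞ eval L (λ e → odd? (D b (shifted L b e) i j))
    ≈⟨ +-cong (matrix-partial b) ((eval-cong L λ e _ → odd-⟦⟧ ((slice X b F.∙ slice Y (shifted L b e)) i j)) ⊚ eval-∑ L (λ l e → slice X b i l ∧ slice Y (shifted L b e) l j) ⊚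
         (sum-cong-≋ λ l → eval-∧ L (slice X b i l) (λ e → slice Y (shifted L b e) l j) ⊚ *-congˡ (eval-shifted b (λ c → slice Y c l j)))) ⟩
   (∑ λ l → a l ⊠ y l) ⊞ (∑ λ l → x l ⊠ (power b ⊠ y l))
    ≈⟨ ∑-distrib-+ _ _ ⟨
   (∑ λ l → a l ⊠ y l ⊞ x l ⊠ (power b ⊠ y l))
    ≈⟨ sum-cong-≋ (λ l → solve 4 (λ a y x p → a :* y :+ x :* (p :* y) := (a :+ x :* p) :* y) ≈.refl (a l) (y l) (x l) (power b)) ⟩
   (∑ λ l → (a l ⊞ x l ⊠ power b) ⊠ y l) ∎
   where
   D = matrixProduct L X Y
   a x y : Fin n → Carrier
   a l = ascending b (λ b → slice X b i l)
   x l = bool (slice X b i l)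
   y l = value (Y l j)

  hadamard-partial : ∀ k → partial (hadamardProduct L X Y) X i j k ≈ ascending k (λ b → slice X b i j) ⊠ value (Y i j)
  hadamard-partial zero    = ≈.sym (zeroˡ _)
  hadamard-partial (suc b) = +-cong (hadamard-partial b) ((eval-cong L λ e _ → bits b (shifted L b e)) ⊚
      eval-∧ L (slice X b i j) (λ e → slice Y (shifted L b e) i j) ⊚ *-congˡ (eval-shifted b (λ c → slice Y c i j))) ⊚
   solve 4 (λ a y x p → a :* y :+ x :* (p :* y) := (a :+ x :* p) :* y) ≈.refl
    (ascending b (λ b → slice X b i j)) (value (Y i j)) (bool (slice X b i j)) (power b)
   where
   times : ∀ p q → odd? (⟦ p ⟧ᵇ * ⟦ q ⟧ᵇ) ≡ p ∧ q
   times true  true  = refl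
   times true  false = refl
   times false _     = refl
   bits : ∀ b c → odd? (bit b (X i j) * bit c (Y i j)) ≡ slice X b i j ∧ slice Y c i j
   bits b c = cong₂ (λ p q → odd? (p * q)) (parity≡ (halves b (X i j))) (parity≡ (halves c (Y i j))) ⊙ times (slice X b i j) (slice Y c i j)

  partial-W : ∀ D W W' k → partial {n} D W i j k ≡ partial D W' i j k
  partial-W D W W' zero    = refl
  partial-W D W W' (suc k) = cong (_⊞ eval L (λ e → odd? (D k (shifted L k e) i j))) (partial-W D W W' k)

  matrix-value : ∀ W → value (convolve L (matrixProduct L X Y) W i j) ≈ value (W i j) ⊞ ∑ λ l → value (X i l) ⊠ value (Y l j)
  matrix-value W = convolve-value D W i j ⊚ +-congˡ (reflexive (partial-W D W X L) ⊚
   matrix-partial L ⊚ (sum-cong-≋ λ l → *-congʳ (ascending≈eval L (λ b → slice X b i l))))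
   where D = matrixProduct L X Y

  hadamard-value : ∀ W → value (convolve L (hadamardProduct L X Y) W i j) ≈ value (W i j) ⊞ value (X i j) ⊠ value (Y i j)
  hadamard-value W = convolve-value D W i j ⊚ +-congˡ (reflexive (partial-W D W X L) ⊚
   hadamard-partial L ⊚ *-congʳ (ascending≈eval L (λ b → slice X b i j)))
   where D = hadamardProduct L X Y

 halves-0 : ∀ e → halves e 0 ≡ 0
 halves-0 zero    = refl
 halves-0 (suc e) = halves-0 e

 value-0 : value 0 ≈ 0#
 value-0 = eval-false L λ e _ → cong odd? (halves-0 e)

 value-1 : value 1 ≈ 1#
 value-1 = +-congˡ (*-congˡ (eval-false m λ e _ → cong odd? (halves-0 e)) ⊚ zeroʳ _) ⊚ +-identityʳ _

 open Walks ring char2 using (earlier; source; gradients; off-diagonal; cyclic)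
 open PowerSeries ring char2 using (Mat; pow; _·_)

 module _ {n} (A Aᵀ : Words n) (transposed : ∀ i j → Aᵀ i j ≡ A j i) (loopless : ∀ i → A i i ≡ 0) where

  M : Mat n
  M i j = value (A i j)

  private
   Mᵀ : ∀ i j → value (Aᵀ i j) ≈ M j i
   Mᵀ i j = reflexive (cong value (transposed i j))

  private
   off-≡ : ∀ (G : Mat n) i → off-diagonal M G i i ≈ 0#
   off-≡ G i with i Fin.≟ i
   ... | yes _ = ≈.refl
   ... | no ¬p = contradiction refl ¬p

   off-≢ : ∀ (G : Mat n) {i j} → i ≢ j → off-diagonal M G i j ≈ G i j
   off-≢ G {i} {j} i≢j with i Fin.≟ j
   ... | yes p = contradiction p i≢j
   ... | no _  = ≈.refl

  record Correct (k : ℕ) (s : Stage {n} L) : Set where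
   open Stage s
   field
    B-value  : ∀ i j → value (B i j) ≈ pow M k i j
    B⁻-value : ∀ i j → value (B⁻ i j) ≈ earlier M (suc k) i j
    G-value  : ∀ i j → value (G i j) ≈ gradients M k j i
    Γ-value  : ∀ i j → value (Γ i j) ≈ cyclic M k j i

  stages-correct : ∀ k → Correct k (stages L A Aᵀ k)
  stages-correct zero = record
   { B-value = unit
   ; B⁻-value = λ _ _ → value-0
   ; G-value = λ i j → unit i j ⊚ ≈.sym (symmetric i j)
   ; Γ-value = λ i j → value-0 ⊚ ≈.sym (off0 i j) }
   where
   unit : ∀ i j → value (withDiagonal L (λ _ → 1) (zeros L) i j) ≈ δ i j
   unit i j with does (i Fin.≟ j)
   ... | true  = value-1
   ... | false = value-0
   symmetric : ∀ i j → δ j i ⊠ δ i i ⊞ M j i ⊠ M j i ⊠ 0# ≈ δ i j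
   symmetric i j = +-cong (*-congˡ (δ-refl i) ⊚ *-identityʳ _) (zeroʳ _) ⊚ +-identityʳ _ ⊚ flip (i Fin.≟ j)
    where
    flip : Dec (i ≡ j) → δ j i ≈ δ i j
    flip (yes refl) = ≈.refl
    flip (no i≢j)   = (δ-≢ λ e → i≢j (sym e)) ⊚ ≈.sym (δ-≢ i≢j)
   off0 : ∀ i j → off-diagonal M (gradients M 0) j i ≈ 0#
   off0 i j with j Fin.≟ i
   ... | yes _  = ≈.refl
   ... | no j≢i = +-cong (zeroˡ _) (zeroʳ _) ⊚ +-identityˡ _
  stages-correct (suc k) = record
   { B-value = B'-value ; B⁻-value = B-value ; G-value = G'-value ; Γ-value = Γ'-value }
   where
   s = stages L A Aᵀ k
   open Stage s
   open Correct (stages-correct k)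
   s′ = stages L A Aᵀ (suc k)
   open Stage s′ using () renaming (B to B′; G to G′; Γ to Γ′)
   B'-value : ∀ i j → value (B′ i j) ≈ pow M (suc k) i j
   B'-value i j = matrix-value A B i j (zeros L) ⊚ +-congʳ value-0 ⊚ +-identityˡ _ ⊚
    (sum-cong-≋ λ l → *-congˡ (B-value l j))
   H1 H : Words n
   H1 = convolve L (hadamardProduct L Aᵀ B⁻) (zeros L)
   H  = convolve L (hadamardProduct L Aᵀ H1) (zeros L)
   H-value : ∀ i j → value (H i j) ≈ M j i ⊠ M j i ⊠ earlier M (suc k) i j
   H-value i j = hadamard-value Aᵀ H1 i j (zeros L) ⊚ +-congʳ value-0 ⊚ +-identityˡ _ ⊚
    *-cong (Mᵀ i j) (hadamard-value Aᵀ B⁻ i j (zeros L) ⊚ +-congʳ value-0 ⊚ +-identityˡ _ ⊚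
     *-cong (Mᵀ i j) (B⁻-value i j)) ⊚ ≈.sym (*-assoc _ _ _)
   S : Words n
   S = withDiagonal L (λ a → B′ a a) H
   S-value : ∀ i j → value (S i j) ≈ source M (suc k) j i
   S-value i j = by (i Fin.≟ j)
    where
    by : Dec (i ≡ j) → value (S i j) ≈ source M (suc k) j i
    by (yes refl) = reflexive (cong value (withDiagonal-≡ L (λ a → B′ a a) H i)) ⊚
     B'-value i i ⊚ ≈.sym (+-cong (*-congʳ (δ-refl i) ⊚ *-identityˡ _)
         (*-congʳ (*-congʳ (reflexive (cong value (loopless i)) ⊚ value-0) ⊚ zeroˡ _) ⊚ zeroˡ _) ⊚ +-identityʳ _)
    by (no i≢j) = reflexive (cong value (withDiagonal-≢ L (λ a → B′ a a) H i≢j)) ⊚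
     H-value i j ⊚ ≈.sym (+-congʳ (*-congʳ (δ-≢ λ e → i≢j (sym e)) ⊚ zeroˡ _) ⊚ +-identityˡ _)
   G'-value : ∀ i j → value (G′ i j) ≈ gradients M (suc k) j i
   G'-value i j = matrix-value G Aᵀ i j S ⊚ +-cong (S-value i j)
    (sum-cong-≋ λ l → *-cong (G-value i l) (Mᵀ l j) ⊚ *-comm _ _)
   Γ'-value : ∀ i j → value (Γ′ i j) ≈ cyclic M (suc k) j i
   Γ'-value i j = matrix-value Aᵀ Γ i j Z ⊚ +-cong Z-value
    (sum-cong-≋ λ l → *-cong (Mᵀ i l) (Γ-value l j) ⊚ *-comm _ _)
    where
    Z : Words n
    Z = withDiagonal L (λ _ → 0) G′
    Z-value : value (Z i j) ≈ off-diagonal M (gradients M (suc k)) j i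
    Z-value = by (i Fin.≟ j)
     where
     by : Dec (i ≡ j) → value (Z i j) ≈ off-diagonal M (gradients M (suc k)) j i
     by (yes refl) = reflexive (cong value (withDiagonal-≡ L (λ _ → 0) G′ i)) ⊚
      value-0 ⊚ ≈.sym (off-≡ (gradients M (suc k)) i)
     by (no i≢j) = reflexive (cong value (withDiagonal-≢ L (λ _ → 0) G′ i≢j)) ⊚
      G'-value i j ⊚ ≈.sym (off-≢ (gradients M (suc k)) λ e → i≢j (sym e))

open import Data.Bool.Base using (_∨_)
open import Data.Fin.Base using (remQuot)
open import Data.Nat.Base using (pred; _≡ᵇ_; >-nonZero)
open import Data.Vec.Base using (tabulate)
import Data.Vec.Properties as Vec

word-injective : ∀ r {x y} → x < 2 ^ r → y < 2 ^ r →
 (∀ e → e < r → odd? (halves e x) ≡ odd? (halves e y)) → x ≡ y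
word-injective zero    (s≤s z≤n) (s≤s z≤n) h = refl
word-injective (suc r) {x} {y} x< y< h = decompose x ⊙ cong₂ (λ a b → a + a + ⟦ b ⟧ᵇ) (word-injective r (half< x<) (half< y<) λ e e<r → h (suc e) (s<s e<r)) (h 0 z<s) ⊙
    sym (decompose y)
 where
 decompose : ∀ x → x ≡ ⌊ x /2⌋ + ⌊ x /2⌋ + ⟦ odd? x ⟧ᵇ
 decompose zero          = refl
 decompose (suc zero)    = refl
 decompose (suc (suc x)) = cong (2 +_) (decompose x) ⊙
  cong₂ _+_ (cong suc (sym (ℕ.+-suc ⌊ x /2⌋ ⌊ x /2⌋))) (cong ⟦_⟧ᵇ (sym (Bool.not-involutive (odd? x))))
 half< : ∀ {x} → x < 2 ^ suc r → ⌊ x /2⌋ < 2 ^ r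
 half< {x} x< with ⌊ x /2⌋ ℕ.<? 2 ^ r
 ... | yes p = p
 ... | no ¬p = contradiction x< (ℕ.≤⇒≯ (ℕ.+-mono-≤ (ℕ.≮⇒≥ ¬p) (ℕ.+-identityʳ (2 ^ r) ≡⟫ ℕ.≮⇒≥ ¬p) ⟫
  ℕ.m≤m+n _ _ ⟫≡ sym (decompose x)))

halves-small : ∀ r x e → x < 2 ^ r → r ≤ e → halves e x ≡ 0
halves-small zero    x e (s≤s z≤n) _ = zeros-only e
 where
 zeros-only : ∀ e → halves e 0 ≡ 0
 zeros-only zero    = refl
 zeros-only (suc e) = zeros-only e
halves-small (suc r) x (suc e) x< (s≤s r≤e) = halves-small r ⌊ x /2⌋ e
 (ℕ.*-cancelˡ-< 2 _ _ (ℕ.≤-<-trans twice x<)) r≤e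
 where
 twice : 2 * ⌊ x /2⌋ ≤ x
 twice = (ℕ.+-monoʳ-≤ ⌊ x /2⌋ ((ℕ.+-identityʳ ⌊ x /2⌋) ≡⟫ ℕ.⌊n/2⌋≤⌈n/2⌉ x)) ⟫≡
  ℕ.⌊n/2⌋+⌈n/2⌉≡n x

-- Most significant bit first.
wordFrom : ℕ → ∀ {r} → Vec Bool r → ℕ
wordFrom x []       = x
wordFrom x (c ∷ cs) = wordFrom (x + x + ⟦ c ⟧ᵇ) cs

⟦⟧≤1 : ∀ c → ⟦ c ⟧ᵇ ≤ 1
⟦⟧≤1 true  = ℕ.≤-refl
⟦⟧≤1 false = z≤n

wordFrom< : ∀ {r} x (cs : Vec Bool r) k → x < 2 ^ k → wordFrom x cs < 2 ^ (k + r)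
wordFrom< x []       k x< = ℕ.<-≤-trans x< (ℕ.≤-reflexive (cong (2 ^_) (sym (ℕ.+-identityʳ k))))
wordFrom< {suc r} x (c ∷ cs) k x< = subst (λ e → wordFrom (x + x + ⟦ c ⟧ᵇ) cs < 2 ^ e) (sym (ℕ.+-suc k r))
 (wordFrom< (x + x + ⟦ c ⟧ᵇ) cs (suc k) (s≤s (ℕ.+-monoʳ-≤ (x + x) (⟦⟧≤1 c)) ⟫
  (cong suc (ℕ.+-comm (x + x) 1) ⊙ sym (cong suc (ℕ.+-suc x x))) ≡⟫
  ℕ.+-mono-≤ x< (x< ⟫≡ sym (ℕ.+-identityʳ (2 ^ k)))))

wordFrom-injective : ∀ {r} x y (cs ds : Vec Bool r) → wordFrom x cs ≡ wordFrom y ds → x ≡ y × cs ≡ ds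
wordFrom-injective x y []       []       e = e , refl
wordFrom-injective x y (c ∷ cs) (d ∷ ds) e with wordFrom-injective _ _ cs ds e
... | e' , refl = sym (half-double x (⟦⟧≤1 c)) ⊙ cong ⌊_/2⌋ e' ⊙ half-double y (⟦⟧≤1 d) ,
      cong (_∷ cs) (sym (low x c) ⊙ cong odd? e' ⊙ low y d)
 where
 low : ∀ x c → odd? (x + x + ⟦ c ⟧ᵇ) ≡ c
 low x c = (odd-double x ⟦ c ⟧ᵇ) ⊙ odd-⟦⟧ c

total-any : ∀ {r n C B} {P : Vec Bool r → Fin n → Set} (P? : ∀ b i → Dec (P b i)) →
 (∀ i → total r (λ b → ⟦ does (P? b i) ⟧ᵇ) * C ≤ B) →
 total r (λ b → ⟦ does (Fin.any? (P? b)) ⟧ᵇ) * C ≤ n * B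
total-any {r} {zero}  {C} P? h = ℕ.≤-reflexive (cong (_* C) (total-zero r λ _ → refl))
total-any {r} {suc n} {C} {B} P? h = begin
 total r (λ b → ⟦ does (P? b zero) ∨ does (Fin.any? (λ i → P? b (suc i))) ⟧ᵇ) * C
  ≤⟨ ℕ.*-monoˡ-≤ C (total-mono r λ b → union (does (P? b zero)) _) ⟩
 total r (λ b → ⟦ does (P? b zero) ⟧ᵇ + ⟦ does (Fin.any? (λ i → P? b (suc i))) ⟧ᵇ) * C
  ≡⟨ cong (_* C) (total-+ r _ _) ⊙ ℕ.*-distribʳ-+ C (total r λ b → ⟦ does (P? b zero) ⟧ᵇ) _ ⟩
 total r (λ b → ⟦ does (P? b zero) ⟧ᵇ) * C + total r (λ b → ⟦ does (Fin.any? (λ i → P? b (suc i))) ⟧ᵇ) * C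
  ≤⟨ ℕ.+-mono-≤ (h zero) (total-any (λ b i → P? b (suc i)) (λ i → h (suc i))) ⟩
 B + n * B ∎
 where
 open ℕ.≤-Reasoning
 union : ∀ p q → ⟦ p ∨ q ⟧ᵇ ≤ ⟦ p ⟧ᵇ + ⟦ q ⟧ᵇ
 union true  q = s≤s z≤n
 union false q = ℕ.≤-refl

total-× : ∀ {r C B} {D : Set} {Z : Vec Bool r → Set} (d : Dec D) (z? : ∀ b → Dec (Z b)) →
 (D → total r (λ b → ⟦ does (z? b) ⟧ᵇ) * C ≤ B) → total r (λ b → ⟦ does (d ×-dec z? b) ⟧ᵇ) * C ≤ B
total-× (yes p) z? h = h p
total-× {r} {C} (no _) z? h = cong (_* C) (total-zero r λ _ → refl) ≡⟫ z≤n

module PathSupport (R : CommutativeRing 0ℓ 0ℓ) (char2 : CharTwo R) where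

 open Char2 R char2 hiding (refl; sym; trans) renaming (_+_ to _⊞_; _*_ to _⊠_)
 private module ≈ = Char2 R char2
 open Resolvent R char2 using (Mat; delete)
 open Walks R char2 using (paths; Supported; supported-cut)

 paths-none : ∀ k {n} {g : Arcs n} {A : Mat n} → Supported g A → ∀ v u → ¬ Path g v u k → paths k A v u ≈ 0#
 paths-none zero    s v u h = δ-≢ {i = v} {u} λ { refl → h [] }
 paths-none (suc k) {g = g} {A} s v u h = ∑-zero term
  where
  term : ∀ y → delete v A v y ⊠ paths k (delete v A) y u ≈ 0#
  term y with cut v g v y in eq
  ... | false = *-congʳ (supported-cut v s v y eq) ⊚ zeroˡ _
  ... | true  = *-congˡ (paths-none k (supported-cut v s) y u λ p → h (subst T (sym eq) tt ∷ p)) ⊚ zeroʳ _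

module Analysis {n : ℕ} (G : Digraph n) (κ : ℕ) where

 private g = arc G

 N r m L : ℕ
 N = n * n
 r = treble κ 2
 m = pred (treble κ 3)
 L = suc m

 private
  treble-positive : ∀ k → 1 ≤ treble k 3
  treble-positive zero    = s≤s z≤n
  treble-positive (suc k) = ℕ.*-mono-≤ (treble-positive k) (s≤s {n = 2} z≤n)

 L≡ : L ≡ treble κ 3
 L≡ = ℕ.suc-pred (treble κ 3) {{>-nonZero (treble-positive κ)}}

 Coins : Set
 Coins = Vec Bool (N * r)

 weight : Coins → Words n
 weight ω i j = wordFrom 0 (lookup (blocks {r} N ω) (combine i j))

 A Aᵀ : Coins → Words n
 A  ω i j = if g i j then weight ω i j else 0
 Aᵀ ω i j = A ω j i

 Γ : Coins → ℕ → Words n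
 Γ ω k = Stage.Γ (stages L (A ω) (Aᵀ ω) k)

 Γ< : ∀ ω k i j → Γ ω k i j < 2 ^ L
 Γ< ω zero    i j = ℕ.m^n>0 2 L
 Γ< ω (suc k) i j = advance-Γ< L (A ω) (Aᵀ ω) (stages L (A ω) (Aᵀ ω) k) i j

 A-loopless : ∀ ω i → A ω i i ≡ 0
 A-loopless ω i rewrite Digraph.loopless G i = refl

 -- The algebra F₂[x]/(x^L - 1), in which words can be compared, and its quotient field.
 Exact Big : Pointed
 Exact = tower (suc κ) 𝔽2
 Big   = tower κ 𝔽4

 private
  treble-1-3 : ∀ k → treble (suc k) 1 ≡ treble k 3
  treble-1-3 zero    = refl
  treble-1-3 (suc k) = cong (_* 3) (treble-1-3 k)

  exact-period : HasPeriod Exact L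
  exact-period = subst (HasPeriod Exact) (treble-1-3 κ ⊙ sym L≡) (tower-period (suc κ) {𝔽2} {1} refl)

  big-period : HasPeriod Big L
  big-period = subst (HasPeriod Big) (sym L≡) (tower-period κ {𝔽4} {3} 𝔽4-period)

  exact-independent : Evaluation.Independent Exact L
  exact-independent = subst (Evaluation.Independent Exact) (treble-1-3 κ ⊙ sym L≡)
   (tower-independent (suc κ) {𝔽2} {1} 𝔽2-independent)

  big-independent : Evaluation.Independent Big r
  big-independent = tower-independent κ {𝔽4} {2} 𝔽4-independent

  r≤L : r ≤ L
  r≤L = subst (r ≤_) (sym L≡) (mono κ)
   where
   mono : ∀ k → treble k 2 ≤ treble k 3
   mono zero    = ℕ.n≤1+n 2
   mono (suc k) = ℕ.*-monoˡ-≤ 3 (mono k)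

 module Tracking (P : Pointed) (period : HasPeriod P L) where
  open Pointed P
  open WordRing P m period public using (value; value-0; M; Correct; stages-correct)
  open Char2 ring char2 using (_≈_; 0#; _⊚_)
  private module ≈ = Char2 ring char2
  open Walks ring char2 public using (Supported; cyclic; paths; cyclic-vanishes; cyclic-leading)

  M' : Coins → Fin n → Fin n → ≈.Carrier
  M' ω = M (A ω) (Aᵀ ω) (λ _ _ → refl) (A-loopless ω)

  supported : ∀ ω → Supported g (M' ω)
  supported ω i j e = ≈.reflexive (cong (λ b → value (if b then weight ω i j else 0)) e) ⊚ value-0

  Γ-value : ∀ ω k i j → value (Γ ω k i j) ≈ cyclic (M' ω) k j i
  Γ-value ω k = Correct.Γ-value (stages-correct (A ω) (Aᵀ ω) (λ _ _ → refl) (A-loopless ω) k)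

 private
  module E = Tracking Exact exact-period
  module K = Tracking Big big-period
  module E≈ = Char2 (Pointed.ring Exact) (Pointed.char2 Exact)
  module K≈ = Char2 (Pointed.ring Big) (Pointed.char2 Big)
  open IsDomain (tower-domain κ 𝔽4-domain)
  module Poly = PathPolynomial (Pointed.ring Big) (Pointed.char2 Big)
  module SZ = SchwartzZippel (Pointed.ring Big) (Pointed.char2 Big) cancel zero?

 value≈0⇒≡0 : ∀ {x} → x < 2 ^ L → E.value x E≈.≈ E≈.0# → x ≡ 0
 value≈0⇒≡0 {x} x< z = word-injective L x< (ℕ.m^n>0 2 L) λ e e<L →
  trans (exact-independent (λ e → odd? (halves e x)) z e e<L) (cong odd? (sym (halves-small 0 0 e (s≤s z≤n) z≤n)))

 Γ-vanishes : ∀ {ℓ} → EvenGirth g ℓ → ∀ ω k → suc k < ℓ → ∀ {u v} → T (g u v) → Γ ω k u v ≡ 0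
 Γ-vanishes {ℓ} c ω k k<ℓ {u} {v} t = value≈0⇒≡0 (Γ< ω k u v)
  (E≈.trans (E.Γ-value ω k u v) (E.cyclic-vanishes (E.M' ω) {ℓ = ℓ} (E.supported ω) c k k<ℓ t))

 module _ {j : ℕ} (oj : odd? j ≡ true) (c : EvenGirth g (suc j)) where

  Γ-no-cycle : ∀ ω {u v} → T (g u v) → ¬ Path g v u j → Γ ω j u v ≡ 0
  Γ-no-cycle ω {u} {v} t np = value≈0⇒≡0 (Γ< ω j u v)
   (E≈.trans (E.Γ-value ω j u v) (E≈.trans (E.cyclic-leading (E.M' ω) {ℓ = suc j} (E.supported ω) c j refl oj t)
    (PathSupport.paths-none (Pointed.ring Exact) (Pointed.char2 Exact) j (E.supported ω) v u np)))

  Γ-cycle : ∀ ω {u v} → T (g u v) → ¬ (K.paths j (K.M' ω) v u K≈.≈ K≈.0#) → Γ ω j u v ≢ 0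
  Γ-cycle ω {u} {v} t nz z = nz (K≈.trans
   (K≈.sym (K.cyclic-leading (K.M' ω) {ℓ = suc j} (K.supported ω) c j refl oj t))
   (K≈.trans (K≈.sym (K.Γ-value ω j u v)) (K≈.trans (K≈.reflexive (cong K.value z)) K.value-0)))

 private
  Field : Set
  Field = K≈.Carrier

  encode : Vec Bool r → Field
  encode b = K.value (wordFrom 0 b)

  encode-injective : ∀ b b' → encode b K≈.≈ encode b' → b ≡ b'
  encode-injective b b' e = snd (wordFrom-injective 0 0 b b' (word-injective r (wordFrom< 0 b 0 z<s) (wordFrom< 0 b' 0 z<s) same))
   where
   open Evaluation Big
   f f' d : ℕ → Bool
   f  e = odd? (halves e (wordFrom 0 b))
   f' e = odd? (halves e (wordFrom 0 b'))
   d e = f e xor f' e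
   r+ : r + (L ∸ r) ≡ L
   r+ = ℕ.m+[n∸m]≡n r≤L
   high : ∀ b e → odd? (halves (r + e) (wordFrom 0 b)) ≡ false
   high b e = cong odd? (halves-small r (wordFrom 0 b) (r + e) (wordFrom< 0 b 0 z<s) (ℕ.m≤m+n r e))
   full : eval L d K≈.≈ K≈.0#
   full = K≈.trans (eval-xor L f f') (K≈.trans (K≈.+-congʳ e) (Pointed.char2 Big (encode b')))
   low : eval r d K≈.≈ K≈.0#
   low = K≈.trans (K≈.sym (K≈.trans (eval-+ r (L ∸ r) d) (K≈.trans (K≈.+-congˡ {eval r d} (K≈.trans
       (K≈.*-congˡ {power r} (eval-false (L ∸ r) λ i _ → cong₂ _xor_ (high b i) (high b' i))) (K≈.zeroʳ (power r)))) (K≈.+-identityʳ (eval r d)))))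
    (K≈.trans (K≈.reflexive (cong (λ l → eval l d) r+)) full)
   same : ∀ e → e < r → f e ≡ f' e
   same e e<r = xor-false (f e) (f' e) (big-independent d low e e<r)
    where
    xor-false : ∀ p q → p xor q ≡ false → p ≡ q
    xor-false true  true  _ = refl
    xor-false false false _ = refl

  masked : Vec Field N → Fin n → Fin n → Field
  masked xs i j = if g i j then lookup xs (combine i j) else K≈.0#

  masked-weights : ∀ ω i j → masked (Vec.map encode (blocks {r} N ω)) i j K≈.≈ K.M' ω i j
  masked-weights ω i j with g i j
  ... | true  = K≈.reflexive (Vec.lookup-map (combine i j) encode (blocks {r} N ω))
  ... | false = K≈.sym K.value-0

  polynomial : ℕ → Fin n → Fin n → Vec Field N → Field
  polynomial j v u xs = K.paths j (masked xs) v u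

  polynomial-affine : ∀ j v u → SZ.MultiAffine (polynomial j v u)
  polynomial-affine j v u = SZ.coordinatewise⇒MultiAffine (polynomial j v u)
   λ i {x} {x0} {x1} c other e e0 e1 →
    Poly.paths-affine j (fst (remQuot n i)) c
     (λ l l≢ k → away i x x0 x1 other l k λ q → l≢ (sym (cong (λ p → fst (remQuot {n} n p)) q ⊙ cong fst (Fin.remQuot-combine l k))))
     (λ k → row i x x0 x1 c other e e0 e1 k) v u
   where
   Other : Fin N → Vec Field N → Vec Field N → Vec Field N → Set
   Other i x x0 x1 = ∀ j → j ≢ i → lookup x j ≡ lookup x0 j × lookup x j ≡ lookup x1 j
   away : ∀ i x x0 x1 → Other i x x0 x1 → ∀ l k → i ≢ combine l k →
    masked x l k K≈.≈ masked x0 l k × masked x l k K≈.≈ masked x1 l k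
   away i x x0 x1 other l k i≢ with g l k
   ... | false = K≈.refl , K≈.refl
   ... | true  = K≈.reflexive (fst (other (combine l k) λ e → i≢ (sym e))) , K≈.reflexive (snd (other (combine l k) λ e → i≢ (sym e)))
   row : ∀ i x x0 x1 c → Other i x x0 x1 → lookup x i ≡ c → lookup x0 i ≡ K≈.0# → lookup x1 i ≡ K≈.1# →
    ∀ k → let l = fst (remQuot n i) in
    masked x l k K≈.≈ masked x0 l k K≈.+ c K≈.* (masked x0 l k K≈.+ masked x1 l k)
   row i x x0 x1 c other e e0 e1 k = by (i Fin.≟ combine l k)
    where
    l = fst (remQuot {n} n i)
    open K≈ using (solve; _:=_; _:+_; _:*_; con)
    constant : ∀ {a b d} → a K≈.≈ b → a K≈.≈ d → a K≈.≈ b K≈.+ c K≈.* (b K≈.+ d)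
    constant {a} {b} {d} p q = K≈.trans p (K≈.trans (solve 2 (λ b c → b := b :+ c :* (b :+ b)) K≈.refl b c)
     (K≈.+-congˡ {b} (K≈.*-congˡ {c} (K≈.+-congˡ {b} (K≈.trans (K≈.sym p) q)))))
    by : Dec (i ≡ combine l k) → masked x l k K≈.≈ masked x0 l k K≈.+ c K≈.* (masked x0 l k K≈.+ masked x1 l k)
    by (no i≢) = let (p , q) = away i x x0 x1 other l k i≢ in constant p q
    by (yes i≡) with g l k
    ... | false = constant K≈.refl K≈.refl
    ... | true rewrite sym i≡ | e | e0 | e1 =
     solve 1 (λ c → c := con false :+ c :* (con false :+ con true)) K≈.refl c

  witness : ∀ {u v j} → Path g v u j → ∃[ xs ] ¬ (polynomial j v u xs K≈.≈ K≈.0#)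
  witness {u} {v} {j} p = xs , λ z → 1≉0 (K≈.trans (K≈.sym (K≈.trans (Poly.paths-cong j same v u) (Poly.paths-onPath p))) z)
   where
   xs : Vec Field N
   xs = tabulate λ q → let (i , j) = remQuot {n} n q in K≈.bool (Poly.onPath p i j)
   same : ∀ i j → masked xs i j K≈.≈ K≈.bool (Poly.onPath p i j)
   same i j with g i j in eq
   ... | true  = K≈.reflexive (Vec.lookup∘tabulate _ (combine i j) ⊙
                   cong (λ (i , j) → K≈.bool (Poly.onPath p i j)) (Fin.remQuot-combine {n} i j))
   ... | false with Poly.onPath p i j in eq'
   ...   | false = K≈.refl
   ...   | true  = contradiction (Poly.onPath⊆ p i j (subst T (sym eq') tt)) (subst (¬_ ∘ T) (sym eq) id)
   1≉0 : ¬ (K≈.1# K≈.≈ K≈.0#)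
   1≉0 z = true≢false (sym refl ⊙ big-independent (λ e → e ≡ᵇ 0) constant-term 0 0<r)
    where
    true≢false : ¬ (true ≡ false)
    true≢false ()
    open Evaluation Big
    0<r : 0 < r
    0<r = positive κ
     where
     positive : ∀ k → 0 < treble k 2
     positive zero    = z<s
     positive (suc k) = ℕ.*-mono-≤ (positive k) (s≤s {n = 2} z≤n)
    first : ∀ k → 0 < k → eval k (λ e → e ≡ᵇ 0) K≈.≈ K≈.1#
    first (suc k) _ = K≈.trans (K≈.+-congˡ {K≈.1#} (K≈.trans (K≈.*-congˡ {Pointed.point Big} (eval-false k λ _ _ → refl)) (K≈.zeroʳ (Pointed.point Big)))) (K≈.+-identityʳ K≈.1#)
    constant-term : eval r (λ e → e ≡ᵇ 0) K≈.≈ K≈.0#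
    constant-term = K≈.trans (first r 0<r) z

 module _ (j : ℕ) where

  unlucky? : ∀ (ω : Coins) u v → Dec (EvenCycleAt g j u v × polynomial j v u (Vec.map encode (blocks {r} N ω)) K≈.≈ K≈.0#)
  unlucky? ω u v = (Bool.T? (g u v) ×-dec path? g v u j) ×-dec zero? _

  unlucky : Coins → Bool
  unlucky ω = does (Fin.any? λ u → Fin.any? λ v → unlucky? ω u v)

  lucky⇒≉0 : ∀ ω → unlucky ω ≡ false → ∀ {u v} → EvenCycleAt g j u v → ¬ (K.paths j (K.M' ω) v u K≈.≈ K≈.0#)
  lucky⇒≉0 ω lucky {u} {v} e z with Fin.any? (λ u → Fin.any? λ v → unlucky? ω u v)
  ... | no free = free (u , v , e , K≈.trans (Poly.paths-cong j (masked-weights ω) v u) z)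

  unlucky-rare : count unlucky * 2 ^ r ≤ n * (n * (N * 2 ^ (N * r)))
  unlucky-rare = subst (λ k → k * 2 ^ r ≤ n * (n * (N * 2 ^ (N * r)))) (sym (count≡total unlucky))
   (total-any (λ ω u → Fin.any? λ v → unlucky? ω u v) λ u → total-any (λ ω v → unlucky? ω u v) λ v → each u v)
   where
   each : ∀ u v → total (N * r) (λ ω → ⟦ does (unlucky? ω u v) ⟧ᵇ) * 2 ^ r ≤ N * 2 ^ (N * r)
   each u v = total-× (Bool.T? (g u v) ×-dec path? g v u j) (λ ω → zero? (polynomial j v u (Vec.map encode (blocks {r} N ω)))) λ (_ , p) →
    let (xs , nz) = witness p in
    SZ.schwartz-zippel encode encode-injective N (polynomial j v u) (polynomial-affine j v u) xs nz

open import Data.Nat.Properties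
open import Relation.Binary.Definitions using (tri<; tri≈; tri>)
open +-*-Solver using (solve; _:=_; _:+_; _:*_; con)

module Verdict {n : ℕ} (G : Digraph n) (κ : ℕ) where

 open Analysis G κ

 hit : Coins → ℕ → Fin n → Fin n → Bool
 hit ω k u v = arc G u v ∧ not (Γ ω k u v ≡ᵇ 0)

 NoHit : Coins → ℕ → Set
 NoHit ω k = ∀ u v → hit ω k u v ≡ false

 Outcome : Coins → Store ℕ → Set
 Outcome ω s =
     (var s 0 ≡ 0 × (∀ k → 1 ≤ k → k ≤ n → NoHit ω k) × (∀ (u v : Fin n) → heap s (toℕ (combine u v)) ≡ 0))
  ⊎ (∃[ k ] (1 ≤ k × (∀ k' → 1 ≤ k' → k' < k → NoHit ω k') × (∃[ u ] ∃[ v ] hit ω k u v ≡ true)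
      × var s 0 ≡ suc k × (∀ (u v : Fin n) → heap s (toℕ (combine u v)) ≡ ⟦ hit ω k u v ⟧ᵇ)))

 private
  Γ≡0⇒NoHit : ∀ ω k → (∀ {u v} → T (arc G u v) → Γ ω k u v ≡ 0) → NoHit ω k
  Γ≡0⇒NoHit ω k h u v with arc G u v in eq
  ... | false = refl
  ... | true  = cong (λ x → not (x ≡ᵇ 0)) (h (subst T (sym eq) tt))

  odd⇒positive : ∀ {j} → odd? j ≡ true → 1 ≤ j
  odd⇒positive {suc j} _ = s≤s z≤n

 bad : Coins → Bool
 bad with girth (arc G)
 ... | acyclic _ = λ _ → false
 ... | attained j _ _ _ _ = unlucky j

 bad-rare : n ^ 7 ≤ 2 ^ r → count bad * n ^ 3 ≤ 1 * 2 ^ (N * r)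
 bad-rare big with girth (arc G)
 ... | acyclic _ = cong (_* n ^ 3) (none-counted (N * r)) ≡⟫ z≤n
  where
  none-counted : ∀ r → count {r} (λ _ → false) ≡ 0
  none-counted zero    = refl
  none-counted (suc r) = cong₂ _+_ (none-counted r) (none-counted r)
 ... | attained j {u} _ _ _ _ = *-cancelʳ-≤ _ _ (n ^ 4) {{m^n≢0 n 4 {{nonZero u}}}} (begin
     C * n ^ 3 * n ^ 4 ≡⟨ *-assoc C (n ^ 3) (n ^ 4) ⊙ cong (C *_) (sym (^-distribˡ-+-* n 3 4)) ⟩
     C * n ^ 7 ≤⟨ *-monoʳ-≤ C big ⟩
     C * 2 ^ r ≤⟨ unlucky-rare j ⟩
     n * (n * (N * 2 ^ (N * r)))
      ≡⟨ solve 2 (λ n p → n :* (n :* (n :* n :* p)) := (con 1 :* p) :* (n :* (n :* (n :* (n :* con 1))))) refl n (2 ^ (N * r)) ⟩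
     1 * 2 ^ (N * r) * n ^ 4 ∎)
  where
  open ≤-Reasoning
  C = count (unlucky j)
  nonZero : ∀ {n} → Fin n → NonZero n
  nonZero {suc n} _ = _

 no-cycle-reported : ∀ ω s → Outcome ω s → ¬ HasEvenCycle G → ReportsNone s
 no-cycle-reported ω s (inj₁ (z , _)) _ = z
 no-cycle-reported ω s (inj₂ (k , _ , _ , (u , v , h) , _)) free =
  contradiction (sym h ⊙ Γ≡0⇒NoHit ω k (Γ-vanishes {ℓ = suc (suc k)} vacuous ω k ≤-refl) u v) λ ()
  where
  vacuous : EvenGirth (arc G) (suc (suc k))
  vacuous {a} {x} {j} oj p t = contradiction cycle free
   where
   cycle : HasEvenCycle G
   cycle with path⇒cycle G p t
   ... | C , l , _ = C , subst (2 ∣_) (sym l) (odd⇒2∣suc j oj)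
    where open import Data.Nat.Divisibility using (_∣_)

 correct : ∀ ω s → Outcome ω s → bad ω ≡ false → CorrectLength G s × CorrectArcs G s
 correct ω s out lucky with girth (arc G)
 correct ω s (inj₁ (z , _ , zeros)) lucky | acyclic h =
  inj₁ (none⇒¬HasEvenCycle G h , z) , λ u v → inj₂ ((λ (C , (even , _) , _) → none⇒¬HasEvenCycle G h (C , even)) , zeros u v)
 correct ω s (inj₂ (k , _ , _ , (u , v , hk) , _)) lucky | acyclic h =
  contradiction (sym hk ⊙ Γ≡0⇒NoHit ω k (Γ-vanishes {ℓ = suc (suc k)} (λ oj p t → contradiction (t , p) (h oj)) ω k ≤-refl) u v) λ ()
 correct ω s out lucky | attained j {x} {y} j<n oj e minimal = conclude out
  where
  hit-on-cycle : ∀ {u v} → EvenCycleAt (arc G) j u v → hit ω j u v ≡ true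
  hit-on-cycle {u} {v} (t , p) with arc G u v in eq | Γ ω j u v in eqΓ
  ... | true | zero  = contradiction eqΓ (Γ-cycle oj minimal ω (subst T (sym eq) tt) (lucky⇒≉0 j ω lucky (subst T (sym eq) tt , p)))
  ... | true | suc _ = refl
  hit-off-cycle : ∀ {u v} → ¬ EvenCycleAt (arc G) j u v → hit ω j u v ≡ false
  hit-off-cycle {u} {v} ne with arc G u v in eq
  ... | false = refl
  ... | true  = cong (λ x → not (x ≡ᵇ 0)) (Γ-no-cycle oj minimal ω (subst T (sym eq) tt) λ p → ne (tt , p))
  early : ∀ k → k < j → NoHit ω k
  early k k<j = Γ≡0⇒NoHit ω k (Γ-vanishes {ℓ = suc j} minimal ω k (s≤s k<j))
  conclude : Outcome ω s → CorrectLength G s × CorrectArcs G s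
  conclude (inj₁ (_ , noHit , _)) = contradiction (sym (hit-on-cycle e) ⊙ noHit j (odd⇒positive oj) (<⇒≤ j<n) x y) λ ()
  conclude (inj₂ (k , 1≤k , before , (u , v , h) , length , arcs)) with <-cmp k j
  ... | tri< k<j _ _ = contradiction (sym h ⊙ early k k<j u v) λ ()
  ... | tri> _ _ j<k = contradiction (sym (hit-on-cycle e) ⊙ before j (odd⇒positive oj) j<k x y) λ ()
  ... | tri≈ _ refl _ = inj₂ (shortest (at⇒shortest G oj minimal e)) , each
   where
   shortest : _ → Σ[ C ∈ Cycle G ] (ShortestEven G C × var s 0 ≡ Cycle.len C)
   shortest (C , sh , l , _) = C , sh , length ⊙ sym l
   each : CorrectArcs G s
   each u v with Bool.T? (arc G u v) | path? (arc G) v u j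
   ... | yes t | yes p = inj₁ ((let (C , sh , _ , uses) = at⇒shortest G oj minimal (t , p) in C , sh , uses)
           , arcs u v ⊙ cong ⟦_⟧ᵇ (hit-on-cycle (t , p)))
   ... | yes t | no ¬p = inj₂ ((λ o → ¬p (snd (onShortest⇒at G oj minimal e o))) , arcs u v ⊙ cong ⟦_⟧ᵇ (hit-off-cycle λ (_ , p) → ¬p p))
   ... | no ¬t | _     = inj₂ ((λ o → ¬t (fst (onShortest⇒at G oj minimal e o))) , arcs u v ⊙ cong ⟦_⟧ᵇ (hit-off-cycle λ (t , _) → ¬t t))

open import Data.List.Base using (List; []; _∷_; [_]; _++_; map; length)
open import Data.List.Properties using (map-++)
open import Data.List.Relation.Unary.All as All using (All; []; _∷_)
import Data.List.Relation.Unary.All.Properties as All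
open import Data.Nat.Base using (_<ᵇ_; _≤ᵇ_)
open import Data.Nat.ListAction.Properties using (sum-++)
open import Data.Nat.Logarithm using (⌊log₂_⌋; ⌊log₂⌋-mono-≤; ⌊log₂[2^n]⌋≡n; ⌊log₂⌊n/2⌋⌋≡⌊log₂n⌋∸1)

<2^size : ∀ n → n < 2 ^ size n
<2^size n with n <? 2 ^ size n
... | yes p = p
... | no ¬p = contradiction (⌊log₂⌋-mono-≤ (≮⇒≥ ¬p))
 (<⇒≱ (subst (⌊log₂ n ⌋ <_) (sym (⌊log₂[2^n]⌋≡n (size n))) (n<1+n ⌊log₂ n ⌋)))

size-mono : ∀ {m n} → m ≤ n → size m ≤ size n
size-mono p = s≤s (⌊log₂⌋-mono-≤ p)

size≤ : ∀ {x} w → x < 2 ^ suc w → size x ≤ suc w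
size≤ {x} zero    x<2 = s≤s (⌊log₂⌋-mono-≤ {x} {1} (s≤s⁻¹ x<2))
size≤ {x} (suc w) x< = s≤s ((m≤n+m∸n ⌊log₂ x ⌋ 1) ⟫
 s≤s (sym (⌊log₂⌊n/2⌋⌋≡⌊log₂n⌋∸1 x) ≡⟫ s≤s⁻¹ (size≤ w (half< x<))))
 where
 half< : ∀ {x} → x < 2 ^ suc (suc w) → ⌊ x /2⌋ < 2 ^ suc w
 half< {x} x< = *-cancelˡ-< 2 _ _ (≤-<-trans ((+-monoʳ-≤ ⌊ x /2⌋ ((+-identityʳ ⌊ x /2⌋) ≡⟫ ⌊n/2⌋≤⌈n/2⌉ x)) ⟫≡
  ⌊n/2⌋+⌈n/2⌉≡n x) x<)

size-+ : ∀ a b → size (a + b) ≤ size a + size b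
size-+ a b = size≤ (⌊log₂ a ⌋ + size b) (begin-strict
 a + b <⟨ +-mono-< (<2^size a) (<2^size b) ⟩
 2 ^ size a + 2 ^ size b ≤⟨ sum≤product _ _ (power≥2 ⌊log₂ a ⌋) (power≥2 ⌊log₂ b ⌋) ⟩
 2 ^ size a * 2 ^ size b ≡⟨ ^-distribˡ-+-* 2 (size a) (size b) ⟨
 2 ^ (size a + size b) ∎)
 where
 open ≤-Reasoning
 power≥2 : ∀ k → 2 ≤ 2 ^ suc k
 power≥2 k = *-monoʳ-≤ 2 (m^n>0 2 k)
 sum≤product : ∀ x y → 2 ≤ x → 2 ≤ y → x + y ≤ x * y
 sum≤product (suc (suc x)) (suc (suc y)) _ _ = begin
  suc (suc x) + suc (suc y) ≤⟨ m≤m+n _ (x * y + (x + y)) ⟩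
  suc (suc x) + suc (suc y) + (x * y + (x + y))
   ≡⟨ solve 2 (λ x y → (con 2 :+ x) :+ (con 2 :+ y) :+ (x :* y :+ (x :+ y)) := (con 2 :+ x) :* (con 2 :+ y)) refl x y ⟩
  suc (suc x) * suc (suc y) ∎
 sum≤product (suc zero) _ (s≤s ()) _
 sum≤product (suc (suc x)) (suc zero) _ (s≤s ())

size≥1 : ∀ x → 1 ≤ size x
size≥1 x = s≤s z≤n

≡ᵇ-refl : ∀ a → (a ≡ᵇ a) ≡ true
≡ᵇ-refl zero    = refl
≡ᵇ-refl (suc a) = ≡ᵇ-refl a

upd-≡ : ∀ {A : Set} (f : ℕ → A) a v → (f [ a ↦ v ]) a ≡ v
upd-≡ f a v rewrite ≡ᵇ-refl a = refl

upd-≢ : ∀ {A : Set} (f : ℕ → A) {a b} v → a ≢ b → (f [ a ↦ v ]) b ≡ f b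
upd-≢ f {a} {b} v a≢b with a ≡ᵇ b in eq
... | false = refl
... | true  = contradiction (≡ᵇ⇒≡ a b (subst T (sym eq) tt)) a≢b

upd-elim : ∀ {A : Set} (P : ℕ → A → Set) (f : ℕ → A) a v → P a v → (∀ b → a ≢ b → P b (f b)) → ∀ b → P b ((f [ a ↦ v ]) b)
upd-elim P f a v p h b with a ≟ b
... | yes refl = subst (P a) (sym (upd-≡ f a v)) p
... | no a≢b   = subst (P b) (sym (upd-≢ f v a≢b)) (h b a≢b)

infixr 4 _▸_
_▸_ : ∀ {Op : Set} → Prog Op → Prog Op → Prog Op
p ▸ q = p ⨾ q

line : List IntOp → Prog CoinOp
line []       = skip
line (o ∷ os) = ‹ int o › ⨾ line os

execs : List IntOp → Store ℕ → Store ℕ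
execs []       s = s
execs (o ∷ os) s = execs os (execInt o s)

bitOperations-++ : ∀ l l′ → bitOperations (l ++ l′) ≡ bitOperations l + bitOperations l′
bitOperations-++ l l′ = cong sum (map-++ coinCost l l′) ⊙ sum-++ (map coinCost l) (map coinCost l′)
 where open import Data.Nat.ListAction using (sum)

-- Costs are compared by a relation ⊑ which is compatible with addition.
module Logic (ok : Store ℕ → Set) (_⊑_ : ℕ → ℕ → Set)
 (≤⇒⊑ : ∀ {a b} → a ≤ b → a ⊑ b)
 (⊑-+ : ∀ {a b c d} → a ⊑ c → b ⊑ d → (a + b) ⊑ (c + d))
 (⊑-≤-trans : ∀ {a b c} → a ⊑ b → b ≤ c → a ⊑ c) where

 record Ex (c : ℕ) (p : Prog CoinOp) (σ : CoinState) (Q : CoinState → Set) : Set where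
  constructor ex
  field
   {trace} : List ((CoinOp ⊎ ℕ) × CoinState)
   {final} : CoinState
   run     : Coin.Run p σ trace final
   cost    : bitOperations trace ⊑ c
   safe    : All (ok ∘ fst ∘ snd) trace
   post    : Q final

 weaken : ∀ {c d p σ} {Q R : CoinState → Set} → c ≤ d → (∀ {τ} → Q τ → R τ) → Ex c p σ Q → Ex d p σ R
 weaken c≤d h (ex run cost safe post) = ex run (⊑-≤-trans cost c≤d) safe (h post)

 ex-skip : ∀ {σ} {Q : CoinState → Set} → Q σ → Ex 0 skip σ Q
 ex-skip q = ex Coin.skip (≤⇒⊑ z≤n) [] q

 infixr 4 _⨟_
 _⨟_ : ∀ {a b p q σ} {Q R : CoinState → Set} →
       Ex a p σ R → (∀ {τ} → R τ → Ex b q τ Q) → Ex (a + b) (p ⨾ q) σ Q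
 _⨟_ {a} {b} (ex {l} run cost safe post) k with k post
 ... | ex {l′} run' cost' safe' post' = ex (Coin.seq run run')
  (subst (_⊑ (a + b)) (sym (bitOperations-++ l l′)) (⊑-+ cost cost')) (All.++⁺ safe safe') post'

 ex-ifz : ∀ {a c x p q s cs} {Q : CoinState → Set} → ok s → size (var s x) ≤ a →
  (var s x ≡ 0 → Ex c p (s , cs) Q) → (var s x ≢ 0 → Ex c q (s , cs) Q) →
  Ex (a + c) (ifz x then p else q) (s , cs) Q
 ex-ifz {x = x} {s = s} o t h k with var s x ≟ 0
 ... | yes z with h z
 ...   | ex run cost safe post = ex (Coin.ifz z run) (⊑-+ (≤⇒⊑ t) cost) (o ∷ safe) post
 ex-ifz {x = x} {s = s} o t h k | no nz with k nz
 ...   | ex run cost safe post = ex (Coin.ifnz nz run) (⊑-+ (≤⇒⊑ t) cost) (o ∷ safe) post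

 ex-stop : ∀ {x p s cs t} {Q : CoinState → Set} → ok s → size (var s x) ≤ t → var s x ≡ 0 → Q (s , cs) → Ex t (while x loop p) (s , cs) Q
 ex-stop o t z q = ex (Coin.stop z) (≤⇒⊑ (+-identityʳ _ ≡⟫ t)) (o ∷ []) q

 ex-again : ∀ {x p c d t s cs} {Q R : CoinState → Set} → ok s → size (var s x) ≤ t → var s x ≢ 0 →
  Ex c p (s , cs) R → (∀ {τ} → R τ → Ex d (while x loop p) τ Q) → Ex (t + (c + d)) (while x loop p) (s , cs) Q
 ex-again {x} {c = c} {d} {t} {s} o ts nz (ex {l} run cost safe post) k with k post
 ... | ex {l′} run' cost' safe' post' = ex (Coin.repeat nz run run')
  (subst (_⊑ (t + (c + d))) (cong (size (var s x) +_) (sym (bitOperations-++ l l′))) (⊑-+ (≤⇒⊑ ts) (⊑-+ cost cost')))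
  (o ∷ All.++⁺ safe safe') post'

 -- The invariant is indexed by an upper bound on the number of iterations left.
 ex-while : ∀ {x p c t} (I : ℕ → CoinState → Set) →
  (∀ {j σ} → I j σ → ok (fst σ) × size (var (fst σ) x) ≤ t) →
  (∀ {σ} → I 0 σ → var (fst σ) x ≡ 0) →
  (∀ {j σ} → I (suc j) σ → var (fst σ) x ≢ 0 → Ex c p σ (I j)) →
  ∀ j {σ} → I j σ → Ex (j * (t + c) + t) (while x loop p) σ (λ τ → var (fst τ) x ≡ 0 × ∃[ i ] I i τ)
 ex-while I good done body zero i = let (o , ts) = good i in ex-stop o ts (done i) (done i , 0 , i)
 ex-while {x} {p} {c} {t} I good done body (suc j) {σ} i with var (fst σ) x ≟ 0 | good i
 ... | yes z | o , ts = ex-stop o (ts ⟫ m≤n+m t (t + c + j * (t + c))) z (z , suc j , i)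
 ... | no nz | o , ts = weaken
  (≤-reflexive (cong (t +_) (sym (+-assoc c (j * (t + c)) t)) ⊙ sym (+-assoc t _ t) ⊙ cong (_+ t) (sym (+-assoc t c _))))
  id (ex-again o ts nz (body i nz) (ex-while I good done body j))

 ex-repeat : ∀ {x p c t} (I : ℕ → CoinState → Set) →
  (∀ {j σ} → I j σ → ok (fst σ) × size (var (fst σ) x) ≤ t × var (fst σ) x ≡ j) →
  (∀ {j σ} → I (suc j) σ → Ex c p σ (I j)) →
  ∀ j {σ} → I j σ → Ex (j * (t + c) + t) (while x loop p) σ (I 0)
 ex-repeat {x} I good body j i = weaken ≤-refl
  (λ { (z , k , i) → subst (λ k → I k _) (sym (snd (snd (good i))) ⊙ z) i })
  (ex-while I (λ i → fst (good i) , fst (snd (good i))) (λ i → snd (snd (good i))) (λ i _ → body i) j i)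

 imply : ∀ {c p σ} {Q R : CoinState → Set} → (∀ {τ} → Q τ → R τ) → Ex c p σ Q → Ex c p σ R
 imply = weaken ≤-refl

 ex-op : ∀ {o s cs t} {Q : CoinState → Set} → ok s → intCost o s ≤ t → Q (execInt o s , cs) → Ex t ‹ int o › (s , cs) Q
 ex-op good t q = ex (Coin.op CoinStep.int) (≤⇒⊑ (+-identityʳ _ ≡⟫ t)) (good ∷ []) q

 ex-toss : ∀ {x s c cs} {Q : CoinState → Set} → ok s → Q (setVar x (if c then 1 else 0) s , cs) → Ex 1 ‹ toss x › (s , c ∷ cs) Q
 ex-toss good q = ex (Coin.op CoinStep.toss) (≤⇒⊑ ≤-refl) (good ∷ []) q

 Obligations : ℕ → List IntOp → Store ℕ → Set
 Obligations t []       s = ok s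
 Obligations t (o ∷ os) s = ok s × intCost o s ≤ t × Obligations t os (execInt o s)

 ex-line : ∀ t os {s cs} → Obligations t os s → Ex (length os * t) (line os) (s , cs) (_≡ (execs os s , cs))
 ex-line t []       _             = ex-skip refl
 ex-line t (o ∷ os) {s} {cs} (good , c , h) = _⨟_ {R = _≡ (execInt o s , cs)} (ex-op good c refl) (λ { refl → ex-line t os h })

open import Function.Bundles using (module Equivalence)

-- Variables: the main program uses 0 to 31, with 16 as the index of the innermost
-- loop, 17 as its counter, 3 as the constant 1, 15 as the constant 0, and 1 as
-- the number of heap cells occupied by the input. Beyond these, the heap is
-- divided into sixteen interleaved arrays.
double : ℕ → ℕ
double v = v + v

cell : ℕ → ℕ → ℕ → ℕ
cell base k p = double (double (double (double p))) + base + k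

address : (t c k p : ℕ) → List IntOp → List IntOp
address t c k p os =
 add t p p ∷ add t t t ∷ add t t t ∷ add t t t ∷ add t t 1 ∷ const c k ∷ add t t c ∷ os

fetch : (x k p : ℕ) → Prog CoinOp
fetch x k p = line (address 30 31 k p []) ▸ ‹ int (load x 30) ›

stash : (k p x : ℕ) → Prog CoinOp
stash k p x = line (address 30 31 k p []) ▸ ‹ int (save 30 x) ›

each : (count stride : ℕ) → Prog CoinOp → Prog CoinOp
each count stride body = line (const 16 0 ∷ add 17 count 15 ∷ []) ▸
 (while 17 loop (body ▸ line (add 16 16 stride ∷ sub 17 17 3 ∷ [])))

extract : Prog CoinOp
extract = (while 25 loop line (half 24 24 ∷ sub 25 25 3 ∷ [])) ▸
 line (half 26 24 ∷ add 26 26 26 ∷ sub 24 24 26 ∷ [])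

double-half≤ : ∀ x → ⌊ x /2⌋ + ⌊ x /2⌋ ≤ x
double-half≤ x = (+-monoʳ-≤ ⌊ x /2⌋ (⌊n/2⌋≤⌈n/2⌉ x)) ⟫≡ ⌊n/2⌋+⌈n/2⌉≡n x

-- Bit number (variable v) of the current entry of array k, in variable 24.
takeBit : (k v : ℕ) → Prog CoinOp
takeBit k v = fetch 24 k 16 ▸ line (add 25 v 15 ∷ []) ▸ extract

module Bounded (Hyp : Set) (S w 𝔹 : ℕ) (size𝔹≤w : size 𝔹 ≤ w) (64≤𝔹 : 64 ≤ 𝔹) where

 record ok (s : Store ℕ) : Set where
  constructor when
  field within : Hyp → FitsInt S w s

 unit : ℕ
 unit = size 𝔹 + size 𝔹

 size≤unit : ∀ {x} → x ≤ 𝔹 → size x ≤ unit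
 size≤unit p = size-mono p ⟫ m≤m+n (size 𝔹) (size 𝔹)

 record Good (s : Store ℕ) : Set where
  field
   fits : ok s
   vars : ∀ x → T (x <ᵇ 32) → var s x ≤ 𝔹

 open Good public

 ok-var : ∀ {s} x {v} → (Hyp → size v ≤ w) → ok s → ok (setVar x v s)
 ok-var {s} x {v} b (when o) = when λ hyp → let (f , g , z) = o hyp in upd-elim (λ _ v → size v ≤ w) (var s) x v (b hyp) (λ y _ → f y) , g , z

 ok-heap : ∀ {s} a {v} → (Hyp → size v ≤ w) → (Hyp → S ≤ a → v ≡ 0) → ok s → ok (setHeap a v s)
 ok-heap {s} a {v} b c (when o) = when λ hyp → let (f , g , z) = o hyp in f , upd-elim (λ _ v → size v ≤ w) (heap s) a v (b hyp) (λ y _ → g y) ,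
       upd-elim (λ a v → S ≤ a → v ≡ 0) (heap s) a v (c hyp) (λ y _ → z y)

 good-var : ∀ {s} x {v} → v ≤ 𝔹 → Good s → Good (setVar x v s)
 good-var {s} x {v} b g = record
  { fits = ok-var x (λ _ → size-mono b ⟫ size𝔹≤w) (fits g)
  ; vars = upd-elim (λ x v → T (x <ᵇ 32) → v ≤ 𝔹) (var s) x v (λ _ → b) (λ y _ → vars g y) }

 good-heap : ∀ {s} a {v} → v ≤ 𝔹 → a < S → Good s → Good (setHeap a v s)
 good-heap a b a<S g = record
  { fits = ok-heap a (λ _ → size-mono b ⟫ size𝔹≤w) (λ _ S≤a → contradiction a<S (≤⇒≯ S≤a)) (fits g)
  ; vars = vars g }

 -- All variables belong to the main program, and those below t are not assigned.
 local : ℕ → List IntOp → Bool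
 local t [] = true
 local t (const x k ∷ os) = (t ≤ᵇ x) ∧ ((x <ᵇ 32) ∧ local t os)
 local t (add x y z ∷ os) = (t ≤ᵇ x) ∧ ((x <ᵇ 32) ∧ ((y <ᵇ 32) ∧ ((z <ᵇ 32) ∧ local t os)))
 local t (sub x y z ∷ os) = (t ≤ᵇ x) ∧ ((x <ᵇ 32) ∧ ((y <ᵇ 32) ∧ ((z <ᵇ 32) ∧ local t os)))
 local t (half x y ∷ os)  = (t ≤ᵇ x) ∧ ((x <ᵇ 32) ∧ ((y <ᵇ 32) ∧ local t os))
 local t (load x y ∷ os)  = (t ≤ᵇ x) ∧ ((x <ᵇ 32) ∧ ((y <ᵇ 32) ∧ local t os))
 local t (save x y ∷ os)  = (x <ᵇ 32) ∧ ((y <ᵇ 32) ∧ local t os)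

 Needs : List IntOp → Store ℕ → Set
 Needs []       s = ⊤
 Needs (const x k ∷ os) s = (k ≤ 𝔹) × Needs os (execInt (const x k) s)
 Needs (add x y z ∷ os) s = (var s y + var s z ≤ 𝔹) × Needs os (execInt (add x y z) s)
 Needs (load x y ∷ os)  s = (heap s (var s y) ≤ 𝔹) × Needs os (execInt (load x y) s)
 Needs (save x y ∷ os)  s = (var s x < S) × Needs os (execInt (save x y) s)
 Needs (o ∷ os)         s = Needs os (execInt o s)

 record Below (t : ℕ) (s s′ : Store ℕ) : Set where
  constructor below
  field same : ∀ x → T (x <ᵇ t) → var s′ x ≡ var s x

 open Below public

 below-refl : ∀ {t s} → Below t s s
 below-refl = below λ _ _ → refl

 below-trans : ∀ {t s s′ s″} → Below t s s′ → Below t s′ s″ → Below t s s″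
 below-trans (below f) (below g) = below λ x l → g x l ⊙ f x l

 below-weaken : ∀ {t u s s′} → t ≤ u → Below u s s′ → Below t s s′
 below-weaken {t} {u} t≤u (below f) = below λ x l → f x (<⇒<ᵇ (<ᵇ⇒< x t l ⟫ t≤u))

 below-var : ∀ {t s} x v → T (t ≤ᵇ x) → Below t s (setVar x v s)
 below-var {t} {s} x v t≤x = below λ y y<t → upd-≢ (var s) {x} {y} v
  λ { refl → <⇒≱ (<ᵇ⇒< x t y<t) (≤ᵇ⇒≤ t x t≤x) }

 open Logic ok _≤_ id +-mono-≤ ≤-trans public

 private
  both : ∀ {a b} → T (a ∧ b) → T a × T b
  both {true} {true} _ = tt , tt

  two : ∀ {a b} → a ≤ 𝔹 → b ≤ 𝔹 → size a + size b ≤ unit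
  two p q = +-mono-≤ (size-mono p) (size-mono q)

 main-op : ∀ t o os {s} → T (local t (o ∷ os)) → Good s → Needs (o ∷ os) s →
  intCost o s ≤ unit × Good (execInt o s) × Below t s (execInt o s) × T (local t os) × Needs os (execInt o s)
 main-op t (const x k) os l g (b , n) =
  let (tx , l) = both {t ≤ᵇ x} l ; (_ , l) = both {x <ᵇ 32} l in size≤unit b , good-var x b g , below-var x k tx , l , n
 main-op t (add x y z) os l g (b , n) =
  let (tx , l) = both {t ≤ᵇ x} l ; (_ , l) = both {x <ᵇ 32} l ; (ly , l) = both {y <ᵇ 32} l ; (lz , l) = both {z <ᵇ 32} l
  in two (vars g y ly) (vars g z lz) , good-var x b g , below-var x _ tx , l , n
 main-op t (sub x y z) os {s} l g n =
  let (tx , l) = both {t ≤ᵇ x} l ; (_ , l) = both {x <ᵇ 32} l ; (ly , l) = both {y <ᵇ 32} l ; (lz , l) = both {z <ᵇ 32} l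
  in two (vars g y ly) (vars g z lz) , good-var x (m∸n≤m (var s y) (var s z) ⟫ vars g y ly) g , below-var x _ tx , l , n
 main-op t (half x y) os {s} l g n =
  let (tx , l) = both {t ≤ᵇ x} l ; (_ , l) = both {x <ᵇ 32} l ; (ly , l) = both {y <ᵇ 32} l
  in size≤unit (vars g y ly) , good-var x (⌊n/2⌋≤n (var s y) ⟫ vars g y ly) g , below-var x _ tx , l , n
 main-op t (load x y) os l g (b , n) =
  let (tx , l) = both {t ≤ᵇ x} l ; (_ , l) = both {x <ᵇ 32} l ; (ly , l) = both {y <ᵇ 32} l
  in two (vars g y ly) b , good-var x b g , below-var x _ tx , l , n
 main-op t (save x y) os {s} l g (b , n) =
  let (lx , l) = both {x <ᵇ 32} l ; (ly , l) = both {y <ᵇ 32} l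
  in two (vars g x lx) (vars g y ly) , good-heap (var s x) (vars g y ly) b g , below (λ _ _ → refl) , l , n

 main-line : ∀ t os {s} → T (local t os) → Good s → Needs os s →
  Obligations unit os s × Good (execs os s) × Below t s (execs os s)
 main-line t [] _ g _ = fits g , g , below-refl
 main-line t (o ∷ os) l g n =
  let (c , g1 , b1 , l1 , n1) = main-op t o os l g n ; (obs , g' , b') = main-line t os l1 g1 n1
  in (fits g , c , obs) , g' , below-trans b1 b'

 run-line : ∀ t os {s cs} {_ : T (local t os)} → Good s → Needs os s →
  Ex (length os * unit) (line os) (s , cs) (λ τ → τ ≡ (execs os s , cs) × Good (execs os s) × Below t s (execs os s))
 run-line t os {_} {_} {l} g n = let (o , r) = main-line t os l g n in imply (λ e → e , r) (ex-line unit os o)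

 pure : List IntOp → Bool
 pure [] = true
 pure (const x k ∷ os) = pure os
 pure (add x y z ∷ os) = (y <ᵇ 16) ∧ ((z <ᵇ 16) ∧ pure os)
 pure (sub x y z ∷ os) = (y <ᵇ 16) ∧ ((z <ᵇ 16) ∧ pure os)
 pure (half x y ∷ os)  = (y <ᵇ 16) ∧ pure os
 pure _                = false

 Agree : (ℕ → ℕ) → (ℕ → ℕ) → Set
 Agree f g = ∀ y → T (y <ᵇ 16) → f y ≡ g y

 private
  update : ∀ {f g} x {u v} → u ≡ v → Agree f g → Agree (f [ x ↦ u ]) (g [ x ↦ v ])
  update {f} {g} x {u} refl h = upd-elim (λ y u' → T (y <ᵇ 16) → u' ≡ (g [ x ↦ u ]) y) f x u (λ _ → sym (upd-≡ g x u))
   (λ y x≢y l → h y l ⊙ sym (upd-≢ g u x≢y))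

 lift : ∀ os {s v} → T (pure os) → Agree (var s) v → Agree (var (execs os s)) (var (execs os (store v (λ _ → 0)))) × heap (execs os s) ≡ heap s
  × (Needs os (store v (λ _ → 0)) → Needs os s)
 lift [] _ h = h , refl , id
 lift (const x k ∷ os) {s} {v} l h =
  let (a , e , f) = lift os {execInt (const x k) s} l (update {var s} {v} x refl h) in a , e , λ (b , ns) → b , f ns
 lift (add x y z ∷ os) {s} {v} l h =
  let (ly , l) = both {y <ᵇ 16} l ; (lz , l) = both {z <ᵇ 16} l ; e0 = cong₂ _+_ (h y ly) (h z lz)
      (a , e , f) = lift os {execInt (add x y z) s} l (update {var s} {v} x e0 h) in a , e , λ (b , ns) → e0 ≡⟫ b , f ns
 lift (sub x y z ∷ os) {s} {v} l h =
  let (ly , l) = both {y <ᵇ 16} l ; (lz , l) = both {z <ᵇ 16} l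
      (a , e , f) = lift os {execInt (sub x y z) s} l (update {var s} {v} x (cong₂ _∸_ (h y ly) (h z lz)) h) in a , e , f
 lift (half x y ∷ os) {s} {v} l h =
  let (ly , l) = both {y <ᵇ 16} l
      (a , e , f) = lift os {execInt (half x y) s} l (update {var s} {v} x (cong ⌊_/2⌋ (h y ly)) h) in a , e , f

 small : ∀ {k} → T (k ≤ᵇ 64) → k ≤ 𝔹
 small {k} t = ≤ᵇ⇒≤ k 64 t ⟫ 64≤𝔹

 address-needs : ∀ {base k p} {R : Set} → k ≤ 𝔹 → cell base k p ≤ 𝔹 → R →
  double p ≤ 𝔹 × double (double p) ≤ 𝔹 × double (double (double p)) ≤ 𝔹 × double (double (double (double p))) ≤ 𝔹 ×
  double (double (double (double p))) + base ≤ 𝔹 × k ≤ 𝔹 × cell base k p ≤ 𝔹 × R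
 address-needs {base} {k} {p} {R} k≤ b r = ≤1 , ≤2 , ≤3 , ≤4 , ≤5 , k≤ , b , r
  where
  ≤5 = m≤m+n _ k ⟫ b
  ≤4 = m≤m+n _ base ⟫ ≤5
  ≤3 = m≤m+n _ _ ⟫ ≤4
  ≤2 = m≤m+n _ _ ⟫ ≤3
  ≤1 = m≤m+n _ _ ⟫ ≤2

 record Same (τ : CoinState) (cs : List Bool) (h : ℕ → ℕ) : Set where
  field
   good1 : Good (fst τ)
   coins1 : snd τ ≡ cs
   heap1 : heap (fst τ) ≡ h

 open Same public

 private
  within-31 : ∀ {x} → T (x <ᵇ 30) → T (x <ᵇ 32)
  within-31 {x} l = <⇒<ᵇ (<ᵇ⇒< x 30 l ⟫ m≤m+n 30 2)

  ∧-pair : ∀ {a b} → T a → T b → T (a ∧ b)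
  ∧-pair {true} _ t = t

  ex-address : ∀ {k p s cs} → T (p <ᵇ 32) → Good s → k ≤ 𝔹 → cell (var s 1) k (var s p) ≤ 𝔹 →
   Ex (7 * unit) (line (address 30 31 k p [])) (s , cs) (λ τ → Same τ cs (heap s) × Below 30 s (fst τ) × var (fst τ) 30 ≡ cell (var s 1) k (var s p))
  ex-address {k} {p} {s} p<32 g k≤ c = imply
   (λ { (refl , g' , b) → record { good1 = g' ; coins1 = refl ; heap1 = refl } , b , refl })
   (run-line 30 (address 30 31 k p []) {_} {_} {∧-pair p<32 (∧-pair p<32 tt)} g (address-needs {var s 1} {k} {var s p} k≤ c tt))

 ex-fetch : ∀ {x k p s cs} → T (x <ᵇ 30) → T (p <ᵇ 32) → Good s → k ≤ 𝔹 → cell (var s 1) k (var s p) ≤ 𝔹 →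
  heap s (cell (var s 1) k (var s p)) ≤ 𝔹 →
  Ex (8 * unit) (fetch x k p) (s , cs) (λ τ → Same τ cs (heap s) ×
   (∀ y → T (y <ᵇ 30) → (x ≡ᵇ y) ≡ false → var (fst τ) y ≡ var s y) × var (fst τ) x ≡ heap s (cell (var s 1) k (var s p)))
 ex-fetch {x} {k} {p} {s} {cs} x<30 p<32 g k≤ c v = weaken (≤-reflexive (+-comm (7 * unit) unit)) id
  (ex-address p<32 g k≤ c ⨟ λ { {s1 , _} (record { good1 = g1 ; coins1 = refl ; heap1 = h } , b , e) →
   let value : heap s1 (var s1 30) ≡ heap s (cell (var s 1) k (var s p))
       value = cong (heap s1) e ⊙ cong (λ h → h _) h
       v≤ = value ≡⟫ v
   in ex-op (fits g1) (two (vars g1 30 tt) v≤)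
    ( record { good1 = good-var x v≤ g1 ; coins1 = refl ; heap1 = h }
    , (λ y y<30 x≢y → cong (λ b → if b then heap s1 (var s1 30) else var s1 y) x≢y ⊙ same b y y<30)
    , upd-≡ (var s1) x _ ⊙ value ) })

 ex-stash : ∀ {k p x s cs} → T (x <ᵇ 30) → T (p <ᵇ 32) → Good s → k ≤ 𝔹 → cell (var s 1) k (var s p) ≤ 𝔹 →
  cell (var s 1) k (var s p) < S →
  Ex (8 * unit) (stash k p x) (s , cs) (λ τ → Good (fst τ) × snd τ ≡ cs × Below 30 s (fst τ) ×
   heap (fst τ) ≡ (heap s [ cell (var s 1) k (var s p) ↦ var s x ]))
 ex-stash {k} {p} {x} {s} {cs} x<30 p<32 g k≤ c c<S = weaken (≤-reflexive (+-comm (7 * unit) unit)) id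
  (ex-address p<32 g k≤ c ⨟ λ { {s1 , _} (record { good1 = g1 ; coins1 = refl ; heap1 = h } , b , e) →
   let x≤ = vars g1 x (within-31 {x} x<30) in
   ex-op (fits g1) (two (vars g1 30 tt) x≤)
    ( good-heap (var s1 30) x≤ (subst (_< S) (sym e) c<S) g1 , refl , below (same b)
    , cong (λ h → h [ var s1 30 ↦ var s1 x ]) h ⊙ cong₂ (λ a v → heap s [ a ↦ v ]) e (same b x x<30) ) })

 record Vars (v0 : ℕ → ℕ) (s : Store ℕ) : Set where
  constructor holding
  field look : ∀ x → T (x <ᵇ 16) → var s x ≡ v0 x

 open Vars public

 below-vars : ∀ {v0 s s′} → Below 16 s s′ → Vars v0 s → Vars v0 s′
 below-vars (below f) (holding h) = holding λ x l → f x l ⊙ h x l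

 eachCost : ℕ → ℕ → ℕ
 eachCost C t = 2 * unit + (C * (unit + (t + 2 * unit)) + unit)

 record Loop (v0 : ℕ → ℕ) (count stride C d : ℕ) : Set where
  field
   count<16  : T (count <ᵇ 16)
   stride<16 : T (stride <ᵇ 16)
   count≡    : v0 count ≡ C
   stride≡   : v0 stride ≡ d
   zero≡     : v0 15 ≡ 0
   one≡      : v0 3 ≡ 1
   C≤        : C ≤ 𝔹
   Cd≤       : C * d ≤ 𝔹

 <32 : ∀ x → T (x <ᵇ 16) → T (x <ᵇ 32)
 <32 x t = <⇒<ᵇ (<ᵇ⇒< x 16 t ⟫ m≤m+n 16 16)

 ex-each : ∀ {v0 count stride C d body t} → Loop v0 count stride C d →
  (J : ℕ → (ℕ → ℕ) → List Bool → Set) →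
  (∀ (i : Fin C) {s cs} → Good s → Vars v0 s → var s 16 ≡ toℕ i * d → var s 17 ≡ C ∸ toℕ i → J (toℕ i) (heap s) cs →
   Ex t body (s , cs) (λ (s′ , cs') → Below 18 s s′ × Good s′ × J (suc (toℕ i)) (heap s′) cs')) →
  ∀ {s cs} → Good s → Vars v0 s → J 0 (heap s) cs →
  Ex (eachCost C t) (each count stride body) (s , cs) (λ (s′ , cs') → Good s′ × Vars v0 s′ × J C (heap s′) cs')
 ex-each {v0} {count} {stride} {C} {d} {body} {t} L J step {s} {cs} g vs j =
  run-line 16 (const 16 0 ∷ add 17 count 15 ∷ []) {_} {_} {∧-intro (<32 count count<16)} g (z≤n , start , tt) ⨟ λ { (refl , g' , b) →
  imply (λ { (i , e , g , vs , _ , _ , j) → g , vs , subst (λ i → J i _ _) (sym (+-identityʳ i) ⊙ e) j })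
   (ex-repeat I (λ (_ , _ , g , _ , _ , e , _) → fits g , size≤unit (vars g 17 tt) , e) iteration C
    (0 , refl , g' , below-vars b vs , refl , cnt , j)) }
  where
  open Loop L
  ∧-intro : ∀ {a b} → T a → {_ : T b} → T (a ∧ b)
  ∧-intro {true} _ {t} = t
  v : ℕ → ℕ
  v i = var (setVar 16 i s) count + var s 15
  count≢16 : 16 ≢ count
  count≢16 refl = count<16
  cnt : v 0 ≡ C
  cnt = cong₂ _+_ (upd-≢ (var s) 0 count≢16 ⊙ look vs count count<16 ⊙ count≡) (look vs 15 tt ⊙ zero≡) ⊙ +-identityʳ C
  start : v 0 ≤ 𝔹
  start = cnt ≡⟫ C≤
  I : ℕ → CoinState → Set
  I k (s , cs) = ∃[ i ] (i + k ≡ C × Good s × Vars v0 s × var s 16 ≡ i * d × var s 17 ≡ k × J i (heap s) cs)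
  iteration : ∀ {k σ} → I (suc k) σ → Ex (t + 2 * unit) (body ⨾ line (add 16 16 stride ∷ sub 17 17 3 ∷ [])) σ (I k)
  iteration {k} {s0 , _} (i , e , g , vs , e16 , e17 , j) =
   at-i ⨟ λ { {s′ , cs'} (b , g , j) →
   let vs' = below-vars (below-weaken (m≤m+n 16 2) b) vs
       next : var s′ 16 + var s′ stride ≡ suc i * d
       next = cong₂ _+_ (same b 16 tt ⊙ e16) (look vs' stride stride<16 ⊙ stride≡) ⊙ +-comm (i * d) d
   in imply (λ { (refl , g' , b') → suc i , sym (+-suc i k) ⊙ e , g' , below-vars b' vs' ,
          next , cong₂ _∸_ (same b 17 tt ⊙ e17) (look vs' 3 tt ⊙ one≡) , j })
        (run-line 16 (add 16 16 stride ∷ sub 17 17 3 ∷ []) {_} {_} {∧-intro (<32 stride stride<16)} g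
         (next ≡⟫ *-monoˡ-≤ d i<C ⟫ Cd≤ , tt)) }
   where
   i<C : i < C
   i<C = subst (i <_) e (m<m+n i z<s)
   at-i : Ex t body (s0 , _) (λ (s′ , cs') → Below 18 s0 s′ × Good s′ × J (suc i) (heap s′) cs')
   at-i = subst (λ i → var s0 16 ≡ i * d → var s0 17 ≡ C ∸ i → J i (heap s0) _ → Ex t body (s0 , _) (λ (s′ , cs') → Below 18 s0 s′ × Good s′ × J (suc i) (heap s′) cs'))
    (Fin.toℕ-fromℕ< i<C) (step (fromℕ< i<C) g vs) e16 (e17 ⊙ sym (cong (_∸ i) (sym e) ⊙ m+n∸m≡n i (suc k))) j

 ex-map : ∀ {v0 count stride C d body t} → Loop v0 count stride C d → .{{NonZero d}} →
  (ad : ℕ → ℕ) → (∀ p q → ad p ≡ ad q → p ≡ q) → (Φ : Fin C → ℕ) → ∀ {h0 : ℕ → ℕ} {cs0} →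
  (∀ (i : Fin C) {s} → Good s → Vars v0 s → var s 16 ≡ toℕ i * d → var s 17 ≡ C ∸ toℕ i →
   (∀ a → (∀ q → q < toℕ i → a ≢ ad (q * d)) → heap s a ≡ h0 a) →
   Ex t body (s , cs0) (λ (s′ , cs') → Below 18 s s′ × Good s′ × cs' ≡ cs0 × (∀ a → heap s′ a ≡ (heap s [ ad (toℕ i * d) ↦ Φ i ]) a))) →
  ∀ {s} → Good s → Vars v0 s → (∀ a → heap s a ≡ h0 a) →
  Ex (eachCost C t) (each count stride body) (s , cs0) (λ (s′ , cs') → Good s′ × Vars v0 s′ × cs' ≡ cs0 ×
   (∀ q → heap s′ (ad (toℕ q * d)) ≡ Φ q) × (∀ a → (∀ (q : Fin C) → a ≢ ad (toℕ q * d)) → heap s′ a ≡ h0 a))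
 ex-map {v0} {C = C} {d} L ad injective Φ {h0} {cs0} step g vs h≡ = imply
  (λ (g , vs , c , done , rest) → g , vs , c , (λ q → done q (Fin.toℕ<n q)) ,
     λ a away → rest a λ q q<C e → away (fromℕ< q<C) (e ⊙ cong (λ q → ad (q * d)) (sym (Fin.toℕ-fromℕ< q<C))))
  (ex-each L J (λ { i g vs e16 e17 (refl , done , rest) → imply
      (λ { {s′ , _} (b , g , c , upd) → b , g , c , extend i {_} {heap s′} done upd , keep (toℕ i) {_} {heap s′} rest upd })
      (step i g vs e16 e17 rest) })
   g vs (refl , (λ _ ()) , λ a _ → h≡ a))
  where
  J : ℕ → (ℕ → ℕ) → List Bool → Set
  J i h cs = cs ≡ cs0 × (∀ (q : Fin C) → toℕ q < i → h (ad (toℕ q * d)) ≡ Φ q) × (∀ a → (∀ q → q < i → a ≢ ad (q * d)) → h a ≡ h0 a)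
  extend : ∀ (i : Fin C) {h h' : ℕ → ℕ} → (∀ q → toℕ q < toℕ i → h (ad (toℕ q * d)) ≡ Φ q) → (∀ a → h' a ≡ (h [ ad (toℕ i * d) ↦ Φ i ]) a) →
           ∀ q → toℕ q < suc (toℕ i) → h' (ad (toℕ q * d)) ≡ Φ q
  extend i {h} done upd q (s≤s q≤i) with q Fin.≟ i
  ... | yes refl = upd (ad (toℕ i * d)) ⊙ upd-≡ h (ad (toℕ i * d)) (Φ i)
  ... | no q≢i   = upd (ad (toℕ q * d)) ⊙ (upd-≢ h (Φ i) λ e → q≢i (Fin.toℕ-injective (*-cancelʳ-≡ (toℕ q) (toℕ i) d (injective _ _ (sym e))))) ⊙
                     done q (≤∧≢⇒< q≤i λ e → q≢i (Fin.toℕ-injective e))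
  keep : ∀ i {h h' : ℕ → ℕ} {v} → (∀ a → (∀ q → q < i → a ≢ ad (q * d)) → h a ≡ h0 a) → (∀ a → h' a ≡ (h [ ad (i * d) ↦ v ]) a) →
         ∀ a → (∀ q → q < suc i → a ≢ ad (q * d)) → h' a ≡ h0 a
  keep i {h} {v = v} rest upd a away = upd a ⊙ (upd-≢ h v λ e → away i ≤-refl (sym e)) ⊙ (rest a λ q q<i → away q (m<n⇒m<1+n q<i))

cell≡ : ∀ b k p → cell b k p ≡ p * 16 + b + k
cell≡ b k p = cong (λ x → x + b + k)
 (solve 1 (λ p → p :+ p :+ (p :+ p) :+ (p :+ p :+ (p :+ p)) :+ (p :+ p :+ (p :+ p) :+ (p :+ p :+ (p :+ p))) := p :* con 16) refl p)

cell-injective : ∀ b {k k'} p p' → k < 16 → k' < 16 → cell b k p ≡ cell b k' p' → k ≡ k' × p ≡ p'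
cell-injective b {k} {k'} p p' k< k'< e = k≡ , *-cancelʳ-≡ p p' 16 (+-cancelˡ-≡ k' _ _ (cong (_+ p * 16) (sym k≡) ⊙ same))
 where
 normal : ∀ k p → cell b k p ≡ b + (k + p * 16)
 normal k p = cell≡ b k p ⊙ cong (_+ k) (+-comm (p * 16) b) ⊙ +-assoc b _ k ⊙ cong (b +_) (+-comm (p * 16) k)
 same : k + p * 16 ≡ k' + p' * 16
 same = +-cancelˡ-≡ b _ _ (sym (normal k p) ⊙ e ⊙ normal k' p')
 k≡ : k ≡ k'
 k≡ = sym (DM.[m+kn]%n≡m%n k p 16 ⊙ DM.m<n⇒m%n≡m k<) ⊙ cong (DM._% 16) same ⊙ DM.[m+kn]%n≡m%n k' p' 16 ⊙ DM.m<n⇒m%n≡m k'<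

base≤cell : ∀ b k p → b ≤ cell b k p
base≤cell b k p = m≤n+m b (double (double (double (double p)))) ⟫ m≤m+n _ k

data Array : Set where
 arcs arcsᵀ powers powers⁻ gradients cycles hits sums tmp1 tmp2 tmp3 flag blank : Array

rank : Array → ℕ
rank arcs      = 0
rank arcsᵀ     = 1
rank powers    = 2
rank powers⁻   = 3
rank gradients = 4
rank cycles    = 5
rank hits      = 6
rank sums      = 7
rank tmp1      = 8
rank tmp2      = 9
rank tmp3      = 10
rank flag      = 11
rank blank     = 12

index : Array → ℕ
index k = 3 + rank k

every-array : ∀ {P : Array → Set} → {{P arcs}} → {{P arcsᵀ}} → {{P powers}} → {{P powers⁻}} → {{P gradients}} → {{P cycles}} → {{P hits}} → {{P sums}} →
 {{P tmp1}} → {{P tmp2}} → {{P tmp3}} → {{P flag}} → {{P blank}} → ∀ k → P k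
every-array {{a}} {{b}} {{c}} {{d}} {{e}} {{f}} {{g}} {{h}} {{i}} {{j}} {{k}} {{l}} {{m}} = λ
 { arcs → a ; arcsᵀ → b ; powers → c ; powers⁻ → d ; gradients → e ; cycles → f ; hits → g ; sums → h ; tmp1 → i ; tmp2 → j ; tmp3 → k ; flag → l ; blank → m }

instance
 reflexive : ∀ {A : Set} {x : A} → x ≡ x
 reflexive = refl

array! : ∀ k → T (index k <ᵇ 16)
array! k = every-array {λ k → T (index k <ᵇ 16)} {{tt}} {{tt}} {{tt}} {{tt}} {{tt}} {{tt}} {{tt}} {{tt}} {{tt}} {{tt}} {{tt}} {{tt}} {{tt}} k

index<16 : ∀ k → index k < 16
index<16 k = <ᵇ⇒< (index k) 16 (array! k)

-- Loop bodies for entry ⟨ i , j ⟩, the number of which is in variable 16.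
copying emitting hitting : Array → Array → Prog CoinOp
copying src k  = fetch 20 (index src) 16 ▸ stash (index k) 16 20
emitting acc k = fetch 20 (index acc) 16 ▸ line (half 21 20 ∷ add 21 21 21 ∷ sub 20 20 21 ∷ []) ▸ fetch 21 (index k) 16 ▸ line (add 21 21 21 ∷ add 21 21 20 ∷ []) ▸ stash (index k) 16 21
hitting k k'   = line (load 20 16 ∷ []) ▸ fetch 21 (index k) 16 ▸ line (sub 21 3 21 ∷ sub 20 20 21 ∷ []) ▸ stash (index k') 16 20

multiplying : Array → Array → Array → Prog CoinOp
multiplying X Y k = takeBit (index X) 13 ▸ line (add 20 24 15 ∷ []) ▸ takeBit (index Y) 12 ▸ line (add 20 20 24 ∷ half 20 20 ∷ []) ▸
 fetch 21 (index k) 16 ▸ line (add 21 21 20 ∷ []) ▸ stash (index k) 16 21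

tallying : Prog CoinOp
tallying = fetch 20 (index hits) 16 ▸ fetch 21 (index flag) 15 ▸ line (add 21 21 20 ∷ []) ▸ stash (index flag) 15 21

Contents : ℕ → Set
Contents n = Array → Words n

_[_≔_] : ∀ {n} → Contents n → Array → Words n → Contents n
(c [ k ≔ X ]) k' = if index k ≡ᵇ index k' then X else c k'

put-≡ : ∀ {n} (c : Contents n) k {X} → (c [ k ≔ X ]) k ≡ X
put-≡ c k rewrite ≡ᵇ-refl (rank k) = refl

put-elim : ∀ {n} (P : Array → Words n → Set) (c : Contents n) k {X} → (∀ k' → index k ≡ index k' → P k' X) → (∀ k' → index k ≢ index k' → P k' (c k')) → ∀ k' → P k' ((c [ k ≔ X ]) k')
put-elim P c k f g k' with index k ≡ᵇ index k' in eq
... | true  = f k' (≡ᵇ⇒≡ (index k) (index k') (subst T (sym eq) tt))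
... | false = g k' λ e → subst T eq (≡⇒≡ᵇ (index k) (index k') e)

Apart : Array → Array → Set
Apart k k' = T (not (index k ≡ᵇ index k'))

apart⇒≢ : ∀ {k k'} → Apart k k' → index k ≢ index k'
apart⇒≢ {k} {k'} t e = contradiction' (index k ≡ᵇ index k') t (≡⇒≡ᵇ (index k) (index k') e)
 where
 contradiction' : ∀ {A : Set} b → T (not b) → T b → A
 contradiction' true ()

put-apart : ∀ {n} (c : Contents n) {k k' X} → Apart k k' → (c [ k ≔ X ]) k' ≡ c k'
put-apart c {k} {k'} t with index k ≡ᵇ index k'
... | false = refl

put-cong : ∀ {n} (c c' : Contents n) k {X Y} → (∀ x i j → c x i j ≡ c' x i j) → (∀ i j → X i j ≡ Y i j) → ∀ x i j → (c [ k ≔ X ]) x i j ≡ (c' [ k ≔ Y ]) x i j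
put-cong c c' k h e x i j with index k ≡ᵇ index x
... | true  = e i j
... | false = h x i j

put-put : ∀ {n} (c : Contents n) k {X Y} x → ((c [ k ≔ X ]) [ k ≔ Y ]) x ≡ (c [ k ≔ Y ]) x
put-put c k x with index k ≡ᵇ index x
... | true  = refl
... | false = refl

put-swap : ∀ {n} (c : Contents n) {a b X Y Z} → Apart a b → ∀ x → (((c [ a ≔ X ]) [ b ≔ Y ]) [ a ≔ Z ]) x ≡ ((c [ a ≔ Z ]) [ b ≔ Y ]) x
put-swap c {a} {b} a#b x with index a ≡ᵇ index x in p | index b ≡ᵇ index x in q
... | true  | true  = contradiction (≡ᵇ⇒≡ (index a) (index x) (subst T (sym p) tt) ⊙ sym (≡ᵇ⇒≡ (index b) (index x) (subst T (sym q) tt))) (apart⇒≢ {a} {b} a#b)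
... | true  | false = refl
... | false | true  = refl
... | false | false = refl

-- The variables of the main program below 16: result, iteration, remaining
-- iterations, current call, and the counters of convolutions. No stamp exceeds stale.
record Registers : Set where
 field res k left cur stale e c b1 b : ℕ

below-16 : ∀ {P : ℕ → Set} → {{p0 : P 0}} → {{p1 : P 1}} → {{p2 : P 2}} → {{p3 : P 3}} → {{p4 : P 4}} → {{p5 : P 5}} → {{p6 : P 6}} → {{p7 : P 7}} → {{p8 : P 8}} →
 {{p9 : P 9}} → {{p10 : P 10}} → {{p11 : P 11}} → {{p12 : P 12}} → {{p13 : P 13}} → {{p14 : P 14}} → {{p15 : P 15}} → ∀ x → T (x <ᵇ 16) → P x
below-16 {{p0}} {{p1}} {{p2}} {{p3}} {{p4}} {{p5}} {{p6}} {{p7}} {{p8}} {{p9}} {{p10}} {{p11}} {{p12}} {{p13}} {{p14}} {{p15}} = λ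
 { 0 _ → p0 ; 1 _ → p1 ; 2 _ → p2 ; 3 _ → p3 ; 4 _ → p4 ; 5 _ → p5 ; 6 _ → p6 ; 7 _ → p7 ; 8 _ → p8 ; 9 _ → p9 ; 10 _ → p10 ; 11 _ → p11
 ; 12 _ → p12 ; 13 _ → p13 ; 14 _ → p14 ; 15 _ → p15
 ; (suc (suc (suc (suc (suc (suc (suc (suc (suc (suc (suc (suc (suc (suc (suc (suc x)))))))))))))))) () }

-- Costs are compared by ⊑; it is to mean "at most a multiple of n ^ τ".
record Setting : Set₁ where
 infix 4 _⊑_
 field
  Hyp       : Set
  S w 𝔹 n L r : ℕ
  size𝔹≤w   : size 𝔹 ≤ w
  64≤𝔹      : 64 ≤ 𝔹
  1≤n       : 1 ≤ n
  cells     : ∀ k p → k < 16 → p < n * n + n * n → cell (n * n) k p ≤ 𝔹 × cell (n * n) k p < S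
  _⊑_       : ℕ → ℕ → Set
  ≤⇒⊑       : ∀ {a b} → a ≤ b → a ⊑ b
  ⊑-+       : ∀ {a b c d} → a ⊑ c → b ⊑ d → a + b ⊑ c + d
  ⊑-≤-trans : ∀ {a b c} → a ⊑ b → b ≤ c → a ⊑ c
  ≤-⊑-trans : ∀ {a b c} → a ≤ b → b ⊑ c → a ⊑ c
  flat⊑     : ∀ c → n * n * c ⊑ c
  raw0      : Words n
  cs0       : List Bool

module Machine (setting : Setting) where

 open Setting setting public
 module A = Bounded Hyp S w 𝔹 size𝔹≤w 64≤𝔹
 open A using (unit; ok; Good; Vars; Below; eachCost; small) public
 open Logic ok _⊑_ ≤⇒⊑ ⊑-+ ⊑-≤-trans public

 relax : ∀ {a b p σ} {Q R : CoinState → Set} → a ⊑ b → (∀ {τ} → Q τ → R τ) → A.Ex a p σ Q → Ex b p σ R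
 relax a⊑b h (A.ex run cost safe post) = ex run (≤-⊑-trans cost a⊑b) safe (h post)

 N : ℕ
 N = n * n

 1≤N : 1 ≤ N
 1≤N = *-mono-≤ 1≤n 1≤n

 n≤N : n ≤ N
 n≤N = sym (*-identityʳ n) ≡⟫ *-monoʳ-≤ n 1≤n

 2N≤𝔹 : N + N ≤ 𝔹
 2N≤𝔹 = +-monoˡ-≤ N (m≤m*n N 16) ⟫ sym (cell≡ N 0 N ⊙ +-identityʳ _) ≡⟫ fst (cells 0 N z<s (m<m+n N 1≤N))

 N≤𝔹 : N ≤ 𝔹
 N≤𝔹 = m≤m+n N N ⟫ 2N≤𝔹

 within : ∀ {d v} → v ≤ 1 → suc d ≤ 𝔹 → d + v ≤ 𝔹
 within {d} v≤1 d< = +-monoʳ-≤ d v≤1 ⟫ +-comm d 1 ≡⟫ d<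

 Small : Words n → Set
 Small X = ∀ i j → X i j ≤ 𝔹

 registers : Registers → ℕ → ℕ
 registers ρ 0  = Registers.res ρ
 registers ρ 1  = N
 registers ρ 2  = n
 registers ρ 3  = 1
 registers ρ 4  = L
 registers ρ 5  = r
 registers ρ 6  = suc n
 registers ρ 7  = Registers.k ρ
 registers ρ 8  = Registers.left ρ
 registers ρ 9  = Registers.cur ρ
 registers ρ 10 = Registers.e ρ
 registers ρ 11 = Registers.b1 ρ
 registers ρ 12 = Registers.c ρ
 registers ρ 13 = Registers.b ρ
 registers ρ _  = 0

 ⟨_,_⟩ : Fin n → Fin n → ℕ
 ⟨ i , j ⟩ = toℕ (combine i j)

 ⟨⟩<N : ∀ i j → ⟨ i , j ⟩ < N
 ⟨⟩<N i j = Fin.toℕ<n (combine i j)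

 ⟨⟩<2N : ∀ i j → ⟨ i , j ⟩ < N + N
 ⟨⟩<2N i j = <-≤-trans (⟨⟩<N i j) (m≤m+n N N)

 ⟨⟩-injective : ∀ {i j k l} → ⟨ i , j ⟩ ≡ ⟨ k , l ⟩ → i ≡ k × j ≡ l
 ⟨⟩-injective {i} {j} {k} {l} e = Fin.combine-injective i j k l (Fin.toℕ-injective e)

 place : ∀ i j → ⟨ i , j ⟩ ≡ toℕ i * n + toℕ j
 place i j = Fin.toℕ-combine i j ⊙ cong (_+ toℕ j) (*-comm n (toℕ i))

 at-row-major : ∀ q → let (i , j) = remQuot {n} n q in toℕ q * 1 ≡ ⟨ i , j ⟩
 at-row-major q = *-identityʳ _ ⊙ cong toℕ (sym (Fin.combine-remQuot {n} n q))

 at-diagonal : ∀ i → toℕ i * suc n ≡ ⟨ i , i ⟩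
 at-diagonal i = *-suc (toℕ i) n ⊙ +-comm (toℕ i) _ ⊙ sym (place i i)

 all-entries : ∀ (P : ℕ → Set) → (∀ i j → P ⟨ i , j ⟩) → ∀ q → q < N → P q
 all-entries P h q q<N = let (i , j , e) = Fin.combine-surjective (fromℕ< q<N) in
  subst P (cong toℕ e ⊙ Fin.toℕ-fromℕ< q<N) (h i j)

 at : Array → ℕ → ℕ
 at k = cell N (index k)

 at-injective : ∀ {k k'} p p' → at k p ≡ at k' p' → index k ≡ index k' × p ≡ p'
 at-injective {k} {k'} p p' = cell-injective N p p' (index<16 k) (index<16 k')

 low≢at : ∀ j {k} p p' {_ : T (j <ᵇ 3)} → cell N j p ≢ at k p'
 low≢at j {k} p p' {t} e = <⇒≱ (<ᵇ⇒< j 3 t) (m≤m+n 3 (rank k) ⟫≡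
  sym (fst (cell-injective N p p' (<-≤-trans (<ᵇ⇒< j 3 t) (m≤m+n 3 13)) (index<16 k) e)))

 raw≢cell : ∀ {a} k p → a < N → a ≢ cell N k p
 raw≢cell k p a<N e = <⇒≱ a<N (base≤cell N k p ⟫≡ sym e)

 record State (ρ : Registers) (c : Contents n) (τ : CoinState) : Set where
  field
   good   : Good (fst τ)
   vars   : Vars (registers ρ) (fst τ)
   raw    : ∀ i j → heap (fst τ) ⟨ i , j ⟩ ≡ raw0 i j
   array  : ∀ k i j → heap (fst τ) (at k ⟨ i , j ⟩) ≡ c k i j
   stamp  : ∀ a → heap (fst τ) (cell N 1 a) ≤ Registers.stale ρ
   field≤ : ∀ a → heap (fst τ) (cell N 2 a) ≤ Registers.stale ρ
   coins  : snd τ ≡ cs0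

 Triple : ℕ → Prog CoinOp → Registers → Contents n → Registers → Contents n → Set
 Triple t p ρ c ρ' c' = ∀ {τ} → State ρ c τ → Ex t p τ (State ρ' c')

 state-cong : ∀ {ρ c c' τ} → (∀ k i j → c k i j ≡ c' k i j) → State ρ c τ → State ρ c' τ
 state-cong h s = record { State s ; array = λ k i j → State.array s k i j ⊙ h k i j }

 same-vars : ∀ {ρ s s′} → Below 18 s s′ → Vars (registers ρ) s → Vars (registers ρ) s′
 same-vars b = A.below-vars (A.below-weaken (m≤m+n 16 2) b)

 ∧-true : ∀ {a} → T a → T (a ∧ true)
 ∧-true {true} t = t

 initially : (ℕ → ℕ) → Store ℕ
 initially v = store v (λ _ → 0)

 same-heap : ∀ {ρ ρ' c s s′ cs} → heap s′ ≡ heap s → Good s′ → Vars (registers ρ') s′ → Registers.stale ρ ≤ Registers.stale ρ' → State ρ c (s , cs) → State ρ' c (s′ , cs)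
 same-heap refl g vs stale≤ st = record { State st ; good = g ; vars = vs ; stamp = λ a → State.stamp st a ⟫ stale≤ ; field≤ = λ a → State.field≤ st a ⟫ stale≤ }

 compute : ∀ o ρ ρ' {c} {_ : T (A.pure [ o ])} {_ : T (A.local 0 [ o ])} → A.Needs [ o ] (initially (registers ρ)) →
  (∀ y → T (y <ᵇ 16) → var (execInt o (initially (registers ρ))) y ≡ registers ρ' y) → Registers.stale ρ ≤ Registers.stale ρ' →
  Triple unit ‹ int o › ρ c ρ' c
 compute o ρ ρ' {c} {p} {l} needs h stale≤ {s , cs} st =
  let (a , e , f) = A.lift [ o ] {s} {registers ρ} p (A.look vars) ; (cost , g , _) = A.main-op 0 o [] l good (f needs) in
  ex-op (A.fits good) cost (same-heap e g (A.holding λ y l → a y l ⊙ h y l) stale≤ st)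
  where open State st using (good; vars)

 extractCost bitCost : ℕ → ℕ
 extractCost E = E * (unit + 2 * unit) + unit + 3 * unit
 bitCost E = 8 * unit + (1 * unit + extractCost E)

 record Extracted (s : Store ℕ) (cs : List Bool) (τ : CoinState) : Set where
  field
   good  : Good (fst τ)
   coins : snd τ ≡ cs
   heap≡ : heap (fst τ) ≡ heap s
   kept  : Below 24 s (fst τ)
   value : var (fst τ) 24 ≡ bit (var s 25) (var s 24)

 ex-extract : ∀ {E s cs} → Good s → var s 3 ≡ 1 → var s 25 ≤ E → A.Ex (extractCost E) extract (s , cs) (Extracted s cs)
 ex-extract {E} {s} {cs} g one v≤E = A.weaken (+-monoˡ-≤ (3 * unit) (+-monoˡ-≤ unit (*-monoˡ-≤ (unit + 2 * unit) v≤E))) id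
  (A.ex-repeat I (λ (g , _ , _ , _ , e , _) → A.fits g , A.size≤unit (A.vars g 25 tt) , e) step (var s 25) (g , refl , refl , A.below-refl , refl , refl)
   A.⨟ λ { {s1 , _} (g , refl , h , b , _ , e) →
    A.imply (λ { (refl , g' , b') → record { good = g' ; coins = refl ; heap≡ = h ; kept = A.below-trans b b' ; value = cong parity e } })
     (A.run-line 24 (half 26 24 ∷ add 26 26 26 ∷ sub 24 24 26 ∷ []) g (double-half≤ (var s1 24) ⟫ A.vars g 24 tt , tt)) })
  where
  I : ℕ → CoinState → Set
  I j (s′ , cs') = Good s′ × cs' ≡ cs × heap s′ ≡ heap s × Below 24 s s′ × var s′ 25 ≡ j × halves j (var s′ 24) ≡ halves (var s 25) (var s 24)
  step : ∀ {j σ} → I (suc j) σ → A.Ex (2 * unit) (line (half 24 24 ∷ sub 25 25 3 ∷ [])) σ (I j)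
  step {j} {s′ , _} (g , refl , h , b , e , v) = A.imply
   (λ { (refl , g' , b') → g' , refl , h , A.below-trans b b' , cong₂ _∸_ e (A.same b 3 tt ⊙ one) , v })
   (A.run-line 24 (half 24 24 ∷ sub 25 25 3 ∷ []) g tt)

 flatCost : ℕ → ℕ
 flatCost t = t + 6 * unit

 flat-cost : ∀ t → eachCost N t ⊑ flatCost t
 flat-cost t = ≤-⊑-trans (begin
  2 * unit + (N * (unit + (t + 2 * unit)) + unit)
   ≡⟨ solve 3 (λ u x t → con 2 :* u :+ (x :* (u :+ (t :+ con 2 :* u)) :+ u) := x :* (t :+ con 3 :* u) :+ con 3 :* u) refl unit N t ⟩
  N * (t + 3 * unit) + 3 * unit
   ≤⟨ +-monoʳ-≤ (N * (t + 3 * unit)) (sym (+-identityʳ (3 * unit)) ≡⟫ *-monoˡ-≤ (3 * unit) 1≤N) ⟩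
  N * (t + 3 * unit) + N * (3 * unit)
   ≡⟨ solve 3 (λ u x t → x :* (t :+ con 3 :* u) :+ x :* (con 3 :* u) := x :* (t :+ con 6 :* u)) refl unit N t ⟩
  N * (t + 6 * unit) ∎) (flat⊑ (flatCost t))
  where
  open ≤-Reasoning

 productCost : ℕ → ℕ
 productCost E = bitCost E + (1 * unit + (bitCost E + (2 * unit + (8 * unit + (1 * unit + 8 * unit)))))

 emitCost hitCost tallyCost : ℕ
 emitCost  = 8 * unit + (3 * unit + (8 * unit + (2 * unit + 8 * unit)))
 hitCost   = 1 * unit + (8 * unit + (2 * unit + 8 * unit))
 tallyCost = 8 * unit + (8 * unit + (1 * unit + 8 * unit))

 below-18 : ∀ {s s′ : Store ℕ} x {_ : T (18 ≤ᵇ x)} → (∀ y → T (y <ᵇ 30) → (x ≡ᵇ y) ≡ false → var s′ y ≡ var s y) → Below 18 s s′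
 below-18 x {18≤x} keep = A.below λ y l → keep y (<⇒<ᵇ (<ᵇ⇒< y 18 l ⟫ m≤m+n 18 12)) (differs y l)
  where
  differs : ∀ y → T (y <ᵇ 18) → (x ≡ᵇ y) ≡ false
  differs y y<18 with x ≡ᵇ y in eq
  ... | false = refl
  ... | true with ≡ᵇ⇒≡ x y (subst T (sym eq) tt)
  ...   | refl = contradiction (≤ᵇ⇒≤ 18 x 18≤x) (<⇒≱ (<ᵇ⇒< x 18 y<18))

 module _ {ρ : Registers} where

  private
   room : ∀ k {s p} → k < 16 → Vars (registers ρ) s → ∀ {q} → p ≡ q → q < N + N → k ≤ 𝔹 × cell (var s 1) k p ≤ 𝔹 × cell (var s 1) k p < S × cell (var s 1) k p ≡ cell N k q
   room k {s} {p} k<16 vs {q} e q< = <⇒≤ k<16 ⟫ small {16} tt , location ≡⟫ fst (cells k q k<16 q<) ,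
    subst (_< S) (sym location) (snd (cells k q k<16 q<)) , location
    where
    location : cell (var s 1) k p ≡ cell N k q
    location = cong₂ (λ b p → cell b k p) (A.look vs 1 tt) e

  get : ∀ {s cs q} x k p {_ : T (x <ᵇ 30)} {_ : T (p <ᵇ 32)} {l : T (18 ≤ᵇ x)} {_ : T (k <ᵇ 16)} → Good s → Vars (registers ρ) s →
   var s p ≡ q → q < N + N → heap s (cell N k q) ≤ 𝔹 →
   A.Ex (8 * unit) (fetch x k p) (s , cs) (λ (s′ , cs') → Good s′ × cs' ≡ cs × heap s′ ≡ heap s ×
    (∀ y → T (y <ᵇ 30) → (x ≡ᵇ y) ≡ false → var s′ y ≡ var s y) × Below 18 s s′ × var s′ x ≡ heap s (cell N k q))
  get {s} x k p {x<} {p<} {l} {k<} g vs e q< v≤ = let (k≤ , c≤ , _ , location) = room k (<ᵇ⇒< k 16 k<) vs e q< in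
   A.imply (λ { {s′ , _} (m , keep , v) → A.good1 m , A.coins1 m , A.heap1 m , keep , below-18 {s} {s′} x {l} keep , v ⊙ cong (heap s) location })
    (A.ex-fetch x< p< g k≤ c≤ (subst (_≤ 𝔹) (cong (heap s) (sym location)) v≤))

  record Stored (cs : List Bool) (ad v : ℕ) (s : Store ℕ) (τ : CoinState) : Set where
   field
    good    : Good (fst τ)
    kept    : Below 18 s (fst τ)
    coins   : snd τ ≡ cs
    updated : ∀ a → heap (fst τ) a ≡ (heap s [ ad ↦ v ]) a

  Written : (ad v : ℕ) (s : Store ℕ) → CoinState → Set
  Written = Stored cs0

  put : ∀ {s s1 cs q v} k p x {_ : T (k <ᵇ 16)} {_ : T (x <ᵇ 30)} {_ : T (p <ᵇ 32)} → Good s1 → Vars (registers ρ) s1 → Below 18 s s1 → heap s1 ≡ heap s →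
   var s1 p ≡ q → q < N + N → var s1 x ≡ v → A.Ex (8 * unit) (stash k p x) (s1 , cs) (Stored cs (cell N k q) v s)
  put {s} k p x {l} {x<} {p<} g vs kept refl e q< v≡ = let (k≤ , c≤ , c< , location) = room k (<ᵇ⇒< k 16 l) vs e q< in
   A.imply (λ (g , cs≡ , b , h) → record { good = g ; kept = A.below-trans kept (A.below-weaken (m≤m+n 18 12) b) ; coins = cs≡
    ; updated = λ a → cong (λ h → h a) h ⊙ cong₂ (λ p v → (heap s [ p ↦ v ]) a) location v≡ })
    (A.ex-stash x< p< g k≤ c≤ c<)

  -- The state τ while entry (i, j) is processed, starting from s.
  record Entry (c : Contents n) (i j : Fin n) (s : Store ℕ) (τ : CoinState) : Set where
   field
    good   : Good (fst τ)
    vars   : Vars (registers ρ) (fst τ)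
    here : var (fst τ) 16 ≡ ⟨ i , j ⟩
    kept   : Below 18 s (fst τ)
    heap≡  : heap (fst τ) ≡ heap s
    coins  : snd τ ≡ cs0
    raw    : heap s ⟨ i , j ⟩ ≡ raw0 i j
    array  : ∀ k → heap s (at k ⟨ i , j ⟩) ≡ c k i j

  move : ∀ {c i j s s1 s2 cs2} → Good s2 → Below 18 s1 s2 → heap s2 ≡ heap s1 → cs2 ≡ cs0 → ∀ {cs1} → Entry c i j s (s1 , cs1) → Entry c i j s (s2 , cs2)
  move g b h cs≡ en = record { good = g ; vars = same-vars {ρ} b vars ; here = A.same b 16 tt ⊙ here ; kept = A.below-trans kept b
                             ; heap≡ = h ⊙ heap≡ ; coins = cs≡ ; raw = raw ; array = array }
   where open Entry en

  module _ {c : Contents n} {i j : Fin n} {s : Store ℕ} where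

   read : ∀ x k {_ : T (x <ᵇ 30)} {l : T (18 ≤ᵇ x)} → c k i j ≤ 𝔹 → ∀ {s1 cs1} → Entry c i j s (s1 , cs1) →
    A.Ex (8 * unit) (fetch x (index k) 16) (s1 , cs1) (λ τ → Entry c i j s τ × var (fst τ) x ≡ c k i j × (∀ y → T (y <ᵇ 30) → (x ≡ᵇ y) ≡ false → var (fst τ) y ≡ var s1 y))
   read x k {x<} {l} v≤ {s1} en = A.imply
    (λ (g , cs≡ , h , keep , b , v) → move g b h (cs≡ ⊙ coins) en , v ⊙ value , keep)
    (get x (index k) 16 {x<} {tt} {l} {array! k} good vars here (⟨⟩<2N i j) (value ≡⟫ v≤))
    where
    open Entry en
    value : heap s1 (at k ⟨ i , j ⟩) ≡ c k i j
    value = cong (λ h → h (at k ⟨ i , j ⟩)) heap≡ ⊙ array k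

   calc : ∀ os {_ : T (A.local 18 os)} {s1 cs1} → heap (execs os s1) ≡ heap s1 → A.Needs os s1 → Entry c i j s (s1 , cs1) →
    A.Ex (length os * unit) (line os) (s1 , cs1) (λ τ → τ ≡ (execs os s1 , cs1) × Entry c i j s (execs os s1 , cs1))
   calc os {l} h needs en = A.imply (λ (e , g , b) → e , move g b h (Entry.coins en) en) (A.run-line 18 os {_} {_} {l} (Entry.good en) needs)

   write : ∀ k p x {v q} {_ : T (k <ᵇ 16)} {_ : T (x <ᵇ 30)} {_ : T (p <ᵇ 32)} {τ} → Entry c i j s τ → var (fst τ) p ≡ q → q < N + N → var (fst τ) x ≡ v →
    A.Ex (8 * unit) (stash k p x) τ (Written (cell N k q) v s)
   write k p x {_} {_} {l} {x<} {p<} {s1 , _} en e q< v with Entry.coins en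
   ... | refl = put k p x {l} {x<} {p<} (Entry.good en) (Entry.vars en) (Entry.kept en) (Entry.heap≡ en) e q< v

   read-bit : ∀ {E} k v {_ : T (v <ᵇ 16)} → c k i j ≤ 𝔹 → registers ρ v ≤ E → ∀ {s1 cs1} → Entry c i j s (s1 , cs1) →
    A.Ex (bitCost E) (takeBit (index k) v) (s1 , cs1) (λ τ → Entry c i j s τ × var (fst τ) 24 ≡ bit (registers ρ v) (c k i j) × (∀ y → T (y <ᵇ 24) → var (fst τ) y ≡ var s1 y))
   read-bit {E} k v {v<16} b vE {s1} en = read 24 k b en A.⨟ λ { {s2 , _} (en2 , e2 , keep2) →
    let exponent : var s2 v + var s2 15 ≡ registers ρ v
        exponent = cong₂ _+_ (A.look (Entry.vars en2) v v<16) (A.look (Entry.vars en2) 15 tt) ⊙ +-identityʳ _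
        v≤𝔹 = subst (_≤ 𝔹) (A.look (Entry.vars en2) v v<16) (A.vars (Entry.good en2) v (A.<32 v v<16))
    in calc (add 25 v 15 ∷ []) {∧-true (A.<32 v v<16)} refl (exponent ≡⟫ v≤𝔹 , tt) en2 A.⨟ λ { (refl , en3) →
    A.imply
     (λ { {s4 , _} x → move (Extracted.good x) (A.below-weaken (m≤m+n 18 6) (Extracted.kept x)) (Extracted.heap≡ x) (Extracted.coins x ⊙ Entry.coins en3) en3
            , Extracted.value x ⊙ cong₂ bit exponent e2
            , λ y y<24 → A.same (Extracted.kept x) y y<24 ⊙ A.same (A.below-var {24} {s2} 25 (var s2 v + var s2 15) tt) y y<24 ⊙
                keep2 y (<⇒<ᵇ (<ᵇ⇒< y 24 y<24 ⟫ m≤m+n 24 6)) (differs y y<24) })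
     (ex-extract (Entry.good en3) (A.look (Entry.vars en3) 3 tt) (exponent ≡⟫ vE)) } }
    where
    differs : ∀ y → T (y <ᵇ 24) → (24 ≡ᵇ y) ≡ false
    differs y l with 24 ≡ᵇ y in eq
    ... | false = refl
    ... | true  = contradiction (<ᵇ⇒< y 24 l) (≤⇒≯ (≤-reflexive (≡ᵇ⇒≡ 24 y (subst T (sym eq) tt))))

  private
   copies : ∀ src k {c i j s} → c src i j ≤ 𝔹 → Entry c i j s (s , cs0) → A.Ex (8 * unit + 8 * unit) (copying src k) (s , cs0) (Written (at k ⟨ i , j ⟩) (c src i j) s)
   copies src k {i = i} {j} b en = read 20 src b en A.⨟ λ { (en , e , _) → write (index k) 16 20 {_} {_} {array! k} en (Entry.here en) (⟨⟩<2N i j) e }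

  -- Loops over entries pos(q), which write Φ(pos(q)) to the cell ad(pos(q)).
  record Looped {C : ℕ} (ad : ℕ → ℕ) (pos : Fin C → Fin n × Fin n) (Φ : Fin n → Fin n → ℕ) (s : Store ℕ) (τ : CoinState) : Set where
   field
    good  : Good (fst τ)
    vars  : Vars (registers ρ) (fst τ)
    coins : snd τ ≡ cs0
    done  : ∀ q → let (i , j) = pos q in heap (fst τ) (ad ⟨ i , j ⟩) ≡ Φ i j
    rest  : ∀ a → (∀ q → let (i , j) = pos q in a ≢ ad ⟨ i , j ⟩) → heap (fst τ) a ≡ heap s a

  entries-loop : ∀ {c count stride C d body t} → A.Loop (registers ρ) count stride C d → .{{NonZero d}} →
   (pos : Fin C → Fin n × Fin n) → (∀ q → let (i , j) = pos q in toℕ q * d ≡ ⟨ i , j ⟩) →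
   (ad : ℕ → ℕ) → (∀ p q → ad p ≡ ad q → p ≡ q) → (∀ p q → p < N → p ≢ ad q) → (∀ k p q → at k p ≡ ad q → p ≡ q) → (Φ : Fin n → Fin n → ℕ) →
   ∀ {s0} → (∀ q {s} → let (i , j) = pos q in (∀ a → (∀ q → a ≢ ad q) → heap s a ≡ heap s0 a) → Entry c i j s (s , cs0) → A.Ex t body (s , cs0) (Written (ad ⟨ i , j ⟩) (Φ i j) s)) →
   State ρ c (s0 , cs0) → A.Ex (eachCost C t) (each count stride body) (s0 , cs0) (Looped ad pos Φ s0)
  entries-loop L pos pos≡ ad injective raw≢ad same-entry Φ body st = A.imply
   (λ { {s′ , _} (g , vs , c , done , rest) → record
    { good = g ; vars = vs ; coins = c
    ; done = λ q → cong (λ p → heap s′ (ad p)) (sym (pos≡ q)) ⊙ done q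
    ; rest = λ a away → rest a λ q e → away q (e ⊙ cong ad (pos≡ q)) } })
   (A.ex-map L ad injective (λ q → let (i , j) = pos q in Φ i j) (λ q {s1} g vs e16 _ rest → let (i , j) = pos q in A.imply
       (λ w → Stored.kept w , Stored.good w , Stored.coins w , λ a → Stored.updated w a ⊙ cong (λ p → (heap s1 [ ad p ↦ Φ i j ]) a) (sym (pos≡ q)))
       (body q (λ a away → rest a λ p _ → away _) record { good = g ; vars = vs ; here = e16 ⊙ pos≡ q ; kept = A.below-refl ; heap≡ = refl ; coins = refl
        ; raw = (rest _ λ p _ e → raw≢ad _ _ (⟨⟩<N i j) e) ⊙ raw i j
        ; array = λ k → (rest _ λ p p<q e → <⇒≢ p<q (*-cancelʳ-≡ p (toℕ q) _ (sym (same-entry k _ _ e) ⊙ sym (pos≡ q)))) ⊙ array k i j }))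
    good vars (λ _ → refl))
   where open State st

  flat : A.Loop (registers ρ) 1 3 N 1
  flat = record { count<16 = tt ; stride<16 = tt ; count≡ = refl ; stride≡ = refl ; zero≡ = refl ; one≡ = refl
                ; C≤ = N≤𝔹 ; Cd≤ = *-identityʳ N ≡⟫ N≤𝔹 }

  diagonal : A.Loop (registers ρ) 2 6 n (suc n)
  diagonal = record { count<16 = tt ; stride<16 = tt ; count≡ = refl ; stride≡ = refl ; zero≡ = refl ; one≡ = refl
                    ; C≤ = n≤N ⟫ N≤𝔹 ; Cd≤ = *-suc n n ≡⟫ +-monoˡ-≤ N n≤N ⟫ 2N≤𝔹 }

  module _ {c : Contents n} where

   entry≤ : ∀ {s cs} → State ρ c (s , cs) → ∀ k {b} → (∀ i j → c k i j ≤ b) → ∀ q → q < N → heap s (at k q) ≤ b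
   entry≤ {s} st k {b} h = all-entries (λ q → heap s (at k q) ≤ b) λ i j → State.array st k i j ≡⟫ h i j

   stored : ∀ {C} k {pos : Fin C → Fin n × Fin n} {Φ s τ} (X : Words n) → Looped (at k) pos Φ s τ → State ρ c (s , cs0) →
    (∀ i j → (∃[ q ] pos q ≡ (i , j) × Φ i j ≡ X i j) ⊎ ((∀ q → pos q ≢ (i , j)) × c k i j ≡ X i j)) → State ρ (c [ k ≔ X ]) τ
   stored k {pos} {Φ} {s} {s′ , _} X lo st covers = record
    { good = good ; vars = vars
    ; raw = λ i j → (rest _ λ q → raw≢cell (index k) (p q) (⟨⟩<N i j)) ⊙ State.raw st i j
    ; array = λ k' i j → put-elim (λ k' Y → heap s′ (at k' ⟨ i , j ⟩) ≡ Y i j) c k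
        (λ k' e → cong (λ a → heap s′ (cell N a ⟨ i , j ⟩)) (sym e) ⊙ own i j (covers i j))
        (λ k' ≢ → (rest _ λ q e → ≢ (sym (fst (at-injective {k'} {k} ⟨ i , j ⟩ (p q) e)))) ⊙ State.array st k' i j) k'
    ; stamp = λ a → (rest _ λ q → low≢at 1 {k} a (p q)) ≡⟫ State.stamp st a
    ; field≤ = λ a → (rest _ λ q → low≢at 2 {k} a (p q)) ≡⟫ State.field≤ st a
    ; coins = coins }
    where
    open Looped lo
    p : ∀ q → ℕ
    p q = let (i , j) = pos q in ⟨ i , j ⟩
    own : ∀ i j → (∃[ q ] pos q ≡ (i , j) × Φ i j ≡ X i j) ⊎ ((∀ q → pos q ≢ (i , j)) × c k i j ≡ X i j) → heap s′ (at k ⟨ i , j ⟩) ≡ X i j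
    own i j (inj₁ (q , refl , e)) = done q ⊙ e
    own i j (inj₂ (away , e))     = (rest _ λ q e' → away q (let (l , r) = ⟨⟩-injective (snd (at-injective {k} {k} ⟨ i , j ⟩ (p q) e')) in sym (cong₂ _,_ l r))) ⊙ State.array st k i j ⊙ e

   flat-loop-at : ∀ k {t body} (X : Words n) → ∀ {s0} → State ρ c (s0 , cs0) →
    (∀ i j {s} → (∀ a → (∀ q → a ≢ at k q) → heap s a ≡ heap s0 a) → Entry c i j s (s , cs0) → A.Ex t body (s , cs0) (Written (at k ⟨ i , j ⟩) (X i j) s)) →
    Ex (flatCost t) (each 1 3 body) (s0 , cs0) (State ρ (c [ k ≔ X ]))
   flat-loop-at k {t} X st body = relax (flat-cost t) (λ lo → stored k X lo st λ i j → inj₁ (combine i j , Fin.remQuot-combine i j , refl))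
    (entries-loop flat (remQuot n) at-row-major (at k) (λ p q e → snd (at-injective {k} {k} p q e)) (λ p q p<N → raw≢cell (index k) q p<N)
     (λ k' p q e → snd (at-injective {k'} {k} p q e)) X (λ q → let (i , j) = remQuot {n} n q in body i j) st)

   flat-loop : ∀ k {t body} (X : Words n) → (∀ i j {s} → Entry c i j s (s , cs0) → A.Ex t body (s , cs0) (Written (at k ⟨ i , j ⟩) (X i j) s)) →
    Triple (flatCost t) (each 1 3 body) ρ c ρ (c [ k ≔ X ])
   flat-loop k X body {s , _} st with State.coins st
   ... | refl = flat-loop-at k X st λ i j _ → body i j

   diagonal-loop : ∀ k {t body} (d : Fin n → ℕ) → (∀ i {s} → Entry c i i s (s , cs0) → A.Ex t body (s , cs0) (Written (at k ⟨ i , i ⟩) (d i) s)) →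
    Triple (flatCost t) (each 2 6 body) ρ c ρ (c [ k ≔ withDiagonal L d (c k) ])
   diagonal-loop k {t} {body} d step {s , _} st with State.coins st
   ... | refl = relax (≤-⊑-trans (+-monoʳ-≤ (2 * unit) (+-monoˡ-≤ unit (*-monoˡ-≤ (unit + (t + 2 * unit)) n≤N))) (flat-cost t))
       (λ lo → stored k _ lo st λ i j → covers i j (i Fin.≟ j))
       (A.imply id (entries-loop diagonal (λ i → i , i) at-diagonal (at k) (λ p q e → snd (at-injective {k} {k} p q e)) (λ p q p<N → raw≢cell (index k) q p<N)
        (λ k' p q e → snd (at-injective {k'} {k} p q e)) (λ i j → d i) (λ i _ → step i) st))
    where
    covers : ∀ i j → Dec (i ≡ j) → (∃[ q ] (q , q) ≡ (i , j) × d i ≡ withDiagonal L d (c k) i j) ⊎ ((∀ q → (q , q) ≢ (i , j)) × c k i j ≡ withDiagonal L d (c k) i j)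
    covers i j (yes refl) = inj₁ (i , refl , sym (withDiagonal-≡ L d (c k) i))
    covers i j (no i≢j)   = inj₂ ((λ { q refl → i≢j refl }) , sym (withDiagonal-≢ L d (c k) i≢j))

   clear : ∀ k → Triple (flatCost (8 * unit)) (each 1 3 (stash (index k) 16 15)) ρ c ρ (c [ k ≔ (λ _ _ → 0) ])
   clear k = flat-loop k _ λ i j en → write (index k) 16 15 {_} {_} {array! k} en (Entry.here en) (⟨⟩<2N i j) (A.look (Entry.vars en) 15 tt)

   copy : ∀ src k → Small (c src) → Triple (flatCost (8 * unit + 8 * unit)) (each 1 3 (copying src k)) ρ c ρ (c [ k ≔ c src ])
   copy src k b = flat-loop k _ λ i j → copies src k (b i j)

   diagonal-constant : ∀ k x {_ : T (x <ᵇ 16)} → Triple (flatCost (8 * unit)) (each 2 6 (stash (index k) 16 x)) ρ c ρ (c [ k ≔ withDiagonal L (λ _ → registers ρ x) (c k) ])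
   diagonal-constant k x {x<} = diagonal-loop k _ λ i en →
    write (index k) 16 x {_} {_} {array! k} {<⇒<ᵇ (<ᵇ⇒< x 16 x< ⟫ m≤m+n 16 14)} en (Entry.here en) (⟨⟩<2N i i) (A.look (Entry.vars en) x x<)

   diagonal-copy : ∀ src k → Small (c src) → Triple (flatCost (8 * unit + 8 * unit)) (each 2 6 (copying src k)) ρ c ρ (c [ k ≔ withDiagonal L (λ i → c src i i) (c k) ])
   diagonal-copy src k b = diagonal-loop k _ λ i → copies src k (b i i)

   bit-slice : ∀ src v k {E} {_ : T (v <ᵇ 16)} → Small (c src) → registers ρ v ≤ E →
    Triple (flatCost (bitCost E + 8 * unit)) (each 1 3 (takeBit (index src) v ▸ stash (index k) 16 24)) ρ c ρ (c [ k ≔ (λ i j → bit (registers ρ v) (c src i j)) ])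
   bit-slice src v k {E} {v<} b vE = flat-loop k _ λ i j en → read-bit src v {v<} (b i j) vE en A.⨟ λ { (en , e , _) →
    write (index k) 16 24 {_} {_} {array! k} en (Entry.here en) (⟨⟩<2N i j) e }

   bit-product : ∀ X Y k {E} → Small (c X) → Small (c Y) → (∀ i j → suc (c k i j) ≤ 𝔹) → Registers.b ρ ≤ E → Registers.c ρ ≤ E →
    Triple (flatCost (productCost E)) (each 1 3 (multiplying X Y k)) ρ c ρ (c [ k ≔ (λ i j → c k i j + bit (Registers.b ρ) (c X i j) * bit (Registers.c ρ) (c Y i j)) ])
   bit-product X Y k X≤ Y≤ k≤ b≤ c≤ = flat-loop k _ λ i j en →
    let β = bit (Registers.b ρ) (c X i j)
        γ = bit (Registers.c ρ) (c Y i j)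
        β≤1 = parity≤1 (halves (Registers.b ρ) (c X i j))
        γ≤1 = parity≤1 (halves (Registers.c ρ) (c Y i j))
    in read-bit X 13 (X≤ i j) b≤ en A.⨟ λ { {s1 , _} (en1 , e1 , _) →
    let first : var s1 24 + var s1 15 ≡ β
        first = cong₂ _+_ e1 (A.look (Entry.vars en1) 15 tt) ⊙ +-identityʳ β
    in calc (add 20 24 15 ∷ []) refl (first ≡⟫ β≤1 ⟫ small {1} tt , tt) en1 A.⨟ λ { {s2 , _} (refl , en2) →
    read-bit Y 12 (Y≤ i j) c≤ en2 A.⨟ λ { {s3 , _} (en3 , e3 , keep3) →
    let sum : var s3 20 + var s3 24 ≡ β + γ
        sum = cong₂ _+_ (keep3 20 tt ⊙ first) e3
    in calc (add 20 20 24 ∷ half 20 20 ∷ []) refl (sum ≡⟫ +-mono-≤ β≤1 γ≤1 ⟫ small {2} tt , tt) en3 A.⨟ λ { (refl , en4) →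
    read 21 k (<⇒≤ (k≤ i j)) en4 A.⨟ λ { {s5 , _} (en5 , e5 , keep5) →
    let total' : var s5 21 + var s5 20 ≡ c k i j + β * γ
        total' = cong₂ _+_ e5 (keep5 20 tt refl ⊙ cong ⌊_/2⌋ sum ⊙ and β γ β≤1 γ≤1)
    in calc (add 21 21 20 ∷ []) refl (total' ≡⟫ within (*-mono-≤ β≤1 γ≤1) (k≤ i j) , tt) en5 A.⨟ λ { (refl , en6) →
    write (index k) 16 21 {_} {_} {array! k} en6 (Entry.here en6) (⟨⟩<2N i j) total' } } } } } }
    where
    and : ∀ b c → b ≤ 1 → c ≤ 1 → ⌊ b + c /2⌋ ≡ b * c
    and zero          _             _        z≤n       = refl
    and zero          _             _        (s≤s z≤n) = refl
    and (suc zero)    _             _        z≤n       = refl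
    and (suc zero)    _             _        (s≤s z≤n) = refl
    and (suc (suc _)) _             (s≤s ())

   emit : ∀ acc k → Small (c acc) → (∀ i j → suc (c k i j + c k i j) ≤ 𝔹) →
    Triple (flatCost emitCost) (each 1 3 (emitting acc k)) ρ c ρ (c [ k ≔ (λ i j → c k i j + c k i j + parity (c acc i j)) ])
   emit acc k acc≤ k≤ = flat-loop k _ λ i j en →
    let d = c k i j in
    read 20 acc (acc≤ i j) en A.⨟ λ { {s1 , _} (en1 , e1 , _) →
    calc (half 21 20 ∷ add 21 21 21 ∷ sub 20 20 21 ∷ []) refl (double-half≤ (var s1 20) ⟫ A.vars (Entry.good en1) 20 tt , tt) en1 A.⨟ λ { {s2 , _} (refl , en2) →
    read 21 k (m≤m+n d d ⟫ <⇒≤ (k≤ i j)) en2 A.⨟ λ { {s3 , _} (en3 , e3 , keep3) →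
    let twice : var s3 21 + var s3 21 ≡ d + d
        twice = cong₂ _+_ e3 e3
        total' : var s3 21 + var s3 21 + var s3 20 ≡ d + d + parity (c acc i j)
        total' = cong₂ _+_ twice (keep3 20 tt refl ⊙ cong parity e1)
    in calc (add 21 21 21 ∷ add 21 21 20 ∷ []) refl
         (twice ≡⟫ <⇒≤ (k≤ i j) , total' ≡⟫ within (parity≤1 (c acc i j)) (k≤ i j) , tt) en3 A.⨟ λ { (refl , en4) →
    write (index k) 16 21 {_} {_} {array! k} en4 (Entry.here en4) (⟨⟩<2N i j) total' } } } }

   -- Input entries other than 0 whose entry in array k is not 0.
   hit : ∀ k k' → Small raw0 → Small (c k) →
    Triple (flatCost hitCost) (each 1 3 (hitting k k')) ρ c ρ (c [ k' ≔ (λ i j → raw0 i j ∸ (1 ∸ c k i j)) ])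
   hit k k' raw≤ k≤ = flat-loop k' _ λ i j {s} en →
    let raw : heap s (var s 16) ≡ raw0 i j
        raw = cong (heap s) (Entry.here en) ⊙ Entry.raw en
    in calc (load 20 16 ∷ []) refl (raw ≡⟫ raw≤ i j , tt) en A.⨟ λ { {s1 , _} (refl , en1) →
    read 21 k (k≤ i j) en1 A.⨟ λ { {s2 , _} (en2 , e2 , keep2) →
    calc (sub 21 3 21 ∷ sub 20 20 21 ∷ []) refl tt en2 A.⨟ λ { (refl , en3) →
    write (index k') 16 20 {_} {_} {array! k'} en3 (Entry.here en3) (⟨⟩<2N i j) (cong₂ _∸_ (keep2 20 tt refl ⊙ raw) (cong₂ _∸_ (A.look (Entry.vars en2) 3 tt) e2)) } } }

   record Tallied (τ : CoinState) : Set where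
    field
     flags  : Words n
     state  : State ρ (c [ flag ≔ flags ]) τ
     zero⊎  : (heap (fst τ) (at flag 0) ≡ 0 × (∀ i j → c hits i j ≡ 0) × (∀ i j → flags i j ≡ c flag i j)) ⊎ (1 ≤ heap (fst τ) (at flag 0) × ∃[ i ] ∃[ j ] c hits i j ≢ 0)
     total≤ : heap (fst τ) (at flag 0) ≤ N

   tally : (∀ i j → c hits i j ≤ 1) → ∀ {τ} → State ρ c τ → heap (fst τ) (at flag 0) ≡ 0 → Ex (flatCost tallyCost) (each 1 3 tallying) τ Tallied
   tally c≤1 {s , _} st empty with State.coins st
   ... | refl = relax (flat-cost tallyCost) finish (A.ex-each flat J step good vars (refl , (λ _ _ → refl) , ≤-reflexive empty , inj₁ (empty , λ _ ())))
    where
    open State st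
    0<2N : 0 < N + N
    0<2N = 1≤N ⟫ m≤m+n N N
    total' : ℕ
    total' = at flag 0
    hit? : ℕ → ℕ
    hit? q = heap s (at hits q)
    Tally : ℕ → (ℕ → ℕ) → Set
    Tally i h = (h total' ≡ 0 × (∀ q → q < i → hit? q ≡ 0)) ⊎ (1 ≤ h total' × ∃[ q ] (q < i × hit? q ≢ 0))
    J : ℕ → (ℕ → ℕ) → List Bool → Set
    J i h cs = cs ≡ cs0 × (∀ a → a ≢ total' → h a ≡ heap s a) × h total' ≤ i × Tally i h
    extend : ∀ i {h h' : ℕ → ℕ} → Tally i h → h' total' ≡ h total' + hit? i → Tally (suc i) h'
    extend i {h} (inj₁ (z , all)) e with hit? i in eq
    ... | zero  = inj₁ (e ⊙ +-identityʳ _ ⊙ z , λ q q≤i → last q (m≤n⇒m<n∨m≡n (s≤s⁻¹ q≤i)))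
     where
     last : ∀ q → q < i ⊎ q ≡ i → hit? q ≡ 0
     last q (inj₁ q<i)  = all q q<i
     last q (inj₂ refl) = eq
    ... | suc v = inj₂ (subst (1 ≤_) (sym (e ⊙ cong (_+ suc v) z)) (s≤s z≤n) , i , ≤-refl , λ z → contradiction (sym eq ⊙ z) λ ())
    extend i (inj₂ (p , q , q<i , nz)) e = inj₂ (p ⟫ m≤m+n _ _ ⟫≡ sym e , q , m<n⇒m<1+n q<i , nz)
    step : ∀ (i : Fin N) {s′ cs} → Good s′ → Vars (registers ρ) s′ → var s′ 16 ≡ toℕ i * 1 → var s′ 17 ≡ N ∸ toℕ i → J (toℕ i) (heap s′) cs →
     A.Ex tallyCost tallying (s′ , cs) (λ (s″ , cs″) → Below 18 s′ s″ × Good s″ × J (suc (toℕ i)) (heap s″) cs″)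
    step i {s′} g vs e16 _ (refl , rest , total≤ , tal) =
     get 20 (index hits) 16 g vs (e16 ⊙ *-identityʳ q) (<-≤-trans q<N (m≤m+n N N)) (value ≡⟫ value≤1 ⟫ small {1} tt) A.⨟ λ { {s1 , _} (g1 , refl , h1 , _ , b1 , v1) →
     let vs1 = same-vars {ρ} b1 vs in
     get 21 (index flag) 15 g1 vs1 (A.look vs1 15 tt) 0<2N (cong (λ h → h total') h1 ≡⟫ total≤ ⟫ <⇒≤ q<N ⟫ N≤𝔹) A.⨟ λ { {s2 , _} (g2 , refl , h2 , keep2 , b2 , v2) →
     let sum : var s2 21 + var s2 20 ≡ heap s′ total' + hit? q
         sum = cong₂ _+_ (v2 ⊙ cong (λ h → h total') h1) (keep2 20 tt refl ⊙ v1 ⊙ value)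
     in A.run-line 18 (add 21 21 20 ∷ []) g2 (sum ≡⟫ sum≤ ⟫ q<N ⟫ N≤𝔹 , tt) A.⨟ λ { (refl , g3 , b3) →
     let b = A.below-trans (A.below-trans b1 b2) b3
         vs3 = same-vars {ρ} b vs
     in A.imply (λ { {s4 , _} w → let open Stored w renaming (good to g4; coins to cs≡) in
         let new : heap s4 total' ≡ heap s′ total' + hit? q
             new = updated total' ⊙ upd-≡ (heap s′) total' (var s2 21 + var s2 20) ⊙ sum
         in kept , g4 , cs≡ , (λ a a≢ → updated a ⊙ (upd-≢ (heap s′) (var s2 21 + var s2 20) λ e → a≢ (sym e)) ⊙ rest a a≢) ,
            subst (_≤ suc q) (sym new) sum≤ , extend q {heap s′} {heap s4} tal new })
      (put {s = s′} (index flag) 15 21 g3 vs3 b (h2 ⊙ h1) (A.look vs3 15 tt) 0<2N refl) } } }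
     where
     q = toℕ i
     q<N = Fin.toℕ<n i
     value : heap s′ (at hits q) ≡ hit? q
     value = rest _ λ e → contradiction (fst (at-injective {hits} {flag} q 0 e)) λ ()
     value≤1 : hit? q ≤ 1
     value≤1 = entry≤ st hits c≤1 q q<N
     sum≤ : heap s′ total' + hit? q ≤ suc q
     sum≤ = +-mono-≤ total≤ value≤1 ⟫≡ +-comm q 1
    finish : ∀ {τ} → Good (fst τ) × Vars (registers ρ) (fst τ) × J N (heap (fst τ)) (snd τ) → Tallied τ
    finish {s′ , _} (g , vs , cs≡ , rest , total≤ , tal) = record
     { flags = flags
     ; state = record
      { good = g ; vars = vs
      ; raw = λ i j → rest _ (raw≢cell (index flag) 0 (⟨⟩<N i j)) ⊙ raw i j
      ; array = λ k i j → put-elim (λ k Y → heap s′ (at k ⟨ i , j ⟩) ≡ Y i j) c flag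
          (λ k e → cong (λ a → heap s′ (cell N a ⟨ i , j ⟩)) (sym e)) (λ k ≢ → (rest _ λ e → ≢ (sym (fst (at-injective {k} {flag} ⟨ i , j ⟩ 0 e)))) ⊙ array k i j) k
      ; stamp = λ a → rest _ (low≢at 1 {flag} a 0) ≡⟫ stamp a
      ; field≤ = λ a → rest _ (low≢at 2 {flag} a 0) ≡⟫ field≤ a
      ; coins = cs≡ }
     ; zero⊎ = translate tal ; total≤ = total≤ }
     where
     flags : Words n
     flags i j = heap s′ (at flag ⟨ i , j ⟩)
     translate : Tally N (heap s′) → (heap s′ total' ≡ 0 × (∀ i j → c hits i j ≡ 0) × (∀ i j → flags i j ≡ c flag i j)) ⊎ (1 ≤ heap s′ total' × ∃[ i ] ∃[ j ] c hits i j ≢ 0)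
     translate (inj₁ (z , all)) = inj₁ (z , (λ i j → sym (array hits i j) ⊙ (all ⟨ i , j ⟩ (⟨⟩<N i j))) , λ i j → unchanged i j (⟨ i , j ⟩ ≟ 0))
      where
      unchanged : ∀ i j → Dec (⟨ i , j ⟩ ≡ 0) → flags i j ≡ c flag i j
      unchanged i j (yes e) = cong (λ p → heap s′ (at flag p)) e ⊙ z ⊙ sym empty ⊙ cong (λ p → heap s (at flag p)) (sym e) ⊙ array flag i j
      unchanged i j (no ≢0) = (rest _ λ e → ≢0 (snd (at-injective {flag} {flag} ⟨ i , j ⟩ 0 e))) ⊙ array flag i j
     translate (inj₂ (p , q , q<N , nz)) = inj₂ (p , all-entries (λ q → hit? q ≢ 0 → ∃[ i ] ∃[ j ] c hits i j ≢ 0) (λ i j nz → i , j , λ z → nz (array hits i j ⊙ z)) q q<N nz)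

open import Data.Nat.ListAction using (sum)

module A2 = Algebraic 𝔽2-field

ivar fvar : ℕ → ℕ
ivar x = 40 + (x + x)
fvar x = 41 + (x + x)

ivar-injective : ∀ {x y} → ivar x ≡ ivar y → x ≡ y
ivar-injective {x} {y} e = n≡⌊n+n/2⌋ x ⊙ cong ⌊_/2⌋ (+-cancelˡ-≡ 40 _ _ e) ⊙ sym (n≡⌊n+n/2⌋ y)

fvar-injective : ∀ {x y} → fvar x ≡ fvar y → x ≡ y
fvar-injective {x} {y} e = ivar-injective (suc-injective e)

ivar≢fvar : ∀ x y → ivar x ≢ fvar y
ivar≢fvar x y e = even≢odd' x y (+-cancelˡ-≡ 40 _ _ (e ⊙ sym (+-suc 40 (y + y))))
 where
 even≢odd' : ∀ x y → x + x ≢ suc (y + y)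
 even≢odd' zero    y ()
 even≢odd' (suc x) zero e = contradiction (sym (+-suc x x) ⊙ suc-injective e) λ ()
 even≢odd' (suc x) (suc y) e = even≢odd' x y (suc-injective (sym (+-suc x x) ⊙ suc-injective e ⊙ cong suc (+-suc y y)))

-- An entry of a simulated heap is valid if it is stamped by the current call. The
-- stamp of an integer follows its value; field elements are represented by stamps.
locate : (k y : ℕ) → Prog CoinOp
locate k y = line (address 32 33 k y [])

mark : ℕ → Prog CoinOp
mark z = ifz z then ‹ int (save 32 15) › else ‹ int (save 32 9) ›

compileInt : IntOp → Prog CoinOp
compileInt (const x k) = ‹ int (const (ivar x) k) ›
compileInt (add x y z) = ‹ int (add (ivar x) (ivar y) (ivar z)) ›
compileInt (sub x y z) = ‹ int (sub (ivar x) (ivar y) (ivar z)) ›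
compileInt (half x y)  = ‹ int (half (ivar x) (ivar y)) ›
compileInt (load x y)  = locate 0 (ivar y) ▸ line (add 34 32 3 ∷ load 34 34 ∷ sub 34 9 34 ∷ []) ▸
 (ifz 34 then ‹ int (load (ivar x) 32) › else ‹ int (const (ivar x) 0) ›)
compileInt (save x y)  = locate 0 (ivar x) ▸ ‹ int (save 32 (ivar y)) › ▸ ‹ int (add 32 32 3) › ▸ mark (ivar y)

compileOp : FieldOp → Prog CoinOp
compileOp (int o)      = compileInt o
compileOp (fzero x)    = ‹ int (const (fvar x) 0) ›
compileOp (fone x)     = ‹ int (const (fvar x) 1) ›
compileOp (fadd x y z) = line (sub 34 (fvar y) (fvar z) ∷ sub 35 (fvar z) (fvar y) ∷ []) ▸ ‹ int (add (fvar x) 34 35) ›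
compileOp (fmul x y z) = line (add 34 (fvar y) (fvar z) ∷ []) ▸ ‹ int (half (fvar x) 34) ›
compileOp (finv x y)   = ‹ int (add (fvar x) (fvar y) 15) ›
compileOp (fload x a)  = locate 2 (ivar a) ▸ line (load 34 32 ∷ sub 34 9 34 ∷ []) ▸ ‹ int (sub (fvar x) 3 34) ›
compileOp (fsave a x)  = locate 2 (ivar a) ▸ mark (fvar x)
compileOp (isZero b x) = ‹ int (sub (ivar b) 3 (fvar x)) ›

compile : Prog FieldOp → Prog CoinOp
compile skip                   = skip
compile ‹ o ›                  = compileOp o
compile (p ⨾ q)                = compile p ⨾ compile q
compile (ifz x then p else q)  = ifz (ivar x) then compile p else compile q
compile (while x loop p)       = while (ivar x) loop compile p

opBound : FieldOp → ℕ
opBound (int (const x k)) = x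
opBound (int (add x y z)) = x + y + z
opBound (int (sub x y z)) = x + y + z
opBound (int (half x y))  = x + y
opBound (int (load x y))  = x + y
opBound (int (save x y))  = x + y
opBound (fzero x)    = x
opBound (fone x)     = x
opBound (fadd x y z) = x + y + z
opBound (fmul x y z) = x + y + z
opBound (finv x y)   = x + y
opBound (fload x a)  = x + a
opBound (fsave a x)  = a + x
opBound (isZero b x) = b + x

varBound : Prog FieldOp → ℕ
varBound skip                  = 0
varBound ‹ o ›                 = opBound o
varBound (p ⨾ q)               = varBound p + varBound q
varBound (ifz x then p else q) = x + varBound p + varBound q
varBound (while x loop p)      = x + varBound p

cost2 : (FieldOp ⊎ ℕ) × A2.FieldState → ℕ
cost2 e = A2.arithmeticCost e + A2.controlCost e

costs2 : List ((FieldOp ⊎ ℕ) × A2.FieldState) → ℕ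
costs2 l = A2.arithmeticOperations l + A2.controlOperations l

costs2-++ : ∀ l l′ → costs2 (l ++ l′) ≡ costs2 l + costs2 l′
costs2-++ l l′ = cong₂ _+_ (sums' A2.arithmeticCost) (sums' A2.controlCost) ⊙
 solve 4 (λ a b c d → (a :+ b) :+ (c :+ d) := (a :+ c) :+ (b :+ d)) refl
  (A2.arithmeticOperations l) (A2.arithmeticOperations l′) (A2.controlOperations l) (A2.controlOperations l′)
 where
 sums' : ∀ f → sum (map f (l ++ l′)) ≡ sum (map f l) + sum (map f l′)
 sums' f = cong sum (map-++ f l l′) ⊙ sum-++ (map f l) (map f l′)

costs2-∷ : ∀ e l → costs2 (e ∷ l) ≡ cost2 e + costs2 l
costs2-∷ e l = solve 4 (λ a b c d → (a :+ b) :+ (c :+ d) := (a :+ c) :+ (b :+ d)) refl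
    (A2.arithmeticCost e) (A2.arithmeticOperations l) (A2.controlCost e) (A2.controlOperations l)

bit≤1 : ∀ b → ⟦ b ⟧ᵇ ≤ 1
bit≤1 true  = ≤-refl
bit≤1 false = z≤n

module Simulation (Hyp : Set) (S w 𝔹 : ℕ) (size𝔹≤w : size 𝔹 ≤ w) (64≤𝔹 : 64 ≤ 𝔹)
 (N cur q Bd S2 w2 : ℕ) (1≤cur : 1 ≤ cur) (sizeN : size N ≤ q) (sizeCur : size cur ≤ q)
 (room : 20 * (q + suc w2) ≤ w) (cells : ∀ k a → k < 3 → a < S2 → cell N k a < S)
 (s0 : Store ℕ) (cs0 : List Bool) (base≡ : var s0 1 ≡ N) (one≡ : var s0 3 ≡ 1) (cur≡ : var s0 9 ≡ cur) (zero≡ : var s0 15 ≡ 0) where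

 open Bounded Hyp S w 𝔹 size𝔹≤w 64≤𝔹 using (ok; when; ok-var; ok-heap; Below; below; same; below-trans; below-var)
 open Logic ok _≤_ id +-mono-≤ ≤-trans

 record Fit (σ : A2.FieldState) : Set where
  constructor fit
  field fitting : Hyp → A2.Fits S2 w2 σ

 open Fit

 Stamped : ℕ → Set → Set → Set
 Stamped h P Q = (h ≡ cur × P) ⊎ (h < cur × Q)

 -- Everything which belongs to the main program is as in s0.
 record Frame (τ : CoinState) : Set where
  field
   main   : Below 32 s0 (fst τ)
   raw    : ∀ a → a < N → heap (fst τ) a ≡ heap s0 a
   array  : ∀ k p → 3 ≤ k → k < 16 → heap (fst τ) (cell N k p) ≡ heap s0 (cell N k p)
   okay   : ok (fst τ)
   coins  : snd τ ≡ cs0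

  base : var (fst τ) 1 ≡ N
  base = same main 1 tt ⊙ base≡

  one : var (fst τ) 3 ≡ 1
  one = same main 3 tt ⊙ one≡

  current : var (fst τ) 9 ≡ cur
  current = same main 9 tt ⊙ cur≡

  nil : var (fst τ) 15 ≡ 0
  nil = same main 15 tt ⊙ zero≡

 -- The state σ of the program over F₂, as represented in τ.
 record Sim (σ : A2.FieldState) (τ : CoinState) : Set where
  field
   ints   : ∀ x → x < Bd → var (fst τ) (ivar x) ≡ var (fst σ) x
   fields : ∀ x → x < Bd → var (fst τ) (fvar x) ≡ ⟦ var (snd σ) x ⟧ᵇ
   iheap  : ∀ a → Stamped (heap (fst τ) (cell N 1 a)) (heap (fst τ) (cell N 0 a) ≡ heap (fst σ) a) (heap (fst σ) a ≡ 0)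
   fheap  : ∀ a → Stamped (heap (fst τ) (cell N 2 a)) (heap (snd σ) a ≡ true) (heap (snd σ) a ≡ false)
   frame  : Frame τ

  open Frame frame public

 open Sim

 stamp≤ : ∀ {h P Q} → Stamped h P Q → h ≤ cur
 stamp≤ (inj₁ (e , _)) = ≤-reflexive e
 stamp≤ (inj₂ (l , _)) = <⇒≤ l

 decode : ∀ {h β} → Stamped h (β ≡ true) (β ≡ false) → 1 ∸ (cur ∸ h) ≡ ⟦ β ⟧ᵇ
 decode (inj₁ (refl , refl)) = cong (1 ∸_) (n∸n≡0 cur)
 decode (inj₂ (l , refl))    = m≤n⇒m∸n≡0 (m<n⇒0<n∸m l)

 private
  D E : ℕ → ℕ
  D c = 20 * (q + c)
  E c = D c + D c

  D-mono : ∀ {c d} → c ≤ d → D c ≤ D d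
  D-mono p = *-monoʳ-≤ 20 (+-monoʳ-≤ q p)

  E-mono : ∀ {a b} → a ≤ b → E a ≤ E b
  E-mono p = +-mono-≤ (D-mono p) (D-mono p)

  c≤D : ∀ {c} → c ≤ D c
  c≤D {c} = m≤n+m c q ⟫ m≤n*m (q + c) 20

  q≤D : ∀ {c x} → x ≤ q → x ≤ D c
  q≤D {c} p = p ⟫ m≤m+n q c ⟫ m≤n*m (q + c) 20

  20≤D : ∀ {c} → 20 ≤ D c
  20≤D {c} = sym (*-identityʳ 20) ≡⟫ *-monoʳ-≤ 20 ((size≥1 N ⟫ sizeN) ⟫ m≤m+n q c)

  fits-D : ∀ {x c} → x ≤ D c → (Hyp → c ≤ w2) → Hyp → x ≤ w
  fits-D x≤ c≤ hyp = x≤ ⟫ D-mono (m≤n⇒m≤1+n (c≤ hyp)) ⟫ room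

  fits-q : ∀ {x} → x ≤ cur → Hyp → size x ≤ w
  fits-q p hyp = q≤D (size-mono p ⟫ sizeCur) ⟫ room

  size-cell : ∀ k v → k < 3 → size (cell N k v) ≤ D (size v)
  size-cell k v k<3 = begin
   size (x + N + k) ≤⟨ size-+ (x + N) k ⟩
   size (x + N) + size k ≤⟨ +-mono-≤ (size-+ x N) (size-mono (<⇒≤ k<3)) ⟩
   size x + size N + 2 ≤⟨ +-mono-≤ (+-mono-≤ (twice (double (double (double v))) (twice (double (double v)) (twice (double v) (twice v ≤-refl)))) sizeN) (*-monoʳ-≤ 2 (size≥1 v)) ⟩
   2 * (2 * (2 * (2 * c))) + q + 2 * c ≤⟨ m≤m+n _ (19 * q + 2 * c) ⟩
   2 * (2 * (2 * (2 * c))) + q + 2 * c + (19 * q + 2 * c)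
    ≡⟨ solve 2 (λ q c → con 2 :* (con 2 :* (con 2 :* (con 2 :* c))) :+ q :+ con 2 :* c :+ (con 19 :* q :+ con 2 :* c) := con 20 :* (q :+ c)) refl q c ⟩
   D c ∎
   where
   open ≤-Reasoning
   c = size v
   x = double (double (double (double v)))
   twice : ∀ x {b} → size x ≤ b → size (double x) ≤ 2 * b
   twice x h = size-+ x x ⟫ +-mono-≤ h (h ⟫ m≤m+n _ 0)

 abstract
  bill : ℕ → ℕ
  bill c = 4000 * (q * c)

  bill≡ : ∀ c → bill c ≡ 4000 * (q * c)
  bill≡ c = refl

  afford : ∀ k c → k ≤ 50 → 1 ≤ c → k * E c ≤ bill c
  afford k c k≤ 1≤c = begin
   k * E c ≤⟨ *-monoˡ-≤ (E c) k≤ ⟩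
   50 * E c ≡⟨ solve 1 (λ y → con 50 :* (con 20 :* y :+ con 20 :* y) := con 2000 :* y) refl (q + c) ⟩
   2000 * (q + c) ≤⟨ *-monoʳ-≤ 2000 (+-mono-≤ (subst (_≤ q * c) (*-identityʳ q) (*-monoʳ-≤ q 1≤c))
                                     (subst (_≤ q * c) (+-identityʳ c) (*-monoˡ-≤ c (size≥1 N ⟫ sizeN)))) ⟩
   2000 * (q * c + q * c) ≡⟨ solve 1 (λ y → con 2000 :* (y :+ y) := con 4000 :* y) refl (q * c) ⟩
   4000 * (q * c) ∎
   where
   open ≤-Reasoning

  bill-+ : ∀ a b → bill a + bill b ≡ bill (a + b)
  bill-+ a b = sym (cong (4000 *_) (*-distribˡ-+ q a b) ⊙ *-distribˡ-+ 4000 (q * a) (q * b))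

  ≤bill : ∀ {c} → c ≤ bill c
  ≤bill {c} = subst (_≤ q * c) (+-identityʳ c) (*-monoˡ-≤ c (size≥1 N ⟫ sizeN)) ⟫ m≤n*m (q * c) 4000

 private
  retag : ∀ k {c p τ} {Q : CoinState → Set} {_ : T (k ≤ᵇ 50)} → 1 ≤ c → Ex (k * E c) p τ Q → Ex (bill c) p τ Q
  retag k {c} {_} {_} {_} {t} 1≤c = weaken (afford k c (≤ᵇ⇒≤ k 50 t) 1≤c) id

  frame-var : ∀ x {v s cs} {_ : T (32 ≤ᵇ x)} → (Hyp → size v ≤ w) → Frame (s , cs) → Frame (setVar x v s , cs)
  frame-var x {v} {s} {_} {t} fv f = record { Frame f ; main = below-trans (Frame.main f) (below-var {32} {s} x v t) ; okay = ok-var x fv (Frame.okay f) }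

  distinct : ∀ {k k'} p p' → k < 16 → k' < 16 → k ≢ k' → cell N k p ≢ cell N k' p'
  distinct p p' k< k'< k≢ e = k≢ (fst (cell-injective N p p' k< k'< e))

  frame-heap : ∀ k a {u s cs} {_ : T (k <ᵇ 3)} → (Hyp → size u ≤ w) → (Hyp → S ≤ cell N k a → u ≡ 0) → Frame (s , cs) → Frame (setHeap (cell N k a) u s , cs)
  frame-heap k a {u} {s} {_} {t} fu zu f = record
   { main = below (same (Frame.main f))
   ; raw = λ x x<N → (upd-≢ (heap s) {cell N k a} {x} u λ e → <⇒≱ x<N (base≤cell N k a ⟫≡ e)) ⊙ Frame.raw f x x<N
   ; array = λ k' p 3≤k' k'<16 → upd-≢ (heap s) u (distinct a p (<-≤-trans k<3 (m≤m+n 3 13)) k'<16 λ { refl → <⇒≱ k<3 3≤k' }) ⊙ Frame.array f k' p 3≤k' k'<16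
   ; okay = ok-heap (cell N k a) fu zu (Frame.okay f) ; coins = Frame.coins f }
   where k<3 = <ᵇ⇒< k 3 t

  set-scratch : ∀ d {v σ s cs} {_ : T (d <ᵇ 8)} → (Hyp → size v ≤ w) → Sim σ (s , cs) → Sim σ (setVar (32 + d) v s , cs)
  set-scratch d {v} {s = s} {_} {t} fv r = record
   { ints = λ x x< → upd-≢ (var s) v (scratch≢ (x + x)) ⊙ ints r x x<
   ; fields = λ x x< → upd-≢ (var s) v (scratch≢ (suc (x + x))) ⊙ fields r x x<
   ; iheap = iheap r ; fheap = fheap r ; frame = frame-var (32 + d) fv (frame r) }
   where
   scratch≢ : ∀ x → 32 + d ≢ 40 + x
   scratch≢ x = <⇒≢ (+-monoʳ-< 32 (<ᵇ⇒< d 8 t) ⟫ m≤m+n 40 x)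

  set-int : ∀ {si tf s cs v} x → Fit (setVar x v si , tf) → Sim (si , tf) (s , cs) → Sim (setVar x v si , tf) (setVar (ivar x) v s , cs)
  set-int {si} {tf} {s} {v = v} x f r = record
   { ints = λ y y< → upd-elim (λ z u → ∀ y → y < Bd → z ≡ ivar y → u ≡ (var si [ x ↦ v ]) y) (var s) (ivar x) v
       (λ y _ e → sym (cong (var si [ x ↦ v ]) (sym (ivar-injective {x} {y} e)) ⊙ upd-≡ (var si) x v))
       (λ z x≢z y y< e → cong (var s) e ⊙ ints r y y< ⊙ sym (upd-≢ (var si) {x} {y} v λ { refl → x≢z (sym e) })) (ivar y) y y< refl
   ; fields = λ y y< → upd-≢ (var s) v (ivar≢fvar x y) ⊙ fields r y y<
   ; iheap = iheap r ; fheap = fheap r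
   ; frame = frame-var (ivar x) (λ hyp → (cong size (sym (upd-≡ (var si) x v)) ≡⟫ fst (fst (fitting f hyp)) x) ⟫
       n≤1+n w2 ⟫ c≤D ⟫ room) (frame r) }

  set-bit : ∀ {si tf s cs} {b : Bool} x → Sim (si , tf) (s , cs) → Sim (si , setVar x b tf) (setVar (fvar x) ⟦ b ⟧ᵇ s , cs)
  set-bit {si} {tf} {s} {b = b} x r = record
   { ints = λ y y< → (upd-≢ (var s) ⟦ b ⟧ᵇ λ e → ivar≢fvar y x (sym e)) ⊙ ints r y y<
   ; fields = λ y y< → upd-elim (λ z u → ∀ y → y < Bd → z ≡ fvar y → u ≡ ⟦ (var tf [ x ↦ b ]) y ⟧ᵇ) (var s) (fvar x) ⟦ b ⟧ᵇ
       (λ y _ e → sym (cong ⟦_⟧ᵇ (cong (var tf [ x ↦ b ]) (sym (fvar-injective {x} {y} e)) ⊙ upd-≡ (var tf) x b)))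
       (λ z x≢z y y< e → cong (var s) e ⊙ fields r y y< ⊙ sym (cong ⟦_⟧ᵇ (upd-≢ (var tf) {x} {y} b λ { refl → x≢z (sym e) }))) (fvar y) y y< refl
   ; iheap = iheap r ; fheap = fheap r ; frame = frame-var (fvar x) (fits-q (bit≤1 b ⟫ 1≤cur)) (frame r) }

  assign : ∀ {si tf s cs o x v t} → Sim (si , tf) (s , cs) → Fit (setVar x v si , tf) → intCost o s ≤ t →
   (∃[ u ] (execInt o s ≡ setVar (ivar x) u s × u ≡ v)) → Ex t ‹ int o › (s , cs) (Sim (setVar x v si , tf))
  assign {x = x} r f c (u , e , refl) = ex-op (okay r) c (subst (λ s′ → Sim _ (s′ , _)) (sym e) (set-int x f r))

  assignBit : ∀ {si tf s cs o x} {b : Bool} {t} → Sim (si , tf) (s , cs) → intCost o s ≤ t →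
   (∃[ u ] (execInt o s ≡ setVar (fvar x) u s × u ≡ ⟦ b ⟧ᵇ)) → Ex t ‹ int o › (s , cs) (Sim (si , setVar x b tf))
  assignBit {x = x} {b} r c (u , e , refl) = ex-op (okay r) c (subst (λ s′ → Sim _ (s′ , _)) (sym e) (set-bit {b = b} x r))

  ex-locate : ∀ k y {σ s cs} → k < 3 → y < Bd → Sim σ (s , cs) → Fit σ → let v = var (fst σ) y in
   Ex (7 * E (size v)) (locate k (ivar y)) (s , cs)
    (λ τ → ∃[ s1 ] (τ ≡ (s1 , cs) × Sim σ (s1 , cs) × var s1 32 ≡ cell N k v))
  ex-locate k y {σ} {s} {cs} k<3 y<Bd r f = imply
   (λ { refl → _ , refl , r7 , cong₂ (λ b v → cell b k v) (base r) v≡ })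
   (ex-line (E c) (address 32 33 k (ivar y) [])
    (okay r , two s0≤ s0≤ , okay r1 , two s1≤ s1≤ , okay r2 , two s2≤ s2≤ , okay r3 , two s3≤ s3≤ ,
     okay r4 , two s4≤ (subst (λ b → size b ≤ D c) (sym (base r)) (q≤D sizeN)) , okay r5 , sk≤ ⟫ m≤m+n (D c) (D c) , okay r6 , two s5≤ sk≤ , okay r7))
   where
   v = var s (ivar y)
   v≡ : v ≡ var (fst σ) y
   v≡ = ints r y y<Bd
   c = size (var (fst σ) y)
   v1 = double v
   v2 = double v1
   v3 = double v2
   v4 = double v3
   two : ∀ {a b} → a ≤ D c → b ≤ D c → a + b ≤ E c
   two = +-mono-≤
   big : ∀ {x} → x ≤ cell (var s 1) k v → size x ≤ D c
   big x≤ = size-mono (x≤ ⟫≡ cong₂ (λ b v → cell b k v) (base r) v≡) ⟫ size-cell k (var (fst σ) y) k<3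
   s6≤ = big ≤-refl
   ≤5 = m≤m+n (v4 + var s 1) k
   ≤4 = m≤m+n v4 (var s 1) ⟫ ≤5
   ≤3 = m≤m+n v3 v3 ⟫ ≤4
   ≤2 = m≤m+n v2 v2 ⟫ ≤3
   ≤1 = m≤m+n v1 v1 ⟫ ≤2
   s5≤ = big ≤5
   s4≤ = big ≤4
   s3≤ = big ≤3
   s2≤ = big ≤2
   s1≤ = big ≤1
   s0≤ = big (m≤m+n v v ⟫ ≤1)
   sk≤ : size k ≤ D c
   sk≤ = size-mono (<⇒≤ k<3) ⟫ m≤m+n 2 18 ⟫ 20≤D
   room-for : ∀ {x} → x ≤ D c → Hyp → x ≤ w
   room-for x≤ = fits-D x≤ λ hyp → fst (fst (fitting f hyp)) y
   r1 = set-scratch 0 (room-for s1≤) r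
   r2 = set-scratch 0 (room-for s2≤) r1
   r3 = set-scratch 0 (room-for s3≤) r2
   r4 = set-scratch 0 (room-for s4≤) r3
   r5 = set-scratch 0 (room-for s5≤) r4
   r6 = set-scratch 1 (room-for sk≤) r5
   r7 = set-scratch 0 (room-for s6≤) r6

  -- Stamping the cell whose address is in variable 32, according to variable z.
  ex-mark : ∀ {s cs a z c} {Q : CoinState → Set} → Frame (s , cs) → var s 32 ≡ a → size a ≤ D c → size (var s z) ≤ D c →
   (var s z ≡ 0 → Q (setHeap a 0 s , cs)) → (var s z ≢ 0 → Q (setHeap a cur s , cs)) → Ex (2 * E c) (mark z) (s , cs) Q
  ex-mark {s} {cs} {a} {z} {c} {Q} f refl a≤ z≤ zero-case stamp-case = imply id
   (ex-ifz (Frame.okay f) (z≤ ⟫ m≤m+n (D c) (D c))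
    (λ e → put (Frame.nil f) z≤n (zero-case e)) (λ e → put (Frame.current f) ≤-refl (stamp-case e)))
   where
   put : ∀ {y u} → var s y ≡ u → u ≤ cur → Q (setHeap (var s 32) u s , cs) → Ex (1 * E c) ‹ int (save 32 y) › (s , cs) Q
   put refl u≤ h = ex-op (Frame.okay f) (+-mono-≤ a≤ (q≤D (size-mono u≤ ⟫ sizeCur)) ⟫ m≤m+n (E c) 0) h

  <Bd : ∀ {x m} → x ≤ m → m < Bd → x < Bd
  <Bd = ≤-<-trans

  size-pair : ∀ {a b a' b'} → a ≡ a' → b ≡ b' → size a + size b ≤ bill (size a' + size b')
  size-pair refl refl = ≤bill

  stamp-size : ∀ {h P Q c} → Stamped h P Q → size h ≤ D c
  stamp-size st = q≤D (size-mono (stamp≤ st) ⟫ sizeCur)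

 sim-int : ∀ o {σ s cs} → opBound (int o) < Bd → Sim σ (s , cs) → Fit σ → Fit (A2.execField (int o) σ) →
  Ex (bill (cost2 (inj₁ (int o) , σ))) (compileInt o) (s , cs) (Sim (A2.execField (int o) σ))
 sim-int (const x k) b r f f' = assign {x = x} r f' ≤bill (k , refl , refl)
 sim-int (add x y z) b r f f' = assign {x = x} r f' (size-pair ey ez) (_ , refl , cong₂ _+_ ey ez)
  where
  ey = ints r y (<Bd (m≤n+m y x ⟫ m≤m+n (x + y) z) b)
  ez = ints r z (<Bd (m≤n+m z (x + y)) b)
 sim-int (sub x y z) b r f f' = assign {x = x} r f' (size-pair ey ez) (_ , refl , cong₂ _∸_ ey ez)
  where
  ey = ints r y (<Bd (m≤n+m y x ⟫ m≤m+n (x + y) z) b)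
  ez = ints r z (<Bd (m≤n+m z (x + y)) b)
 sim-int (half x y) b r f f' = assign {x = x} r f' (cong size ey ≡⟫ ≤bill) (_ , refl , cong ⌊_/2⌋ ey)
  where ey = ints r y (<Bd (m≤n+m y x) b)
 sim-int (load x y) {σ@(si , tf)} b r f f' = retag 12 1≤c (weaken (+-monoˡ-≤ _ (*-monoʳ-≤ 7 (E-mono v≤c)) ⟫≡ tally (E c)) id
  (ex-locate 0 y z<s (<Bd (m≤n+m y x) b) r f ⨟ λ { (s1 , refl , r1 , e1) → second s1 r1 e1 }))
  where
  v = var si y
  c = intCost (load x y) si
  v≤c : size v ≤ c
  v≤c = m≤m+n (size v) _
  1≤c : 1 ≤ c
  1≤c = size≥1 v ⟫ v≤c
  σ' = A2.execField (int (load x y)) σ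
  tally : ∀ e → 7 * e + (3 * e + (e + e)) ≡ 12 * e
  tally = solve 1 (λ e → con 7 :* e :+ (con 3 :* e :+ (e :+ e)) := con 12 :* e) refl
  at : ∀ k → k < 3 → size (cell N k v) ≤ D c
  at k k<3 = size-cell k v k<3 ⟫ D-mono v≤c
  branch : Prog CoinOp
  branch = ifz 34 then ‹ int (load (ivar x) 32) › else ‹ int (const (ivar x) 0) ›
  third : ∀ {s1 cs} → Sim σ (s1 , cs) → var s1 32 ≡ cell N 0 v → var s1 34 ≡ cur ∸ heap s1 (cell N 1 v) → Ex (E c + E c) branch (s1 , cs) (Sim σ')
  third {s1} r1 e1 e2 = ex-ifz (okay r1) (q≤D (size-mono (e2 ≡⟫ m∸n≤m cur (heap s1 (cell N 1 v))) ⟫ sizeCur) ⟫ m≤m+n (D c) (D c))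
   (λ z → let h = valid z (iheap r1 v) in assign {x = x} r1 f'
    (+-mono-≤ (cong size e1 ≡⟫ at 0 z<s) (cong size h ≡⟫ m≤n+m (size (heap si v)) (size v) ⟫ c≤D)) (_ , refl , h))
   (λ nz → assign {x = x} r1 f' (1≤c ⟫ c≤D ⟫ m≤m+n (D c) (D c)) (_ , refl , sym (stale nz (iheap r1 v))))
   where
   valid : var s1 34 ≡ 0 → Stamped (heap s1 (cell N 1 v)) (heap s1 (cell N 0 v) ≡ heap si v) (heap si v ≡ 0) → heap s1 (var s1 32) ≡ heap si v
   valid z (inj₁ (_ , h)) = cong (heap s1) e1 ⊙ h
   valid z (inj₂ (l , _)) = contradiction (m∸n≡0⇒m≤n (sym e2 ⊙ z)) (<⇒≱ l)
   stale : var s1 34 ≢ 0 → Stamped (heap s1 (cell N 1 v)) (heap s1 (cell N 0 v) ≡ heap si v) (heap si v ≡ 0) → heap si v ≡ 0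
   stale nz (inj₁ (e , _)) = contradiction (e2 ⊙ cong (cur ∸_) e ⊙ n∸n≡0 cur) nz
   stale nz (inj₂ (_ , h)) = h
  second : ∀ s1 {cs} → Sim σ (s1 , cs) → var s1 32 ≡ cell N 0 v → Ex (3 * E c + (E c + E c)) (line (add 34 32 3 ∷ load 34 34 ∷ sub 34 9 34 ∷ []) ▸ branch) (s1 , cs) (Sim σ')
  second s1 r1 e1 = ex-line (E c) (add 34 32 3 ∷ load 34 34 ∷ sub 34 9 34 ∷ [])
      ( okay r1 , +-mono-≤ (cong size e1 ≡⟫ at 0 z<s) (size-mono (≤-reflexive (one r1)) ⟫ m≤m+n 1 19 ⟫ 20≤D)
      , okay r2 , +-mono-≤ (cong size next ≡⟫ at 1 (s≤s z<s)) stamp-size'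
      , okay r3 , +-mono-≤ (q≤D (size-mono (≤-reflexive (current r1)) ⟫ sizeCur)) stamp-size' , okay r4)
   ⨟ λ { refl → third r4 e1 (cong₂ _∸_ (current r1) (cong (heap s1) next)) }
   where
   next : var s1 32 + var s1 3 ≡ cell N 1 v
   next = cong₂ _+_ e1 (one r1) ⊙ +-assoc (double (double (double (double v))) + N) 0 1
   stamp : Stamped (heap s1 (var s1 32 + var s1 3)) (heap s1 (cell N 0 v) ≡ heap si v) (heap si v ≡ 0)
   stamp = subst (λ a → Stamped (heap s1 a) (heap s1 (cell N 0 v) ≡ heap si v) (heap si v ≡ 0)) (sym next) (iheap r1 v)
   stamp-size' : size (heap s1 (var s1 32 + var s1 3)) ≤ D c
   stamp-size' = stamp-size stamp
   r2 = set-scratch 2 (fits-D {c = size v} (cong size next ≡⟫ size-cell 1 v (s≤s z<s)) λ hyp → fst (fst (fitting f hyp)) y) r1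
   r3 = set-scratch 2 (fits-q (stamp≤ stamp)) r2
   r4 = set-scratch 2 (fits-q (m∸n≤m (var s1 9) (heap s1 (var s1 32 + var s1 3)) ⟫≡ current r1)) r3
 sim-int (save x y) {σ@(si , tf)} b r f f' = retag 11 1≤c (weaken (+-monoˡ-≤ _ (*-monoʳ-≤ 7 (E-mono a≤c)) ⟫≡ tally (E c)) id
  (ex-locate 0 x z<s (<Bd (m≤m+n x y) b) r f ⨟ λ { (s1 , refl , r1 , e1) → write s1 r1 e1 }))
  where
  a = var si x
  v = var si y
  c = intCost (save x y) si
  a≤c : size a ≤ c
  a≤c = m≤m+n (size a) _
  v≤D : size v ≤ D c
  v≤D = m≤n+m (size v) (size a) ⟫ c≤D
  1≤c : 1 ≤ c
  1≤c = size≥1 a ⟫ a≤c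
  tally : ∀ e → 7 * e + (e + (e + 2 * e)) ≡ 11 * e
  tally = solve 1 (λ e → con 7 :* e :+ (e :+ (e :+ con 2 :* e)) := con 11 :* e) refl
  at : ∀ k → k < 3 → size (cell N k a) ≤ D c
  at k k<3 = size-cell k a k<3 ⟫ D-mono a≤c
  confined : Hyp → ∀ k → k < 3 → S ≤ cell N k a → v ≡ 0
  confined hyp k k<3 S≤ with a <? S2
  ... | yes a<S2 = contradiction (cells k a k<3 a<S2) (≤⇒≯ S≤)
  ... | no a≮S2  = sym (upd-≡ (heap si) a v) ⊙ snd (snd (fst (fitting f' hyp))) a (≮⇒≥ a≮S2)
  value-fits : Hyp → size v ≤ w
  value-fits hyp = fst (fst (fitting f hyp)) y ⟫ n≤1+n w2 ⟫ c≤D ⟫ room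
  write : ∀ s1 {cs} → Sim σ (s1 , cs) → var s1 32 ≡ cell N 0 a →
   Ex (E c + (E c + 2 * E c)) (‹ int (save 32 (ivar y)) › ▸ ‹ int (add 32 32 3) › ▸ mark (ivar y)) (s1 , cs) (Sim (A2.execField (int (save x y)) σ))
  write s1 {cs} r1 e1 =
   _⨟_ {R = _≡ (s2 , cs)} (ex-op (okay r1) (+-mono-≤ (cong size e1 ≡⟫ at 0 z<s) (cong size ey ≡⟫ v≤D)) (cong₂ (λ p u → setHeap p u s1 , cs) e1 ey)) λ { refl →
   _⨟_ {R = _≡ (s3 , cs)} (ex-op (Frame.okay f2) (+-mono-≤ (cong size e1 ≡⟫ at 0 z<s) (size-mono (≤-reflexive (one r1)) ⟫ m≤m+n 1 19 ⟫ 20≤D)) refl) λ { refl →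
   ex-mark {z = ivar y} {c} f3 next (at 1 (s≤s z<s)) (cong size ey ≡⟫ v≤D)
    (λ z → stamped 0 (inj₂ (refl , sym ey ⊙ z)) (fits-q z≤n) λ _ _ → refl)
    (λ nz → stamped cur (inj₁ refl) (fits-q ≤-refl) λ hyp S≤ → contradiction (ey ⊙ confined hyp 1 (s≤s z<s) S≤) nz) } }
   where
   ey : var s1 (ivar y) ≡ v
   ey = ints r1 y (<Bd (m≤n+m y x) b)
   next : var s1 32 + var s1 3 ≡ cell N 1 a
   next = cong₂ _+_ e1 (one r1) ⊙ +-assoc (double (double (double (double a))) + N) 0 1
   s2 s3 : Store ℕ
   s2 = setHeap (cell N 0 a) v s1
   s3 = setVar 32 (var s1 32 + var s1 3) s2
   f2 = frame-heap 0 a value-fits (λ hyp → confined hyp 0 z<s) (frame r1)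
   f3 = frame-var 32 (λ hyp → fits-D (cong size next ≡⟫ size-cell 1 a (s≤s z<s)) (λ hyp → fst (fst (fitting f hyp)) x) hyp) f2
   stamped : ∀ u → (u ≡ cur ⊎ (u ≡ 0 × v ≡ 0)) → (Hyp → size u ≤ w) → (Hyp → S ≤ cell N 1 a → u ≡ 0) → Sim (A2.execField (int (save x y)) σ) (setHeap (cell N 1 a) u s3 , cs)
   stamped u how fu zu = record
    { ints = ints r1 ; fields = fields r1
    ; iheap = λ z → upd-elim (λ z h → Stamped (heap4 (cell N 1 z)) (heap4 (cell N 0 z) ≡ h) (h ≡ 0)) (heap si) a v
        (subst₂ (λ h1 h0 → Stamped h1 (h0 ≡ v) (v ≡ 0)) (sym (upd-≡ (heap s2) (cell N 1 a) u))
         (sym ((other a a 1 0 λ ()) ⊙ upd-≡ (heap s1) (cell N 0 a) v)) (entry how))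
        (λ z a≢z → subst₂ (λ h1 h0 → Stamped h1 (h0 ≡ heap si z) (heap si z ≡ 0))
         (sym (upd-≢ (heap s2) u (a≢z ∘ same-index 1 z) ⊙ upd-≢ (heap s1) v (distinct {0} {1} a z z<s (s≤s z<s) λ ())))
         (sym ((other a z 1 0 λ ()) ⊙ upd-≢ (heap s1) v (a≢z ∘ same-index 0 z))) (iheap r1 z)) z
    ; fheap = λ z → subst (λ h → Stamped h (heap tf z ≡ true) (heap tf z ≡ false))
        (sym ((other a z 1 2 λ ()) ⊙ upd-≢ (heap s1) v (distinct {0} {2} a z z<s (s≤s (s≤s z<s)) λ ()))) (fheap r1 z)
    ; frame = frame-heap 1 a fu zu f3 }
    where
    heap4 : ℕ → ℕ
    heap4 = heap s2 [ cell N 1 a ↦ u ]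
    same-index : ∀ k z {_ : T (k <ᵇ 16)} → cell N k a ≡ cell N k z → a ≡ z
    same-index k z {t} e = snd (cell-injective N a z (<ᵇ⇒< k 16 t) (<ᵇ⇒< k 16 t) e)
    other : ∀ a z k k' {_ : T (k <ᵇ 16)} {_ : T (k' <ᵇ 16)} → k ≢ k' → (heap s2 [ cell N k a ↦ u ]) (cell N k' z) ≡ heap s2 (cell N k' z)
    other a z k k' {t} {t'} ≢ = upd-≢ (heap s2) u (distinct {k} {k'} a z (<ᵇ⇒< k 16 t) (<ᵇ⇒< k' 16 t') ≢)
    entry : (u ≡ cur ⊎ (u ≡ 0 × v ≡ 0)) → Stamped u (v ≡ v) (v ≡ 0)
    entry (inj₁ e)          = inj₁ (e , refl)
    entry (inj₂ (refl , z)) = inj₂ (1≤cur , z)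

 private
  bits-size : ∀ {x y} a b → x ≡ ⟦ a ⟧ᵇ → y ≡ ⟦ b ⟧ᵇ → size x + size y ≤ E 1
  bits-size a b refl refl = +-mono-≤ (tiny a) (tiny b)
   where
   tiny : ∀ a → size ⟦ a ⟧ᵇ ≤ D 1
   tiny a = size-mono (bit≤1 a) ⟫ m≤m+n 1 19 ⟫ 20≤D

 sim-op : ∀ o {σ s cs} → opBound o < Bd → Sim σ (s , cs) → Fit σ → Fit (A2.execField o σ) →
  Ex (bill (cost2 (inj₁ o , σ))) (compileOp o) (s , cs) (Sim (A2.execField o σ))
 sim-op (int o) b r f f' = sim-int o b r f f'
 sim-op (fzero x) b r f f' = assignBit {x = x} {b = false} r ≤bill (0 , refl , refl)
 sim-op (fone x)  b r f f' = assignBit {x = x} {b = true} r ≤bill (1 , refl , refl)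
 sim-op (fadd x y z) {si , tf} {s} b r f f' = retag 3 ≤-refl (weaken (≤-reflexive (+-comm (2 * E 1) (E 1))) id
  (ex-line (E 1) (sub 34 (fvar y) (fvar z) ∷ sub 35 (fvar z) (fvar y) ∷ [])
     (okay r , bits-size β γ ey ez , okay r1 , bits-size γ β ez ey , okay r2) ⨟ λ { refl →
   assignBit {x = x} {b = β xor γ} r2 (bits-size (β ∧ not γ) (γ ∧ not β) d1 d2) (_ , refl , cong₂ _+_ d1 d2 ⊙ xor-bits β γ) }))
  where
  β = var tf y
  γ = var tf z
  ey = fields r y (<Bd (m≤n+m y x ⟫ m≤m+n (x + y) z) b)
  ez = fields r z (<Bd (m≤n+m z (x + y)) b)
  difference : ∀ a b → ⟦ a ⟧ᵇ ∸ ⟦ b ⟧ᵇ ≡ ⟦ a ∧ not b ⟧ᵇ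
  difference true  true  = refl
  difference true  false = refl
  difference false true  = refl
  difference false false = refl
  xor-bits : ∀ a b → ⟦ a ∧ not b ⟧ᵇ + ⟦ b ∧ not a ⟧ᵇ ≡ ⟦ a xor b ⟧ᵇ
  xor-bits true  true  = refl
  xor-bits true  false = refl
  xor-bits false true  = refl
  xor-bits false false = refl
  d1 = cong₂ _∸_ ey ez ⊙ difference β γ
  d2 = cong₂ _∸_ ez ey ⊙ difference γ β
  r1 = set-scratch 2 (fits-q (d1 ≡⟫ bit≤1 (β ∧ not γ) ⟫ 1≤cur)) r
  r2 = set-scratch 3 (fits-q (d2 ≡⟫ bit≤1 (γ ∧ not β) ⟫ 1≤cur)) r1
 sim-op (fmul x y z) {si , tf} {s} b r f f' = retag 2 ≤-refl (weaken (≤-reflexive (+-comm (1 * E 1) (E 1))) id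
  (ex-line (E 1) (add 34 (fvar y) (fvar z) ∷ []) (okay r , bits-size β γ ey ez , okay r1) ⨟ λ { refl →
   assignBit {x = x} {b = β ∧ γ} r1 ((size-mono total≤2 ⟫ m≤m+n 2 18) ⟫ 20≤D ⟫ m≤m+n (D 1) (D 1))
    (_ , refl , cong ⌊_/2⌋ (cong₂ _+_ ey ez) ⊙ and-bits β γ) }))
  where
  β = var tf y
  γ = var tf z
  ey = fields r y (<Bd (m≤n+m y x ⟫ m≤m+n (x + y) z) b)
  ez = fields r z (<Bd (m≤n+m z (x + y)) b)
  total≤2 : var s (fvar y) + var s (fvar z) ≤ 2
  total≤2 = cong₂ _+_ ey ez ≡⟫ +-mono-≤ (bit≤1 β) (bit≤1 γ)
  and-bits : ∀ a b → ⌊ ⟦ a ⟧ᵇ + ⟦ b ⟧ᵇ /2⌋ ≡ ⟦ a ∧ b ⟧ᵇ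
  and-bits true  true  = refl
  and-bits true  false = refl
  and-bits false true  = refl
  and-bits false false = refl
  r1 = set-scratch 2 (λ hyp → size-mono total≤2 ⟫ m≤m+n 2 18 ⟫ 20≤D ⟫ room) r
 sim-op (finv x y) {si , tf} b r f f' = retag 1 ≤-refl (weaken (m≤m+n (E 1) 0) id
  (assignBit {x = x} {b = var tf y} r (bits-size (var tf y) false ey (nil r)) (_ , refl , cong₂ _+_ ey (nil r) ⊙ +-identityʳ _)))
  where ey = fields r y (<Bd (m≤n+m y x) b)
 sim-op (fload x a) {σ@(si , tf)} b r f f' = retag 10 (size≥1 v) (weaken (≤-reflexive (tally (E c))) id
  (ex-locate 2 a (s≤s (s≤s z<s)) (<Bd (m≤n+m a x) b) r f ⨟ λ { (s1 , refl , r1 , e1) → read s1 r1 e1 }))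
  where
  v = var si a
  c = size v
  tally : ∀ e → 7 * e + (2 * e + e) ≡ 10 * e
  tally = solve 1 (λ e → con 7 :* e :+ (con 2 :* e :+ e) := con 10 :* e) refl
  read : ∀ s1 {cs} → Sim σ (s1 , cs) → var s1 32 ≡ cell N 2 v →
   Ex (2 * E c + E c) (line (load 34 32 ∷ sub 34 9 34 ∷ []) ▸ ‹ int (sub (fvar x) 3 34) ›) (s1 , cs) (Sim (A2.execField (fload x a) σ))
  read s1 r1 e1 = ex-line (E c) (load 34 32 ∷ sub 34 9 34 ∷ [])
      ( okay r1 , +-mono-≤ (cong size e1 ≡⟫ size-cell 2 v (s≤s (s≤s z<s))) (stamp-size stamp)
      , okay r2 , +-mono-≤ current≤ (stamp-size stamp) , okay r3) ⨟ λ { refl →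
   assignBit {x = x} {b = heap tf v} r3 (+-mono-≤ (size-mono (≤-reflexive (one r1)) ⟫ m≤m+n 1 19 ⟫ 20≤D)
       (size-mono (m∸n≤m (var s1 9) (heap s1 (var s1 32))) ⟫ current≤))
    (_ , refl , cong₂ _∸_ (one r1) (cong (_∸ heap s1 (var s1 32)) (current r1)) ⊙ decode stamp) }
   where
   stamp : Stamped (heap s1 (var s1 32)) (heap tf v ≡ true) (heap tf v ≡ false)
   stamp = subst (λ p → Stamped (heap s1 p) (heap tf v ≡ true) (heap tf v ≡ false)) (sym e1) (fheap r1 v)
   current≤ : size (var s1 9) ≤ D c
   current≤ = q≤D (size-mono (≤-reflexive (current r1)) ⟫ sizeCur)
   r2 = set-scratch 2 (fits-q (stamp≤ stamp)) r1
   r3 = set-scratch 2 (fits-q (m∸n≤m (var s1 9) (heap s1 (var s1 32)) ⟫≡ current r1)) r2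
 sim-op (fsave a x) {σ@(si , tf)} b r f f' = retag 9 (size≥1 v) (weaken (≤-reflexive (tally (E c))) id
  (ex-locate 2 a (s≤s (s≤s z<s)) (<Bd (m≤m+n a x) b) r f ⨟ λ { (s1 , refl , r1 , e1) →
   let ex' = fields r1 x (<Bd (m≤n+m x a) b) in
   ex-mark {z = fvar x} (frame r1) e1 (size-cell 2 v (s≤s (s≤s z<s))) (size-mono (ex' ≡⟫ bit≤1 β) ⟫ m≤m+n 1 19 ⟫ 20≤D)
    (λ z → put r1 0 (inj₂ (1≤cur , is-false β (sym ex' ⊙ z))) λ _ _ → refl)
    (λ nz → let t = is-true β λ z → nz (ex' ⊙ z) in put r1 cur (inj₁ (refl , t)) λ hyp S≤ → contradiction (sym t ⊙ confined hyp S≤) λ ()) }))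
  where
  v = var si a
  c = size v
  β = var tf x
  tally : ∀ e → 7 * e + 2 * e ≡ 9 * e
  tally = solve 1 (λ e → con 7 :* e :+ con 2 :* e := con 9 :* e) refl
  is-false : ∀ β → ⟦ β ⟧ᵇ ≡ 0 → β ≡ false
  is-false false _ = refl
  is-true : ∀ β → ⟦ β ⟧ᵇ ≢ 0 → β ≡ true
  is-true true  _ = refl
  is-true false n = contradiction refl n
  confined : Hyp → S ≤ cell N 2 v → β ≡ false
  confined hyp S≤ with v <? S2
  ... | yes v<S2 = contradiction (cells 2 v (s≤s (s≤s z<s)) v<S2) (≤⇒≯ S≤)
  ... | no v≮S2  = sym (upd-≡ (heap tf) v β) ⊙ snd (fitting f' hyp) v (≮⇒≥ v≮S2)
  put : ∀ {s2 cs} → Sim σ (s2 , cs) → ∀ u → Stamped u (β ≡ true) (β ≡ false) → (Hyp → S ≤ cell N 2 v → u ≡ 0) → Sim (A2.execField (fsave a x) σ) (setHeap (cell N 2 v) u s2 , cs)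
  put {s2} r2 u st zu = record
   { ints = ints r2 ; fields = fields r2
   ; iheap = λ z → subst₂ (λ h1 h0 → Stamped h1 (h0 ≡ heap si z) (heap si z ≡ 0)) (sym (other z 1 λ ())) (sym (other z 0 λ ())) (iheap r2 z)
   ; fheap = λ z → upd-elim (λ z β → Stamped (heap3 (cell N 2 z)) (β ≡ true) (β ≡ false)) (heap tf) v β
       (subst (λ h → Stamped h (β ≡ true) (β ≡ false)) (sym (upd-≡ (heap s2) (cell N 2 v) u)) st)
       (λ z v≢z → subst (λ h → Stamped h (heap tf z ≡ true) (heap tf z ≡ false))
        (sym (upd-≢ (heap s2) u λ e → v≢z (snd (cell-injective N v z (s≤s (s≤s z<s)) (s≤s (s≤s z<s)) e)))) (fheap r2 z)) z
   ; frame = frame-heap 2 v (fits-q (stamp≤ st)) zu (frame r2) }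
   where
   heap3 : ℕ → ℕ
   heap3 = heap s2 [ cell N 2 v ↦ u ]
   other : ∀ z k {_ : T (k <ᵇ 16)} → 2 ≢ k → heap3 (cell N k z) ≡ heap s2 (cell N k z)
   other z k {t} ≢ = upd-≢ (heap s2) u (distinct {2} {k} v z (s≤s (s≤s z<s)) (<ᵇ⇒< k 16 t) ≢)
 sim-op (isZero y x) {si , tf} b r f f' = retag 1 ≤-refl (weaken (m≤m+n (E 1) 0) id
  (assign {x = y} r f' (bits-size true (var tf x) (one r) ex') (_ , refl , cong₂ _∸_ (one r) ex' ⊙ negate (var tf x))))
  where
  ex' = fields r x (<Bd (m≤n+m x y) b)
  negate : ∀ β → 1 ∸ ⟦ β ⟧ᵇ ≡ (if does (BinaryField._≟_ 𝔽2-field β false) then 1 else 0)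
  negate true  = refl
  negate false = refl

 private
  run-start : ∀ {P : A2.FieldState → Set} {p σ l σ'} → A2.Run p σ l σ' → All (P ∘ snd) l → P σ' → P σ
  run-start A2.skip             _       h = h
  run-start (A2.op _)           (h ∷ _) _ = h
  run-start (A2.seq {l = l} r r') a     h = run-start r (All.++⁻ˡ l a) (run-start r' (All.++⁻ʳ l a) h)
  run-start (A2.ifz _ _)        (h ∷ _) _ = h
  run-start (A2.ifnz _ _)       (h ∷ _) _ = h
  run-start (A2.stop _)         (h ∷ _) _ = h
  run-start (A2.repeat _ _ _)   (h ∷ _) _ = h

  paid : ∀ {a b} → a ≡ b → size a ≤ bill (size b)
  paid refl = ≤bill

  test : ∀ {l p τ} {Q : CoinState → Set} x σ → Ex (bill (size (var (fst σ) x)) + bill (costs2 l)) p τ Q → Ex (bill (costs2 ((inj₂ x , σ) ∷ l))) p τ Q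
  test {l} x σ = weaken (≤-reflexive (bill-+ (size (var (fst σ) x)) (costs2 l) ⊙ cong bill (sym (costs2-∷ (inj₂ x , σ) l)))) id

 simulate : ∀ {p σ l σ' s cs} → A2.Run p σ l σ' → varBound p < Bd → All (Fit ∘ snd) l → Fit σ' → Sim σ (s , cs) →
  Ex (bill (costs2 l)) (compile p) (s , cs) (Sim σ')
 simulate A2.skip b a f r = weaken z≤n id (ex-skip r)
 simulate {σ = σ} (A2.op {o = o} refl) b (f ∷ []) f' r =
  weaken (≤-reflexive (cong bill (sym ((costs2-∷ (inj₁ o , σ) []) ⊙ +-identityʳ _)))) id (sim-op o b r f f')
 simulate (A2.seq {p} {q} {l = l} {l′} run run') b a f r =
  weaken (≤-reflexive (bill-+ (costs2 l) (costs2 l′) ⊙ cong bill (sym (costs2-++ l l′)))) id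
   (simulate run (<Bd (m≤m+n _ (varBound q)) b) (All.++⁻ˡ l a) (run-start run' (All.++⁻ʳ l a) f) r ⨟
    simulate run' (<Bd (m≤n+m _ (varBound p)) b) (All.++⁻ʳ l a) f)
 simulate (A2.ifz {x} {p} {q} {s = σ} {l = l} z run) b (f0 ∷ a) f r =
  test {l = l} x σ (ex-ifz (okay r) (paid e) (λ _ → simulate run (<Bd (m≤n+m (varBound p) x ⟫ m≤m+n _ (varBound q)) b) a f r)
   (λ nz → contradiction (e ⊙ z) nz))
  where e = ints r x (<Bd (m≤m+n x (varBound p) ⟫ m≤m+n _ (varBound q)) b)
 simulate (A2.ifnz {x} {p} {q} {s = σ} {l = l} nz run) b (f0 ∷ a) f r =
  test {l = l} x σ (ex-ifz (okay r) (paid e) (λ z → contradiction (sym e ⊙ z) nz) (λ _ → simulate run (<Bd (m≤n+m (varBound q) (x + varBound p)) b) a f r))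
  where e = ints r x (<Bd (m≤m+n x (varBound p) ⟫ m≤m+n _ (varBound q)) b)
 simulate (A2.stop {x} {p} {s = σ} z) b (f0 ∷ []) f r = weaken (≤-reflexive (cong bill (sym ((costs2-∷ (inj₂ x , σ) []) ⊙ +-identityʳ _)))) id
     (ex-stop (okay r) (paid e) (e ⊙ z) r)
  where e = ints r x (<Bd (m≤m+n x (varBound p)) b)
 simulate (A2.repeat {x} {p} {s = σ} {l = l} {l′} nz run run') b (f0 ∷ a) f r =
  test {l = l ++ l′} x σ (weaken (≤-reflexive (cong (bill (size (var (fst σ) x)) +_) (bill-+ (costs2 l) (costs2 l′) ⊙ cong bill (sym (costs2-++ l l′))))) id
   (ex-again (okay r) (paid e) (λ z → nz (sym e ⊙ z))
    (simulate run (<Bd (m≤n+m (varBound p) x) b) (All.++⁻ˡ l a) (run-start run' (All.++⁻ʳ l a) f) r)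
    (simulate run' b (All.++⁻ʳ l a) f)))
  where e = ints r x (<Bd (m≤m+n x (varBound p)) b)

reset : ℕ → Prog CoinOp
reset zero    = skip
reset (suc m) = reset m ▸ ‹ int (const (ivar m) 0) › ▸ ‹ int (const (fvar m) 0) ›

sliceInto : Array → (v off : ℕ) → Prog CoinOp
sliceInto X v off = takeBit (index X) v ▸ line (add 18 16 off ∷ sub 20 3 24 ∷ sub 20 9 20 ∷ []) ▸ stash 2 18 20

readout : Prog CoinOp
readout = fetch 20 2 16 ▸ line (sub 20 9 20 ∷ sub 20 3 20 ∷ []) ▸ fetch 21 (index sums) 16 ▸ line (add 21 21 20 ∷ []) ▸ stash (index sums) 16 21

-- The product of bit slices b (variable 13) of X and c (variable 12) of Y is added to sums.
call : Prog FieldOp → (X Y : Array) → Prog CoinOp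
call mul X Y = ‹ int (add 9 9 3) › ▸ (each 1 3 (sliceInto X 13 15) ▸ each 1 3 (sliceInto Y 12 1)) ▸
 (reset (2 + varBound mul) ▸ ‹ int (add (ivar 0) 2 15) › ▸ ‹ int (add (ivar 1) 3 15) ›) ▸ compile mul ▸ each 1 3 readout

record Multiplier (setting : Setting) (mul : Prog FieldOp) : Set where
 open Setting setting
 field
  M S2 w2 : ℕ
  room    : 20 * (size 𝔹 + suc w2) ≤ w
  cells2  : ∀ k a → k < 3 → a < S2 → cell (n * n) k a < S
  runs    : ∀ (X : Fin 2 → F.Matrix n) σ → A2.Input X σ → ∃[ log ] ∃[ σ' ]
   ( A2.Run mul σ log σ' × F.Stores (X zero F.∙ X (suc zero)) (heap (snd σ'))
   × All (λ e → Hyp → A2.Fits S2 w2 (snd e)) log × (Hyp → A2.Fits S2 w2 σ') × 4000 * (size 𝔹 * costs2 log) ⊑ M)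

word-cong : ∀ k {f g : ℕ → ℕ} → (∀ e → f e ≡ g e) → word k f ≡ word k g
word-cong zero    h = refl
word-cong (suc k) h = cong₂ _+_ (cong₂ _+_ (word-cong k (h ∘ suc)) (word-cong k (h ∘ suc))) (cong parity (h 0))

stepBack : Prog CoinOp
stepBack = ifz 12 then ‹ int (sub 12 4 3) › else ‹ int (sub 12 12 3) ›

inner : Prog CoinOp → Prog CoinOp
inner body = body ▸ ‹ int (add 13 13 3) › ▸ stepBack ▸ ‹ int (sub 11 11 3) ›

outer : (out W : Array) → Prog CoinOp → Prog CoinOp
outer out W body = ‹ int (sub 10 10 3) › ▸ ‹ int (add 12 10 15) › ▸ each 1 3 (takeBit (index W) 10 ▸ stash (index sums) 16 24) ▸
 ‹ int (const 13 0) › ▸ ‹ int (add 11 4 15) › ▸ (while 11 loop inner body) ▸ each 1 3 (emitting sums out)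

convolution : (out W : Array) → Prog CoinOp → Prog CoinOp
convolution out W body = each 1 3 (stash (index out) 16 15) ▸ ‹ int (add 10 4 15) › ▸ (while 10 loop outer out W body) ▸
 ‹ int (const 12 0) › ▸ ‹ int (const 13 0) › ▸ each 1 3 (stash (index sums) 16 15)

hadamardBody : (X Y : Array) → Prog CoinOp
hadamardBody X Y = each 1 3 (multiplying X Y sums) ▸ ‹ int (add 9 9 3) ›

squareStage powerStage gradientStage cycleStage : Prog FieldOp → Prog CoinOp
squareStage mul   = convolution tmp1 blank (hadamardBody arcsᵀ powers⁻) ▸ convolution tmp2 blank (hadamardBody arcsᵀ tmp1)
powerStage mul    = each 1 3 (copying powers powers⁻) ▸ convolution tmp3 blank (call mul arcs powers) ▸ each 1 3 (copying tmp3 powers)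
gradientStage mul = each 2 6 (copying powers tmp2) ▸ convolution tmp3 tmp2 (call mul gradients arcsᵀ) ▸ each 1 3 (copying tmp3 gradients)
cycleStage mul    = each 2 6 (stash (index tmp3) 16 15) ▸ convolution tmp1 tmp3 (call mul arcsᵀ cycles) ▸ each 1 3 (copying tmp1 cycles)

report : Prog CoinOp
report = each 1 3 (hitting cycles hits) ▸ each 1 3 tallying ▸ ‹ int (add 7 7 3) › ▸ fetch 20 (index flag) 15 ▸ (ifz 20 then skip else ‹ int (add 0 7 3) ›)

step : Prog FieldOp → Prog CoinOp
step mul = squareStage mul ▸ powerStage mul ▸ gradientStage mul ▸ cycleStage mul ▸ report

search : Prog FieldOp → Prog CoinOp
search mul = while 8 loop ((ifz 0 then step mul else skip) ▸ ‹ int (sub 8 8 3) ›)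

publish : Prog CoinOp
publish = each 1 3 (fetch 20 (index hits) 16 ▸ ‹ int (save 16 20) ›)

record Weights (setting : Setting) : Set where
 open Setting setting
 field
  A Aᵀ   : Words n
  1≤L    : 1 ≤ L
  L≤𝔹    : L + 3 ≤ 𝔹
  2^L≤𝔹  : 2 ^ suc L ≤ 𝔹
  A≤     : ∀ i j → A i j ≤ 𝔹
  Aᵀ≤    : ∀ i j → Aᵀ i j ≤ 𝔹
  raw≤1  : ∀ i j → raw0 i j ≤ 1
  n+2≤𝔹  : n + 2 ≤ 𝔹

half-halves : ∀ c x → ⌊ halves c x /2⌋ ≡ halves (suc c) x
half-halves zero    x = refl
half-halves (suc c) x = half-halves c ⌊ x /2⌋

double-half : ∀ x → x ≤ suc (⌊ x /2⌋ + ⌊ x /2⌋)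
double-half zero          = z≤n
double-half (suc zero)    = s≤s z≤n
double-half (suc (suc x)) = s≤s (s≤s (double-half x) ⟫≡ cong suc (sym (+-suc ⌊ x /2⌋ ⌊ x /2⌋)))

halves≡0⇒< : ∀ c x → halves c x ≡ 0 → x < 2 ^ c
halves≡0⇒< zero    x refl = s≤s z≤n
halves≡0⇒< (suc c) x e = s≤s (double-half x) ⟫ cong suc (sym (+-suc ⌊ x /2⌋ ⌊ x /2⌋)) ≡⟫
 +-mono-≤ (halves≡0⇒< c ⌊ x /2⌋ e) ((halves≡0⇒< c ⌊ x /2⌋ e) ⟫ m≤m+n _ 0)

<⇒halves≡0 : ∀ c x → x < 2 ^ c → halves c x ≡ 0
<⇒halves≡0 zero    zero    _ = refl
<⇒halves≡0 zero    (suc x) (s≤s ())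
<⇒halves≡0 (suc c) x x< = <⇒halves≡0 c ⌊ x /2⌋ (*-cancelˡ-< 2 _ _ (≤-<-trans (cong (⌊ x /2⌋ +_) (+-identityʳ ⌊ x /2⌋) ≡⟫ double-half≤ x) x<))

halves-size : ∀ n c → 1 ≤ n → c ≤ size n → halves c n ≡ 0 → c ≡ size n
halves-size n zero    1≤n _  e = contradiction e (m<n⇒n≢0 1≤n)
halves-size n (suc c) 1≤n c≤ e = ≤-antisym c≤ (size≤ c (halves≡0⇒< (suc c) n e))

-- 3 ^ level c is the power of three from 9 on which exceeds 4 c.
level-step : ℕ → ℕ → ℕ
level-step zero    κ = κ
level-step (suc _) κ = suc κ

level : ℕ → ℕ
level zero    = 2
level (suc c) = level-step (suc c * 4 ∸ treble (level c) 1) (level c)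

level-bounds : ∀ c → 9 ≤ treble (level c) 1 × c * 4 ≤ treble (level c) 1 × treble (level c) 1 ≤ 9 + 12 * c
level-bounds zero    = ≤-refl , z≤n , ≤-refl
level-bounds (suc c) = by (level-bounds c) (suc c * 4 ∸ treble (level c) 1) refl
 where
 h = treble (level c) 1
 by : 9 ≤ h × c * 4 ≤ h × h ≤ 9 + 12 * c → ∀ d → suc c * 4 ∸ h ≡ d →
  9 ≤ treble (level-step d (level c)) 1 × suc c * 4 ≤ treble (level-step d (level c)) 1 × treble (level-step d (level c)) 1 ≤ 9 + 12 * suc c
 by (9≤ , ≤h , h≤) zero    eq = 9≤ , m∸n≡0⇒m≤n {suc c * 4} {h} eq , h≤ ⟫ +-monoʳ-≤ 9 (*-monoʳ-≤ 12 (n≤1+n c))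
 by (9≤ , ≤h , h≤) (suc d) eq = 9≤ ⟫ m≤m*n h 3
     , +-mono-≤ (m≤m+n 4 5 ⟫ 9≤) ≤h ⟫ m≤m+n (h + h) h ⟫≡ solve 1 (λ h → h :+ h :+ h := h :* con 3) refl h
     , *-monoˡ-≤ 3 h< ⟫
         solve 1 (λ c → (con 1 :+ c) :* con 4 :* con 3 := con 12 :* (con 1 :+ c)) refl c ≡⟫ m≤n+m (12 * suc c) 9
  where
  h< : h ≤ suc c * 4
  h< = <⇒≤ (m∸n≢0⇒n<m {suc c * 4} {h} λ z → contradiction (sym eq ⊙ z) λ ())

file : List ℕ → ℕ → ℕ
file []       _       = 0
file (x ∷ xs) zero    = x
file (x ∷ xs) (suc k) = file xs k

prologue : Prog CoinOp
prologue = line (const 3 1 ∷ add 2 0 15 ∷ add 14 2 15 ∷ const 0 0 ∷ []) ▸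
 (while 14 loop line (add 1 1 2 ∷ sub 14 14 3 ∷ [])) ▸
 line (add 6 2 3 ∷ add 14 2 15 ∷ const 10 9 ∷ const 12 4 ∷ []) ▸
 (while 14 loop (line (half 14 14 ∷ add 11 11 12 ∷ sub 13 11 10 ∷ []) ▸
                 (ifz 13 then skip else line (add 13 10 10 ∷ add 10 13 10 ∷ [])))) ▸
 line (add 4 10 10 ∷ add 4 4 10 ∷ add 5 10 10 ∷ []) ▸
 line (const 10 0 ∷ const 11 0 ∷ const 12 0 ∷ const 13 0 ∷ [])

module Prologue (Hyp : Set) (S w 𝔹 : ℕ) (size𝔹≤w : size 𝔹 ≤ w) (64≤𝔹 : 64 ≤ 𝔹) (n : ℕ) (1≤n : 1 ≤ n)
 (N≤𝔹 : n * n ≤ 𝔹) (n<𝔹 : n + 1 ≤ 𝔹) (room : 36 + 48 * size n ≤ 𝔹) (h0 : ℕ → ℕ) (cs0 : List Bool) where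

 open Bounded Hyp S w 𝔹 size𝔹≤w 64≤𝔹

 record Pre (v : ℕ → ℕ) (τ : CoinState) : Set where
  field
   good  : Good (fst τ)
   vars  : Vars v (fst τ)
   heap≡ : heap (fst τ) ≡ h0
   coins : snd τ ≡ cs0

 pre-line : ∀ os xs xs' {_ : T (pure os)} {_ : T (local 0 os)} → Needs os (store (file xs) (λ _ → 0)) → Agree (var (execs os (store (file xs) (λ _ → 0)))) (file xs') →
  ∀ {τ} → Pre (file xs) τ → Ex (length os * unit) (line os) τ (Pre (file xs'))
 pre-line os xs xs' {p} {l} needs agree {s , _} pre =
  let (a , e , f) = lift os {s} {file xs} p (look (Pre.vars pre)) in
  imply (λ { (refl , g , _) → record { good = g ; vars = holding λ y l → a y l ⊙ agree y l ; heap≡ = e ⊙ Pre.heap≡ pre ; coins = Pre.coins pre } })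
   (run-line 0 os {_} {_} {l} (Pre.good pre) (f needs))

 N : ℕ
 N = n * n

 n≤𝔹 : n ≤ 𝔹
 n≤𝔹 = m≤m+n n 1 ⟫ n<𝔹

 h : ℕ → ℕ
 h c = treble (level c) 1

 file1 : ℕ → ℕ → List ℕ
 file1 p y = 0 ∷ p ∷ n ∷ 1 ∷ 0 ∷ 0 ∷ 0 ∷ 0 ∷ 0 ∷ 0 ∷ 0 ∷ 0 ∷ 0 ∷ 0 ∷ y ∷ 0 ∷ []

 file3 : (h u t y : ℕ) → List ℕ
 file3 h u t y = 0 ∷ N ∷ n ∷ 1 ∷ 0 ∷ 0 ∷ suc n ∷ 0 ∷ 0 ∷ 0 ∷ h ∷ u ∷ 4 ∷ t ∷ y ∷ 0 ∷ []

 file4 : (L r : ℕ) → List ℕ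
 file4 L r = 0 ∷ N ∷ n ∷ 1 ∷ L ∷ r ∷ suc n ∷ 0 ∷ 0 ∷ 0 ∷ 0 ∷ 0 ∷ 0 ∷ 0 ∷ 0 ∷ 0 ∷ []

 squareCost levelCost prologueCost : ℕ
 squareCost   = n * (unit + 2 * unit) + unit
 levelCost    = size n * (unit + (3 * unit + (unit + 2 * unit))) + unit
 prologueCost = 4 * unit + (squareCost + (4 * unit + (levelCost + (3 * unit + 4 * unit))))

 ex-square : ∀ {τ} → Pre (file (file1 0 n)) τ → Ex squareCost (while 14 loop line (add 1 1 2 ∷ sub 14 14 3 ∷ [])) τ (Pre (file (file1 N 0)))
 ex-square pre = imply (λ {τ} (i , e , p) → subst (λ p → Pre (file (file1 p 0)) τ) (cong (_* n) (sym (+-identityʳ i) ⊙ e)) p)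
  (ex-repeat (λ j τ → ∃[ i ] (i + j ≡ n × Pre (file (file1 (i * n) j)) τ))
   (λ (i , e , p) → fits (Pre.good p) , size≤unit (Good.vars (Pre.good p) 14 tt) , look (Pre.vars p) 14 tt)
   (λ {j} (i , e , p) → let next = trans (+-comm (i * n) n) refl in
    imply (λ p → suc i , sym (+-suc i j) ⊙ e , p)
     (pre-line (add 1 1 2 ∷ sub 14 14 3 ∷ []) (file1 (i * n) (suc j)) (file1 (suc i * n) j)
      (next ≡⟫ *-monoˡ-≤ n ((+-comm 1 i ≡⟫ +-monoʳ-≤ i (s≤s z≤n)) ⟫≡ e) ⟫ N≤𝔹 , tt)
      (below-16 {{p1 = next}}) p))
   n (0 , refl , pre))

 LevelLoop : ℕ → CoinState → Set
 LevelLoop j τ = ∃[ c ] ∃[ t ] (c + j ≡ size n × Pre (file (file3 (h c) (c * 4) t (halves c n))) τ)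

 ex-level : ∀ {τ} → Pre (file (file3 9 0 0 n)) τ →
  Ex levelCost (while 14 loop (line (half 14 14 ∷ add 11 11 12 ∷ sub 13 11 10 ∷ []) ▸ (ifz 13 then skip else line (add 13 10 10 ∷ add 10 13 10 ∷ [])))) τ
   (λ τ → ∃[ t ] Pre (file (file3 (h (size n)) (size n * 4) t 0)) τ)
 ex-level pre = imply finish
  (ex-while LevelLoop (λ (c , t , e , p) → fits (Pre.good p) , size≤unit (Good.vars (Pre.good p) 14 tt))
   (λ (c , t , e , p) → look (Pre.vars p) 14 tt ⊙ subst (λ c → halves c n ≡ 0) (sym e ⊙ +-identityʳ c) (<⇒halves≡0 (size n) n (<2^size n)))
   (λ i _ → iteration i) (size n) (0 , 0 , refl , pre))
  where
  finish : ∀ {τ} → var (fst τ) 14 ≡ 0 × ∃[ i ] LevelLoop i τ → ∃[ t ] Pre (file (file3 (h (size n)) (size n * 4) t 0)) τ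
  finish {τ} (z , j , c , t , e , p) = t , subst₂ (λ c y → Pre (file (file3 (h c) (c * 4) t y)) τ)
   (halves-size n c 1≤n (m≤m+n c j ⟫≡ e) y≡0) y≡0 p
   where
   y≡0 : halves c n ≡ 0
   y≡0 = sym (look (Pre.vars p) 14 tt) ⊙ z
  iteration : ∀ {j τ} → LevelLoop (suc j) τ → Ex (3 * unit + (unit + 2 * unit))
   (line (half 14 14 ∷ add 11 11 12 ∷ sub 13 11 10 ∷ []) ▸ (ifz 13 then skip else line (add 13 10 10 ∷ add 10 13 10 ∷ []))) τ (LevelLoop j)
  iteration {j} (c , t , e , p) =
   pre-line (half 14 14 ∷ add 11 11 12 ∷ sub 13 11 10 ∷ []) (file3 (h c) (c * 4) t (halves c n)) (file3 (h c) (suc c * 4) (suc c * 4 ∸ h c) (halves (suc c) n))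
    (subst (_≤ 𝔹) (+-comm 4 (c * 4)) u≤ , tt)
    (below-16 {{p11 = +-comm (c * 4) 4}} {{p13 = cong (_∸ h c) (+-comm (c * 4) 4)}} {{p14 = half-halves c n}}) p ⨟ λ { {s , _} p →
   ex-ifz (fits (Pre.good p)) (size≤unit (Good.vars (Pre.good p) 13 tt))
    (λ z → weaken z≤n id (ex-skip (suc c , _ , e' , subst (λ h → Pre (file (file3 h (suc c * 4) (suc c * 4 ∸ treble (level c) 1) (halves (suc c) n))) _) (stay (sym (look (Pre.vars p) 13 tt) ⊙ z)) p)))
    (λ nz → let e″ = climb (λ z → nz (look (Pre.vars p) 13 tt ⊙ z)) in
     imply (λ p → suc c , h c + h c , e' , p)
     (pre-line (add 13 10 10 ∷ add 10 13 10 ∷ []) (file3 (h c) (suc c * 4) (suc c * 4 ∸ h c) (halves (suc c) n)) (file3 (h (suc c)) (suc c * 4) (h c + h c) (halves (suc c) n))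
      (m≤m+n (h c + h c) (h c) ⟫ e″ ≡⟫ h≤ , e″ ≡⟫ h≤ , tt)
      (below-16 {{p10 = e″}}) p)) }
   where
   e' : suc c + j ≡ size n
   e' = sym (+-suc c j) ⊙ e
   c<size : suc c ≤ size n
   c<size = m≤m+n (suc c) j ⟫≡ e'
   u≤ : suc c * 4 ≤ 𝔹
   u≤ = *-monoˡ-≤ 4 c<size ⟫ (*-comm (size n) 4 ≡⟫ *-monoˡ-≤ (size n) (m≤m+n 4 44)) ⟫ m≤n+m _ 36 ⟫ room
   h≤ : h (suc c) ≤ 𝔹
   h≤ = snd (snd (level-bounds (suc c))) ⟫ +-mono-≤ (m≤m+n 9 27) (*-mono-≤ (m≤m+n 12 36) c<size) ⟫ room
   stay : suc c * 4 ∸ h c ≡ 0 → h c ≡ h (suc c)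
   stay z = cong (λ d → treble (level-step d (level c)) 1) (sym z)
   climb : suc c * 4 ∸ h c ≢ 0 → h c + h c + h c ≡ h (suc c)
   climb nz = solve 1 (λ h → h :+ h :+ h := h :* con 3) refl (h c) ⊙ up _ nz
    where
    up : ∀ d → d ≢ 0 → h c * 3 ≡ treble (level-step d (level c)) 1
    up zero    nz = contradiction refl nz
    up (suc d) nz = refl

 ex-prologue : ∀ {τ} → Pre (file (n ∷ [])) τ → Ex prologueCost prologue τ (Pre (file (file4 (h (size n) + h (size n) + h (size n)) (h (size n) + h (size n)))))
 ex-prologue p =
  pre-line (const 3 1 ∷ add 2 0 15 ∷ add 14 2 15 ∷ const 0 0 ∷ []) (n ∷ []) (file1 0 n)
   (small {1} tt , n+0 ≡⟫ n≤𝔹 , (+-identityʳ (n + 0) ⊙ n+0) ≡⟫ n≤𝔹 , z≤n , tt)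
   (below-16 {{p2 = n+0}} {{p14 = +-identityʳ (n + 0) ⊙ n+0}}) p ⨟ λ p →
  ex-square p ⨟ λ p →
  pre-line (add 6 2 3 ∷ add 14 2 15 ∷ const 10 9 ∷ const 12 4 ∷ []) (file1 N 0) (file3 9 0 0 n)
   (n<𝔹 , n+0 ≡⟫ n≤𝔹 , small {9} tt , small {4} tt , tt)
   (below-16 {{p6 = +-comm n 1}} {{p14 = n+0}}) p ⨟ λ p →
  ex-level p ⨟ λ (t , p) →
  pre-line (add 4 10 10 ∷ add 4 4 10 ∷ add 5 10 10 ∷ []) (file3 H (size n * 4) t 0) (file5 t)
   (2H≤ , 3H≤ , 2H≤ , tt)
   below-16 p ⨟ λ p →
  pre-line (const 10 0 ∷ const 11 0 ∷ const 12 0 ∷ const 13 0 ∷ []) (file5 t) (file4 (H + H + H) (H + H)) (z≤n , z≤n , z≤n , z≤n , tt)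
   below-16 p
  where
  n+0 : n + 0 ≡ n
  n+0 = +-identityʳ n
  H : ℕ
  H = h (size n)
  file5 : ℕ → List ℕ
  file5 t = 0 ∷ N ∷ n ∷ 1 ∷ (H + H + H) ∷ (H + H) ∷ suc n ∷ 0 ∷ 0 ∷ 0 ∷ H ∷ size n * 4 ∷ 4 ∷ t ∷ 0 ∷ 0 ∷ []
  3H≤ : H + H + H ≤ 𝔹
  3H≤ = solve 1 (λ h → h :+ h :+ h := con 3 :* h) refl H ≡⟫
   *-monoʳ-≤ 3 (snd (snd (level-bounds (size n)))) ⟫
   solve 1 (λ s → con 3 :* (con 9 :+ con 12 :* s) := con 27 :+ con 36 :* s) refl (size n) ≡⟫
   +-mono-≤ (m≤m+n 27 9) (*-monoˡ-≤ (size n) (m≤m+n 36 12)) ⟫ room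
  2H≤ : H + H ≤ 𝔹
  2H≤ = m≤m+n (H + H) H ⟫ 3H≤

import Data.List.Properties as List
open import Data.Vec.Base using (toList)

wordFrom≥ : ∀ {r} x (b : Vec Bool r) → x ≤ wordFrom x b
wordFrom≥ x []      = ≤-refl
wordFrom≥ x (c ∷ b) = (m≤m+n x x ⟫ (m≤m+n (x + x) ⟦ c ⟧ᵇ)) ⟫ wordFrom≥ (x + x + ⟦ c ⟧ᵇ) b

words : ∀ {r} N → Vec Bool (N * r) → ℕ → ℕ
words zero    ω q       = 0
words {r} (suc N) ω zero    = wordFrom 0 (take r ω)
words {r} (suc N) ω (suc q) = words N (drop r ω) q

words≡ : ∀ {r} N (ω : Vec Bool (N * r)) p → words N ω (toℕ p) ≡ wordFrom 0 (lookup (blocks {r} N ω) p)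
words≡ {r} (suc N) ω zero    = refl
words≡ {r} (suc N) ω (suc p) = words≡ N (drop r ω) p

words< : ∀ {r} N (ω : Vec Bool (N * r)) q → words N ω q < 2 ^ r
words< {r} zero    ω q       = m^n>0 2 r
words< {r} (suc N) ω zero    = wordFrom< 0 (take r ω) 0 z<s
words< {r} (suc N) ω (suc q) = words< N (drop r ω) q

mask : ℕ → ℕ → ℕ
mask zero    w = 0
mask (suc _) w = w

mask≤ : ∀ x w → mask x w ≤ w
mask≤ zero    w = z≤n
mask≤ (suc _) w = ≤-refl

tossWord : Prog CoinOp
tossWord = line (const 20 0 ∷ add 21 5 15 ∷ []) ▸
 (while 21 loop (‹ toss 22 › ▸ line (add 20 20 20 ∷ add 20 20 22 ∷ sub 21 21 3 ∷ [])))

drawEntry moveEntry sample transpose units : Prog CoinOp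
drawEntry = tossWord ▸ line (load 23 16 ∷ []) ▸ (ifz 23 then line (const 20 0 ∷ []) else skip) ▸ stash (index arcs) 16 20
moveEntry = line (sub 18 2 17 ∷ add 18 18 11 ∷ []) ▸ fetch 20 (index arcs) 18 ▸ line (add 19 16 10 ∷ []) ▸ stash (index arcsᵀ) 19 20
sample    = each 1 3 drawEntry
transpose = ‹ int (add 8 2 15) › ▸ (while 8 loop (each 2 2 moveEntry ▸ ‹ int (add 10 10 3) › ▸ ‹ int (add 11 11 2) › ▸ ‹ int (sub 8 8 3) ›)) ▸
 ‹ int (const 10 0) › ▸ ‹ int (const 11 0) ›
units     = each 2 6 (stash (index powers) 16 3) ▸ each 2 6 (stash (index gradients) 16 3) ▸ ‹ int (add 8 2 15) ›

module Computation (setting : Setting) (mul : Prog FieldOp) (multiplier : Multiplier setting mul) where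

 open Machine setting

 innerCost outerCost convolutionCost : ℕ → ℕ
 innerCost t = t + (unit + (unit + unit + unit))
 outerCost t = unit + (unit + (flatCost (bitCost L + 8 * unit) + (unit + (unit + (L * (unit + innerCost t) + unit + flatCost emitCost)))))
 convolutionCost t = flatCost (8 * unit) + (unit + (L * (unit + outerCost t) + unit + (unit + (unit + flatCost (8 * unit)))))

 module Run (res k left : ℕ) (c : Contents n) (out W : Array) (bodyCost : ℕ) (body : Prog CoinOp) (D : ℕ → ℕ → Words n)
  (out#sums : Apart out sums) (sums#out : Apart sums out) (sums#W : Apart sums W) (out#W : Apart out W) (1≤L : 1 ≤ L) (W≤ : Small (c W)) (D≤1 : ∀ b c i j → D b c i j ≤ 1)
  (L≤𝔹 : L + 3 ≤ 𝔹) (2^L≤𝔹 : 2 ^ suc L ≤ 𝔹) where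

  regs : (cur e c b1 b : ℕ) → Registers
  regs cur e c b1 b = record { res = res ; k = k ; left = left ; cur = cur ; stale = cur ; e = e ; c = c ; b1 = b1 ; b = b }

  K : Words n → Words n → Contents n
  K O Acc = (c [ out ≔ O ]) [ sums ≔ Acc ]

  module _ (body-spec : ∀ O Acc cur e c b1 b → (∀ i j → suc (Acc i j) ≤ 𝔹) → suc cur ≤ 𝔹 → b ≤ L → c ≤ L →
   Triple bodyCost body (regs cur e c b1 b) (K O Acc) (regs (cur + 1) e c b1 b) (K O (λ i j → Acc i j + D b c i j))) where

   acc : ℕ → ℕ → Words n
   acc = collect L D (c W)

   acc≤ : ∀ e b i j → acc e b i j ≤ suc b
   acc≤ e zero    i j = parity≤1 (halves e (c W i j))
   acc≤ e (suc b) i j = +-mono-≤ (acc≤ e b i j) (D≤1 b (shifted L b e) i j) ⟫≡ +-comm (suc b) 1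

   previous-≤ : ∀ x → x ≤ L → previous L x ≤ L
   previous-≤ zero    _ = m∸n≤m L 1
   previous-≤ (suc x) l = n≤1+n x ⟫ l

   shifted-≤ : ∀ b e → e ≤ L → shifted L b e ≤ L
   shifted-≤ zero    e l = l
   shifted-≤ (suc b) e l = previous-≤ (shifted L b e) (shifted-≤ b e l)

   L≤ : L ≤ 𝔹
   L≤ = m≤m+n L 3 ⟫ L≤𝔹

   record Inner (O : Words n) (e end j : ℕ) (τ : CoinState) : Set where
    field
     b cur : ℕ
     done  : b + j ≡ L
     used  : cur + j ≡ end
     state : State (regs cur e (shifted L b e) j b) (K O (acc e b)) τ

   step-back : ∀ {cur e x b1 b c'} → x ≤ L → Triple (unit + unit) stepBack (regs cur e x b1 b) c' (regs cur e (previous L x) b1 b) c'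
   step-back {x = zero} x≤ {_ , _} st = ex-ifz (A.fits (State.good st)) (A.size≤unit (A.vars (State.good st) 12 tt))
    (λ _ → compute (sub 12 4 3) _ _ tt below-16 ≤-refl st)
    (λ nz → contradiction (A.look (State.vars st) 12 tt) nz)
   step-back {x = suc x} x≤ {_ , _} st = ex-ifz (A.fits (State.good st)) (A.size≤unit (A.vars (State.good st) 12 tt))
    (λ z → contradiction (sym (A.look (State.vars st) 12 tt) ⊙ z) λ ())
    (λ _ → compute (sub 12 12 3) _ _ tt below-16 ≤-refl st)

   inner-step : ∀ {O e end j τ} → e ≤ L → end ≤ 𝔹 → Inner O e end (suc j) τ → Ex (innerCost bodyCost) (inner body) τ (Inner O e end j)
   inner-step {O} {e} {end} {j} e≤L end≤ I =
    body-spec O (acc e b) cur e (shifted L b e) (suc j) b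
     (λ x y → s≤s (acc≤ e b x y) ⟫ s≤s (s≤s b≤L) ⟫ (+-comm 2 L ≡⟫ +-monoʳ-≤ L (s≤s (s≤s z≤n))) ⟫ L≤𝔹)
     ((+-comm 1 cur ≡⟫ +-monoʳ-≤ cur (s≤s z≤n) ⟫≡ used) ⟫ end≤)
     b≤L (shifted-≤ b e e≤L) state ⨟ λ st →
    compute (add 13 13 3) (regs (cur + 1) e (shifted L b e) (suc j) b) (regs (cur + 1) e (shifted L b e) (suc j) (suc b))
     (+-comm b 1 ≡⟫ b<L ⟫ L≤ , tt)
     (below-16 {{p13 = +-comm b 1}}) ≤-refl st ⨟ λ st →
    step-back {cur + 1} {e} {shifted L b e} {suc j} {suc b} (shifted-≤ b e e≤L) st ⨟ λ st →
    imply (λ st → record { b = suc b ; cur = cur + 1 ; done = sym (+-suc b j) ⊙ done ; used = +-assoc cur 1 j ⊙ used ; state = st })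
     (compute (sub 11 11 3) (regs (cur + 1) e (shifted L (suc b) e) (suc j) (suc b)) (regs (cur + 1) e (shifted L (suc b) e) j (suc b)) tt
      below-16 ≤-refl st)
    where
    open Inner I
    b≤L : b ≤ L
    b≤L = m≤m+n b (suc j) ⟫≡ done
    b<L : b < L
    b<L = m<m+n b z<s ⟫≡ done

   inner-loop : ∀ {O e cur τ} → e ≤ L → cur + L ≤ 𝔹 → State (regs cur e e L 0) (K O (λ i j → bit e (c W i j))) τ →
    Ex (L * (unit + innerCost bodyCost) + unit) (while 11 loop inner body) τ (λ τ → State (regs (cur + L) e (shifted L L e) 0 L) (K O (acc e L)) τ)
   inner-loop {O} {e} {cur} e≤L end≤ st = imply (λ I → finish I)
    (ex-repeat (Inner O e (cur + L)) (λ I → let open Inner I in A.fits (State.good state) , A.size≤unit (A.vars (State.good state) 11 tt) , A.look (State.vars state) 11 tt)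
     (inner-step e≤L end≤) L (record { b = 0 ; cur = cur ; done = refl ; used = refl ; state = st }))
    where
    finish : ∀ {τ} → Inner O e (cur + L) 0 τ → State (regs (cur + L) e (shifted L L e) 0 L) (K O (acc e L)) τ
    finish record { b = b ; cur = cur' ; done = done ; used = used ; state = state }
     with trans (sym (+-identityʳ b)) done | trans (sym (+-identityʳ cur')) used
    ... | refl | refl = state

   emitted : ℕ → Words n
   emitted j x y = word (L ∸ j) (λ e → acc (j + e) L x y)

   record Outer (end j : ℕ) (τ : CoinState) : Set where
    field
     cur c' b : ℕ
     Acc      : Words n
     j≤L      : j ≤ L
     used     : cur + j * L ≡ end
     state    : State (regs cur j c' 0 b) (K (emitted j) Acc) τ

   emitted-step : ∀ e → e < L → ∀ x y → emitted (suc e) x y + emitted (suc e) x y + parity (acc e L x y) ≡ emitted e x y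
   emitted-step e e<L x y = sym (cong (λ l → word l (λ i → acc (e + i) L x y)) (+-∸-assoc 1 e<L) ⊙
    cong₂ _+_ (cong₂ _+_ tail tail) (cong (λ i → parity (acc i L x y)) (+-identityʳ e)))
    where
    tail : word (L ∸ suc e) (λ i → acc (e + suc i) L x y) ≡ emitted (suc e) x y
    tail = word-cong (L ∸ suc e) λ i → cong (λ i → acc i L x y) (+-suc e i)

   outer-step : ∀ {end j τ} → end ≤ 𝔹 → Outer end (suc j) τ → Ex (outerCost bodyCost) (outer out W body) τ (Outer end j)
   outer-step {end} {e} end≤ O =
    compute (sub 10 10 3) (regs cur (suc e) c' 0 b) (regs cur e c' 0 b) tt below-16 ≤-refl state ⨟ λ st →
    compute (add 12 10 15) (regs cur e c' 0 b) (regs cur e e 0 b) (+-identityʳ e ≡⟫ e≤𝔹 , tt)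
     (below-16 {{p12 = +-identityʳ e}}) ≤-refl st ⨟ λ st →
    imply (state-cong λ x i j → cong (λ X → X i j) (put-put (c [ out ≔ emitted (suc e) ]) sums x) ⊙
        put-cong (c [ out ≔ emitted (suc e) ]) (c [ out ≔ emitted (suc e) ]) sums (λ _ _ _ → refl) (λ i j → cong (λ X → bit e (X i j)) atW) x i j)
     (bit-slice W 10 sums {L} (λ i j → cong (λ X → X i j) atW ≡⟫ W≤ i j) e≤L st) ⨟ λ st →
    compute (const 13 0) (regs cur e e 0 b) (regs cur e e 0 0) (z≤n , tt) below-16 ≤-refl st ⨟ λ st →
    compute (add 11 4 15) (regs cur e e 0 0) (regs cur e e L 0) (+-identityʳ L ≡⟫ L≤ , tt)
     (below-16 {{p11 = +-identityʳ L}}) ≤-refl st ⨟ λ st →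
    inner-loop e≤L ((+-monoʳ-≤ cur (m≤m+n L (e * L)) ⟫≡ used) ⟫ end≤)
     st ⨟ λ st →
    imply (λ st → record
        { cur = cur + L ; c' = shifted L L e ; b = L ; Acc = acc e L ; j≤L = e≤L
        ; used = +-assoc cur L (e * L) ⊙ used
        ; state = state-cong (λ x i j → cong (λ X → X i j) (put-swap c {out} {sums} out#sums x) ⊙
            put-cong _ (c [ out ≔ emitted e ]) sums (put-cong c c out (λ _ _ _ → refl) λ i j → cong (λ v → v + v + parity (acc e L i j)) (atOut i j) ⊙ emitted-step e e<L i j) (λ _ _ → refl) x i j) st })
     (emit sums out (λ i j → acc≤ e L i j ⟫ +-comm 1 L ≡⟫ +-monoʳ-≤ L (s≤s z≤n) ⟫ L≤𝔹)
      (λ i j → subst (λ x → suc (x + x) ≤ 𝔹) (sym (atOut i j)) (emitted≤ i j)) st)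
    where
    open Outer O
    e<L = j≤L
    e≤L = <⇒≤ e<L
    e≤𝔹 = e≤L ⟫ L≤
    atW : K (emitted (suc e)) Acc W ≡ c W
    atW = put-apart (c [ out ≔ emitted (suc e) ]) {sums} {W} sums#W ⊙ put-apart c {out} {W} out#W
    atOut : ∀ i j → K (emitted (suc e)) (acc e L) out i j ≡ emitted (suc e) i j
    atOut i j = cong (λ X → X i j) (put-apart (c [ out ≔ emitted (suc e) ]) {sums} {out} sums#out ⊙ put-≡ c out)
    emitted≤ : ∀ i j → suc (emitted (suc e) i j + emitted (suc e) i j) ≤ 𝔹
    emitted≤ i j = +-mono-≤ below-2^L (<⇒≤ below-2^L ⟫≡ sym (+-identityʳ (2 ^ L))) ⟫ 2^L≤𝔹
     where
     below-2^L : emitted (suc e) i j < 2 ^ L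
     below-2^L = <-≤-trans (word< (L ∸ suc e) (λ i' → acc (suc e + i') L i j)) (^-monoʳ-≤ 2 (m∸n≤m L (suc e)))

   ex-convolution : ∀ {cur} → cur + L * L ≤ 𝔹 →
    Triple (convolutionCost bodyCost) (convolution out W body) (regs cur 0 0 0 0) c (regs (cur + L * L) 0 0 0 0) ((c [ out ≔ convolve L D (c W) ]) [ sums ≔ (λ _ _ → 0) ])
   ex-convolution {cur} end≤ st0 =
    clear out st0 ⨟ λ st →
    compute (add 10 4 15) (regs cur 0 0 0 0) (regs cur L 0 0 0) (+-identityʳ L ≡⟫ L≤ , tt)
     (below-16 {{p10 = +-identityʳ L}}) ≤-refl st ⨟ λ st →
    ex-repeat (Outer (cur + L * L)) (λ O → let open Outer O in A.fits (State.good state) , A.size≤unit (A.vars (State.good state) 10 tt) , A.look (State.vars state) 10 tt)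
     (outer-step end≤) L (record { cur = cur ; c' = 0 ; b = 0 ; Acc = c sums ; j≤L = ≤-refl ; used = refl ; state = state-cong start st }) ⨟ λ O → finish O
    where
    start : ∀ x i j → (c [ out ≔ (λ _ _ → 0) ]) x i j ≡ K (emitted L) (c sums) x i j
    start x i j = sym (put-elim (λ x X → X i j ≡ (c [ out ≔ (λ _ _ → 0) ]) x i j) (c [ out ≔ emitted L ]) sums
     (λ { sums _ → cong (λ X → X i j) (sym (put-apart c {out} {sums} out#sums)) })
     (λ x _ → put-cong c c out (λ _ _ _ → refl) (λ i j → cong (λ l → word l (λ e → acc (L + e) L i j)) (n∸n≡0 L)) x i j) x)
    finish : ∀ {τ} → Outer (cur + L * L) 0 τ → Ex (unit + (unit + flatCost (8 * unit))) (‹ int (const 12 0) › ▸ ‹ int (const 13 0) › ▸ each 1 3 (stash (index sums) 16 15)) τ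
     (State (regs (cur + L * L) 0 0 0 0) ((c [ out ≔ convolve L D (c W) ]) [ sums ≔ (λ _ _ → 0) ]))
    finish record { cur = cur' ; c' = c' ; b = b ; used = used ; state = st } with trans (sym (+-identityʳ cur')) used
    ... | refl =
     compute (const 12 0) (regs cur' 0 c' 0 b) (regs cur' 0 0 0 b) (z≤n , tt) below-16 ≤-refl st ⨟ λ st →
     compute (const 13 0) (regs cur' 0 0 0 b) (regs cur' 0 0 0 0) (z≤n , tt) below-16 ≤-refl st ⨟ λ st →
     imply (state-cong λ x i j → cong (λ X → X i j) (put-put (c [ out ≔ emitted 0 ]) sums x)) (clear sums st)

 open Multiplier multiplier

 Bd : ℕ
 Bd = 2 + varBound mul

 record Reset (m : ℕ) (s : Store ℕ) (cs : List Bool) (τ : CoinState) : Set where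
  field
   good   : Good (fst τ)
   kept   : Below 32 s (fst τ)
   heap≡  : heap (fst τ) ≡ heap s
   coins  : snd τ ≡ cs
   ints   : ∀ x → x < m → var (fst τ) (ivar x) ≡ 0
   fields : ∀ x → x < m → var (fst τ) (fvar x) ≡ 0

 ex-reset : ∀ m {s cs} → Good s → A.Ex (m * (unit + unit)) (reset m) (s , cs) (Reset m s cs)
 ex-reset zero    g = A.ex-skip record { good = g ; kept = A.below-refl ; heap≡ = refl ; coins = refl ; ints = λ _ () ; fields = λ _ () }
 ex-reset (suc m) {s} {cs} g = A.weaken (≤-reflexive (+-comm (m * (unit + unit)) (unit + unit))) id
  (ex-reset m g A.⨟ λ { {s1 , cs1} r → let open Reset r in
   A._⨟_ {R = _≡ (setVar (ivar m) 0 s1 , cs1)} (A.ex-op (A.fits good) zero-size refl) λ { refl → A.ex-op (A.fits (A.good-var (ivar m) z≤n good)) zero-size record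
    { good = A.good-var (fvar m) z≤n (A.good-var (ivar m) z≤n good)
    ; kept = A.below-trans kept (A.below-trans (A.below-var {32} {s1} (ivar m) 0 tt) (A.below-var {32} {setVar (ivar m) 0 s1} (fvar m) 0 tt))
    ; heap≡ = heap≡ ; coins = coins
    ; ints = λ x x≤m → upd-elim (λ z u → z ≡ ivar x → u ≡ 0) (var s1 [ ivar m ↦ 0 ]) (fvar m) 0 (λ _ → refl)
        (λ z _ → upd-elim (λ z u → z ≡ ivar x → u ≡ 0) (var s1) (ivar m) 0 (λ _ → refl)
         (λ z m≢ e → cong (var s1) e ⊙ ints x (smaller x≤m λ { refl → m≢ (sym e) })) z) (ivar x) refl
    ; fields = λ x x≤m → upd-elim (λ z u → z ≡ fvar x → u ≡ 0) (var s1 [ ivar m ↦ 0 ]) (fvar m) 0 (λ _ → refl)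
        (λ z m≢ e → upd-elim (λ y u → y ≡ z → u ≡ 0) (var s1) (ivar m) 0 (λ _ → refl)
         (λ y _ e' → cong (var s1) (e' ⊙ e) ⊙ fields x (smaller x≤m λ { refl → m≢ (sym e) })) z refl) (fvar x) refl } } })
  where
  zero-size : size 0 ≤ unit
  zero-size = A.size≤unit z≤n
  smaller : ∀ {x} → x < suc m → x ≢ m → x < m
  smaller x≤m x≢m = ≤∧≢⇒< (s≤s⁻¹ x≤m) x≢m

 sliceCost readoutCost callCost : ℕ
 sliceCost   = bitCost L + (3 * unit + 8 * unit)
 readoutCost = 8 * unit + (2 * unit + (8 * unit + (1 * unit + 8 * unit)))
 callCost    = unit + (flatCost sliceCost + flatCost sliceCost + (Bd * (unit + unit) + (unit + unit) + (M + flatCost readoutCost)))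

 record Sliced (o : ℕ) (Φ : Fin n → Fin n → ℕ) (ρ : Registers) (c : Contents n) (s : Store ℕ) (τ : CoinState) : Set where
  field
   state : State ρ c τ
   done  : ∀ i j → heap (fst τ) (cell N 2 (o + ⟨ i , j ⟩)) ≡ Φ i j
   rest  : ∀ a → (∀ i j → a ≢ cell N 2 (o + ⟨ i , j ⟩)) → heap (fst τ) a ≡ heap s a

 slice-loop : ∀ X v off {ρ c s} {_ : T (v <ᵇ 16)} {_ : T (off <ᵇ 16)} → registers ρ off ≤ N → registers ρ v ≤ L → Small (c X) →
  Registers.cur ρ ≤ Registers.stale ρ → State ρ c (s , cs0) →
  Ex (flatCost sliceCost) (each 1 3 (sliceInto X v off)) (s , cs0) (Sliced (registers ρ off) (λ i j → Registers.cur ρ ∸ (1 ∸ bit (registers ρ v) (c X i j))) ρ c s)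
 slice-loop X v off {ρ} {c} {s} {v<} {off<} o≤N v≤L X≤ cur≤ st = relax (flat-cost sliceCost) finish
  (entries-loop flat (remQuot n) at-row-major ad (λ p q e → +-cancelˡ-≡ o _ _ (ad-injective e)) (λ p q → raw≢cell 2 (o + q))
   (λ k p q e → contradiction (sym e) (low≢at 2 {k} (o + q) p)) Φ body st)
  where
  open State st using (raw; array; stamp; field≤)
  o : ℕ
  o = registers ρ off
  ad : ℕ → ℕ
  ad p = cell N 2 (o + p)
  Φ : Fin n → Fin n → ℕ
  Φ i j = Registers.cur ρ ∸ (1 ∸ bit (registers ρ v) (c X i j))
  ad-injective : ∀ {p q} → cell N 2 p ≡ cell N 2 q → p ≡ q
  ad-injective {p} {q} e = snd (cell-injective N p q (s≤s (s≤s (s≤s z≤n))) (s≤s (s≤s (s≤s z≤n))) e)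
  body : ∀ q {s1} → let (i , j) = remQuot {n} n q in (∀ a → (∀ q → a ≢ ad q) → heap s1 a ≡ heap s a) → Entry c i j s1 (s1 , cs0) →
   A.Ex sliceCost (sliceInto X v off) (s1 , cs0) (Written (ad ⟨ i , j ⟩) (Φ i j) s1)
  body q _ en = let (i , j) = remQuot {n} n q in read-bit X v {v<} (X≤ i j) v≤L en A.⨟ λ { {s1 , _} (en1 , e1 , _) →
   let place≡ : var s1 16 + var s1 off ≡ o + ⟨ i , j ⟩
       place≡ = cong₂ _+_ (Entry.here en1) (A.look (Entry.vars en1) off off<) ⊙ (+-comm ⟨ i , j ⟩ o)
       place< : o + ⟨ i , j ⟩ < N + N
       place< = +-mono-≤-< o≤N (⟨⟩<N i j)
   in calc (add 18 16 off ∷ sub 20 3 24 ∷ sub 20 9 20 ∷ []) {∧-true (A.<32 off off<)} refl (place≡ ≡⟫ <⇒≤ place< ⟫ 2N≤𝔹 , tt) en1 A.⨟ λ { (refl , en2) →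
   write 2 18 20 en2 place≡ place<
    (cong₂ _∸_ (A.look (Entry.vars en1) 9 tt) (cong₂ _∸_ (A.look (Entry.vars en1) 3 tt) e1)) } }
  finish : ∀ {τ} → Looped ad (remQuot n) Φ s τ → Sliced o Φ ρ c s τ
  finish {s′ , _} lo = record
   { state = record
    { good = good ; vars = vars ; coins = coins
    ; raw = λ i j → (rest _ λ q → raw≢cell 2 (o + p q) (⟨⟩<N i j)) ⊙ raw i j
    ; array = λ k i j → (rest _ λ q e → low≢at 2 {k} (o + p q) ⟨ i , j ⟩ (sym e)) ⊙ array k i j
    ; stamp = λ a → (rest _ λ q e → contradiction (fst (cell-injective N a (o + p q) (s≤s (s≤s z≤n)) (s≤s (s≤s (s≤s z≤n))) e)) λ ()) ≡⟫ stamp a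
    ; field≤ = λ a → either a (Fin.any? λ q → a ≟ o + p q) }
   ; done = λ i j → let here = λ q → heap s′ (ad (p q)) ≡ (let (i , j) = remQuot n q in Φ i j) in
       subst (λ (i , j) → heap s′ (ad ⟨ i , j ⟩) ≡ Φ i j) (Fin.remQuot-combine i j) (done (combine i j))
   ; rest = λ a away → rest a λ q → let (i , j) = remQuot {n} n q in away i j }
   where
   open Looped lo
   p : Fin (n * n) → ℕ
   p q = let (i , j) = remQuot {n} n q in ⟨ i , j ⟩
   either : ∀ a → Dec (∃[ q ] a ≡ o + p q) → heap s′ (cell N 2 a) ≤ Registers.stale ρ
   either a (yes (q , refl)) = (done q ≡⟫ (let (i , j) = remQuot {n} n q in m∸n≤m (Registers.cur ρ) (1 ∸ bit (registers ρ v) (c X i j)))) ⟫ cur≤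
   either a (no none)        = (rest _ λ q e → none (q , ad-injective e)) ≡⟫ field≤ a

 module _ {ρ : Registers} {c : Contents n} (X Y : Array)
  (stale≤ : Registers.stale ρ ≤ Registers.cur ρ) (cur< : suc (Registers.cur ρ) ≤ 𝔹) (b≤ : Registers.b ρ ≤ L) (c≤ : Registers.c ρ ≤ L)
  (X≤ : ∀ i j → c X i j ≤ 𝔹) (Y≤ : ∀ i j → c Y i j ≤ 𝔹) (sums≤ : ∀ i j → suc (c sums i j) ≤ 𝔹) where

  private
   b' c' cur : ℕ
   b' = Registers.b ρ
   c' = Registers.c ρ
   cur = Registers.cur ρ + 1

   ρ1 : Registers
   ρ1 = record ρ { cur = cur }

  ρ⁺ : Registers
  ρ⁺ = record ρ { cur = cur ; stale = cur }

  private
   cur≤𝔹 : cur ≤ 𝔹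
   cur≤𝔹 = +-comm _ 1 ≡⟫ cur<

   stale<cur : Registers.stale ρ < cur
   stale<cur = s≤s stale≤ ⟫≡ +-comm 1 _

   P Q : F.Matrix n
   P = slice (c X) b'
   Q = slice (c Y) c'

   factors : Fin 2 → F.Matrix n
   factors zero       = P
   factors (suc zero) = Q

   -- The array of field elements holds both factors, and stale values.
   record Prepared (s : Store ℕ) : Set where
    field
     state  : State ρ⁺ c (s , cs0)
     stamp< : ∀ a → heap s (cell N 1 a) < cur
     left   : ∀ i j → heap s (cell N 2 ⟨ i , j ⟩) ≡ cur ∸ (1 ∸ bit b' (c X i j))
     right  : ∀ i j → heap s (cell N 2 (N + ⟨ i , j ⟩)) ≡ cur ∸ (1 ∸ bit c' (c Y i j))
     beyond : ∀ a → N + N ≤ a → heap s (cell N 2 a) < cur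

   vars⁺ : ∀ {s} → Vars (registers ρ1) s → Vars (registers ρ⁺) s
   vars⁺ vs = A.holding λ a l → A.look vs a l ⊙ below-16 {λ a → registers ρ1 a ≡ registers ρ⁺ a} a l

   slices : ∀ {τ} → State ρ1 c τ → Ex (flatCost sliceCost + flatCost sliceCost) (each 1 3 (sliceInto X 13 15) ▸ each 1 3 (sliceInto Y 12 1)) τ
    (λ τ → Prepared (fst τ) × snd τ ≡ cs0)
   slices {s , _} st with State.coins st
   ... | refl = slice-loop X 13 15 z≤n b≤ X≤ ≤-refl st⁺ ⨟ λ { {s1 , _} sl1 → second s1 sl1 (State.coins (Sliced.state sl1)) }
    where
    st⁺ : State ρ⁺ c (s , cs0)
    st⁺ = record { State st ; vars = vars⁺ (State.vars st) ; stamp = λ a → State.stamp st a ⟫ <⇒≤ stale<cur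
                 ; field≤ = λ a → State.field≤ st a ⟫ <⇒≤ stale<cur }
    fields-cell : ∀ {p q} → cell N 2 p ≡ cell N 2 q → p ≡ q
    fields-cell {p} {q} e = snd (cell-injective N p q (s≤s (s≤s (s≤s z≤n))) (s≤s (s≤s (s≤s z≤n))) e)
    stamp-cell : ∀ {a q} → cell N 1 a ≢ cell N 2 q
    stamp-cell {a} {q} e = contradiction (fst (cell-injective N a q (s≤s (s≤s z≤n)) (s≤s (s≤s (s≤s z≤n))) e)) λ ()
    second : ∀ s1 {cs} → Sliced 0 _ ρ⁺ c s (s1 , cs) → cs ≡ cs0 → Ex (flatCost sliceCost) (each 1 3 (sliceInto Y 12 1)) (s1 , cs) (λ τ → Prepared (fst τ) × snd τ ≡ cs0)
    second s1 sl1 refl = imply (λ { {s2 , _} sl2 → prepared s2 sl2 (State.coins (Sliced.state sl2)) , State.coins (Sliced.state sl2) })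
        (slice-loop Y 12 1 ≤-refl c≤ Y≤ ≤-refl (Sliced.state sl1))
     where
     module S1 = Sliced sl1
     prepared : ∀ s2 {cs} → Sliced N _ ρ⁺ c s1 (s2 , cs) → cs ≡ cs0 → Prepared s2
     prepared s2 sl2 refl = record
      { state = state
      ; stamp< = λ a → ≤-<-trans (((rest _ λ i j → stamp-cell {a} {N + ⟨ i , j ⟩}) ⊙ (S1.rest _ λ i j → stamp-cell {a} {⟨ i , j ⟩})) ≡⟫ State.stamp st a) stale<cur
      ; left = λ i j → (rest _ λ i' j' e → <⇒≱ (⟨⟩<N i j) ((m≤m+n N ⟨ i' , j' ⟩) ⟫≡ sym (fields-cell e))) ⊙ S1.done i j
      ; right = done
      ; beyond = λ a 2N≤a → ≤-<-trans (((rest _ λ i j e → <⇒≱ (+-monoʳ-< N (⟨⟩<N i j)) (2N≤a ⟫≡ fields-cell e)) ⊙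
          (S1.rest _ λ i j e → <⇒≱ (⟨⟩<2N i j) (2N≤a ⟫≡ fields-cell e))) ≡⟫ State.field≤ st a) stale<cur }
      where open Sliced sl2

   dimensions : ℕ → ℕ
   dimensions = ((λ _ → 0) [ 1 ↦ 1 ]) [ 0 ↦ n ]

   record Ready (s : Store ℕ) : Set where
    field
     prepared : Prepared s
     ints     : ∀ a → a < Bd → var s (ivar a) ≡ dimensions a
     fields   : ∀ a → a < Bd → var s (fvar a) ≡ 0

   prepared-cong : ∀ {s s′} → Good s′ → Below 32 s s′ → heap s′ ≡ heap s → Prepared s → Prepared s′
   prepared-cong {s} {s′} g b refl p = record
    { state = record { State state ; good = g ; vars = same-vars {ρ⁺} (A.below-weaken (m≤m+n 18 14) b) (State.vars state) }
    ; stamp< = stamp< ; left = left ; right = right ; beyond = beyond }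
    where open Prepared p

   ready : ∀ {s} → Prepared s → A.Ex (Bd * (unit + unit) + (unit + unit)) (reset Bd ▸ ‹ int (add (ivar 0) 2 15) › ▸ ‹ int (add (ivar 1) 3 15) ›) (s , cs0)
    (λ τ → Ready (fst τ) × snd τ ≡ cs0)
   ready {s} p = ex-reset Bd (State.good (Prepared.state p)) A.⨟ λ { {s1 , _} record { good = g ; kept = b ; heap≡ = h ; coins = refl ; ints = i0 ; fields = f0 } →
    let vs = State.vars (Prepared.state (prepared-cong {s} {s1} g b h p))
        first : var s1 2 + var s1 15 ≡ n
        first = cong₂ _+_ (A.look vs 2 tt) (A.look vs 15 tt) ⊙ +-identityʳ n
        second : var s1 3 + var s1 15 ≡ 1
        second = cong₂ _+_ (A.look vs 3 tt) (A.look vs 15 tt)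
        two : ∀ y z {_ : T (y <ᵇ 32)} {_ : T (z <ᵇ 32)} → size (var s1 y) + size (var s1 z) ≤ unit
        two y z {ly} {lz} = +-mono-≤ (size-mono (A.vars g y ly)) (size-mono (A.vars g z lz))
        g2 = A.good-var {s1} 40 (first ≡⟫ n≤N ⟫ N≤𝔹) g
        g3 = A.good-var {setVar 40 (var s1 2 + var s1 15) s1} 42 (second ≡⟫ small {1} tt) g2
    in A._⨟_ {R = _≡ (setVar 40 (var s1 2 + var s1 15) s1 , cs0)} (A.ex-op (A.fits g) (two 2 15) refl) λ { refl →
       A.ex-op (A.fits g2) (two 3 15)
        ( record
         { prepared = prepared-cong {s} g3 (A.below-trans b (A.below-trans (A.below-var {32} {s1} 40 _ tt) (A.below-var {32} {setVar 40 (var s1 2 + var s1 15) s1} 42 _ tt))) h p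
         ; ints = λ a a< → upd-elim (λ z u → z ≡ ivar a → u ≡ dimensions a) (var s1 [ 40 ↦ var s1 2 + var s1 15 ]) 42 (var s1 3 + var s1 15)
             (λ e → second ⊙ cong dimensions (ivar-injective {1} {a} e))
             (λ z 42≢ → upd-elim (λ z u → 42 ≢ z → z ≡ ivar a → u ≡ dimensions a) (var s1) 40 (var s1 2 + var s1 15)
              (λ _ e → first ⊙ cong dimensions (ivar-injective {0} {a} e))
              (λ z 40≢ 42≢ e → (cong (var s1) e ⊙ i0 a a<) ⊙ (rest a (λ { refl → 40≢ (sym e) }) λ { refl → 42≢ (sym e) })) z 42≢) (ivar a) refl
         ; fields = λ a a< → upd-≢ (var s1 [ 40 ↦ var s1 2 + var s1 15 ]) (var s1 3 + var s1 15) (ivar≢fvar 1 a) ⊙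
             upd-≢ (var s1) (var s1 2 + var s1 15) (ivar≢fvar 0 a) ⊙ f0 a a< }
        , refl) } }
    where
    rest : ∀ a → a ≢ 0 → a ≢ 1 → 0 ≡ dimensions a
    rest zero          p q = contradiction refl p
    rest (suc zero)    p q = contradiction refl q
    rest (suc (suc a)) p q = refl

   entering : Store ℕ → A2.FieldState
   entering s = store dimensions (λ _ → 0) , store (λ _ → false) (λ a → heap s (cell N 2 a) ≡ᵇ cur)

   is-current : ∀ k → 1 ≤ k → ∀ β → (k ∸ (1 ∸ ⟦ β ⟧ᵇ) ≡ᵇ k) ≡ β
   is-current k       _ true  = ≡ᵇ-refl k
   is-current (suc k) _ false = smaller k
    where
    smaller : ∀ k → (k ≡ᵇ suc k) ≡ false
    smaller zero    = refl
    smaller (suc k) = smaller k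

   input : ∀ {s} → Prepared s → A2.Input factors (entering s)
   input {s} p = refl , refl , (λ { (suc zero) (s≤s ()) ; (suc (suc a)) _ → refl }) , (λ _ → refl) , (λ _ → refl) , entries , beyond'
    where
    open Prepared p
    is-slice : ∀ {h} e v → h ≡ cur ∸ (1 ∸ bit e v) → (h ≡ᵇ cur) ≡ odd? (halves e v)
    is-slice e v refl = cong (λ β → cur ∸ (1 ∸ β) ≡ᵇ cur) (parity≡ (halves e v)) ⊙ is-current cur (s≤s z≤n ⟫ stale<cur) (odd? (halves e v))
    entries : ∀ m i j → (heap s (cell N 2 (toℕ (combine m (combine i j)))) ≡ᵇ cur) ≡ factors m i j
    entries zero i j = is-slice b' (c X i j) (cong (λ q → heap s (cell N 2 q)) (Fin.toℕ-combine {2} zero (combine i j) ⊙ cong (_+ ⟨ i , j ⟩) (*-zeroʳ N)) ⊙ left i j)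
    entries (suc zero) i j = is-slice c' (c Y i j) (cong (λ q → heap s (cell N 2 q)) (Fin.toℕ-combine {2} (suc zero) (combine i j) ⊙ cong (_+ ⟨ i , j ⟩) (*-identityʳ N)) ⊙ right i j)
    beyond' : ∀ a → 2 * (n * n) ≤ a → (heap s (cell N 2 a) ≡ᵇ cur) ≡ false
    beyond' a 2N≤a with heap s (cell N 2 a) ≡ᵇ cur in eq
    ... | false = refl
    ... | true  = contradiction (≡ᵇ⇒≡ (heap s (cell N 2 a)) cur (subst T (sym eq) tt))
                    (<⇒≢ (beyond a (cong (N +_) (sym (+-identityʳ N)) ≡⟫ 2N≤a)))

   module Sim₂ {s} (rd : Ready s) where
    open Ready rd public using (prepared)
    open Prepared prepared public
    open State state public
    open Simulation Hyp S w 𝔹 size𝔹≤w 64≤𝔹 N cur (size 𝔹) Bd S2 w2 (s≤s z≤n ⟫ stale<cur) (size-mono N≤𝔹) (size-mono cur≤𝔹) room cells2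
     s cs0 (A.look vars 1 tt) (A.look vars 3 tt) (A.look vars 9 tt) (A.look vars 15 tt) public

   simulated : ∀ {s} (rd : Ready s) → Sim₂.Sim rd (entering s) (s , cs0)
   simulated {s} rd = record
    { ints = Ready.ints rd ; fields = Ready.fields rd
    ; iheap = λ a → inj₂ (stamp< a , refl)
    ; fheap = λ a → tracked a (heap s (cell N 2 a) ≡ᵇ cur) refl
    ; frame = record { main = A.below-refl ; raw = λ _ _ → refl ; array = λ _ _ _ _ → refl ; okay = A.fits good ; coins = refl } }
    where
    open Sim₂ rd
    tracked : ∀ a β → (heap s (cell N 2 a) ≡ᵇ cur) ≡ β → Stamped (heap s (cell N 2 a)) (β ≡ true) (β ≡ false)
    tracked a true  e = inj₁ (≡ᵇ⇒≡ _ cur (subst T (sym e) tt) , refl)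
    tracked a false e = inj₂ (≤∧≢⇒< (field≤ a) (λ e' → subst T e (≡⇒≡ᵇ _ cur e')) , refl)

   record Multiplied (τ : CoinState) : Set where
    field
     state  : State ρ⁺ c τ
     result : ∀ i j → 1 ∸ (cur ∸ heap (fst τ) (cell N 2 ⟨ i , j ⟩)) ≡ ⟦ (P F.∙ Q) i j ⟧ᵇ

   multiplied : ∀ {s τ σ} (rd : Ready s) → F.Stores (P F.∙ Q) (heap (snd σ)) → Sim₂.Sim rd σ τ → Multiplied τ
   multiplied rd stores r = record
    { state = record
     { good = record { fits = okay ; vars = λ a l → A.same main a l ≡⟫ A.vars good a l }
     ; vars = same-vars {ρ⁺} (A.below-weaken (m≤m+n 18 14) main) vars
     ; raw = λ i j → raw′ _ (⟨⟩<N i j) ⊙ raw i j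
     ; array = λ k i j → (array′ (index k) ⟨ i , j ⟩ (m≤m+n 3 (rank k)) (index<16 k)) ⊙ array k i j
     ; stamp = λ a → stamp≤ (iheap a)
     ; field≤ = λ a → stamp≤ (fheap a)
     ; coins = coins′ }
    ; result = λ i j → decode (fheap ⟨ i , j ⟩) ⊙ cong ⟦_⟧ᵇ (stores i j) }
    where
    open Sim₂ rd
    open Sim r using (main; okay; iheap; fheap) renaming (raw to raw′; array to array′; coins to coins′)

   multiply : ∀ {s} → Ready s → Ex M (compile mul) (s , cs0) Multiplied
   multiply {s} rd = relax (≤-⊑-trans (≤-reflexive (bill≡ (costs2 log))) cost≤) (multiplied rd stores)
       (simulate run (s≤s (n≤1+n (varBound mul))) (All.map fit fits) (fit fits') (simulated rd))
    where
    open Sim₂ rd using (bill≡; simulate; fit)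
    result = runs factors (entering s) (input (Ready.prepared rd))
    log    = fst result
    run    = fst (snd (snd result))
    stores = fst (snd (snd (snd result)))
    fits   = fst (snd (snd (snd (snd result))))
    fits'  = fst (snd (snd (snd (snd (snd result)))))
    cost≤  = snd (snd (snd (snd (snd (snd result)))))

   accumulate : ∀ {τ} → Multiplied τ → Ex (flatCost readoutCost) (each 1 3 readout) τ (State ρ⁺ (c [ sums ≔ (λ i j → c sums i j + ⟦ (P F.∙ Q) i j ⟧ᵇ) ]))
   accumulate {s , _} record { state = state ; result = result } with State.coins state
   ... | refl = flat-loop-at sums _ state λ i j {s1} untouched en →
    let unread : heap s1 (cell N 2 ⟨ i , j ⟩) ≡ heap s (cell N 2 ⟨ i , j ⟩)
        unread = untouched _ λ q → low≢at 2 {sums} ⟨ i , j ⟩ q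
    in get 20 2 16 (Entry.good en) (Entry.vars en) (Entry.here en) (⟨⟩<2N i j) (unread ≡⟫ (State.field≤ state ⟨ i , j ⟩) ⟫ cur≤𝔹) A.⨟ λ { {s2 , _} (g , refl , h , _ , b , e2) →
    let en2 = move g b h refl en in
    calc (sub 20 9 20 ∷ sub 20 3 20 ∷ []) refl tt en2 A.⨟ λ { {s3 , _} (refl , en3) →
    read 21 sums (<⇒≤ (sums≤ i j)) en3 A.⨟ λ { {s4 , _} (en4 , e4 , keep4) →
    let total : var s4 21 + var s4 20 ≡ c sums i j + ⟦ (P F.∙ Q) i j ⟧ᵇ
        total = cong₂ _+_ e4 (keep4 20 tt refl ⊙ cong₂ _∸_ (A.look (Entry.vars en2) 3 tt)
         (cong₂ _∸_ (A.look (Entry.vars en2) 9 tt) (e2 ⊙ unread)) ⊙ result i j)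
    in calc (add 21 21 20 ∷ []) refl (total ≡⟫ within (bit≤1 ((P F.∙ Q) i j)) (sums≤ i j) , tt) en4 A.⨟ λ { (refl , en5) →
    write (index sums) 16 21 en5 (Entry.here en5) (⟨⟩<2N i j) total } } } }
  call-product : Triple callCost (call mul X Y) ρ c ρ⁺ (c [ sums ≔ (λ i j → c sums i j + ⟦ (P F.∙ Q) i j ⟧ᵇ) ])
  call-product st =
   compute (add 9 9 3) ρ ρ1 (cur≤𝔹 , tt) below-16 ≤-refl st ⨟ λ { {s1 , _} st1 →
   slices st1 ⨟ λ { {s2 , _} (p , refl) →
   relax (≤⇒⊑ ≤-refl) id (ready p) ⨟ λ { {s3 , _} (rd , refl) →
   multiply rd ⨟ accumulate } } }

 hadamardCost : ℕ
 hadamardCost = flatCost (productCost L) + unit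

 idle : (res k left cur : ℕ) → Registers
 idle res k left cur = record { res = res ; k = k ; left = left ; cur = cur ; stale = cur ; e = 0 ; c = 0 ; b1 = 0 ; b = 0 }

 module _ (1≤L : 1 ≤ L) (L≤𝔹 : L + 3 ≤ 𝔹) (2^L≤𝔹 : 2 ^ suc L ≤ 𝔹) {res k left : ℕ} {c : Contents n} (out W X Y : Array)
  {out#sums : Apart out sums} {sums#out : Apart sums out} {sums#W : Apart sums W} {out#W : Apart out W}
  {sums#X : Apart sums X} {sums#Y : Apart sums Y} {out#X : Apart out X} {out#Y : Apart out Y}
  (W≤ : Small (c W)) (X≤ : Small (c X)) (Y≤ : Small (c Y)) where

  private
   kept : ∀ {Z} O Acc → Apart sums Z → Apart out Z → ((c [ out ≔ O ]) [ sums ≔ Acc ]) Z ≡ c Z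
   kept {Z} O Acc sums#Z out#Z = put-apart (c [ out ≔ O ]) {sums} {Z} sums#Z ⊙ put-apart c {out} {Z} out#Z

   kept≤ : ∀ {Z} O Acc → Apart sums Z → Apart out Z → Small (c Z) → ∀ i j → ((c [ out ≔ O ]) [ sums ≔ Acc ]) Z i j ≤ 𝔹
   kept≤ {Z} O Acc sums#Z out#Z Z≤ i j = subst (λ X → X i j ≤ 𝔹) (sym (kept {Z} O Acc sums#Z out#Z)) (Z≤ i j)

   module H = Run res k left c out W hadamardCost (hadamardBody X Y) (hadamardProduct L (c X) (c Y)) out#sums sums#out sums#W out#W 1≤L W≤
    (λ b c' i j → *-mono-≤ (parity≤1 (halves b (c X i j))) (parity≤1 (halves c' (c Y i j)))) L≤𝔹 2^L≤𝔹

   module P = Run res k left c out W callCost (call mul X Y) (matrixProduct L (c X) (c Y)) out#sums sums#out sums#W out#W 1≤L W≤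
    (λ b c' i j → bit≤1 ((slice (c X) b F.∙ slice (c Y) c') i j)) L≤𝔹 2^L≤𝔹

   replace : ∀ O {Acc Acc' Acc″ : Words n} → (∀ i j → Acc' i j ≡ Acc″ i j) → ∀ x i j →
    (((c [ out ≔ O ]) [ sums ≔ Acc ]) [ sums ≔ Acc' ]) x i j ≡ ((c [ out ≔ O ]) [ sums ≔ Acc″ ]) x i j
   replace O h x i j = cong (λ X → X i j) (put-put (c [ out ≔ O ]) sums x) ⊙ put-cong (c [ out ≔ O ]) (c [ out ≔ O ]) sums (λ _ _ _ → refl) h x i j

   hadamard-spec : ∀ O Acc cur e c' b1 b → (∀ i j → suc (Acc i j) ≤ 𝔹) → suc cur ≤ 𝔹 → b ≤ L → c' ≤ L →
    Triple hadamardCost (hadamardBody X Y) (H.regs cur e c' b1 b) (H.K O Acc) (H.regs (cur + 1) e c' b1 b) (H.K O (λ i j → Acc i j + hadamardProduct L (c X) (c Y) b c' i j))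
   hadamard-spec O Acc cur e c' b1 b acc≤ cur≤ b≤ c≤ st =
    bit-product X Y sums {L} (kept≤ {X} O Acc sums#X out#X X≤) (kept≤ {Y} O Acc sums#Y out#Y Y≤) acc≤ b≤ c≤ st ⨟ λ st →
    imply (state-cong (replace O λ i j → cong₂ (λ X Y → Acc i j + bit b (X i j) * bit c' (Y i j)) (kept {X} O Acc sums#X out#X) (kept {Y} O Acc sums#Y out#Y)))
     (compute (add 9 9 3) (H.regs cur e c' b1 b) (H.regs (cur + 1) e c' b1 b) (subst (_≤ 𝔹) (+-comm 1 cur) cur≤ , tt)
      below-16 (m≤m+n cur 1) st)

   call-spec : ∀ O Acc cur e c' b1 b → (∀ i j → suc (Acc i j) ≤ 𝔹) → suc cur ≤ 𝔹 → b ≤ L → c' ≤ L →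
    Triple callCost (call mul X Y) (P.regs cur e c' b1 b) (P.K O Acc) (P.regs (cur + 1) e c' b1 b) (P.K O (λ i j → Acc i j + matrixProduct L (c X) (c Y) b c' i j))
   call-spec O Acc cur e c' b1 b acc≤ cur≤ b≤ c≤ st =
    imply (state-cong (replace O λ i j → cong₂ (λ X Y → Acc i j + ⟦ (slice X b F.∙ slice Y c') i j ⟧ᵇ) (kept {X} O Acc sums#X out#X) (kept {Y} O Acc sums#Y out#Y)))
     (call-product {P.regs cur e c' b1 b} {P.K O Acc} X Y ≤-refl cur≤ b≤ c≤ (kept≤ {X} O Acc sums#X out#X X≤) (kept≤ {Y} O Acc sums#Y out#Y Y≤) acc≤ st)

  hadamard : ∀ {cur} → cur + L * L ≤ 𝔹 →
   Triple (convolutionCost hadamardCost) (convolution out W (hadamardBody X Y)) (idle res k left cur) c (idle res k left (cur + L * L))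
    ((c [ out ≔ convolve L (hadamardProduct L (c X) (c Y)) (c W) ]) [ sums ≔ (λ _ _ → 0) ])
  hadamard = H.ex-convolution hadamard-spec

  matrix : ∀ {cur} → cur + L * L ≤ 𝔹 →
   Triple (convolutionCost callCost) (convolution out W (call mul X Y)) (idle res k left cur) c (idle res k left (cur + L * L))
    ((c [ out ≔ convolve L (matrixProduct L (c X) (c Y)) (c W) ]) [ sums ≔ (λ _ _ → 0) ])
  matrix = P.ex-convolution call-spec

 module Steps (weights : Weights setting) where

  open Weights weights

  record Memory : Set where
   field B B⁻ G Γ out t1 t2 t3 marks : Words n

  contents : Memory → Contents n
  contents m arcs      = A
  contents m arcsᵀ     = Aᵀ
  contents m powers    = Memory.B m
  contents m powers⁻   = Memory.B⁻ m
  contents m gradients = Memory.G m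
  contents m cycles    = Memory.Γ m
  contents m hits      = Memory.out m
  contents m tmp1      = Memory.t1 m
  contents m tmp2      = Memory.t2 m
  contents m tmp3      = Memory.t3 m
  contents m flag      = Memory.marks m
  contents m _         = zeros L

  tidy : ∀ {ρ c τ} m → (∀ k → c k ≡ contents m k) → State ρ c τ → State ρ (contents m) τ
  tidy m h = state-cong λ k i j → cong (λ X → X i j) (h k)

  record Within (m : Memory) : Set where
   open Memory m
   field
    B≤  : Small B
    B⁻≤ : Small B⁻
    G≤  : Small G
    Γ≤  : Small Γ

  convolve≤ : ∀ D W → Small (convolve L D W)
  convolve≤ D W i j = <⇒≤ (word< L λ e → collect L D W e L i j) ⟫ ^-monoʳ-≤ 2 (n≤1+n L) ⟫ 2^L≤𝔹

  zeros≤ : Small (zeros L)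
  zeros≤ _ _ = z≤n

  diagonal≤ : ∀ d {X} → (∀ i → d i ≤ 𝔹) → Small X → Small (withDiagonal L d X)
  diagonal≤ d d≤ X≤ i j with does (i Fin.≟ j)
  ... | true  = d≤ i
  ... | false = X≤ i j

  Δ : ℕ
  Δ = L * L

  had : Memory → Words n
  had m = convolve L (hadamardProduct L Aᵀ (convolve L (hadamardProduct L Aᵀ (Memory.B⁻ m)) (zeros L))) (zeros L)

  after-squares : Memory → Memory
  after-squares m = record m { t1 = convolve L (hadamardProduct L Aᵀ (Memory.B⁻ m)) (zeros L) ; t2 = had m }

  copyCost hadCost callCost' : ℕ
  copyCost = flatCost (8 * unit + 8 * unit)
  hadCost = convolutionCost hadamardCost
  callCost' = convolutionCost callCost

  ex-squares : ∀ m {cur res k left} → Within m → cur + Δ + Δ ≤ 𝔹 →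
   Triple (hadCost + hadCost) (squareStage mul) (idle res k left cur) (contents m) (idle res k left (cur + Δ + Δ)) (contents (after-squares m))
  ex-squares m {cur} w b st =
   hadamard 1≤L L≤𝔹 2^L≤𝔹 {c = contents m} tmp1 blank arcsᵀ powers⁻ zeros≤ Aᵀ≤ (Within.B⁻≤ w) (m≤m+n (cur + Δ) Δ ⟫ b) st ⨟ λ st →
   imply (tidy (after-squares m) every-array)
    (hadamard 1≤L L≤𝔹 2^L≤𝔹 {c = contents m1} tmp2 blank arcsᵀ tmp1 zeros≤ Aᵀ≤ (convolve≤ _ (zeros L)) b
     (tidy m1 every-array st))
   where
   m1 = record m { t1 = convolve L (hadamardProduct L Aᵀ (Memory.B⁻ m)) (zeros L) }

  B⁺ G⁺ Γ⁺ : Memory → Words n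
  B⁺ m = convolve L (matrixProduct L A (Memory.B m)) (zeros L)
  G⁺ m = convolve L (matrixProduct L (Memory.G m) Aᵀ) (withDiagonal L (λ i → Memory.B m i i) (Memory.t2 m))
  Γ⁺ m = convolve L (matrixProduct L Aᵀ (Memory.Γ m)) (withDiagonal L (λ _ → 0) (Memory.G m))

  after-powers after-gradient after-cycles : Memory → Memory
  after-powers m   = record m { B = B⁺ m ; B⁻ = Memory.B m ; t3 = B⁺ m }
  after-gradient m = record m { t2 = withDiagonal L (λ i → Memory.B m i i) (Memory.t2 m) ; t3 = G⁺ m ; G = G⁺ m }
  after-cycles m   = record m { t3 = withDiagonal L (λ _ → 0) (Memory.t3 m) ; t1 = Γ⁺ m ; Γ = Γ⁺ m }

  ex-powers : ∀ m {cur res k left} → Within m → cur + Δ ≤ 𝔹 →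
   Triple (copyCost + (callCost' + copyCost)) (powerStage mul) (idle res k left cur) (contents m) (idle res k left (cur + Δ)) (contents (after-powers m))
  ex-powers m {cur} w b st =
   copy powers powers⁻ (Within.B≤ w) st ⨟ λ st →
   matrix 1≤L L≤𝔹 2^L≤𝔹 {c = contents m1} tmp3 blank arcs powers zeros≤ A≤ (Within.B≤ w) b
    (tidy m1 every-array st) ⨟ λ st →
   imply (tidy (after-powers m) every-array)
    (copy {c = contents m2} tmp3 powers (convolve≤ _ (zeros L)) (tidy m2 every-array st))
   where
   m1 m2 : Memory
   m1 = record m { B⁻ = Memory.B m }
   m2 = record m1 { t3 = B⁺ m }

  ex-gradient : ∀ m {cur res k left} → Within m → Small (Memory.t2 m) → cur + Δ ≤ 𝔹 →
   Triple (copyCost + (callCost' + copyCost)) (gradientStage mul) (idle res k left cur) (contents m) (idle res k left (cur + Δ)) (contents (after-gradient m))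
  ex-gradient m {cur} w t≤ b st =
   diagonal-copy powers tmp2 (Within.B≤ w) st ⨟ λ st →
   matrix 1≤L L≤𝔹 2^L≤𝔹 {c = contents m1} tmp3 tmp2 gradients arcsᵀ (diagonal≤ _ (λ i → Within.B≤ w i i) t≤) (Within.G≤ w) Aᵀ≤ b
    (tidy m1 every-array st) ⨟ λ st →
   imply (tidy (after-gradient m) every-array)
    (copy {c = contents m2} tmp3 gradients (convolve≤ _ (Memory.t2 m1)) (tidy m2 every-array st))
   where
   m1 m2 : Memory
   m1 = record m { t2 = withDiagonal L (λ i → Memory.B m i i) (Memory.t2 m) }
   m2 = record m1 { t3 = G⁺ m }

  ex-cycles : ∀ m {cur res k left} → Within m → Memory.t3 m ≡ Memory.G m → cur + Δ ≤ 𝔹 →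
   Triple (flatCost (8 * unit) + (callCost' + copyCost)) (cycleStage mul) (idle res k left cur) (contents m) (idle res k left (cur + Δ)) (contents (after-cycles m))
  ex-cycles m {cur} w refl b st =
   diagonal-constant tmp3 15 st ⨟ λ st →
   matrix 1≤L L≤𝔹 2^L≤𝔹 {c = contents m1} tmp1 tmp3 arcsᵀ cycles (diagonal≤ _ (λ _ → z≤n) (Within.G≤ w)) Aᵀ≤ (Within.Γ≤ w) b
    (tidy m1 every-array st) ⨟ λ st →
   imply (tidy (after-cycles m) every-array)
    (copy {c = contents m2} tmp1 cycles (convolve≤ _ (Memory.t3 m1)) (tidy m2 every-array st))
   where
   m1 m2 : Memory
   m1 = record m { t3 = withDiagonal L (λ _ → 0) (Memory.t3 m) }
   m2 = record m1 { t1 = Γ⁺ m }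

  final-memory : Memory → Memory
  final-memory m = after-cycles (after-gradient (after-powers (after-squares m)))

  ex-stage : ∀ m {cur res k left p t} → Within m → cur + Δ + Δ + Δ + Δ + Δ ≤ 𝔹 → ∀ {Q : CoinState → Set} →
   (∀ {τ} → State (idle res k left (cur + Δ + Δ + Δ + Δ + Δ)) (contents (final-memory m)) τ → Ex t p τ Q) →
   ∀ {τ} → State (idle res k left cur) (contents m) τ →
   Ex (hadCost + hadCost + (copyCost + (callCost' + copyCost) + (copyCost + (callCost' + copyCost) + (flatCost (8 * unit) + (callCost' + copyCost) + t))))
    (squareStage mul ▸ powerStage mul ▸ gradientStage mul ▸ cycleStage mul ▸ p) τ Q
  ex-stage m {cur} w b next st =
   ex-squares m w b2 st ⨟ λ st → ex-powers m1 w1 b3 st ⨟ λ st → ex-gradient m2 w2' (convolve≤ _ (zeros L)) b4 st ⨟ λ st → ex-cycles m3 w3 refl b st ⨟ next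
   where
   m1 m2 m3 : Memory
   m1 = after-squares m
   m2 = after-powers m1
   m3 = after-gradient m2
   w1 : Within m1
   w1 = record { Within w }
   w2' : Within m2
   w2' = record { B≤ = convolve≤ _ (zeros L) ; B⁻≤ = Within.B≤ w ; G≤ = Within.G≤ w ; Γ≤ = Within.Γ≤ w }
   w3 : Within m3
   w3 = record { B≤ = convolve≤ _ (zeros L) ; B⁻≤ = Within.B≤ w ; G≤ = convolve≤ _ (Memory.t2 m3) ; Γ≤ = Within.Γ≤ w }
   b4 = m≤m+n _ Δ ⟫ b
   b3 = m≤m+n _ Δ ⟫ b4
   b2 = m≤m+n _ Δ ⟫ b3

  hitsOf : Words n → Words n
  hitsOf Γ i j = raw0 i j ∸ (1 ∸ Γ i j)

  hitsOf≤1 : ∀ Γ i j → hitsOf Γ i j ≤ 1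
  hitsOf≤1 Γ i j = m∸n≤m (raw0 i j) (1 ∸ Γ i j) ⟫ raw≤1 i j

  reportCost : ℕ
  reportCost = flatCost hitCost + (flatCost tallyCost + (unit + (8 * unit + (unit + unit))))

  data Reported (k left cur : ℕ) (m : Memory) (τ : CoinState) : Set where
   none-hit : (∀ i j → hitsOf (Memory.Γ m) i j ≡ 0) → State (idle 0 (suc k) left cur) (contents (record m { out = hitsOf (Memory.Γ m) })) τ → Reported k left cur m τ
   some-hit : ∀ flags → (∃[ i ] ∃[ j ] hitsOf (Memory.Γ m) i j ≢ 0) →
    State (idle (suc (suc k)) (suc k) left cur) (contents (record m { out = hitsOf (Memory.Γ m) ; marks = flags })) τ → Reported k left cur m τ

  ex-report : ∀ k left cur m → k < n → Small (Memory.Γ m) → (∀ i j → Memory.marks m i j ≡ 0) → ∀ {τ} → State (idle 0 k left cur) (contents m) τ →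
   Ex reportCost report τ (Reported k left cur m)
  ex-report k left cur m k<n Γ≤ flag≡0 st =
   hit cycles hits (λ i j → raw≤1 i j ⟫ small {1} tt) Γ≤ st ⨟ λ st →
   let st1 = tidy m1 every-array st in
   tally {c = contents m1} (hitsOf≤1 (Memory.Γ m)) st1 (empty st1) ⨟ λ t → branch t
   where
   m1 : Memory
   m1 = record m { out = hitsOf (Memory.Γ m) }
   0<2N : 0 < N + N
   0<2N = 1≤N ⟫ m≤m+n N N
   ⟨0,0⟩ : ⟨ fromℕ< 1≤n , fromℕ< 1≤n ⟩ ≡ 0
   ⟨0,0⟩ = Fin.toℕ-combine (fromℕ< 1≤n) (fromℕ< 1≤n) ⊙ cong₂ (λ i j → n * i + j) (Fin.toℕ-fromℕ< 1≤n) (Fin.toℕ-fromℕ< 1≤n) ⊙ +-identityʳ (n * 0) ⊙ *-zeroʳ n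
   empty : ∀ {τ} → State (idle 0 k left cur) (contents m1) τ → heap (fst τ) (at flag 0) ≡ 0
   empty {τ} st = cong (λ p → heap (fst τ) (at flag p)) (sym ⟨0,0⟩) ⊙ State.array st flag (fromℕ< 1≤n) (fromℕ< 1≤n) ⊙ flag≡0 (fromℕ< 1≤n) (fromℕ< 1≤n)
   branch : ∀ {τ} → Tallied {idle 0 k left cur} {contents m1} τ →
    Ex (unit + (8 * unit + (unit + unit))) (‹ int (add 7 7 3) › ▸ fetch 20 (index flag) 15 ▸ (ifz 20 then skip else ‹ int (add 0 7 3) ›)) τ (Reported k left cur m)
   branch {τ} t =
    compute (add 7 7 3) (idle 0 k left cur) (idle 0 (suc k) left cur) (+-comm k 1 ≡⟫ k<n ⟫ m≤m+n n 2 ⟫ n+2≤𝔹 , tt)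
     (below-16 {{p7 = +-comm k 1}}) ≤-refl state ⨟ λ { {s1 , cs1} st →
    let value : heap s1 (at flag 0) ≡ flags z z
        value = cong (λ p → heap s1 (at flag p)) (sym ⟨0,0⟩) ⊙ State.array st flag z z
    in relax (≤⇒⊑ ≤-refl) id (get {idle 0 (suc k) left cur} 20 (index flag) 15 (State.good st) (State.vars st) (A.look (State.vars st) 15 tt) 0<2N
          ((value ⊙ sym flag≡) ≡⟫ total≤ ⟫ N≤𝔹)) ⨟ λ { {s2 , _} (g , refl , h , _ , b , v) →
    let st2 : State (idle 0 (suc k) left cur) (contents m1 [ flag ≔ flags ]) (s2 , cs1)
        st2 = same-heap h g (same-vars {idle 0 (suc k) left cur} b (State.vars st)) ≤-refl st
    in ex-ifz (A.fits g) (A.size≤unit (A.vars g 20 tt))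
         (λ e → weaken z≤n id (ex-skip (quiet (sym (v ⊙ value) ⊙ e) st2)))
         (λ e → imply (loud λ q → e ((v ⊙ value) ⊙ q))
          (compute (add 0 7 3) (idle 0 (suc k) left cur) (idle (suc (suc k)) (suc k) left cur)
           (+-comm (suc k) 1 ≡⟫ s≤s k<n ⟫ +-comm 1 n ≡⟫ +-monoʳ-≤ n (s≤s z≤n) ⟫ n+2≤𝔹 , tt)
           (below-16 {{p0 = +-comm (suc k) 1}}) ≤-refl st2)) } }
    where
    open Tallied t
    z = fromℕ< 1≤n
    flag≡ : heap (fst τ) (at flag 0) ≡ flags z z
    flag≡ = cong (λ p → heap (fst τ) (at flag p)) (sym ⟨0,0⟩) ⊙ State.array state flag z z
    quiet : ∀ {τ'} → flags z z ≡ 0 → State (idle 0 (suc k) left cur) (contents m1 [ flag ≔ flags ]) τ' → Reported k left cur m τ'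
    quiet e st with zero⊎
    ... | inj₁ (_ , all , same-flags) = none-hit all (state-cong (λ x i j → put-cong (contents m1) (contents m1) flag (λ _ _ _ → refl) same-flags x i j ⊙
        cong (λ X → X i j) (every-array {λ x → (contents m1 [ flag ≔ Memory.marks m ]) x ≡ contents m1 x} x)) st)
    ... | inj₂ (p , _) = contradiction (flag≡ ⊙ e) (m<n⇒n≢0 p)
    loud : ∀ {τ'} → flags z z ≢ 0 → State (idle (suc (suc k)) (suc k) left cur) (contents m1 [ flag ≔ flags ]) τ' → Reported k left cur m τ'
    loud e st with zero⊎
    ... | inj₁ (q , _) = contradiction (sym flag≡ ⊙ q) e
    ... | inj₂ (_ , found) = some-hit flags found (tidy (record m1 { marks = flags }) every-array st)

  Δ5 : ℕ
  Δ5 = L * L + L * L + L * L + L * L + L * L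

  stage-at : ℕ → Stage {n} L
  stage-at = stages L A Aᵀ

  memory : Stage {n} L → (out t1 t2 t3 marks : Words n) → Memory
  memory s out t1 t2 t3 marks = record { B = Stage.B s ; B⁻ = Stage.B⁻ s ; G = Stage.G s ; Γ = Stage.Γ s ; out = out ; t1 = t1 ; t2 = t2 ; t3 = t3 ; marks = marks }

  stage≤ : ∀ k {out t1 t2 t3 marks} → Within (memory (stage-at k) out t1 t2 t3 marks)
  stage≤ zero = record { B≤ = one≤ ; B⁻≤ = zeros≤ ; G≤ = one≤ ; Γ≤ = zeros≤ }
   where
   one≤ : Small (withDiagonal L (λ _ → 1) (zeros L))
   one≤ = diagonal≤ (λ _ → 1) (λ _ → small {1} tt) zeros≤
  stage≤ (suc k) = record { B≤ = convolve≤ _ (zeros L) ; B⁻≤ = Within.B≤ (stage≤ k {zeros L} {zeros L} {zeros L} {zeros L} {zeros L}) ; G≤ = convolve≤ _ _ ; Γ≤ = convolve≤ _ _ }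

  NoHits : ℕ → Set
  NoHits k = ∀ i j → hitsOf (Stage.Γ (stage-at k)) i j ≡ 0

  data Progress (total j : ℕ) (τ : CoinState) : Set where
   searching : ∀ k cur out t1 t2 t3 marks → k + j ≡ n → cur + j * Δ5 ≡ total → (∀ x y → marks x y ≡ 0) → (∀ x y → out x y ≡ 0) →
    (∀ k' → 1 ≤ k' → k' ≤ k → NoHits k') → State (idle 0 k j cur) (contents (memory (stage-at k) out t1 t2 t3 marks)) τ → Progress total j τ
   found : ∀ k k0 cur c → 1 ≤ k → (∀ k' → 1 ≤ k' → k' < k → NoHits k') → (∃[ x ] ∃[ y ] hitsOf (Stage.Γ (stage-at k)) x y ≢ 0) →
    (∀ x y → c hits x y ≡ hitsOf (Stage.Γ (stage-at k)) x y) → State (idle (suc k) k0 j cur) c τ → Progress total j τ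

  stepCost : ℕ
  stepCost = hadCost + hadCost + (copyCost + (callCost' + copyCost) + (copyCost + (callCost' + copyCost) + (flatCost (8 * unit) + (callCost' + copyCost) + reportCost)))

  record Stepped (total k j : ℕ) (out marks : Words n) (τ : CoinState) : Set where
   field
    cur      : ℕ
    t1 t2 t3 : Words n
    used     : cur + j * Δ5 ≡ total
    reported : Reported k (suc j) cur (memory (stage-at (suc k)) out t1 t2 t3 marks) τ

  ex-step : ∀ {total} k j cur out t1 t2 t3 marks → k + suc j ≡ n → cur + suc j * Δ5 ≡ total → total ≤ 𝔹 → (∀ x y → marks x y ≡ 0) →
   ∀ {τ} → State (idle 0 k (suc j) cur) (contents (memory (stage-at k) out t1 t2 t3 marks)) τ → Ex stepCost (step mul) τ (Stepped total k j out marks)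
  ex-step {total} k j cur out t1 t2 t3 marks k+j used total≤ flag≡0 =
   ex-stage m (stage≤ k) (m≤m+n cur5 (j * Δ5) ⟫ used5 ≡⟫ total≤) λ st →
    imply (λ r → record { cur = cur5 ; t1 = Memory.t1 m' ; t2 = Memory.t2 m' ; t3 = Memory.t3 m' ; used = used5 ; reported = r })
     (ex-report k (suc j) cur5 m' (m<m+n k z<s ⟫≡ k+j) (Within.Γ≤ (stage≤ (suc k) {out} {Memory.t1 m'} {Memory.t2 m'} {Memory.t3 m'} {marks})) flag≡0 st)
   where
   m m' : Memory
   m  = memory (stage-at k) out t1 t2 t3 marks
   m' = final-memory m
   cur5 : ℕ
   cur5 = cur + Δ + Δ + Δ + Δ + Δ
   used5 : cur5 + j * Δ5 ≡ total
   used5 = solve 3 (λ c d x → c :+ d :+ d :+ d :+ d :+ d :+ x := c :+ (d :+ d :+ d :+ d :+ d :+ x)) refl cur Δ (j * Δ5) ⊙ used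

  iterationCost : ℕ
  iterationCost = unit + stepCost + unit

  ex-iteration : ∀ {total j τ} → total ≤ 𝔹 → Progress total (suc j) τ →
   Ex iterationCost ((ifz 0 then step mul else skip) ▸ ‹ int (sub 8 8 3) ›) τ (Progress total j)
  ex-iteration {total} {j} {s , cs} total≤ (searching k cur out t1 t2 t3 marks k+j used flag≡0 out≡0 none st) =
   ex-ifz (A.fits (State.good st)) (A.size≤unit (A.vars (State.good st) 0 tt))
    (λ _ → ex-step k j cur out t1 t2 t3 marks k+j used total≤ flag≡0 st)
    (λ nz → contradiction (A.look (State.vars st) 0 tt) nz) ⨟ λ t → next (Stepped.used t) (Stepped.reported t)
   where
   next : ∀ {cur u1 u2 u3 τ} → cur + j * Δ5 ≡ total → Reported k (suc j) cur (memory (stage-at (suc k)) out u1 u2 u3 marks) τ → Ex unit ‹ int (sub 8 8 3) › τ (Progress total j)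
   next {cur} {u1} {u2} {u3} used' (none-hit all st) = imply
    (searching (suc k) cur (hitsOf (Stage.Γ (stage-at (suc k)))) u1 u2 u3 marks (sym (+-suc k j) ⊙ k+j) used' flag≡0 all
       λ k' 1≤k' k'≤ → extend k' 1≤k' (m≤n⇒m<n∨m≡n k'≤))
    (compute (sub 8 8 3) (idle 0 (suc k) (suc j) cur) (idle 0 (suc k) j cur) tt below-16 ≤-refl st)
    where
    extend : ∀ k' → 1 ≤ k' → k' < suc k ⊎ k' ≡ suc k → NoHits k'
    extend k' 1≤k' (inj₁ l)    = none k' 1≤k' (s≤s⁻¹ l)
    extend k' 1≤k' (inj₂ refl) = all
   next {cur} used' (some-hit flags hit st) = imply
    (found (suc k) (suc k) cur _ (s≤s z≤n) (λ k' 1≤k' k'≤k → none k' 1≤k' (s≤s⁻¹ k'≤k)) hit (λ _ _ → refl))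
    (compute (sub 8 8 3) (idle (suc (suc k)) (suc k) (suc j) cur) (idle (suc (suc k)) (suc k) j cur) tt below-16 ≤-refl st)
  ex-iteration {total} {j} {s , cs} total≤ (found k k0 cur c 1≤k none hit out≡ st) =
   ex-ifz {c = stepCost} (A.fits (State.good st)) (A.size≤unit (A.vars (State.good st) 0 tt))
    (λ z → contradiction (sym (A.look (State.vars st) 0 tt) ⊙ z) λ ())
    (λ _ → weaken z≤n id (ex-skip st)) ⨟ λ st →
   imply (found k k0 cur c 1≤k none hit out≡)
    (compute (sub 8 8 3) (idle (suc k) k0 (suc j) cur) (idle (suc k) k0 j cur) tt below-16 ≤-refl st)

  progress-left : ∀ {total j τ} → Progress total j τ → ok (fst τ) × size (var (fst τ) 8) ≤ unit × var (fst τ) 8 ≡ j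
  progress-left (searching _ _ _ _ _ _ _ _ _ _ _ _ st) = A.fits (State.good st) , A.size≤unit (A.vars (State.good st) 8 tt) , A.look (State.vars st) 8 tt
  progress-left (found _ _ _ _ _ _ _ _ st)              = A.fits (State.good st) , A.size≤unit (A.vars (State.good st) 8 tt) , A.look (State.vars st) 8 tt

  searchCost : ℕ
  searchCost = n * (unit + iterationCost) + unit

  ex-search : ∀ {total τ} → total ≤ 𝔹 → Progress total n τ → Ex searchCost (search mul) τ (Progress total 0)
  ex-search {total} total≤ = ex-repeat (Progress total) progress-left (ex-iteration total≤) n

  record Result (τ : CoinState) : Set where
   field
    outcome : (var (fst τ) 0 ≡ 0 × (∀ k → 1 ≤ k → k ≤ n → NoHits k) × (∀ i j → heap (fst τ) ⟨ i , j ⟩ ≡ 0))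
     ⊎ (∃[ k ] (1 ≤ k × (∀ k' → 1 ≤ k' → k' < k → NoHits k') × (∃[ x ] ∃[ y ] hitsOf (Stage.Γ (stage-at k)) x y ≢ 0)
          × var (fst τ) 0 ≡ suc k × (∀ i j → heap (fst τ) ⟨ i , j ⟩ ≡ hitsOf (Stage.Γ (stage-at k)) i j)))
    final-ok : ok (fst τ)

  publishCost : ℕ
  publishCost = flatCost (8 * unit + unit)

  ex-publish : ∀ {ρ c} → (∀ i j → c hits i j ≤ 1) → ∀ {τ} → State ρ c τ → Ex publishCost publish τ
   (λ τ → var (fst τ) 0 ≡ Registers.res ρ × (∀ i j → heap (fst τ) ⟨ i , j ⟩ ≡ c hits i j) × ok (fst τ))
  ex-publish {ρ} {c} c≤1 {s , cs} st = relax (flat-cost (8 * unit + unit))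
   (λ { {s′ , _} (g , vs , _ , done , _) → A.look vs 0 tt
      , (λ i j → cong (heap s′) (sym (*-identityʳ ⟨ i , j ⟩)) ⊙ done (combine i j) ⊙ array hits i j) , A.fits g })
   (A.ex-map flat id (λ _ _ e → e) (λ q → heap s (at hits (toℕ q))) body good vars (λ _ → refl))
   where
   open State st
   body : ∀ (i : Fin N) {s1} → Good s1 → Vars (registers ρ) s1 → var s1 16 ≡ toℕ i * 1 → var s1 17 ≡ N ∸ toℕ i → (∀ a → (∀ q → q < toℕ i → a ≢ q * 1) → heap s1 a ≡ heap s a) →
    A.Ex (8 * unit + unit) (fetch 20 (index hits) 16 ▸ ‹ int (save 16 20) ›) (s1 , cs)
     (λ (s′ , cs') → Below 18 s1 s′ × Good s′ × cs' ≡ cs × (∀ a → heap s′ a ≡ (heap s1 [ toℕ i * 1 ↦ heap s (at hits (toℕ i)) ]) a))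
   body i {s1} g vs e16 _ rest =
    get {ρ} 20 (index hits) 16 g vs (e16 ⊙ *-identityʳ q) (<-≤-trans q<N (m≤m+n N N))
     (value ≡⟫ entry≤ st hits c≤1 q q<N ⟫ small {1} tt) A.⨟ λ { {s2 , _} (g2 , refl , h , keep , b , v) →
    let e : var s2 16 ≡ q
        e = keep 16 tt refl ⊙ e16 ⊙ *-identityʳ q
    in A.ex-op (A.fits g2) (+-mono-≤ (size-mono (A.vars g2 16 tt)) (size-mono (A.vars g2 20 tt)))
     ( A.below (A.same b)
     , A.good-heap (var s2 16) (A.vars g2 20 tt) (subst (_< S) (sym e) (<-≤-trans q<N N≤S)) g2 , refl
     , λ a → cong₂ (λ p h → (fst h [ p ↦ snd h ]) a) (e ⊙ sym (*-identityʳ q)) (cong₂ _,_ h (v ⊙ value)) ) }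
    where
    q : ℕ
    q = toℕ i
    q<N : q < N
    q<N = Fin.toℕ<n i
    value : heap s1 (at hits q) ≡ heap s (at hits q)
    value = rest _ λ p p<q e → raw≢cell (index hits) q (<-trans p<q q<N) (sym (*-identityʳ p) ⊙ sym e)
    N≤S : N ≤ S
    N≤S = base≤cell N 0 0 ⟫ <⇒≤ (snd (cells 0 0 z<s (1≤N ⟫ m≤m+n N N)))

  ex-main : ∀ {total τ} → total ≤ 𝔹 → Progress total n τ → Ex (searchCost + publishCost) (search mul ▸ publish) τ Result
  ex-main total≤ p = ex-search total≤ p ⨟ λ p → conclude p
   where
   conclude : ∀ {total τ} → Progress total 0 τ → Ex publishCost publish τ Result
   conclude (searching k cur out t1 t2 t3 marks k≡n used flag≡0 out≡0 none st) = imply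
    (λ (v , h , o) → record { outcome = inj₁ (v , (λ k' 1≤k' k'≤n → none k' 1≤k' (k'≤n ⟫≡ sym (sym (+-identityʳ k) ⊙ k≡n))) , λ i j → h i j ⊙ out≡0 i j) ; final-ok = o })
    (ex-publish (λ i j → out≡0 i j ≡⟫ z≤n) st)
   conclude (found k k0 cur c 1≤k none hit out≡ st) = imply
    (λ (v , h , o) → record { outcome = inj₂ (k , 1≤k , none , hit , v , λ i j → h i j ⊙ out≡ i j) ; final-ok = o })
    (ex-publish (λ i j → out≡ i j ≡⟫ hitsOf≤1 (Stage.Γ (stage-at k)) i j) st)

 module Initialization (ω : Vec Bool (n * n * r))
  (2^r≤𝔹 : 2 ^ r ≤ 𝔹) (r≤𝔹 : r ≤ 𝔹) (raw≤1 : ∀ i j → raw0 i j ≤ 1) where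

  idle0 : Registers
  idle0 = record { res = 0 ; k = 0 ; left = 0 ; cur = 0 ; stale = 0 ; e = 0 ; c = 0 ; b1 = 0 ; b = 0 }

  v0 : ℕ → ℕ
  v0 = registers idle0

  tossCost : ℕ
  tossCost = 2 * unit + (r * (unit + (1 + 3 * unit)) + unit)

  record Tossed (s : Store ℕ) (rest : List Bool) (value : ℕ) (τ : CoinState) : Set where
   field
    good  : Good (fst τ)
    kept  : Below 18 s (fst τ)
    heap≡ : heap (fst τ) ≡ heap s
    coins : snd τ ≡ rest
    word≡ : var (fst τ) 20 ≡ value

  ex-tossWord : ∀ {s rest} (b : Vec Bool r) → Good s → Vars v0 s → A.Ex tossCost tossWord (s , toList b ++ rest) (Tossed s rest (wordFrom 0 b))
  ex-tossWord {s} {rest} b g vs =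
   A.run-line 18 (const 20 0 ∷ add 21 5 15 ∷ []) g (z≤n , count≡ ≡⟫ r≤𝔹 , tt) A.⨟ λ { (refl , g1 , b1) →
   A.imply (λ { (g , k , h , e , [] , c , w) → record { good = g ; kept = k ; heap≡ = h ; coins = c ; word≡ = w } })
    (A.ex-repeat I (λ (g , _ , _ , e , _) → A.fits g , A.size≤unit (A.vars g 21 tt) , e) iteration r
     (g1 , b1 , refl , count≡ , b , refl , refl)) }
   where
   count≡ : var s 5 + var s 15 ≡ r
   count≡ = cong₂ _+_ (A.look vs 5 tt) (A.look vs 15 tt) ⊙ +-identityʳ r
   I : ℕ → CoinState → Set
   I j (s′ , cs') = Good s′ × Below 18 s s′ × heap s′ ≡ heap s × var s′ 21 ≡ j × Σ[ b' ∈ Vec Bool j ] (cs' ≡ toList b' ++ rest × wordFrom (var s′ 20) b' ≡ wordFrom 0 b)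
   iteration : ∀ {j τ} → I (suc j) τ → A.Ex (1 + 3 * unit) (‹ toss 22 › ▸ line (add 20 20 20 ∷ add 20 20 22 ∷ sub 21 21 3 ∷ [])) τ (I j)
   iteration {j} {s1 , _} (g , k , h , e , c ∷ b' , refl , w) =
    A._⨟_ {R = _≡ (setVar 22 ⟦ c ⟧ᵇ s1 , toList b' ++ rest)} (A.ex-toss (A.fits g) (cong (λ x → setVar 22 x s1 , toList b' ++ rest) (coin≡ c))) λ { refl →
    A.imply (λ { (refl , g' , k') → g' , A.below-trans k (A.below-trans (A.below-var {18} {s1} 22 ⟦ c ⟧ᵇ tt) k') , h ,
        trans (cong₂ _∸_ e (A.same k 3 tt ⊙ A.look vs 3 tt)) refl , b' , refl , w })
     (A.run-line 18 (add 20 20 20 ∷ add 20 20 22 ∷ sub 21 21 3 ∷ []) (A.good-var {s1} 22 (⟦⟧≤1 c ⟫ small {1} tt) g)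
      ((m≤m+n _ ⟦ c ⟧ᵇ) ⟫ new≤ , new≤ , tt)) }
    where
    coin≡ : ∀ c → (if c then 1 else 0) ≡ ⟦ c ⟧ᵇ
    coin≡ true  = refl
    coin≡ false = refl
    new≤ : var s1 20 + var s1 20 + ⟦ c ⟧ᵇ ≤ 𝔹
    new≤ = wordFrom≥ _ b' ⟫ w ≡⟫ <⇒≤ (wordFrom< 0 b 0 z<s) ⟫ 2^r≤𝔹

  weights : Words n
  weights i j = mask (raw0 i j) (words N ω ⟨ i , j ⟩)

  weights≤ : Small weights
  weights≤ i j = mask≤ (raw0 i j) _ ⟫ <⇒≤ (words< N ω ⟨ i , j ⟩) ⟫ 2^r≤𝔹

  clean : Contents n
  clean _ = λ _ _ → 0

  record Fresh (τ : CoinState) : Set where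
   field
    good  : Good (fst τ)
    vars  : Vars v0 (fst τ)
    raw   : ∀ i j → heap (fst τ) ⟨ i , j ⟩ ≡ raw0 i j
    empty : ∀ a → N ≤ a → heap (fst τ) a ≡ 0
    coins : snd τ ≡ toList ω ++ cs0

  sampleCost : ℕ
  sampleCost = tossCost + (1 * unit + (unit + 1 * unit + 8 * unit))

  ex-sample : ∀ {τ} → Fresh τ → Ex (flatCost sampleCost) sample τ (State idle0 (clean [ arcs ≔ weights ]))
  ex-sample {s , _} record { good = good ; vars = vars ; raw = raw ; empty = empty ; coins = refl } = relax (flat-cost sampleCost) finish
      (A.ex-each flat J draw good vars (N , ω , refl , refl , (λ _ _ → refl) , (λ _ ()) , λ _ _ → refl))
   where
   masked : ℕ → ℕ
   masked q = mask (heap s q) (words N ω q)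
   arcs-injective : ∀ {p q} → at arcs p ≡ at arcs q → p ≡ q
   arcs-injective {p} {q} e = snd (at-injective {arcs} {arcs} p q e)
   J : ℕ → (ℕ → ℕ) → List Bool → Set
   J i h cs = ∃[ m ] Σ[ ω' ∈ Vec Bool (m * r) ] (i + m ≡ N × cs ≡ toList ω' ++ cs0 × (∀ q → q < m → words m ω' q ≡ words N ω (i + q))
    × (∀ q → q < i → h (at arcs q) ≡ masked q) × (∀ a → (∀ q → q < i → a ≢ at arcs q) → h a ≡ heap s a))
   draw : ∀ (p : Fin N) {s′ cs} → Good s′ → Vars v0 s′ → var s′ 16 ≡ toℕ p * 1 → var s′ 17 ≡ N ∸ toℕ p → J (toℕ p) (heap s′) cs →
    A.Ex sampleCost drawEntry (s′ , cs) (λ (s″ , cs″) → Below 18 s′ s″ × Good s″ × J (suc (toℕ p)) (heap s″) cs″)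
   draw p g vs e16 _ (zero , _ , i+0 , _) = contradiction (sym (+-identityʳ (toℕ p)) ⊙ i+0) (<⇒≢ (Fin.toℕ<n p))
   draw p {s0} g vs e16 _ (suc m , ω' , i+m , refl , same-words , done , rest) =
    subst (λ cs → A.Ex sampleCost drawEntry (s0 , cs) _) (sym split)
     (ex-tossWord (take r ω') g vs A.⨟ λ { {s1 , _} record { good = g1 ; kept = k1 ; heap≡ = h1 ; coins = refl ; word≡ = w1 } →
      let raw≡ : heap s1 (var s1 16) ≡ heap s i
          raw≡ = cong₂ (λ h a → h a) h1 (A.same k1 16 tt ⊙ here) ⊙ (rest i λ q _ → raw≢cell (index arcs) q i<N)
      in A.run-line 18 (load 23 16 ∷ []) g1 (raw≡ ≡⟫ raw≤ i i<N , tt) A.⨟ λ { (refl , g2 , k2) →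
      A.ex-ifz {c = 1 * unit} {s = setVar 23 (heap s1 (var s1 16)) s1} {Q = Tossed s1 (toList (drop r ω') ++ cs0) (mask (heap s i) (var s1 20))} (A.fits g2) (A.size≤unit (A.vars g2 23 tt))
       (λ z → A.imply (λ { (refl , g3 , k3) → record { good = g3 ; kept = A.below-trans k2 k3 ; heap≡ = refl ; coins = refl
                                                             ; word≡ = sym (cong (λ x → mask x (var s1 20)) (sym raw≡ ⊙ z)) } })
        (A.run-line 18 (const 20 0 ∷ []) g2 (z≤n , tt)))
       (λ nz → A.weaken z≤n id (A.ex-skip record { good = g2 ; kept = k2 ; heap≡ = refl ; coins = refl ; word≡ = sym (unmasked (heap s i) λ z → nz (raw≡ ⊙ z)) }))
      A.⨟ λ { {s3 , _} record { good = g3 ; kept = k3 ; heap≡ = h3 ; coins = refl ; word≡ = w3 } →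
      let k13 = A.below-trans k1 k3 in
      A.imply (λ { {s4 , _} wr →
          let h≡ = λ a → Stored.updated wr a
          in Stored.kept wr , Stored.good wr ,
             m , drop r ω' , sym (+-suc i m) ⊙ i+m , Stored.coins wr , (λ q q<m → same-words (suc q) (s≤s q<m) ⊙ cong (words N ω) (+-suc i q)) ,
             (λ q q≤i → h≡ (at arcs q) ⊙ upd-elim (λ a v → ∀ q → q < suc i → a ≡ at arcs q → v ≡ masked q) (heap s0) (at arcs i) (masked i)
                 (λ q _ e → cong masked (arcs-injective e))
                 (λ a a≢ q q≤i e → cong (heap s0) e ⊙ done q (≤∧≢⇒< (s≤s⁻¹ q≤i) λ { refl → a≢ (sym e) })) (at arcs q) q q≤i refl) ,
             λ a away → h≡ a ⊙ (upd-≢ (heap s0) (masked i) λ e → away i ≤-refl (sym e)) ⊙ (rest a λ q q<i → away q (m<n⇒m<1+n q<i)) })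
       (put {idle0} {s0} (index arcs) 16 20 g3 (same-vars {idle0} k13 vs) k13 (h3 ⊙ h1) (A.same k13 16 tt ⊙ here)
        (<-≤-trans i<N (m≤m+n N N)) (w3 ⊙ cong (mask (heap s i)) (w1 ⊙ same-words 0 z<s ⊙ cong (words N ω) (+-identityʳ i)))) } } })
    where
    i : ℕ
    i = toℕ p
    i<N : i < N
    i<N = Fin.toℕ<n p
    here : var s0 16 ≡ i
    here = e16 ⊙ *-identityʳ i
    unmasked : ∀ x {w} → x ≢ 0 → mask x w ≡ w
    unmasked zero    p = contradiction refl p
    unmasked (suc x) p = refl
    raw≤ : ∀ q → q < N → heap s q ≤ 𝔹
    raw≤ = all-entries (λ q → heap s q ≤ 𝔹) λ i j → raw i j ≡⟫ raw≤1 i j ⟫ small {1} tt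
    split : toList ω' ++ cs0 ≡ toList (take r ω') ++ (toList (drop r ω') ++ cs0)
    split = cong (λ ω → toList ω ++ cs0) (sym (Vec.take++drop≡id r ω')) ⊙
     cong (_++ cs0) (Vec.toList-++ (take r ω') (drop r ω')) ⊙ List.++-assoc (toList (take r ω')) (toList (drop r ω')) cs0
   finish : ∀ {τ} → Good (fst τ) × Vars v0 (fst τ) × J N (heap (fst τ)) (snd τ) → State idle0 (clean [ arcs ≔ weights ]) τ
   finish {s′ , _} (g , vs , suc m , _ , i+m , _) = contradiction i+m (m+1+n≢m N)
   finish {s′ , _} (g , vs , zero , [] , i+m , refl , _ , done , rest) = record
    { good = g ; vars = vs
    ; raw = λ i j → (rest _ λ q _ → raw≢cell (index arcs) q (⟨⟩<N i j)) ⊙ raw i j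
    ; array = λ k i j → put-elim (λ k X → heap s′ (at k ⟨ i , j ⟩) ≡ X i j) clean arcs
        (λ { arcs _ → done _ (⟨⟩<N i j) ⊙ cong (λ x → mask x (words N ω ⟨ i , j ⟩)) (raw i j) })
        (λ k ≢ → (rest _ λ q _ e → ≢ (sym (fst (at-injective {k} {arcs} ⟨ i , j ⟩ q e)))) ⊙ empty _ (base≤cell N (index k) ⟨ i , j ⟩)) k
    ; stamp = λ a → ≤-reflexive ((rest _ λ q _ → low≢at 1 {arcs} a q) ⊙ empty _ (base≤cell N 1 a))
    ; field≤ = λ a → ≤-reflexive ((rest _ λ q _ → low≢at 2 {arcs} a q) ⊙ empty _ (base≤cell N 2 a))
    ; coins = refl }

  transposing : ℕ → ℕ → Registers
  transposing i j = record idle0 { left = j ; e = i ; b1 = i * n }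

  columns : ℕ → Words n
  columns i a b = if toℕ b <ᵇ i then weights b a else 0

  columns-below : ∀ {i} a b → toℕ b < i → columns i a b ≡ weights b a
  columns-below {i} a b l = cong (λ β → if β then weights b a else 0) (is-true (<⇒<ᵇ l))
   where
   is-true : ∀ {β} → T β → β ≡ true
   is-true {true} _ = refl

  columns-above : ∀ {i} a b → i ≤ toℕ b → columns i a b ≡ 0
  columns-above {i} a b l with toℕ b <ᵇ i in eq
  ... | false = refl
  ... | true  = contradiction l (<⇒≱ (<ᵇ⇒< (toℕ b) i (subst T (sym eq) tt)))

  half-transposed : ℕ → Contents n
  half-transposed i = (clean [ arcs ≔ weights ]) [ arcsᵀ ≔ columns i ]

  columnCost transposeCost unitsCost : ℕ
  columnCost    = 2 * unit + (8 * unit + (1 * unit + 8 * unit))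
  transposeCost = unit + (n * (unit + (flatCost columnCost + (unit + (unit + unit)))) + unit + (unit + unit))
  unitsCost     = flatCost (8 * unit) + (flatCost (8 * unit) + unit)

  ex-column : ∀ (i : Fin n) j {τ} → State (transposing (toℕ i) j) (half-transposed (toℕ i)) τ →
   A.Ex (eachCost n columnCost) (each 2 2 moveEntry) τ (State (transposing (toℕ i) j) (half-transposed (suc (toℕ i))))
  ex-column i left {s , cs} st with State.coins st
  ... | refl = A.imply finish (A.ex-map loop {{>-nonZero 1≤n}} ad injective (λ j → weights i j) body good vars (λ _ → refl))
   where
   open State st
   ρ : Registers
   ρ = transposing (toℕ i) left
   loop : A.Loop (registers ρ) 2 2 n n
   loop = record { count<16 = tt ; stride<16 = tt ; count≡ = refl ; stride≡ = refl ; zero≡ = refl ; one≡ = refl ; C≤ = n≤N ⟫ N≤𝔹 ; Cd≤ = N≤𝔹 }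
   ad : ℕ → ℕ
   ad p = at arcsᵀ (p + toℕ i)
   ad≡ : ∀ j → ad (toℕ j * n) ≡ at arcsᵀ ⟨ j , i ⟩
   ad≡ j = cong (at arcsᵀ) (sym (place j i))
   injective : ∀ p q → ad p ≡ ad q → p ≡ q
   injective p q e = +-cancelʳ-≡ (toℕ i) p q (snd (at-injective {arcsᵀ} {arcsᵀ} (p + toℕ i) (q + toℕ i) e))
   body : ∀ j {s0} → Good s0 → Vars (registers ρ) s0 → var s0 16 ≡ toℕ j * n → var s0 17 ≡ n ∸ toℕ j → (∀ a → (∀ q → q < toℕ j → a ≢ ad (q * n)) → heap s0 a ≡ heap s a) →
    A.Ex columnCost moveEntry (s0 , cs0) (λ (s′ , cs') → Below 18 s0 s′ × Good s′ × cs' ≡ cs0 × (∀ a → heap s′ a ≡ (heap s0 [ ad (toℕ j * n) ↦ weights i j ]) a))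
   body j {s0} g vs e16 e17 rest =
    A.run-line 18 (sub 18 2 17 ∷ add 18 18 11 ∷ []) g (source ≡⟫ <⇒≤ (⟨⟩<N i j) ⟫ N≤𝔹 , tt) A.⨟ λ { (refl , g1 , k1) →
    get {ρ} 20 (index arcs) 18 g1 (same-vars {ρ} k1 vs) source (⟨⟩<2N i j) (value ≡⟫ weights≤ i j) A.⨟ λ { {s2 , _} (g2 , refl , h2 , _ , k2 , v2) →
    let k12 = A.below-trans k1 k2
        target : var s2 16 + var s2 10 ≡ ⟨ j , i ⟩
        target = cong₂ _+_ (A.same k12 16 tt ⊙ e16) (A.look (same-vars {ρ} k12 vs) 10 tt) ⊙ sym (place j i)
    in A.run-line 18 (add 19 16 10 ∷ []) g2 (target ≡⟫ <⇒≤ (⟨⟩<N j i) ⟫ N≤𝔹 , tt) A.⨟ λ { (refl , g3 , k3) →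
    let k13 = A.below-trans k12 k3 in
    A.imply (λ w →
        Stored.kept w , Stored.good w , Stored.coins w , λ a → Stored.updated w a ⊙ cong (λ p → (heap s0 [ p ↦ weights i j ]) a) (sym (ad≡ j)))
     (put {ρ} {s0} (index arcsᵀ) 19 20 g3 (same-vars {ρ} k13 vs) k13 h2 target (⟨⟩<2N j i) (v2 ⊙ value)) } } }
    where
    source : var s0 2 ∸ var s0 17 + var s0 11 ≡ ⟨ i , j ⟩
    source = cong₂ _+_ (cong₂ _∸_ (A.look vs 2 tt) e17 ⊙ m∸[m∸n]≡n (<⇒≤ (Fin.toℕ<n j))) (A.look vs 11 tt) ⊙
     +-comm (toℕ j) _ ⊙ sym (place i j)
    value : heap s0 (at arcs ⟨ i , j ⟩) ≡ weights i j
    value = (rest _ λ q _ e → contradiction (fst (at-injective {arcs} {arcsᵀ} ⟨ i , j ⟩ (q * n + toℕ i) e)) λ ()) ⊙ array arcs i j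
   finish : ∀ {τ} → Good (fst τ) × Vars (registers ρ) (fst τ) × snd τ ≡ cs0 × (∀ q → heap (fst τ) (ad (toℕ q * n)) ≡ weights i q)
    × (∀ a → (∀ (q : Fin n) → a ≢ ad (toℕ q * n)) → heap (fst τ) a ≡ heap s a) → State ρ (half-transposed (suc (toℕ i))) τ
   finish {s′ , _} (g , vs , cs≡ , done , rest) = state-cong same-column (stored arcsᵀ {pos = λ q → q , i} {Φ = λ j _ → weights i j} (λ a b → transposed a b (b Fin.≟ i)) record
       { good = g ; vars = vs ; coins = cs≡ ; done = λ q → cong (heap s′) (sym (ad≡ q)) ⊙ done q
       ; rest = λ a away → rest a λ q e → away q (e ⊙ ad≡ q) } st covers)
    where
    transposed : ∀ a b → Dec (b ≡ i) → ℕ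
    transposed a b (yes _) = weights i a
    transposed a b (no _)  = columns (toℕ i) a b
    covers : ∀ a b → (∃[ q ] (q , i) ≡ (a , b) × weights i a ≡ transposed a b (b Fin.≟ i)) ⊎ ((∀ q → (q , i) ≢ (a , b)) × columns (toℕ i) a b ≡ transposed a b (b Fin.≟ i))
    covers a b with b Fin.≟ i
    ... | yes refl = inj₁ (a , refl , refl)
    ... | no b≢i   = inj₂ ((λ { q refl → b≢i refl }) , refl)
    column : ∀ a b (d : Dec (b ≡ i)) → transposed a b d ≡ columns (suc (toℕ i)) a b
    column a b (yes refl) = sym (columns-below a b ≤-refl)
    column a b (no b≢i) with <-≤-connex (toℕ b) (toℕ i)
    ... | inj₁ b<i = columns-below a b b<i ⊙ sym (columns-below a b (m<n⇒m<1+n b<i))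
    ... | inj₂ i≤b = columns-above a b i≤b ⊙ sym (columns-above a b (≤∧≢⇒< i≤b λ e → b≢i (Fin.toℕ-injective (sym e))))
    same-column : ∀ k a b → (half-transposed (toℕ i) [ arcsᵀ ≔ (λ a b → transposed a b (b Fin.≟ i)) ]) k a b ≡ half-transposed (suc (toℕ i)) k a b
    same-column k a b = cong (λ X → X a b) (put-put (clean [ arcs ≔ weights ]) arcsᵀ k) ⊙
     put-cong (clean [ arcs ≔ weights ]) (clean [ arcs ≔ weights ]) arcsᵀ (λ _ _ _ → refl) (λ a b → column a b (b Fin.≟ i)) k a b

  ex-transpose : ∀ {τ} → n + 1 ≤ 𝔹 → State idle0 (clean [ arcs ≔ weights ]) τ → Ex transposeCost transpose τ (State idle0 ((clean [ arcs ≔ weights ]) [ arcsᵀ ≔ (λ i j → weights j i) ]))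
  ex-transpose n<𝔹 st =
   compute (add 8 2 15) idle0 (transposing 0 n) (+-identityʳ n ≡⟫ n≤N ⟫ N≤𝔹 , tt)
    (below-16 {{p8 = +-identityʳ n}}) ≤-refl st ⨟ λ st →
   ex-repeat Columns (λ (_ , _ , st) → A.fits (State.good st) , A.size≤unit (A.vars (State.good st) 8 tt) , A.look (State.vars st) 8 tt)
    iteration n (0 , refl , state-cong start st) ⨟ λ (i , i+0 , st) →
   compute (const 10 0) (transposing i 0) (record (transposing i 0) { e = 0 }) (z≤n , tt) below-16 ≤-refl st ⨟ λ st →
   imply (state-cong (put-cong (clean [ arcs ≔ weights ]) (clean [ arcs ≔ weights ]) arcsᵀ (λ _ _ _ → refl) λ a b →
       columns-below a b (<-≤-trans (Fin.toℕ<n b) (≤-reflexive (sym (sym (+-identityʳ i) ⊙ i+0))))))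
    (compute (const 11 0) (record (transposing i 0) { e = 0 }) idle0 (z≤n , tt) below-16 ≤-refl st)
   where
   start : ∀ k i j → (clean [ arcs ≔ weights ]) k i j ≡ half-transposed 0 k i j
   start k i j = cong (λ X → X i j) (every-array {λ k → (clean [ arcs ≔ weights ]) k ≡ half-transposed 0 k} k)
   Columns : ℕ → CoinState → Set
   Columns j τ = ∃[ i ] (i + j ≡ n × State (transposing i j) (half-transposed i) τ)
   iteration : ∀ {j τ} → Columns (suc j) τ → Ex (flatCost columnCost + (unit + (unit + unit)))
    (each 2 2 moveEntry ▸ ‹ int (add 10 10 3) › ▸ ‹ int (add 11 11 2) › ▸ ‹ int (sub 8 8 3) ›) τ (Columns j)
   iteration {j} (i , i+j , st) =
    relax (≤-⊑-trans (+-monoʳ-≤ (2 * unit) (+-monoˡ-≤ unit (*-monoˡ-≤ (unit + (columnCost + 2 * unit)) n≤N))) (flat-cost columnCost)) id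
     (subst (λ i → State (transposing i (suc j)) (half-transposed i) _ → A.Ex (eachCost n columnCost) (each 2 2 moveEntry) _ (State (transposing i (suc j)) (half-transposed (suc i))))
      (Fin.toℕ-fromℕ< i<n) (ex-column (fromℕ< i<n) (suc j)) st) ⨟ λ st →
    compute (add 10 10 3) (transposing i (suc j)) (record (transposing i (suc j)) { e = suc i })
     (+-comm i 1 ≡⟫ i<n ⟫ n≤N ⟫ N≤𝔹 , tt)
     (below-16 {{p10 = +-comm i 1}}) ≤-refl st ⨟ λ st →
    compute (add 11 11 2) (record (transposing i (suc j)) { e = suc i }) (transposing (suc i) (suc j))
     (+-comm (i * n) n ≡⟫ *-monoˡ-≤ n i<n ⟫ N≤𝔹 , tt)
     (below-16 {{p11 = +-comm (i * n) n}}) ≤-refl st ⨟ λ st →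
    imply (λ st → suc i , sym (+-suc i j) ⊙ i+j , st)
     (compute (sub 8 8 3) (transposing (suc i) (suc j)) (transposing (suc i) j) tt below-16 ≤-refl st)
    where
    i<n : i < n
    i<n = m<m+n i z<s ⟫≡ i+j

  ex-units : ∀ {c τ} → State idle0 c τ → Ex unitsCost units τ
   (State (record idle0 { left = n }) ((c [ powers ≔ withDiagonal L (λ _ → 1) (c powers) ]) [ gradients ≔ withDiagonal L (λ _ → 1) (c gradients) ]))
  ex-units {c} st =
   diagonal-constant powers 3 st ⨟ λ st → diagonal-constant gradients 3 st ⨟ λ st →
   compute (add 8 2 15) idle0 (record idle0 { left = n }) (+-identityʳ n ≡⟫ n≤N ⟫ N≤𝔹 , tt)
    (below-16 {{p8 = +-identityʳ n}}) ≤-refl st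

algorithm : Prog FieldOp → Prog CoinOp
algorithm mul = ifz 0 then skip else (prologue ▸ sample ▸ transpose ▸ units ▸ search mul ▸ publish)

level-of : ℕ → ℕ
level-of n = level (size n)

module _ {n : ℕ} (G : Digraph n) where

 open Analysis G (level-of n) using (N; r; L; L≡; Coins)

 -- A number which exceeds everything computed outside of the simulated calls is 2 ^ width.
 width : ℕ
 width = 2 * L + 2 * size n + 9

 adjacency : Words n
 adjacency u v = if arc G u v then 1 else 0

 record Resources : Set₁ where
  infix 4 _⊑_
  field
   Hyp       : Set
   S w       : ℕ
   1≤n       : 1 ≤ n
   size≤w    : size (2 ^ width) ≤ w
   cells<S   : ∀ k p → k < 16 → p < n * n + n * n → cell (n * n) k p < S
   _⊑_       : ℕ → ℕ → Set
   ≤⇒⊑       : ∀ {a b} → a ≤ b → a ⊑ b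
   ⊑-+       : ∀ {a b c d} → a ⊑ c → b ⊑ d → a + b ⊑ c + d
   ⊑-≤-trans : ∀ {a b c} → a ⊑ b → b ≤ c → a ⊑ c
   ≤-⊑-trans : ∀ {a b c} → a ≤ b → b ⊑ c → a ⊑ c
   flat⊑     : ∀ c → n * n * c ⊑ c

 module _ (1≤n : 1 ≤ n) where

  private
   σ 𝔹 : ℕ
   σ = size n
   𝔹 = 2 ^ width
   1≤σ : 1 ≤ σ
   1≤σ = size≥1 n
   n≤ : n ≤ 2 ^ σ
   n≤ = <⇒≤ (<2^size n)
   power : ∀ a b → a ≤ b → 2 ^ a ≤ 2 ^ b
   power a b = ^-monoʳ-≤ 2
   <2^ : ∀ x → x < 2 ^ x
   <2^ zero    = s≤s z≤n
   <2^ (suc x) = s≤s (<2^ x) ⟫ +-mono-≤ (m^n>0 2 x) (≤-reflexive (sym (+-identityʳ (2 ^ x))))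
   times : ∀ {a b} x y {c} → a ≤ 2 ^ x → b ≤ 2 ^ y → x + y ≤ c → a * b ≤ 2 ^ c
   times x y p q l = *-mono-≤ p q ⟫ sym (^-distribˡ-+-* 2 x y) ≡⟫ power (x + y) _ l

  N≤2^ : N ≤ 2 ^ (2 * σ)
  N≤2^ = times σ σ n≤ n≤ (≤-reflexive (cong (σ +_) (sym (+-identityʳ σ))))

  1≤L : 1 ≤ L
  1≤L = s≤s z≤n

  cells≤ : ∀ k p → k < 16 → p < N + N → cell N k p ≤ 𝔹
  cells≤ k p k<16 p<2N = begin
   cell N k p ≡⟨ cell≡ N k p ⟩
   p * 16 + N + k ≤⟨ +-mono-≤ (+-monoˡ-≤ N (*-monoˡ-≤ 16 (<⇒≤ p<2N))) (<⇒≤ k<16 ⟫ *-monoʳ-≤ 16 (*-mono-≤ 1≤n 1≤n)) ⟩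
   (N + N) * 16 + N + 16 * N ≡⟨ solve 1 (λ x → (x :+ x) :* con 16 :+ x :+ con 16 :* x := con 49 :* x) refl N ⟩
   49 * N ≤⟨ times 6 (2 * σ) (m≤m+n 49 15) N≤2^ (+-comm 6 (2 * σ) ≡⟫ +-monoʳ-≤ (2 * σ) (m≤m+n 6 3) ⟫ +-monoˡ-≤ 9 (m≤n+m (2 * σ) (2 * L))) ⟩
   𝔹 ∎
   where open ≤-Reasoning

  64≤𝔹 : 64 ≤ 𝔹
  64≤𝔹 = power 6 width (m≤m+n 6 3 ⟫ m≤n+m 9 (2 * L + 2 * σ))

  L+1≤width : suc L ≤ width
  L+1≤width = (+-comm 1 L ≡⟫ +-mono-≤ (m≤m+n L (L + 0)) (m≤m+n 1 8 ⟫ m≤n+m 9 (2 * σ))) ⟫≡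
   sym (+-assoc (2 * L) (2 * σ) 9)

  2^L≤𝔹 : 2 ^ suc L ≤ 𝔹
  2^L≤𝔹 = power (suc L) width L+1≤width

  L≤𝔹 : L + 3 ≤ 𝔹
  L≤𝔹 = <⇒≤ (<2^ (L + 3)) ⟫ power (L + 3) width (+-mono-≤ (m≤m+n L (L + 0)) (m≤m+n 3 6 ⟫ m≤n+m 9 (2 * σ)) ⟫≡ sym (+-assoc (2 * L) (2 * σ) 9))

  r≤L : r ≤ L
  r≤L = subst₂ _≤_ (sym (treble≡ (level-of n) 2)) (sym (L≡ ⊙ treble≡ (level-of n) 3)) (*-monoˡ-≤ (3 ^ level-of n) (n≤1+n 2))

  2^r≤𝔹 : 2 ^ r ≤ 𝔹
  2^r≤𝔹 = power r width (r≤L ⟫ n≤1+n L ⟫ L+1≤width)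

  r≤𝔹 : r ≤ 𝔹
  r≤𝔹 = r≤L ⟫ m≤m+n L 3 ⟫ L≤𝔹

  n+2≤𝔹 : n + 2 ≤ 𝔹
  n+2≤𝔹 = +-mono-≤ {n} {n * 1} (≤-reflexive (sym (*-identityʳ n))) (*-monoˡ-≤ 2 1≤n) ⟫ sym (*-distribˡ-+ n 1 2) ≡⟫
   times σ 2 n≤ (n≤1+n 3) (+-mono-≤ (m≤m+n σ (σ + 0)) (m≤m+n 2 7) ⟫ +-monoˡ-≤ 9 (m≤n+m (2 * σ) (2 * L)))

  prologue≤𝔹 : 36 + 48 * σ ≤ 𝔹
  prologue≤𝔹 = begin
   36 + 48 * σ ≤⟨ +-monoˡ-≤ (48 * σ) (*-monoʳ-≤ 36 1≤σ) ⟩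
   36 * σ + 48 * σ ≡⟨ *-distribʳ-+ σ 36 48 ⟨
   84 * σ ≤⟨ times 7 σ (m≤m+n 84 44) (<⇒≤ (<2^ σ)) (+-comm 7 σ ≡⟫ +-mono-≤ (m≤m+n σ (σ + 0)) (m≤m+n 7 2) ⟫ +-monoˡ-≤ 9 (m≤n+m (2 * σ) (2 * L))) ⟩
   𝔹 ∎
   where open ≤-Reasoning

  calls≤𝔹 : n * (L * L + L * L + L * L + L * L + L * L) ≤ 𝔹
  calls≤𝔹 = begin
   n * (L * L + L * L + L * L + L * L + L * L) ≡⟨ solve 2 (λ n x → n :* (x :* x :+ x :* x :+ x :* x :+ x :* x :+ x :* x) := con 5 :* n :* (x :* x)) refl n L ⟩
   5 * n * (L * L) ≤⟨ times (3 + σ) (L + L) (times 3 σ (m≤m+n 5 3) n≤ ≤-refl) (times L L (<⇒≤ (<2^ L)) (<⇒≤ (<2^ L)) ≤-refl)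
                                                        (m≤m+n _ (σ + 6) ⟫≡ solve 2 (λ s x → con 3 :+ s :+ (x :+ x) :+ (s :+ con 6) := con 2 :* x :+ con 2 :* s :+ con 9) refl σ L) ⟩
   𝔹 ∎
   where open ≤-Reasoning

 module Assembly (resources : Resources) (mul : Prog FieldOp) where

  open Resources resources

  setting : List Bool → Setting
  setting cs = record
   { Hyp = Hyp ; S = S ; w = w ; 𝔹 = 2 ^ width ; n = n ; L = L ; r = r ; size𝔹≤w = size≤w ; 64≤𝔹 = 64≤𝔹 1≤n ; 1≤n = 1≤n
   ; cells = λ k p k<16 p<2N → cells≤ 1≤n k p k<16 p<2N , cells<S k p k<16 p<2N
   ; _⊑_ = _⊑_ ; ≤⇒⊑ = ≤⇒⊑ ; ⊑-+ = ⊑-+ ; ⊑-≤-trans = ⊑-≤-trans ; ≤-⊑-trans = ≤-⊑-trans ; flat⊑ = flat⊑ ; raw0 = adjacency ; cs0 = cs }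

  module _ (multiplier : ∀ cs → Multiplier (setting cs) mul) (ω : Coins) (rest : List Bool) where

   open Machine (setting rest) using (state-cong; unit; relax; flatCost; Ex; imply; _⨟_; ex-ifz; ok) renaming (module A to M)
   open Verdict G (level-of n) using (hit; Outcome)
   open Analysis G (level-of n) using (A; Aᵀ; weight)

   private
    adjacency≤1 : ∀ u v → adjacency u v ≤ 1
    adjacency≤1 u v with arc G u v
    ... | true  = ≤-refl
    ... | false = z≤n

    module I = Computation.Initialization (setting rest) mul (multiplier rest) ω (2^r≤𝔹 1≤n) (r≤𝔹 1≤n) adjacency≤1
    module X = Prologue Hyp S w (2 ^ width) size≤w (64≤𝔹 1≤n) n 1≤n ((base≤cell N 0 0 ⟫ ≤-refl) ⟫ cells≤ 1≤n 0 0 z<s (*-mono-≤ 1≤n 1≤n ⟫ m≤m+n N N))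
     (+-monoʳ-≤ n (n≤1+n 1) ⟫ n+2≤𝔹 1≤n) (prologue≤𝔹 1≤n)

    ws : Words n
    ws = I.weights

    ws≡A : ∀ u v → ws u v ≡ A ω u v
    ws≡A u v with arc G u v
    ... | true  = words≡ N ω (combine u v)
    ... | false = refl

    ws≤ : ∀ u v → ws u v ≤ 2 ^ width
    ws≤ = I.weights≤

    weights : Weights (setting rest)
    weights = record
     { A = A ω ; Aᵀ = Aᵀ ω ; 1≤L = 1≤L 1≤n ; L≤𝔹 = L≤𝔹 1≤n ; 2^L≤𝔹 = 2^L≤𝔹 1≤n
     ; A≤ = λ i j → subst (_≤ 2 ^ width) (ws≡A i j) (ws≤ i j) ; Aᵀ≤ = λ i j → subst (_≤ 2 ^ width) (ws≡A j i) (ws≤ j i)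
     ; raw≤1 = adjacency≤1 ; n+2≤𝔹 = n+2≤𝔹 1≤n }

    module Y = Computation.Steps (setting rest) mul (multiplier rest) weights

    H : ℕ
    H = treble (level-of n) 1

    3H≡L : H + H + H ≡ L
    3H≡L = cong (λ h → h + h + h) (treble≡ (level-of n) 1) ⊙ solve 1 (λ p → con 1 :* p :+ con 1 :* p :+ con 1 :* p := con 3 :* p) refl (3 ^ level-of n) ⊙
     sym (L≡ ⊙ treble≡ (level-of n) 3)

    2H≡r : H + H ≡ r
    2H≡r = cong (λ h → h + h) (treble≡ (level-of n) 1) ⊙ solve 1 (λ p → con 1 :* p :+ con 1 :* p := con 2 :* p) refl (3 ^ level-of n) ⊙ sym (treble≡ (level-of n) 2)

    starting : ∀ {s} → InputGraph G s → X.Pre (heap s) (toList ω ++ rest) (file (n ∷ [])) (s , toList ω ++ rest)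
    starting {s} (v0 , v , edges , empty) = record
     { good = record
      { fits = M.when λ _ → (λ x → fits (var≤ x)) , (λ a → fits (heap≤ a)) , λ a S≤a → empty a (N≤S ⟫ S≤a)
      ; vars = λ x _ → var≤ x }
     ; vars = M.holding λ x _ → contents x ; heap≡ = refl ; coins = refl }
     where
     contents : ∀ x → var s x ≡ file (n ∷ []) x
     contents zero    = v0
     contents (suc x) = v (suc x) (s≤s z≤n)
     n≤ : n ≤ 2 ^ width
     n≤ = m≤m+n n 2 ⟫ n+2≤𝔹 1≤n
     var≤ : ∀ x → var s x ≤ 2 ^ width
     var≤ zero    = v0 ≡⟫ n≤
     var≤ (suc x) = v (suc x) (s≤s z≤n) ≡⟫ z≤n
     fits : ∀ {x} → x ≤ 2 ^ width → size x ≤ w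
     fits p = size-mono p ⟫ size≤w
     heap≤ : ∀ a → heap s a ≤ 2 ^ width
     heap≤ a with a <? N
     ... | yes a<N = Machine.all-entries (setting rest) (λ a → heap s a ≤ 2 ^ width) (λ u v → edges u v ≡⟫ adjacency≤1 u v ⟫ m^n>0 2 width) a a<N
     ... | no a≮N  = empty a (≮⇒≥ a≮N) ≡⟫ z≤n
     N≤S : N ≤ S
     N≤S = base≤cell N 0 0 ⟫ <⇒≤ (cells<S 0 0 z<s (*-mono-≤ 1≤n 1≤n ⟫ m≤m+n N N))

    fresh : ∀ {s τ} → InputGraph G s → X.Pre (heap s) (toList ω ++ rest) (file (X.file4 (heap s) (toList ω ++ rest) (H + H + H) (H + H))) τ →
     I.Fresh τ
    fresh (_ , _ , edges , empty) p = record
     { good = X.Pre.good p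
     ; vars = M.holding λ x l → M.look (X.Pre.vars p) x l ⊙
         below-16 {λ x → file (X.file4 (λ _ → 0) [] (H + H + H) (H + H)) x ≡ I.v0 x} {{p4 = 3H≡L}} {{p5 = 2H≡r}} x l
     ; raw = λ i j → cong (λ h → h (toℕ (combine i j))) (X.Pre.heap≡ p) ⊙ edges i j
     ; empty = λ a N≤a → cong (λ h → h a) (X.Pre.heap≡ p) ⊙ empty a N≤a
     ; coins = X.Pre.coins p }

    hit≡ : ∀ k u v → ⟦ hit ω k u v ⟧ᵇ ≡ Y.hitsOf (Stage.Γ (stages L (A ω) (Aᵀ ω) k)) u v
    hit≡ k u v with arc G u v
    ... | false = sym (0∸n≡0 (1 ∸ Stage.Γ (stages L (A ω) (Aᵀ ω) k) u v))
    ... | true  = positive (Stage.Γ (stages L (A ω) (Aᵀ ω) k) u v)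
     where
     positive : ∀ x → ⟦ not (x ≡ᵇ 0) ⟧ᵇ ≡ 1 ∸ (1 ∸ x)
     positive zero    = refl
     positive (suc x) = cong (1 ∸_) (sym (0∸n≡0 x))

    quiet : ∀ k → Y.NoHits k → ∀ u v → hit ω k u v ≡ false
    quiet k h u v = is-false (hit≡ k u v ⊙ h u v)
     where
     is-false : ∀ {β} → ⟦ β ⟧ᵇ ≡ 0 → β ≡ false
     is-false {false} _ = refl

    verdict : ∀ {τ} → Y.Result τ → Outcome ω (fst τ) × ok (fst τ)
    verdict record { outcome = inj₁ (v , none , out) ; final-ok = o } = inj₁ (v , (λ k 1≤k k≤n → quiet k (none k 1≤k k≤n)) , out) , o
    verdict record { outcome = inj₂ (k , 1≤k , none , (x , y , nz) , v , out) ; final-ok = o } =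
     inj₂ (k , 1≤k , (λ k' 1≤k' k'<k → quiet k' (none k' 1≤k' k'<k)) , (x , y , is-true λ z → nz (sym (hit≡ k x y) ⊙ z)) , v , λ u v → out u v ⊙ sym (hit≡ k u v)) , o
     where
     is-true : ∀ {β} → ⟦ β ⟧ᵇ ≢ 0 → β ≡ true
     is-true {true}  _ = refl
     is-true {false} p = contradiction refl p

   algorithmCost : ℕ
   algorithmCost = unit + (X.prologueCost (λ _ → 0) [] + (flatCost (I.sampleCost) + (I.transposeCost +
    (I.unitsCost + (Y.searchCost + Y.publishCost)))))

   ex-algorithm : ∀ {s} → InputGraph G s → Ex algorithmCost (algorithm mul) (s , toList ω ++ rest) (λ τ → Outcome ω (fst τ) × ok (fst τ))
   ex-algorithm {s} input = ex-ifz (M.fits (X.Pre.good pre)) (M.size≤unit (M.vars (X.Pre.good pre) 0 tt))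
       (λ z → contradiction (sym (fst input) ⊙ z) (m<n⇒n≢0 1≤n))
       (λ _ → relax (≤⇒⊑ ≤-refl) id (X.ex-prologue (heap s) (toList ω ++ rest) pre) ⨟ λ p →
              I.ex-sample (fresh input p) ⨟ λ st →
              I.ex-transpose (+-monoʳ-≤ n (n≤1+n 1) ⟫ n+2≤𝔹 1≤n) st ⨟ λ st →
              I.ex-units st ⨟ λ st →
              imply verdict (Y.ex-main {n * Y.Δ5} (calls≤𝔹 1≤n)
               (Y.searching 0 0 (zeros L) (zeros L) (zeros L) (zeros L) (zeros L) refl refl (λ _ _ → refl) (λ _ _ → refl) (λ { zero () _ ; (suc _) _ () }) (state-cong initial≗ st))))
    where
    pre = starting input
    start : Contents n
    start = (((((λ _ _ _ → 0) [ arcs ≔ ws ]) [ arcsᵀ ≔ (λ i j → ws j i) ]) [ powers ≔ withDiagonal L (λ _ → 1) (λ _ _ → 0) ]) [ gradients ≔ withDiagonal L (λ _ → 1) (λ _ _ → 0) ])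
    same : ∀ {X : Words n} i j → X i j ≡ X i j
    same _ _ = refl
    initial≗ : ∀ k i j → start k i j ≡ Y.contents (Y.memory (Y.stage-at 0) (zeros L) (zeros L) (zeros L) (zeros L) (zeros L)) k i j
    initial≗ = every-array {{ws≡A}} {{λ i j → ws≡A j i}} {{same}} {{same}} {{same}} {{same}} {{same}} {{same}} {{same}} {{same}} {{same}} {{same}} {{same}}

open import Data.Integer.Base using (+_; +<+)
import Data.Integer.Properties as ℤ
open import Data.Nat.Base using (_⊔_)
open import Data.Rational.Base using (ℚ) renaming (_/_ to _/ℚ_; _<_ to _<ℚ_)
import Data.Rational.Properties as ℚ
open import Data.Rational.Unnormalised.Base as ℚᵘ using (mkℚᵘ)
import Data.Rational.Unnormalised.Properties as ℚᵘ

fraction< : ∀ p q → p < 2 * suc q → (+ p /ℚ suc q) <ℚ (+ 2 /ℚ 1)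
fraction< p q p<2q = ℚ.toℚᵘ-cancel-< (ℚᵘ.<-respˡ-≃ (ℚᵘ.≃-sym (ℚ.toℚᵘ-fromℚᵘ (mkℚᵘ (+ p) q))) (ℚᵘ.<-respʳ-≃ (ℚᵘ.≃-sym (ℚ.toℚᵘ-fromℚᵘ (mkℚᵘ (+ 2) 0)))
 (ℚᵘ.*<* (subst₂ (λ a b → a ℤ.< b) (sym (ℤ.*-identityʳ (+ p))) (ℤ.pos-* 2 (suc q)) (+<+ p<2q)))))
 where import Data.Integer.Base as ℤ

^-distribʳ-* : ∀ a b q → (a * b) ^ q ≡ a ^ q * b ^ q
^-distribʳ-* a b zero    = refl
^-distribʳ-* a b (suc q) = cong (a * b *_) (^-distribʳ-* a b q) ⊙
 solve 4 (λ a b x y → a :* b :* (x :* y) := a :* x :* (b :* y)) refl a b (a ^ q) (b ^ q)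

-- If a ≤ c y and b ≤ d y, where y is the q-th root of x, then a + b ≤ (c + d) y.
+-root-≤ : ∀ q a b c d x → a ^ q ≤ c ^ q * x → b ^ q ≤ d ^ q * x → (a + b) ^ q ≤ (c + d) ^ q * x
+-root-≤ zero    a b c d x p _ = p
+-root-≤ (suc q) a b zero    d x p p' = subst (λ a → (a + b) ^ suc q ≤ d ^ suc q * x) (sym (m^n≡0⇒m≡0 a (suc q) (n≤0⇒n≡0 p))) p'
+-root-≤ (suc q) a b (suc c) zero x p p' = subst₂ (λ b c → (a + b) ^ suc q ≤ c ^ suc q * x)
 (sym (m^n≡0⇒m≡0 b (suc q) (n≤0⇒n≡0 p'))) (sym (+-identityʳ (suc c))) (subst (λ a → a ^ suc q ≤ suc c ^ suc q * x) (sym (+-identityʳ a)) p)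
+-root-≤ (suc q) a b (suc c) (suc d) x p p' = by (≤-total (a * suc d) (b * suc c))
 where
 scaled : ∀ b d → b ^ suc q ≤ suc d ^ suc q * x → ∀ {s t} → s * suc d ≤ b * t → s ^ suc q ≤ t ^ suc q * x
 scaled b d h {s} {t} l = *-cancelʳ-≤ _ _ (suc d ^ suc q) {{m^n≢0 (suc d) (suc q)}} (begin
  s ^ suc q * suc d ^ suc q ≡⟨ ^-distribʳ-* s (suc d) (suc q) ⟨
  (s * suc d) ^ suc q ≤⟨ ^-monoˡ-≤ (suc q) l ⟩
  (b * t) ^ suc q ≡⟨ ^-distribʳ-* b t (suc q) ⟩
  b ^ suc q * t ^ suc q ≤⟨ *-monoˡ-≤ (t ^ suc q) h ⟩
  suc d ^ suc q * x * t ^ suc q ≡⟨ solve 3 (λ d x t → d :* x :* t := t :* x :* d) refl (suc d ^ suc q) x (t ^ suc q) ⟩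
  t ^ suc q * x * suc d ^ suc q ∎)
  where
  open ≤-Reasoning
 by : a * suc d ≤ b * suc c ⊎ b * suc c ≤ a * suc d → (a + b) ^ suc q ≤ (suc c + suc d) ^ suc q * x
 by (inj₁ l) = scaled b d p' {a + b} {suc c + suc d} (*-distribʳ-+ (suc d) a b ≡⟫ +-monoˡ-≤ (b * suc d) l ⟫≡ sym (*-distribˡ-+ b (suc c) (suc d)))
 by (inj₂ l) = scaled a c p {a + b} {suc c + suc d} (*-distribʳ-+ (suc c) a b ≡⟫ +-monoʳ-≤ (a * suc c) l ⟫≡ sym (*-distribˡ-+ a (suc c) (suc d)))

module Growth (τ : ℝ) (2<τ : (+ 2 /ℚ 1) <ʳ τ) (n : ℕ) (1≤n : 1 ≤ n) where

 infix 4 _⊑_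
 _⊑_ : ℕ → ℕ → Set
 f ⊑ c = f ≲ c · n ^ʳ τ

 exponent : ∀ p q .{{_ : NonZero q}} → upper τ (+ p /ℚ q) → 2 * q ≤ p
 exponent p (suc q) u with 2 * suc q ≤? p
 ... | yes l = l
 ... | no ¬l = contradiction (Equivalence.from (ℝ.lower-rounded τ (+ p /ℚ suc q)) (_ , fraction< p q (≰⇒> ¬l) , 2<τ) , u) (ℝ.disjoint τ _)

 1≤n^ : ∀ p → 1 ≤ n ^ p
 1≤n^ p = m^n>0 n {{>-nonZero 1≤n}} p

 ≤⇒⊑ : ∀ {a b} → a ≤ b → a ⊑ b
 ≤⇒⊑ {a} {b} h p q _ = ^-monoˡ-≤ q h ⟫ sym (*-identityʳ (b ^ q)) ≡⟫ *-monoʳ-≤ (b ^ q) (1≤n^ p)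

 ⊑-+ : ∀ {a b c d} → a ⊑ c → b ⊑ d → a + b ⊑ c + d
 ⊑-+ {a} {b} {c} {d} h k p q u = +-root-≤ q a b c d (n ^ p) (h p q u) (k p q u)

 ⊑-≤-trans : ∀ {a b c} → a ⊑ b → b ≤ c → a ⊑ c
 ⊑-≤-trans h b≤c p q u = h p q u ⟫ *-monoˡ-≤ (n ^ p) (^-monoˡ-≤ q b≤c)

 ≤-⊑-trans : ∀ {a b c} → a ≤ b → b ⊑ c → a ⊑ c
 ≤-⊑-trans a≤b h p q u = ^-monoˡ-≤ q a≤b ⟫ h p q u

 ⊑-* : ∀ k {a c} → a ⊑ c → k * a ⊑ k * c
 ⊑-* k {a} {c} h p q u = begin
  (k * a) ^ q ≡⟨ ^-distribʳ-* k a q ⟩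
  k ^ q * a ^ q ≤⟨ *-monoʳ-≤ (k ^ q) (h p q u) ⟩
  k ^ q * (c ^ q * n ^ p) ≡⟨ *-assoc (k ^ q) (c ^ q) (n ^ p) ⟨
  k ^ q * c ^ q * n ^ p ≡⟨ cong (_* n ^ p) (^-distribʳ-* k c q) ⟨
  (k * c) ^ q * n ^ p ∎
  where open ≤-Reasoning

 flat⊑ : ∀ c → n * n * c ⊑ c
 flat⊑ c p q u = begin
  (n * n * c) ^ q ≡⟨ ^-distribʳ-* (n * n) c q ⟩
  (n * n) ^ q * c ^ q ≡⟨ *-comm ((n * n) ^ q) (c ^ q) ⟩
  c ^ q * (n * n) ^ q ≡⟨ cong (λ x → c ^ q * x) (cong (λ x → (n * x) ^ q) (sym (*-identityʳ n)) ⊙ ^-*-assoc n 2 q) ⟩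
  c ^ q * n ^ (2 * q) ≤⟨ *-monoʳ-≤ (c ^ q) (^-monoʳ-≤ n {{>-nonZero 1≤n}} (exponent p q u)) ⟩
  c ^ q * n ^ p ∎
  where open ≤-Reasoning

infixl 6 _⊕_
infixl 7 _⊗_
data Expr : Set where
 con     : ℕ → Expr
 quantity     : ℕ → Expr
 dim     : Expr
 _⊕_ _⊗_ : Expr → Expr → Expr

coefficient degree dim-degree : Expr → ℕ
coefficient (con k) = k
coefficient (quantity i) = 1
coefficient dim     = 1
coefficient (a ⊕ b) = coefficient a + coefficient b
coefficient (a ⊗ b) = coefficient a * coefficient b
degree (con k) = 0
degree (quantity i) = 1
degree dim     = 0
degree (a ⊕ b) = degree a + degree b
degree (a ⊗ b) = degree a + degree b
dim-degree (con k) = 0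
dim-degree (quantity i) = 0
dim-degree dim     = 1
dim-degree (a ⊕ b) = dim-degree a ⊔ dim-degree b
dim-degree (a ⊗ b) = dim-degree a + dim-degree b

module Values (n : ℕ) (1≤n : 1 ≤ n) (v : ℕ → ℕ) (X : ℕ) (1≤X : 1 ≤ X) (v≤ : ∀ i → v i ≤ X) where

 eval : Expr → ℕ
 eval (con k) = k
 eval (quantity i) = v i
 eval dim     = n
 eval (a ⊕ b) = eval a + eval b
 eval (a ⊗ b) = eval a * eval b

 private
  raise : ∀ x → 1 ≤ x → ∀ {a b} → a ≤ b → x ^ a ≤ x ^ b
  raise x 1≤x = ^-monoʳ-≤ x {{>-nonZero 1≤x}}

 eval≤ : ∀ e → eval e ≤ coefficient e * X ^ degree e * n ^ dim-degree e
 eval≤ (con k) = ≤-reflexive (sym (*-identityʳ (k * 1) ⊙ *-identityʳ k))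
 eval≤ (quantity i) = v≤ i ⟫≡ sym (*-identityʳ _ ⊙ +-identityʳ _ ⊙ *-identityʳ X)
 eval≤ dim     = ≤-reflexive (sym (+-identityʳ _ ⊙ *-identityʳ n))
 eval≤ (a ⊕ b) = +-mono-≤
     (eval≤ a ⟫ *-mono-≤ (*-monoʳ-≤ (coefficient a) (raise X 1≤X (m≤m+n (degree a) (degree b)))) (raise n 1≤n (m≤m⊔n (dim-degree a) (dim-degree b))))
     (eval≤ b ⟫ *-mono-≤ (*-monoʳ-≤ (coefficient b) (raise X 1≤X (m≤n+m (degree b) (degree a)))) (raise n 1≤n (m≤n⊔m (dim-degree a) (dim-degree b)))) ⟫≡
  solve 4 (λ a b x y → a :* x :* y :+ b :* x :* y := (a :+ b) :* x :* y) refl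
   (coefficient a) (coefficient b) (X ^ (degree a + degree b)) (n ^ (dim-degree a ⊔ dim-degree b))
 eval≤ (a ⊗ b) = *-mono-≤ (eval≤ a) (eval≤ b) ⟫≡ (solve 6 (λ a x y b x' y' → a :* x :* y :* (b :* x' :* y') := a :* b :* (x :* x') :* (y :* y')) refl
     (coefficient a) (X ^ degree a) (n ^ dim-degree a) (coefficient b) (X ^ degree b) (n ^ dim-degree b) ⊙
  cong₂ (λ x y → coefficient a * coefficient b * x * y) (sym (^-distribˡ-+-* X (degree a) (degree b))) (sym (^-distribˡ-+-* n (dim-degree a) (dim-degree b))))

open import Data.List.Base using (replicate)

open Coin using (Run)

Trace : Set
Trace = List ((CoinOp ⊎ ℕ) × CoinState)

step-deterministic : ∀ {o σ σ' σ″} → CoinStep o σ σ' → CoinStep o σ σ″ → σ' ≡ σ″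
step-deterministic int  int  = refl
step-deterministic toss toss = refl

deterministic : ∀ {p σ l l′ σ' σ″} → Run p σ l σ' → Run p σ l′ σ″ → l ≡ l′ × σ' ≡ σ″
deterministic Coin.skip     Coin.skip     = refl , refl
deterministic (Coin.op s)   (Coin.op s′)  = refl , step-deterministic s s′
deterministic (Coin.seq r q) (Coin.seq r' q') with deterministic r r'
... | refl , refl with deterministic q q'
...   | refl , refl = refl , refl
deterministic (Coin.ifz z r)   (Coin.ifz _ r') with deterministic r r'
... | refl , refl = refl , refl
deterministic (Coin.ifz z r)   (Coin.ifnz nz _)  = contradiction z nz
deterministic (Coin.ifnz nz r) (Coin.ifz z _)    = contradiction z nz
deterministic (Coin.ifnz _ r)  (Coin.ifnz _ r') with deterministic r r'
... | refl , refl = refl , refl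
deterministic (Coin.stop z)     (Coin.stop _)        = refl , refl
deterministic (Coin.stop z)     (Coin.repeat nz _ _) = contradiction z nz
deterministic (Coin.repeat nz _ _) (Coin.stop z)     = contradiction z nz
deterministic (Coin.repeat _ r q) (Coin.repeat _ r' q') with deterministic r r'
... | refl , refl with deterministic q q'
...   | refl , refl = refl , refl

record Extended (p : Prog CoinOp) (σ : CoinState) (l : Trace) (σ' : CoinState) (e : List Bool) : Set₁ where
 field
  trace : Trace
  run   : Run p (fst σ , snd σ ++ e) trace (fst σ' , snd σ' ++ e)
  back  : ∀ {P : Store ℕ → Set} → All (P ∘ fst ∘ snd) trace → All (P ∘ fst ∘ snd) l

extend : ∀ {p σ l σ'} e → Run p σ l σ' → Extended p σ l σ' e
extend e Coin.skip          = record { run = Coin.skip ; back = λ _ → [] }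
extend e (Coin.op int)      = record { run = Coin.op int ; back = λ { (h ∷ []) → h ∷ [] } }
extend e (Coin.op toss)     = record { run = Coin.op toss ; back = λ { (h ∷ []) → h ∷ [] } }
extend e (Coin.seq r q)     = record { run = Coin.seq (run r') (run q') ; back = λ a → All.++⁺ (back r' (All.++⁻ˡ (trace r') a)) (back q' (All.++⁻ʳ (trace r') a)) }
 where
 open Extended
 r' = extend e r
 q' = extend e q
extend e (Coin.ifz z r)     = record { run = Coin.ifz z (run r') ; back = λ { (h ∷ a) → h ∷ back r' a } }
 where
 open Extended
 r' = extend e r
extend e (Coin.ifnz nz r)   = record { run = Coin.ifnz nz (run r') ; back = λ { (h ∷ a) → h ∷ back r' a } }
 where
 open Extended
 r' = extend e r
extend e (Coin.stop z)      = record { run = Coin.stop z ; back = λ { (h ∷ []) → h ∷ [] } }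
extend e (Coin.repeat nz r q) = record { run = Coin.repeat nz (run r') (run q')
                                       ; back = λ { (h ∷ a) → h ∷ All.++⁺ (back r' (All.++⁻ˡ (trace r') a)) (back q' (All.++⁻ʳ (trace r') a)) } }
 where
 open Extended
 r' = extend e r
 q' = extend e q

split : ∀ m (cs : List Bool) → m ≤ length cs → Σ[ ω ∈ Vec Bool m ] ∃[ rest ] cs ≡ toList ω ++ rest
split zero    cs       _       = [] , cs , refl
split (suc m) (c ∷ cs) (s≤s l) = let (ω , rest , e) = split m cs l in c ∷ ω , rest , cong (c ∷_) e

supply : ∀ m (cs : List Bool) → Σ[ ω ∈ Vec Bool m ] ∃[ rest ] cs ++ replicate m false ≡ toList ω ++ rest
supply m cs = split m (cs ++ replicate m false)
 (m≤n+m m (length cs) ⟫≡ sym (List.length-++ cs ⊙ cong (λ x → length cs + x) (List.length-replicate m)))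

all-runs : ∀ {p s m} {P : Store ℕ → Set} →
 (∀ (ω : Vec Bool m) rest → ∃[ l ] ∃[ σ' ] (Run p (s , toList ω ++ rest) l σ' × All (P ∘ fst ∘ snd) l × P (fst σ'))) →
 ∀ {cs l σ'} → Run p (s , cs) l σ' → All (P ∘ fst ∘ snd) l × P (fst σ')
all-runs {p} {s} {m} {P} h {cs} {l} {σ'} r = by (supply m cs)
 where
 open Extended (extend (replicate m false) r)
 by : Σ[ ω ∈ Vec Bool m ] ∃[ rest ] cs ++ replicate m false ≡ toList ω ++ rest → All (P ∘ fst ∘ snd) l × P (fst σ')
 by (ω , rest , e) with h ω rest
 ... | l′ , σ″ , r' , a , final with deterministic r' (subst (λ cs → Run p (s , cs) trace (fst σ' , snd σ' ++ replicate m false)) e run)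
 ...   | refl , refl = back {P} a , final

-- The cost of the algorithm as an expression in n and, in this order, the size of
-- the largest number, L, r, the size of n, the cost of a simulated call, and the
-- number of simulated variables.
private
 Uᵉ Lᵉ rᵉ σᵉ Mᵉ Bᵉ uᵉ : Expr
 Uᵉ = quantity 0
 Lᵉ = quantity 1
 rᵉ = quantity 2
 σᵉ = quantity 3
 Mᵉ = quantity 4
 Bᵉ = quantity 5
 uᵉ = Uᵉ ⊕ Uᵉ

 _·u : ℕ → Expr
 k ·u = con k ⊗ uᵉ

 flatᵉ bitᵉ productᵉ innerᵉ outerᵉ convolutionᵉ : Expr → Expr
 flatᵉ t = t ⊕ 6 ·u
 bitᵉ t  = 8 ·u ⊕ (1 ·u ⊕ (t ⊗ (uᵉ ⊕ 2 ·u) ⊕ uᵉ ⊕ 3 ·u))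
 productᵉ t = bitᵉ t ⊕ (1 ·u ⊕ (bitᵉ t ⊕ (2 ·u ⊕ (8 ·u ⊕ (1 ·u ⊕ 8 ·u)))))
 innerᵉ t = t ⊕ (uᵉ ⊕ (uᵉ ⊕ uᵉ ⊕ uᵉ))
 outerᵉ t = uᵉ ⊕ (uᵉ ⊕ (flatᵉ (bitᵉ Lᵉ ⊕ 8 ·u) ⊕ (uᵉ ⊕ (uᵉ ⊕ (Lᵉ ⊗ (uᵉ ⊕ innerᵉ t) ⊕ uᵉ ⊕ flatᵉ (8 ·u ⊕ (3 ·u ⊕ (8 ·u ⊕ (2 ·u ⊕ 8 ·u)))))))))
 convolutionᵉ t = flatᵉ (8 ·u) ⊕ (uᵉ ⊕ (Lᵉ ⊗ (uᵉ ⊕ outerᵉ t) ⊕ uᵉ ⊕ (uᵉ ⊕ (uᵉ ⊕ flatᵉ (8 ·u)))))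

 hadamardᵉ sliceᵉ readoutᵉ callᵉ copyᵉ reportᵉ stepᵉ searchᵉ publishᵉ prologueᵉ sampleᵉ transposeᵉ unitsᵉ algorithmᵉ : Expr
 hadamardᵉ = flatᵉ (productᵉ Lᵉ) ⊕ uᵉ
 sliceᵉ    = bitᵉ Lᵉ ⊕ (3 ·u ⊕ 8 ·u)
 readoutᵉ  = 8 ·u ⊕ (2 ·u ⊕ (8 ·u ⊕ (1 ·u ⊕ 8 ·u)))
 callᵉ     = uᵉ ⊕ (flatᵉ sliceᵉ ⊕ flatᵉ sliceᵉ ⊕ (Bᵉ ⊗ (uᵉ ⊕ uᵉ) ⊕ (uᵉ ⊕ uᵉ) ⊕ (Mᵉ ⊕ flatᵉ readoutᵉ)))
 copyᵉ     = flatᵉ (8 ·u ⊕ 8 ·u)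
 reportᵉ   = flatᵉ (1 ·u ⊕ (8 ·u ⊕ (2 ·u ⊕ 8 ·u))) ⊕ (flatᵉ (8 ·u ⊕ (8 ·u ⊕ (1 ·u ⊕ 8 ·u))) ⊕ (uᵉ ⊕ (8 ·u ⊕ (uᵉ ⊕ uᵉ))))
 stepᵉ     = convolutionᵉ hadamardᵉ ⊕ convolutionᵉ hadamardᵉ ⊕ (copyᵉ ⊕ (convolutionᵉ callᵉ ⊕ copyᵉ) ⊕ (copyᵉ ⊕ (convolutionᵉ callᵉ ⊕ copyᵉ) ⊕ (flatᵉ (8 ·u) ⊕ (convolutionᵉ callᵉ ⊕ copyᵉ) ⊕ reportᵉ)))
 searchᵉ   = dim ⊗ (uᵉ ⊕ (uᵉ ⊕ stepᵉ ⊕ uᵉ)) ⊕ uᵉ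
 publishᵉ  = flatᵉ (8 ·u ⊕ uᵉ)
 prologueᵉ = 4 ·u ⊕ (dim ⊗ (uᵉ ⊕ 2 ·u) ⊕ uᵉ ⊕ (4 ·u ⊕ (σᵉ ⊗ (uᵉ ⊕ (3 ·u ⊕ (uᵉ ⊕ 2 ·u))) ⊕ uᵉ ⊕ (3 ·u ⊕ 4 ·u))))
 sampleᵉ   = 2 ·u ⊕ (rᵉ ⊗ (uᵉ ⊕ (con 1 ⊕ 3 ·u)) ⊕ uᵉ) ⊕ (1 ·u ⊕ (uᵉ ⊕ 1 ·u ⊕ 8 ·u))
 transposeᵉ = uᵉ ⊕ (dim ⊗ (uᵉ ⊕ (flatᵉ (2 ·u ⊕ (8 ·u ⊕ (1 ·u ⊕ 8 ·u))) ⊕ (uᵉ ⊕ (uᵉ ⊕ uᵉ)))) ⊕ uᵉ ⊕ (uᵉ ⊕ uᵉ))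
 unitsᵉ    = flatᵉ (8 ·u) ⊕ (flatᵉ (8 ·u) ⊕ uᵉ)
 algorithmᵉ = uᵉ ⊕ (prologueᵉ ⊕ (flatᵉ sampleᵉ ⊕ (transposeᵉ ⊕ (unitsᵉ ⊕ (searchᵉ ⊕ publishᵉ)))))

 quantities : (U L r σ M B : ℕ) → ℕ → ℕ
 quantities U L r σ M B 0 = U
 quantities U L r σ M B 1 = L
 quantities U L r σ M B 2 = r
 quantities U L r σ M B 3 = σ
 quantities U L r σ M B 4 = M
 quantities U L r σ M B 5 = B
 quantities U L r σ M B _ = 0

abstract
 costScale costDegree : ℕ
 costScale  = coefficient algorithmᵉ
 costDegree = degree algorithmᵉ

 value≤ : ∀ n 1≤n v X 1≤X v≤ → Values.eval n 1≤n v X 1≤X v≤ algorithmᵉ ≤ costScale * X ^ costDegree * n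
 value≤ n 1≤n v X 1≤X v≤ = Values.eval≤ n 1≤n v X 1≤X v≤ algorithmᵉ ⟫≡
  cong (costScale * X ^ costDegree *_) (*-identityʳ n)

module _ {n : ℕ} (G : Digraph n) (resources : Resources G) (mul : Prog FieldOp) where

 open Resources resources using (1≤n)
 open Analysis G (level-of n) using (L; r; Coins)

 module _ (multiplier : ∀ cs → Multiplier (Assembly.setting G resources mul cs) mul) (ω : Coins) (rest : List Bool)
  (X : ℕ) (1≤X : 1 ≤ X) (U≤ : size (2 ^ width G) ≤ X) (L≤ : L ≤ X) (r≤ : r ≤ X) (σ≤ : size n ≤ X) (M≤ : Multiplier.M (multiplier rest) ≤ X) (B≤ : 2 + varBound mul ≤ X) where

  private
   v : ℕ → ℕ
   v = quantities (size (2 ^ width G)) L r (size n) (Multiplier.M (multiplier rest)) (2 + varBound mul)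

   v≤ : ∀ i → v i ≤ X
   v≤ 0 = U≤
   v≤ 1 = L≤
   v≤ 2 = r≤
   v≤ 3 = σ≤
   v≤ 4 = M≤
   v≤ 5 = B≤
   v≤ (suc (suc (suc (suc (suc (suc i)))))) = z≤n

  algorithmCost≤ : Assembly.algorithmCost G resources mul multiplier ω rest ≤ costScale * X ^ costDegree * n
  algorithmCost≤ = value≤ n 1≤n v X 1≤X v≤

open import Data.Empty using (⊥)

module _ {n : ℕ} (G : Digraph n) where

 open Analysis G (level-of n) using (L; L≡; r)

 private
  σ : ℕ
  σ = size n

  1≤σ : 1 ≤ σ
  1≤σ = size≥1 n

 L≤63σ : L ≤ 63 * σ
 L≤63σ = begin
  L ≡⟨ L≡ ⊙ treble≡ (level-of n) 3 ⟩
  3 * 3 ^ level-of n ≡⟨ cong (3 *_) (sym (+-identityʳ _) ⊙ sym (treble≡ (level-of n) 1)) ⟩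
  3 * treble (level-of n) 1 ≤⟨ *-monoʳ-≤ 3 (snd (snd (level-bounds σ))) ⟩
  3 * (9 + 12 * σ) ≤⟨ *-monoʳ-≤ 3 (+-monoˡ-≤ (12 * σ) (*-monoʳ-≤ 9 1≤σ)) ⟩
  3 * (9 * σ + 12 * σ) ≡⟨ solve 1 (λ s → con 3 :* (con 9 :* s :+ con 12 :* s) := con 63 :* s) refl σ ⟩
  63 * σ ∎
  where open ≤-Reasoning

 8σ≤r : 8 * σ ≤ r
 8σ≤r = begin
  8 * σ ≡⟨ solve 1 (λ s → con 8 :* s := con 2 :* (s :* con 4)) refl σ ⟩
  2 * (σ * 4) ≤⟨ *-monoʳ-≤ 2 (fst (snd (level-bounds σ))) ⟩
  2 * treble (level-of n) 1 ≡⟨ cong (2 *_) (treble≡ (level-of n) 1 ⊙ +-identityʳ _) ⟩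
  2 * 3 ^ level-of n ≡⟨ treble≡ (level-of n) 2 ⟨
  r ∎
  where open ≤-Reasoning

 enough-coins : n ^ 7 ≤ 2 ^ r
 enough-coins = begin
  n ^ 7 ≤⟨ ^-monoˡ-≤ 7 (<⇒≤ (<2^size n)) ⟩
  (2 ^ σ) ^ 7 ≡⟨ ^-*-assoc 2 σ 7 ⟩
  2 ^ (σ * 7) ≤⟨ ^-monoʳ-≤ 2 (*-monoʳ-≤ σ (n≤1+n 7) ⟫ *-comm σ 8 ≡⟫ 8σ≤r) ⟩
  2 ^ r ∎
  where open ≤-Reasoning

 largest : ℕ
 largest = size (2 ^ width G)

 largest≤138σ : largest ≤ 138 * σ
 largest≤138σ = begin
  largest ≡⟨ cong suc (⌊log₂[2^n]⌋≡n (width G)) ⟩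
  1 + (2 * L + 2 * σ + 9) ≤⟨ +-mono-≤ 1≤σ (+-mono-≤ (+-monoˡ-≤ (2 * σ) (*-monoʳ-≤ 2 L≤63σ)) (*-monoʳ-≤ 9 1≤σ)) ⟩
  σ + (2 * (63 * σ) + 2 * σ + 9 * σ) ≡⟨ solve 1 (λ s → s :+ (con 2 :* (con 63 :* s) :+ con 2 :* s :+ con 9 :* s) := con 138 :* s) refl σ ⟩
  138 * σ ∎
  where open ≤-Reasoning

abstract
 timeBase : (K v : ℕ) → ℕ
 timeBase K v = 4000 * (138 * (K + K)) + v + 140

 call≤ : ∀ K e v σ U → 1 ≤ σ → U ≤ 138 * σ → 4000 * (U * (K + K * σ ^ e)) ≤ timeBase K v * σ ^ suc e
 call≤ K e v σ U 1≤σ U≤ = begin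
  4000 * (U * (K + K * σ ^ e)) ≤⟨ *-monoʳ-≤ 4000 (*-mono-≤ U≤ (+-monoˡ-≤ (K * σ ^ e)
                                                      (sym (*-identityʳ K) ≡⟫ *-monoʳ-≤ K (m^n>0 σ {{>-nonZero 1≤σ}} e)))) ⟩
  4000 * (138 * σ * (K * σ ^ e + K * σ ^ e)) ≡⟨ regroup 4000 138 σ K (σ ^ e) ⟩
  4000 * (138 * (K + K)) * σ ^ suc e ≤⟨ *-monoˡ-≤ (σ ^ suc e) (m≤m+n (4000 * (138 * (K + K))) v ⟫ m≤m+n (4000 * (138 * (K + K)) + v) 140) ⟩
  timeBase K v * σ ^ suc e ∎
  where
  open ≤-Reasoning
  regroup : ∀ a b s k x → a * (b * s * (k * x + k * x)) ≡ a * (b * (k + k)) * (s * x)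
  regroup = solve 5 (λ a b s k x → a :* (b :* s :* (k :* x :+ k :* x)) := a :* (b :* (k :+ k)) :* (s :* x)) refl

 multiple≤ : ∀ K e v σ {x} c → 1 ≤ σ → c ≤ 140 → x ≤ c * σ → x ≤ timeBase K v * σ ^ suc e
 multiple≤ K e v σ c 1≤σ c≤ h = h ⟫ *-mono-≤ (c≤ ⟫ m≤n+m 140 (4000 * (138 * (K + K)) + v))
  (sym (*-identityʳ σ) ≡⟫ *-monoʳ-≤ σ (m^n>0 σ {{>-nonZero 1≤σ}} e))

 variables≤ : ∀ K e v σ → 1 ≤ σ → 2 + v ≤ timeBase K v * σ ^ suc e
 variables≤ K e v σ 1≤σ = (+-comm 2 v ≡⟫ +-mono-≤ (m≤n+m v (4000 * (138 * (K + K)))) (m≤m+n 2 138)) ⟫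
  sym (*-identityʳ (timeBase K v)) ≡⟫ *-monoʳ-≤ (timeBase K v) (m^n>0 σ {{>-nonZero 1≤σ}} (suc e))

 spaceScale : ℕ → ℕ
 spaceScale K = 16 * K + 49 + 20 * (139 + K)

 words≤ : ∀ K σ U → 1 ≤ σ → U ≤ 138 * σ → 20 * (U + suc (K * σ)) ≤ spaceScale K * σ
 words≤ K σ U 1≤σ U≤ = begin
  20 * (U + suc (K * σ)) ≤⟨ *-monoʳ-≤ 20 (+-mono-≤ U≤ (+-monoˡ-≤ (K * σ) 1≤σ)) ⟩
  20 * (138 * σ + (σ + K * σ)) ≡⟨ solve 2 (λ s k → con 20 :* (con 138 :* s :+ (s :+ k :* s)) := con 20 :* (con 139 :+ k) :* s) refl σ K ⟩
  20 * (139 + K) * σ ≤⟨ *-monoˡ-≤ σ (m≤n+m (20 * (139 + K)) (16 * K + 49)) ⟩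
  spaceScale K * σ ∎
  where open ≤-Reasoning

 cells-total≤ : ∀ K n → 1 ≤ n → 16 * (K * n ^ 2 + (n * n + n * n)) + n * n + 16 ≤ spaceScale K * n ^ 2
 cells-total≤ K n 1≤n = begin
  16 * (K * n ^ 2 + (n * n + n * n)) + n * n + 16 ≤⟨ +-monoʳ-≤ (16 * (K * n ^ 2 + (n * n + n * n)) + n * n) (*-monoʳ-≤ 16 (*-mono-≤ 1≤n 1≤n)) ⟩
  16 * (K * n ^ 2 + (n * n + n * n)) + n * n + 16 * (n * n)
   ≡⟨ solve 2 (λ k n → con 16 :* (k :* (n :* (n :* con 1)) :+ (n :* n :+ n :* n)) :+ n :* n :+ con 16 :* (n :* n) := (con 16 :* k :+ con 49) :* (n :* (n :* con 1))) refl K n ⟩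
  (16 * K + 49) * n ^ 2 ≤⟨ *-monoˡ-≤ (n ^ 2) (m≤m+n (16 * K + 49) (20 * (139 + K))) ⟩
  spaceScale K * n ^ 2 ∎
  where open ≤-Reasoning

-- Hyp is the assumption that multiplication takes at most K1 n² cells.
module Program (τ : ℝ) (2<τ : (+ 2 /ℚ 1) <ʳ τ) (mul : Prog FieldOp) (fast : Fast τ multiplication mul)
 (Hyp : Set) (K1 : ℕ) (workspace : Hyp → ∀ n → 1 ≤ n → ∀ X s log s′ → A2.Input {2} {n} X s → A2.Run mul s log s′ →
  All (A2.Fits (K1 * n ^ 2) (K1 * size n) ∘ snd) log × A2.Fits (K1 * n ^ 2) (K1 * size n) s′) where

 K e : ℕ
 K = fst (fast 1)
 e = fst (snd (fast 1))

 timeConstant timeExponent : ℕ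
 timeConstant = suc (costScale * timeBase K (varBound mul) ^ costDegree)
 timeExponent = suc e * costDegree

 module _ {n : ℕ} (G : Digraph n) (1≤n : 1 ≤ n) where

  open Analysis G (level-of n) using (N; L; r; Coins)
  open Verdict G (level-of n) using (Outcome)

  private
   σ S w S2 w2 : ℕ
   σ = size n
   S2 = K1 * n ^ 2
   w2 = K1 * σ
   S = 16 * (S2 + (N + N)) + N + 16
   w = 20 * (largest G + suc w2)
   1≤σ : 1 ≤ σ
   1≤σ = size≥1 n

   module Gr = Growth τ 2<τ n 1≤n

   cell< : ∀ k p → k < 16 → p ≤ S2 + (N + N) → cell N k p < S
   cell< k p k<16 p≤ = ≤-<-trans (≤-reflexive (cell≡ N k p))
    (+-mono-≤-< (+-monoˡ-≤ N (*-monoˡ-≤ 16 p≤ ⟫≡ *-comm (S2 + (N + N)) 16)) k<16)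

   resources : Resources G
   resources = record
    { Hyp = Hyp ; S = S ; w = w ; 1≤n = 1≤n
    ; size≤w = m≤m+n (largest G) (suc w2) ⟫ m≤n*m (largest G + suc w2) 20
    ; cells<S = λ k p k<16 p<2N → cell< k p k<16 (<⇒≤ p<2N ⟫ m≤n+m (N + N) S2)
    ; _⊑_ = Gr._⊑_ ; ≤⇒⊑ = Gr.≤⇒⊑ ; ⊑-+ = Gr.⊑-+ ; ⊑-≤-trans = Gr.⊑-≤-trans ; ≤-⊑-trans = Gr.≤-⊑-trans ; flat⊑ = Gr.flat⊑ }

   setting : List Bool → Setting
   setting = Assembly.setting G resources mul

   algorithmCost : (∀ cs → Multiplier (setting cs) mul) → Coins → List Bool → ℕ
   algorithmCost = Assembly.algorithmCost G resources mul

   callBound : ℕ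
   callBound = 4000 * (largest G * (K + K * σ ^ e))

   multiplier : ∀ cs → Multiplier (setting cs) mul
   multiplier cs = record
    { M = callBound ; S2 = S2 ; w2 = w2 ; room = ≤-refl
    ; cells2 = λ k a k<3 a<S2 → cell< k a (<-≤-trans k<3 (m≤m+n 3 13)) (<⇒≤ a<S2 ⟫ m≤m+n S2 (N + N))
    ; runs = λ X s input →
        let (log , s′ , run , out , arithmetic , control) = snd (snd (fast 1)) n 1≤n 1 (1≤σ ⟫≡ sym (+-identityʳ σ)) 𝔽2-field X s input
        in log , s′ , run , out ,
           All.tabulate (λ i hyp → All.lookup (fst (workspace hyp n 1≤n X s log s′ input run)) i) ,
           (λ hyp → snd (workspace hyp n 1≤n X s log s′ input run)) ,
           Gr.⊑-* 4000 (Gr.⊑-* (largest G) (Gr.⊑-+ {A2.arithmeticOperations log} {A2.controlOperations log} arithmetic control)) }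

  execution : ∀ ω rest {s} → InputGraph G s → Machine.Ex (setting rest) (algorithmCost multiplier ω rest) (algorithm mul) (s , toList ω ++ rest)
   (λ τ → Outcome ω (fst τ) × Machine.ok (setting rest) (fst τ))
  execution ω rest input = Assembly.ex-algorithm G resources mul multiplier ω rest input

  total≤ : ∀ ω rest → algorithmCost multiplier ω rest ≤ timeConstant * σ ^ timeExponent * n
  total≤ ω rest = begin
   algorithmCost multiplier ω rest
    ≤⟨ algorithmCost≤ G resources mul multiplier ω rest (base * σ ^ suc e)
         (at-most 1 (s≤s z≤n) (1≤σ ⟫≡ sym (+-identityʳ σ))) (at-most 138 (m≤m+n 138 2) (largest≤138σ G))
         (at-most 63 (m≤m+n 63 77) (L≤63σ G)) (at-most 63 (m≤m+n 63 77) (r≤L G 1≤n ⟫ L≤63σ G))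
         (at-most 1 (s≤s z≤n) (≤-reflexive (sym (+-identityʳ σ)))) (call≤ K e (varBound mul) σ (largest G) 1≤σ (largest≤138σ G)) (variables≤ K e (varBound mul) σ 1≤σ) ⟩
   costScale * (base * σ ^ suc e) ^ costDegree * n
    ≡⟨ cong (λ x → costScale * x * n) (^-distribʳ-* base (σ ^ suc e) costDegree ⊙ cong (base ^ costDegree *_) (^-*-assoc σ (suc e) costDegree)) ⟩
   costScale * (base ^ costDegree * σ ^ timeExponent) * n
    ≡⟨ cong (_* n) (*-assoc costScale (base ^ costDegree) (σ ^ timeExponent)) ⟨
   costScale * base ^ costDegree * σ ^ timeExponent * n
    ≤⟨ *-monoˡ-≤ n (*-monoˡ-≤ (σ ^ timeExponent) (n≤1+n (costScale * base ^ costDegree))) ⟩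
   timeConstant * σ ^ timeExponent * n ∎
   where
   open ≤-Reasoning
   base : ℕ
   base = timeBase K (varBound mul)
   at-most : ∀ {x} c → c ≤ 140 → x ≤ c * σ → x ≤ base * σ ^ suc e
   at-most c = multiple≤ K e (varBound mul) σ c 1≤σ

  quadratic : ∀ s → FitsInt S w s → FitsInt (spaceScale K1 * n ^ 2) (spaceScale K1 * σ) s
  quadratic s (f , g , z) = (λ x → f x ⟫ w≤) , (λ a → g a ⟫ w≤) , λ a h → z a (cells-total≤ K1 n 1≤n ⟫ h)
   where
   w≤ : w ≤ spaceScale K1 * σ
   w≤ = words≤ K1 σ (largest G) 1≤σ (largest≤138σ G)

  timed : ∀ ω {s} {C : Store ℕ → Set} → InputGraph G s → (∀ s → Outcome ω s → C s) → ∃[ log ] Σ[ s′ ∈ CoinState ]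
   ( Coin.Run (algorithm mul) (s , toList ω) log s′ × (1 ≤ n → bitOperations log ≲ (timeConstant * σ ^ timeExponent) * n · n ^ʳ τ) × C (fst s′))
  timed ω {s} {C} input consequence = by (execution ω [] input)
   where
   by : Machine.Ex (setting []) (algorithmCost multiplier ω []) (algorithm mul) (s , toList ω ++ []) (λ τ → Outcome ω (fst τ) × Machine.ok (setting []) (fst τ)) →
    ∃[ log ] Σ[ s′ ∈ CoinState ] ( Coin.Run (algorithm mul) (s , toList ω) log s′
     × (1 ≤ n → bitOperations log ≲ (timeConstant * σ ^ timeExponent) * n · n ^ʳ τ) × C (fst s′))
   by x = Logic.Ex.trace x , Logic.Ex.final x ,
    subst (λ cs → Coin.Run (algorithm mul) (s , cs) (Logic.Ex.trace x) (Logic.Ex.final x)) (List.++-identityʳ (toList ω)) (Logic.Ex.run x) ,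
    (λ _ → Gr.⊑-≤-trans {bitOperations (Logic.Ex.trace x)} (Logic.Ex.cost x) (total≤ ω [])) , consequence (fst (Logic.Ex.final x)) (fst (Logic.Ex.post x))

  confined : Hyp → ∀ {s cs log s′} → InputGraph G s → Coin.Run (algorithm mul) (s , cs) log s′ →
   All (FitsInt (spaceScale K1 * n ^ 2) (spaceScale K1 * σ) ∘ fst ∘ snd) log × FitsInt (spaceScale K1 * n ^ 2) (spaceScale K1 * σ) (fst s′)
  confined hyp {s} input = all-runs {m = N * r} {P = FitsInt (spaceScale K1 * n ^ 2) (spaceScale K1 * σ)} λ ω rest → split-up rest (execution ω rest input)
   where
   split-up : ∀ rest {c σ0} {Q : CoinState → Set} → Machine.Ex (setting rest) c (algorithm mul) σ0 (λ τ → Q τ × Machine.ok (setting rest) (fst τ)) →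
    ∃[ l ] ∃[ σ' ] (Coin.Run (algorithm mul) σ0 l σ' × All (FitsInt (spaceScale K1 * n ^ 2) (spaceScale K1 * σ) ∘ fst ∘ snd) l × FitsInt (spaceScale K1 * n ^ 2) (spaceScale K1 * σ) (fst σ'))
   split-up rest x = Logic.Ex.trace x , Logic.Ex.final x , Logic.Ex.run x ,
    All.map (λ {x} o → quadratic (fst (snd x)) (Bounded.ok.within o hyp)) (Logic.Ex.safe x) ,
    quadratic (fst (Logic.Ex.final x)) (Bounded.ok.within (snd (Logic.Ex.post x)) hyp)

 correctness : ∀ {n} (G : Digraph n) ω s → Verdict.Outcome G (level-of n) ω s →
  (¬ HasEvenCycle G → ReportsNone s) × (Verdict.bad G (level-of n) ω ≡ false → CorrectLength G s × CorrectArcs G s)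
 correctness {n} G ω s out = Verdict.no-cycle-reported G (level-of n) ω s out , Verdict.correct G (level-of n) ω s out

 finds : FindsShortestEvenCycles τ (algorithm mul)
 finds = (λ n → n * n * treble (level-of n) 2) , timeConstant , timeExponent , λ n G →
  Verdict.bad G (level-of n) , Verdict.bad-rare G (level-of n) (enough-coins G) ⟫ *-monoˡ-≤ (2 ^ (n * n * treble (level-of n) 2)) 1≤timeConstant , outcome n G
  where
  1≤timeConstant : 1 ≤ timeConstant
  1≤timeConstant = s≤s z≤n
  Finished : ∀ n (G : Digraph n) → Vec Bool (n * n * treble (level-of n) 2) → Store ℕ → Set
  Finished n G ω s = ∃[ log ] Σ[ s′ ∈ CoinState ]
   ( Coin.Run (algorithm mul) (s , toList ω) log s′
   × (1 ≤ n → bitOperations log ≲ (timeConstant * size n ^ timeExponent) * n · n ^ʳ τ)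
   × (¬ HasEvenCycle G → ReportsNone (fst s′))
   × (Verdict.bad G (level-of n) ω ≡ false → CorrectLength G (fst s′) × CorrectArcs G (fst s′)))
  outcome : ∀ n (G : Digraph n) ω s → InputGraph G s → Finished n G ω s
  outcome zero G ω s input = _ , _ , Coin.ifz (fst input) Coin.skip , (λ ()) , correctness G ω s (inj₁ (fst input , (λ { zero () _ ; (suc k) _ () }) , λ ()))
  outcome (suc n) G ω s input = timed G (s≤s z≤n) ω input (correctness G ω)

theorem1p2 : (τ : ℝ) → (+ 2 /ℚ 1) <ʳ τ → τ ≤ʳ (+ 3 /ℚ 1) →
 (mul : Prog FieldOp) → Fast τ multiplication mul →
 (Σ[ alg ∈ Prog CoinOp ] FindsShortestEvenCycles τ alg)
 × ((dt inv : Prog FieldOp) →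
    Fast τ determinant dt → Fast τ inversion inv →
    QuadraticWorkspace multiplication mul →
    QuadraticWorkspace determinant dt →
    QuadraticWorkspace inversion inv →
    Σ[ alg ∈ Prog CoinOp ]
     (FindsShortestEvenCycles τ alg × QuadraticSpace alg))
theorem1p2 τ 2<τ _ mul fast = (algorithm mul , finds) , λ _ _ _ _ workspace _ _ → algorithm mul , finds ,
    spaceScale (fst (workspace 1)) , λ n 1≤n G s cs log s′ input run → Program.confined τ 2<τ mul fast ⊤ (fst (workspace 1)) (λ _ → confined workspace) G 1≤n tt input run
 where
 finds : FindsShortestEvenCycles τ (algorithm mul)
 finds = Program.finds τ 2<τ mul fast ⊥ 0 λ ()
 confined : ∀ (workspace : QuadraticWorkspace multiplication mul) n → 1 ≤ n → ∀ X s log s′ → A2.Input {2} {n} X s → A2.Run mul s log s′ →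
  All (A2.Fits (fst (workspace 1) * n ^ 2) (fst (workspace 1) * size n) ∘ snd) log × A2.Fits (fst (workspace 1) * n ^ 2) (fst (workspace 1) * size n) s′
 confined workspace n 1≤n X s log s′ input run =
  snd (workspace 1) n 1≤n 1 (size≥1 n ⟫≡ sym (+-identityʳ (size n))) 𝔽2-field X s log s′ input run
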